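{- There is a positive absolute constant $C$ such that if $n\ge2$, $2\le y\le\log n$ and $h\in\mathbb{F}_q[x]\setminus\{0\}$ is a fixed polynomial with $\deg h\le y$, then $$\Big|\sum_{f\in\mathcal{M}_n}\lambda_y(f)\lambda_y(f+h)\Big|<C\,\frac{\log^4y}{y^4}\,q^n.$$
   Context: $\mathbb{F}_q$ is a fixed finite field of odd cardinality $q$; $\mathcal{M}_n$ is the set of monic polynomials of degree $n$ in $\mathbb{F}_q[x]$. The truncated Liouville function $\lambda_y$ is the multiplicative function on monic polynomials given on powers of monic irreducibles $P$ ($t\ge1$) by $\lambda_y(P^t)=(-1)^t$ if $\deg P\le y$ and $\lambda_y(P^t)=1$ if $\deg P>y$. -}

module Defs where

open import Algebra.Bundles using (CommutativeRing; RawSemiring)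
import Algebra.Definitions.RawSemiring as SemiringDefs
open import Data.Fin.Base using (Fin)
open import Data.Integer.Base as ℤ using (ℤ; +_; 0ℤ; 1ℤ; -1ℤ)
open import Data.List.Base
  using (List; []; _∷_; map; foldr; allFin; upTo; cartesianProductWith)
open import Data.Nat.Base as ℕ using (ℕ; zero; suc)
open import Data.Product.Base using (∃-syntax; _×_)
open import Data.Rational.Base as ℚ using (ℚ; 0ℚ; 1ℚ)
import Data.Rational.Properties as ℚ
open import Function.Bundles using (Inverse)
open import Level using (Level; _⊔_) renaming (suc to lsuc)
open import Relation.Binary.PropositionalEquality using (_≡_)
import Relation.Binary.PropositionalEquality as ≡
open import Relation.Nullary using (¬_; yes; no)

-- Real numbers are represented by Cauchy sequences of rationals, with
-- arithmetic carried out termwise.  The orders below are those of the limits;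
-- they respect the equality "the termwise difference tends to 0".

Seq : Set
Seq = ℕ → ℚ

IsCauchy : Seq → Set
IsCauchy x = ∀ ε → 0ℚ ℚ.< ε →
  ∃[ N ] (∀ i j → N ℕ.≤ i → N ℕ.≤ j → ℚ.∣ x i ℚ.- x j ∣ ℚ.≤ ε)

infix 4 _≤ʳ_ _<ʳ_

_≤ʳ_ : Seq → Seq → Set
x ≤ʳ y = ∀ ε → 0ℚ ℚ.< ε → ∃[ N ] (∀ k → N ℕ.≤ k → x k ℚ.≤ y k ℚ.+ ε)

_<ʳ_ : Seq → Seq → Set
x <ʳ y = ∃[ ε ] (0ℚ ℚ.< ε × ∃[ N ] (∀ k → N ℕ.≤ k → x k ℚ.+ ε ℚ.≤ y k))

fromℕ : ℕ → Seq
fromℕ m _ = + m ℚ./ 1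

-- Division made total by p / 0 = 0.  Below it only matters for positive
-- denominators: in a quotient of sequences whose denominator has a positive
-- limit, only finitely many terms can be affected.
infixl 7 _÷₀_ _*ʳ_ _÷ʳ_
infixr 8 _^ʳ_

_÷₀_ : ℚ → ℚ → ℚ
p ÷₀ q with q ℚ.≟ 0ℚ
... | yes _   = 0ℚ
... | no  q≢0 = ℚ._÷_ p q {{ℚ.≢-nonZero q≢0}}

_*ʳ_ : Seq → Seq → Seq
(x *ʳ y) k = x k ℚ.* y k

_÷ʳ_ : Seq → Seq → Seq
(x ÷ʳ y) k = x k ÷₀ y k

_^ʳ_ : Seq → ℕ → Seq
(x ^ʳ m) k = x k ^ m
  where open SemiringDefs ℚ.+-*-rawSemiring using (_^_)

-- The right-endpoint Riemann sum of ∫₁ˣ dt/t over k equal subintervals: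
--   Σ_{j=1}^{k} ((x-1)/k) · 1/(1 + j(x-1)/k)  =  Σ_{j=1}^{k} (x-1)/(k + j(x-1)).
logSum : ℕ → ℚ → ℚ
logSum k x = foldr ℚ._+_ 0ℚ (map term (upTo k))
  where
  term : ℕ → ℚ
  term i = (x ℚ.- 1ℚ) ÷₀ ((+ k ℚ./ 1) ℚ.+ (+ suc i ℚ./ 1) ℚ.* (x ℚ.- 1ℚ))

-- The natural logarithm ∫₁ˣ dt/t of a positive real.  The Riemann sums converge
-- uniformly for x in compact subsets of (0,∞), so the diagonal sequence
-- converges to the logarithm of the limit.
log : Seq → Seq
log x k = logSum k (x k)

record FiniteField (c ℓ : Level) : Set (lsuc (c ⊔ ℓ)) where
  field
    commutativeRing : CommutativeRing c ℓ
  open CommutativeRing commutativeRing public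
  field
    0≉1     : ¬ (0# ≈ 1#)
    inverse : ∀ x → ¬ (x ≈ 0#) → ∃[ y ] (x * y ≈ 1#)
    card    : ℕ
    enum    : Inverse (≡.setoid (Fin card)) setoid

module Polynomials {c ℓ : Level} (F : FiniteField c ℓ) where
  private module F = FiniteField F

  q : ℕ
  q = F.card

  -- Coefficient lists, constant term first; trailing zeros are allowed, and
  -- equality is equality of all coefficients.
  Poly : Set c
  Poly = List F.Carrier

  coeff : Poly → ℕ → F.Carrier
  coeff []      _       = F.0#
  coeff (a ∷ _) zero    = a
  coeff (_ ∷ p) (suc i) = coeff p i

  infix  4 _≋_
  infixl 6 _+ₚ_
  infixl 7 _*ₚ_

  _≋_ : Poly → Poly → Set ℓ
  f ≋ g = ∀ i → coeff f i F.≈ coeff g i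

  0ₚ 1ₚ : Poly
  0ₚ = []
  1ₚ = F.1# ∷ []

  _+ₚ_ : Poly → Poly → Poly
  []      +ₚ g       = g
  (a ∷ f) +ₚ []      = a ∷ f
  (a ∷ f) +ₚ (b ∷ g) = (a F.+ b) ∷ (f +ₚ g)

  _*ₚ_ : Poly → Poly → Poly
  []      *ₚ g = []
  (a ∷ f) *ₚ g = map (a F.*_) g +ₚ (F.0# ∷ (f *ₚ g))

  polyRawSemiring : RawSemiring c ℓ
  polyRawSemiring = record
    { Carrier = Poly ; _≈_ = _≋_ ; _+_ = _+ₚ_ ; _*_ = _*ₚ_ ; 0# = 0ₚ ; 1# = 1ₚ }

  open SemiringDefs polyRawSemiring public
    using (Irreducible; Coprime) renaming (_^_ to _^ₚ_)

  HasDegree : Poly → ℕ → Set ℓ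
  HasDegree p d = ¬ (coeff p d F.≈ F.0#) × (∀ i → d ℕ.< i → coeff p i F.≈ F.0#)

  MonicOfDegree : ℕ → Poly → Set ℓ
  MonicOfDegree d p = coeff p d F.≈ F.1# × (∀ i → d ℕ.< i → coeff p i F.≈ F.0#)

  Monic : Poly → Set ℓ
  Monic p = ∃[ d ] MonicOfDegree d p

  -- The truncated Liouville function λ_y.  Its values off the monic polynomials
  -- are left unspecified.
  record IsTruncatedLiouville (y : Seq) (lam : Poly → ℤ) : Set (c ⊔ ℓ) where
    field
      cong           : ∀ {f g} → f ≋ g → lam f ≡ lam g
      unit           : lam 1ₚ ≡ 1ℤ
      multiplicative : ∀ {f g} → Monic f → Monic g → Coprime f g →
                       lam (f *ₚ g) ≡ lam f ℤ.* lam g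
      small          : ∀ {P d} t → MonicOfDegree d P → Irreducible P → 1 ℕ.≤ t →
                       fromℕ d ≤ʳ y → lam (P ^ₚ t) ≡ -1ℤ ℤ.^ t
      large          : ∀ {P d} t → MonicOfDegree d P → Irreducible P → 1 ℕ.≤ t →
                       y <ʳ fromℕ d → lam (P ^ₚ t) ≡ 1ℤ

  -- Each monic polynomial of degree n exactly once.
  monics : ℕ → List Poly
  monics zero    = 1ₚ ∷ []
  monics (suc n) =
    cartesianProductWith _∷_ (map (Inverse.to F.enum) (allFin q)) (monics n)

  sumOverMonics : ℕ → (Poly → ℤ) → ℤ
  sumOverMonics n φ = foldr ℤ._+_ 0ℤ (map φ (monics n))

{-# OPTIONS --safe #-}
-- Write λ for λ_y, Y for the integer part of y and ρ = 1/q.  By unique factorisation λ(f) is the product over the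
-- monic irreducibles P of degree at most Y of (-1)^{v_P(f)}.  Choose z ≪ log Y with q^{z+1} larger than a fixed power
-- of Y.  Then, outside a set of f of density O(Y^{-4}), no P of degree > z divides f or f + h to the second power, or
-- divides both h and f, and no P of degree ≤ z divides f or f + h to a power higher than z + 1.  On the remaining
-- f the primes of degree ≤ z contribute a sign that only depends on f modulo M = ∏_{deg P ≤ z} P^{z+1}, and each prime
-- P ∤ h of degree z < deg P ≤ Y contributes 1 - 2 u_P, where u_P is the indicator of P ∣ f (f + h).  In each residue
-- class modulo M, expanding ∏ (1 - 2 u_P) by inclusion and exclusion up to a level of order Y log Y (Brun's pure
-- sieve) gives exactly computable terms, because n ≥ e^y leaves room for moduli of degree polynomial in Y; the
-- truncation error is negligible.  So the correlation is at most about ∏ (1 - 4 ρ^{deg P}) over these P, which is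
-- ≪ (z/Y)^4 by Mertens' theorem, and Mertens' theorem follows from the count ∑_{i deg P = n} deg P = q^n.  The losses
-- z^4 from the small primes account for the factor log^4 y.
module Submission where

open import Defs
open import Algebra.Bundles using (CommutativeRing; CommutativeSemiring)
open import Algebra.Structures using (IsCommutativeMonoid; IsCommutativeRing)
import Algebra.Definitions.RawMagma as Div
import Algebra.Definitions.RawSemiring as SemiringDefs
import Algebra.Properties.CommutativeSemigroup as CommutativeSemigroupProperties
import Algebra.Properties.CommutativeSemiring.Exp as CommutativeSemiringExp
import Algebra.Properties.Group as GroupProperties
import Algebra.Properties.Ring as RingProperties
import Algebra.Properties.Semiring.Exp as SemiringExp
import Algebra.Solver.Ring.NaturalCoefficients.Default as NaturalCoefficients
open import Data.Bool.Base using (true; false; if_then_else_)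
open import Data.Fin.Base using (Fin; zero; suc)
import Data.Fin.Properties as Fin
open import Data.Integer.Base as ℤ using (ℤ; +_; -[1+_]; 0ℤ; 1ℤ; -1ℤ)
import Data.Integer.Properties as ℤ
open import Data.List.Base using (List; []; _∷_; _++_; map; foldr; concatMap; filter; mapMaybe; allFin; upTo; cartesianProductWith; length; tabulate; replicate)
open import Data.List.Properties using (map-tabulate; length-map; length-tabulate; concatMap-++; upTo-∷ʳ)
open import Data.List.Relation.Unary.All as All using (All; []; _∷_)
import Data.List.Relation.Unary.All.Properties as All
open import Data.List.Relation.Unary.Any as Any using (Any; here; there)
open import Data.List.Relation.Unary.AllPairs as AllPairs using (AllPairs; []; _∷_)
import Data.List.Relation.Unary.AllPairs.Properties as AllPairs
open import Data.List.Membership.Propositional using (_∈_; find; lose)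
open import Data.Maybe.Base using (Maybe; just; nothing; maybe′)
open import Data.Nat.Base as ℕ using (ℕ; zero; suc; z≤n; s≤s)
import Data.Nat.Properties as ℕ
import Data.Nat.Coprimality as Coprimality
open import Data.Product.Base using (∃-syntax; _×_; _,_; proj₁; proj₂)
open import Data.Rational.Base as ℚ using (ℚ; 0ℚ; 1ℚ)
import Data.Rational.Properties as ℚ
open import Data.Sum.Base using (_⊎_; inj₁; inj₂)
open import Function.Base using (_∘_; id)
open import Function.Bundles using (Inverse)
open import Level using (Level; _⊔_)
open import Relation.Binary.PropositionalEquality using (_≡_; _≢_; refl; sym; trans; cong; cong₂; subst; subst₂; module ≡-Reasoning)
import Relation.Binary.Reasoning.Setoid as SetoidReasoning
open import Relation.Binary.Definitions using (tri<; tri≈; tri>)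
open import Relation.Nullary using (¬_; ¬?; Dec; yes; no; does; contradiction)
open import Relation.Nullary.Decidable using (dec⇒maybe; decidable-stable)
open import Tactic.RingSolver using (solve-∀)
open import Data.Nat.Tactic.RingSolver using () renaming (solve-∀ to ℕ-solve-∀)
open import Tactic.RingSolver.Core.AlmostCommutativeRing using (AlmostCommutativeRing; fromCommutativeRing)

-- Two obstacles shape the form of the argument. First, λ_y depends on y through its integer part Y,
-- which a Cauchy sequence does not yield constructively. So y is bracketed between 2^l and 2^(l+1)
-- by means of a rational approximation, and the estimate is proved as an inequality between natural
-- numbers in which only l occurs. Such an inequality is decidable, so it is enough that Y exists up
-- to double negation; passing from y to 2^l and from log y to l affects only the constant. Second,
-- only rational numbers are available. Powers of 1 + s/m with Bernoulli's inequality take the place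
-- of the exponential function, and a power β of 1/2 takes the place of a square root in Mertens'
-- theorem. Counting is exact: a residue class modulo a polynomial of degree m ≤ n contains exactly
-- q^(n-m) monic f. Hence the sieve has no error term other than its truncation. Primes dividing h
-- are kept out of the sieve, because for them P ∣ f and P ∣ f + h coincide instead of excluding
-- each other. They number at most deg h ≤ Y, so those of degree above z cost little in the
-- exceptional set and at most a factor 2 in the main product.

ℚ-ring : AlmostCommutativeRing _ _
ℚ-ring = fromCommutativeRing ℚ.+-*-commutativeRing (λ x → dec⇒maybe (0ℚ ℚ.≟ x))

-- Ordered arithmetic, powers and Bernoulli's inequality in the rationals

module RationalOrder where
  open import Data.Rational.Base using (_+_; _*_; _-_; -_; _≤_; _<_; ∣_∣)
  open SemiringDefs ℚ.+-*-rawSemiring public using (_^_)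
  open CommutativeRing ℚ.+-*-commutativeRing using (semiring; commutativeSemiring)

  2ℚ : ℚ
  2ℚ = 1ℚ + 1ℚ

  0≤1 : 0ℚ ≤ 1ℚ
  0≤1 = ℚ.≤ᵇ⇒≤ _

  0≤2 : 0ℚ ≤ 2ℚ
  0≤2 = ℚ.≤ᵇ⇒≤ _

  +-nonneg : ∀ {a b} → 0ℚ ≤ a → 0ℚ ≤ b → 0ℚ ≤ a + b
  +-nonneg a≥0 b≥0 = ℚ.+-mono-≤ a≥0 b≥0

  *-monoˡ : ∀ {a b c} → 0ℚ ≤ c → a ≤ b → c * a ≤ c * b
  *-monoˡ {c = c} c≥0 = ℚ.*-monoˡ-≤-nonNeg c {{ℚ.nonNegative c≥0}}

  *-monoʳ : ∀ {a b c} → 0ℚ ≤ c → a ≤ b → a * c ≤ b * c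
  *-monoʳ {c = c} c≥0 = ℚ.*-monoʳ-≤-nonNeg c {{ℚ.nonNegative c≥0}}

  *-nonneg : ∀ {a b} → 0ℚ ≤ a → 0ℚ ≤ b → 0ℚ ≤ a * b
  *-nonneg {a} a≥0 b≥0 = ℚ.≤-trans (ℚ.≤-reflexive (sym (ℚ.*-zeroʳ a))) (*-monoˡ a≥0 b≥0)

  *-mono : ∀ {a b c d} → 0ℚ ≤ a → a ≤ b → 0ℚ ≤ c → c ≤ d → a * c ≤ b * d
  *-mono a≥0 a≤b c≥0 c≤d = ℚ.≤-trans (*-monoʳ c≥0 a≤b) (*-monoˡ (ℚ.≤-trans a≥0 a≤b) c≤d)

  *-cancelˡ : ∀ {a b c} → 0ℚ < c → c * a ≤ c * b → a ≤ b
  *-cancelˡ {c = c} c>0 = ℚ.*-cancelˡ-≤-pos c {{ℚ.positive c>0}}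

  ≤⇒0≤- : ∀ {a b} → a ≤ b → 0ℚ ≤ b - a
  ≤⇒0≤- {a} {b} a≤b =
    ℚ.≤-trans (ℚ.≤-reflexive (sym (ℚ.+-inverseʳ a))) (ℚ.+-monoˡ-≤ (- a) a≤b)

  +-nonneg-≤ : ∀ {a b} d → 0ℚ ≤ d → a + d ≡ b → a ≤ b
  +-nonneg-≤ {a} d d≥0 eq =
    ℚ.≤-trans (ℚ.≤-reflexive (sym (ℚ.+-identityʳ a))) (ℚ.≤-trans (ℚ.+-monoʳ-≤ a d≥0) (ℚ.≤-reflexive eq))

  0≤-⇒≤ : ∀ {a b} → 0ℚ ≤ b - a → a ≤ b
  0≤-⇒≤ {a} {b} h = +-nonneg-≤ (b - a) h (identity a b)
    where
    identity : ∀ a b → a + (b - a) ≡ b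
    identity = solve-∀ ℚ-ring

  ≤-+ʳ : ∀ {a b} → 0ℚ ≤ b → a ≤ a + b
  ≤-+ʳ b≥0 = +-nonneg-≤ _ b≥0 refl

  *-≤ʳ : ∀ {a b} → 0ℚ ≤ a → b ≤ 1ℚ → a * b ≤ a
  *-≤ʳ {a} a≥0 b≤1 = ℚ.≤-trans (*-monoˡ a≥0 b≤1) (ℚ.≤-reflexive (ℚ.*-identityʳ a))

  *-≤1 : ∀ {a b} → 0ℚ ≤ a → a ≤ 1ℚ → b ≤ 1ℚ → a * b ≤ 1ℚ
  *-≤1 a≥0 a≤1 b≤1 = ℚ.≤-trans (*-≤ʳ a≥0 b≤1) a≤1

  ∣∣-≤ : ∀ {a b} → a ≤ b → - a ≤ b → ∣ a ∣ ≤ b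
  ∣∣-≤ {a} a≤b -a≤b with ℚ.∣p∣≡p∨∣p∣≡-p a
  ... | inj₁ eq = subst (_≤ _) (sym eq) a≤b
  ... | inj₂ eq = subst (_≤ _) (sym eq) -a≤b

  ≤-∣∣ : ∀ a → a ≤ ∣ a ∣
  ≤-∣∣ a with ℚ.≤-total 0ℚ a
  ... | inj₁ a≥0 = ℚ.≤-reflexive (sym (ℚ.0≤p⇒∣p∣≡p a≥0))
  ... | inj₂ a≤0 = ℚ.≤-trans a≤0 (ℚ.0≤∣p∣ a)

  ∣∣-swap : ∀ a b → ∣ a - b ∣ ≡ ∣ b - a ∣
  ∣∣-swap a b = trans (cong ∣_∣ (identity a b)) (ℚ.∣-p∣≡∣p∣ (b - a))
    where
    identity : ∀ a b → a - b ≡ - (b - a)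
    identity = solve-∀ ℚ-ring

  ∣∣-triangle : ∀ a b → ∣ a ∣ ≤ ∣ b ∣ + ∣ a - b ∣
  ∣∣-triangle a b =
    subst (λ x → ∣ x ∣ ≤ ∣ b ∣ + ∣ a - b ∣) (identity a b) (ℚ.∣p+q∣≤∣p∣+∣q∣ b (a - b))
    where
    identity : ∀ a b → b + (a - b) ≡ a
    identity = solve-∀ ℚ-ring

  ^-homo : ∀ x m n → x ^ (m ℕ.+ n) ≡ x ^ m * x ^ n
  ^-homo = SemiringExp.^-homo-* semiring

  ^-assoc : ∀ x m n → (x ^ m) ^ n ≡ x ^ (m ℕ.* n)
  ^-assoc = SemiringExp.^-assocʳ semiring

  ^-distrib : ∀ x y n → (x * y) ^ n ≡ x ^ n * y ^ n
  ^-distrib = CommutativeSemiringExp.^-distrib-* commutativeSemiring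

  1^ : ∀ n → 1ℚ ^ n ≡ 1ℚ
  1^ zero    = refl
  1^ (suc n) = trans (ℚ.*-identityˡ (1ℚ ^ n)) (1^ n)

  ^-nonneg : ∀ {x} n → 0ℚ ≤ x → 0ℚ ≤ x ^ n
  ^-nonneg zero    _   = 0≤1
  ^-nonneg (suc n) x≥0 = *-nonneg x≥0 (^-nonneg n x≥0)

  ^-pos : ∀ {x} n → 0ℚ < x → 0ℚ < x ^ n
  ^-pos     zero    _   = ℚ.positive⁻¹ 1ℚ
  ^-pos {x} (suc n) x>0 =
    subst (_< x * x ^ n) (ℚ.*-zeroʳ x) (ℚ.*-monoʳ-<-pos x {{ℚ.positive x>0}} (^-pos n x>0))

  ^-mono : ∀ {x y} n → 0ℚ ≤ x → x ≤ y → x ^ n ≤ y ^ n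
  ^-mono zero    _   _   = ℚ.≤-refl
  ^-mono (suc n) x≥0 x≤y = *-mono x≥0 x≤y (^-nonneg n x≥0) (^-mono n x≥0 x≤y)

  ^-≤1 : ∀ {x} n → 0ℚ ≤ x → x ≤ 1ℚ → x ^ n ≤ 1ℚ
  ^-≤1 n x≥0 x≤1 = ℚ.≤-trans (^-mono n x≥0 x≤1) (ℚ.≤-reflexive (1^ n))

  ^-≥1 : ∀ {x} n → 1ℚ ≤ x → 1ℚ ≤ x ^ n
  ^-≥1 n x≥1 = ℚ.≤-trans (ℚ.≤-reflexive (sym (1^ n))) (^-mono n 0≤1 x≥1)

  ^-antimono : ∀ {x m n} → 0ℚ ≤ x → x ≤ 1ℚ → m ℕ.≤ n → x ^ n ≤ x ^ m
  ^-antimono {x} {m} {n} x≥0 x≤1 m≤n = begin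
    x ^ n                   ≡⟨ cong (x ^_) (ℕ.m+[n∸m]≡n m≤n) ⟨
    x ^ (m ℕ.+ (n ℕ.∸ m))   ≡⟨ ^-homo x m (n ℕ.∸ m) ⟩
    x ^ m * x ^ (n ℕ.∸ m)   ≤⟨ *-≤ʳ (^-nonneg m x≥0) (^-≤1 (n ℕ.∸ m) x≥0 x≤1) ⟩
    x ^ m                   ∎
    where open ℚ.≤-Reasoning

  ^-mono-exp : ∀ {x m n} → 1ℚ ≤ x → m ℕ.≤ n → x ^ m ≤ x ^ n
  ^-mono-exp {x} {m} {n} x≥1 m≤n = begin
    x ^ m                   ≡⟨ ℚ.*-identityʳ (x ^ m) ⟨
    x ^ m * 1ℚ              ≤⟨ *-monoˡ (^-nonneg m (ℚ.≤-trans 0≤1 x≥1)) (^-≥1 (n ℕ.∸ m) x≥1) ⟩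
    x ^ m * x ^ (n ℕ.∸ m)   ≡⟨ ^-homo x m (n ℕ.∸ m) ⟨
    x ^ (m ℕ.+ (n ℕ.∸ m))   ≡⟨ cong (x ^_) (ℕ.m+[n∸m]≡n m≤n) ⟩
    x ^ n                   ∎
    where open ℚ.≤-Reasoning

  private
    integral : ℤ → ℚ
    integral i = ℚ.mkℚ i 0 (Coprimality.sym (Coprimality.1-coprimeTo ℤ.∣ i ∣))

  -- Opaque, as the normal forms of quotients by 1 are unwieldy.
  opaque
    ι : ℕ → ℚ
    ι n = + n ℚ./ 1

    fromℤ : ℤ → ℚ
    fromℤ i = i ℚ./ 1

    ι-def : ∀ n → ι n ≡ + n ℚ./ 1
    ι-def n = refl

    ι-0 : ι 0 ≡ 0ℚ
    ι-0 = refl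

    ι-1 : ι 1 ≡ 1ℚ
    ι-1 = refl

    fromℤ-0 : fromℤ 0ℤ ≡ 0ℚ
    fromℤ-0 = refl

    fromℤ-1 : fromℤ 1ℤ ≡ 1ℚ
    fromℤ-1 = refl

    fromℤ-integral : ∀ i → fromℤ i ≡ integral i
    fromℤ-integral i = ℚ.↥p/↧p≡p (integral i)

    fromℤ-+ : ∀ i j → fromℤ (i ℤ.+ j) ≡ fromℤ i + fromℤ j
    fromℤ-+ i j = begin
      fromℤ (i ℤ.+ j)                   ≡⟨ cong fromℤ (cong₂ ℤ._+_ (ℤ.*-identityʳ i) (ℤ.*-identityʳ j)) ⟨
      integral i + integral j           ≡⟨ cong₂ _+_ (fromℤ-integral i) (fromℤ-integral j) ⟨
      fromℤ i + fromℤ j                 ∎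
      where open ≡-Reasoning

    fromℤ-* : ∀ i j → fromℤ (i ℤ.* j) ≡ fromℤ i * fromℤ j
    fromℤ-* i j = sym (cong₂ _*_ (fromℤ-integral i) (fromℤ-integral j))

    fromℤ-neg : ∀ i → fromℤ (ℤ.- i) ≡ - fromℤ i
    fromℤ-neg i = begin
      fromℤ (ℤ.- i)                 ≡⟨ cong fromℤ (ℤ.-1*i≡-i i) ⟨
      fromℤ (-1ℤ ℤ.* i)             ≡⟨ fromℤ-* -1ℤ i ⟩
      - 1ℚ * fromℤ i                ≡⟨ ℚ.neg-distribˡ-* 1ℚ (fromℤ i) ⟨
      - (1ℚ * fromℤ i)              ≡⟨ cong -_ (ℚ.*-identityˡ (fromℤ i)) ⟩
      - fromℤ i                     ∎
      where open ≡-Reasoning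

    fromℤ-mono : ∀ {i j} → i ℤ.≤ j → fromℤ i ≤ fromℤ j
    fromℤ-mono {i} {j} i≤j =
      subst₂ _≤_ (sym (fromℤ-integral i)) (sym (fromℤ-integral j))
        (ℚ.*≤* (subst₂ ℤ._≤_ (sym (ℤ.*-identityʳ i)) (sym (ℤ.*-identityʳ j)) i≤j))

    fromℤ-cancel : ∀ {i j} → fromℤ i ≤ fromℤ j → i ℤ.≤ j
    fromℤ-cancel {i} {j} h
      with subst₂ _≤_ (fromℤ-integral i) (fromℤ-integral j) h
    ... | ℚ.*≤* h′ = subst₂ ℤ._≤_ (ℤ.*-identityʳ i) (ℤ.*-identityʳ j) h′

    ι-+ : ∀ m n → ι (m ℕ.+ n) ≡ ι m + ι n
    ι-+ m n = fromℤ-+ (+ m) (+ n)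

    ι-suc : ∀ n → ι (suc n) ≡ 1ℚ + ι n
    ι-suc n = trans (ι-+ 1 n) (cong (_+ ι n) ι-1)

    ι-* : ∀ m n → ι (m ℕ.* n) ≡ ι m * ι n
    ι-* m n = trans (cong fromℤ (ℤ.pos-* m n)) (fromℤ-* (+ m) (+ n))

    ι-2 : ι 2 ≡ 2ℚ
    ι-2 = refl

    ι-^ : ∀ m n → ι (m ℕ.^ n) ≡ ι m ^ n
    ι-^ m zero    = refl
    ι-^ m (suc n) = trans (ι-* m (m ℕ.^ n)) (cong (ι m *_) (ι-^ m n))

    ι-mono : ∀ {m n} → m ℕ.≤ n → ι m ≤ ι n
    ι-mono m≤n = fromℤ-mono (ℤ.+≤+ m≤n)

    ι-cancel : ∀ {m n} → ι m ≤ ι n → m ℕ.≤ n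
    ι-cancel h = ℤ.drop‿+≤+ (fromℤ-cancel h)

    ι-nonneg : ∀ n → 0ℚ ≤ ι n
    ι-nonneg n = ι-mono {0} {n} z≤n

    ι-pos : ∀ n → 0ℚ < ι (suc n)
    ι-pos n = ℚ.<-≤-trans (ℚ.positive⁻¹ 1ℚ) (ι-mono {1} {suc n} (s≤s z≤n))

    -- A denominator is at least 1. This Archimedean bound starts the search for the dyadic bracket
    -- of y.
    ≤-ι-numerator : ∀ x → x ≤ ι ℤ.∣ ℚ.↥ x ∣
    ≤-ι-numerator x@(ℚ.mkℚ (+ a) d-1 c) = subst (x ≤_) (sym (fromℤ-integral (+ a)))
      (ℚ.*≤* (ℤ.*-monoˡ-≤-nonNeg (+ a) (ℤ.+≤+ (s≤s z≤n))))
    ≤-ι-numerator x@(ℚ.mkℚ -[1+ a ] d-1 c) = ℚ.≤-trans (ℚ.<⇒≤ (ℚ.negative⁻¹ x)) (ι-nonneg (suc a))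

    ∣fromℤ∣ : ∀ i → ∣ fromℤ i ∣ ≡ ι ℤ.∣ i ∣
    ∣fromℤ∣ (+ n)      = ℚ.0≤p⇒∣p∣≡p (ι-nonneg n)
    ∣fromℤ∣ -[1+ n ] = begin
      ∣ fromℤ (ℤ.- (+ suc n)) ∣   ≡⟨ cong ∣_∣ (fromℤ-neg (+ suc n)) ⟩
      ∣ - ι (suc n) ∣             ≡⟨ ℚ.∣-p∣≡∣p∣ (ι (suc n)) ⟩
      ∣ ι (suc n) ∣               ≡⟨ ℚ.0≤p⇒∣p∣≡p (ι-nonneg (suc n)) ⟩
      ι (suc n)                   ∎
      where open ≡-Reasoning

  -- Each induction step discards a nonnegative multiple of x^2. The logarithm bounds and the last
  -- step of Mertens' theorem rest on this inequality.
  bernoulli : ∀ {x} n → 0ℚ ≤ 1ℚ + x → 1ℚ + ι n * x ≤ (1ℚ + x) ^ n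
  bernoulli {x} zero    _     = ℚ.≤-reflexive (trans (cong (λ y → 1ℚ + y) (trans (cong (_* x) ι-0) (ℚ.*-zeroˡ x))) (ℚ.+-identityʳ 1ℚ))
  bernoulli {x} (suc n) 1+x≥0 = begin
    1ℚ + ι (suc n) * x                        ≡⟨ cong (λ y → 1ℚ + y * x) (ι-suc n) ⟩
    1ℚ + (1ℚ + ι n) * x                       ≤⟨ +-nonneg-≤ (ι n * (x * x)) (*-nonneg (ι-nonneg n) (0≤x²)) (identity x (ι n)) ⟩
    (1ℚ + x) * (1ℚ + ι n * x)                 ≤⟨ *-monoˡ 1+x≥0 (bernoulli n 1+x≥0) ⟩
    (1ℚ + x) * (1ℚ + x) ^ n                   ∎
    where
    open ℚ.≤-Reasoning
    identity : ∀ x m → 1ℚ + (1ℚ + m) * x + m * (x * x) ≡ (1ℚ + x) * (1ℚ + m * x)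
    identity = solve-∀ ℚ-ring
    0≤x² : 0ℚ ≤ x * x
    0≤x² with ℚ.≤-total 0ℚ x
    ... | inj₁ x≥0 = *-nonneg x≥0 x≥0
    ... | inj₂ x≤0 = subst (0ℚ ≤_) (identity′ x) (*-nonneg (ℚ.neg-antimono-≤ x≤0) (ℚ.neg-antimono-≤ x≤0))
      where
      identity′ : ∀ x → - x * - x ≡ x * x
      identity′ = solve-∀ ℚ-ring

  bernoulli-neg : ∀ {x} n → x ≤ 1ℚ → 1ℚ - ι n * x ≤ (1ℚ - x) ^ n
  bernoulli-neg {x} n x≤1 =
    subst (_≤ (1ℚ - x) ^ n) (cong (λ y → 1ℚ + y) (sym (ℚ.neg-distribʳ-* (ι n) x))) (bernoulli n (≤⇒0≤- x≤1))

-- Folds over lists in a commutative monoid, for sums and products alike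

module ListFold {a} {A : Set a} (_∙_ : A → A → A) (ε : A) (isCommutativeMonoid : IsCommutativeMonoid _≡_ _∙_ ε) where
  open IsCommutativeMonoid isCommutativeMonoid using (assoc; comm; identityˡ; identityʳ)

  private
    variable
      b b′ : Level
      B : Set b
      B′ : Set b′

  ⨁ : List B → (B → A) → A
  ⨁ []       f = ε
  ⨁ (x ∷ xs) f = f x ∙ ⨁ xs f

  ⨁-congAll : {f g : B → A} {xs : List B} → All (λ x → f x ≡ g x) xs → ⨁ xs f ≡ ⨁ xs g
  ⨁-congAll []       = refl
  ⨁-congAll (p ∷ ps) = cong₂ _∙_ p (⨁-congAll ps)

  ⨁-cong : {f g : B → A} (xs : List B) → (∀ x → f x ≡ g x) → ⨁ xs f ≡ ⨁ xs g
  ⨁-cong xs f≗g = ⨁-congAll (All.universal f≗g xs)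

  ⨁-ε : (xs : List B) → ⨁ xs (λ _ → ε) ≡ ε
  ⨁-ε []       = refl
  ⨁-ε (x ∷ xs) = trans (identityˡ _) (⨁-ε xs)

  interchange : ∀ w x y z → (w ∙ x) ∙ (y ∙ z) ≡ (w ∙ y) ∙ (x ∙ z)
  interchange w x y z = begin
    (w ∙ x) ∙ (y ∙ z)   ≡⟨ assoc w x (y ∙ z) ⟩
    w ∙ (x ∙ (y ∙ z))   ≡⟨ cong (w ∙_) (assoc x y z) ⟨
    w ∙ ((x ∙ y) ∙ z)   ≡⟨ cong (λ u → w ∙ (u ∙ z)) (comm x y) ⟩
    w ∙ ((y ∙ x) ∙ z)   ≡⟨ cong (w ∙_) (assoc y x z) ⟩
    w ∙ (y ∙ (x ∙ z))   ≡⟨ assoc w y (x ∙ z) ⟨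
    (w ∙ y) ∙ (x ∙ z)   ∎
    where open ≡-Reasoning

  ⨁-distrib : (xs : List B) (f g : B → A) → ⨁ xs (λ x → f x ∙ g x) ≡ ⨁ xs f ∙ ⨁ xs g
  ⨁-distrib []       f g = sym (identityˡ ε)
  ⨁-distrib (x ∷ xs) f g =
    trans (cong ((f x ∙ g x) ∙_) (⨁-distrib xs f g)) (interchange (f x) (g x) _ _)

  ⨁-swap : (xs : List B) (ys : List B′) (f : B → B′ → A) →
           ⨁ xs (λ x → ⨁ ys (f x)) ≡ ⨁ ys (λ y → ⨁ xs (λ x → f x y))
  ⨁-swap []       ys f = sym (⨁-ε ys)
  ⨁-swap (x ∷ xs) ys f =
    trans (cong (⨁ ys (f x) ∙_) (⨁-swap xs ys f)) (sym (⨁-distrib ys (f x) _))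

  ⨁-++ : (xs ys : List B) (f : B → A) → ⨁ (xs ++ ys) f ≡ ⨁ xs f ∙ ⨁ ys f
  ⨁-++ []       ys f = sym (identityˡ _)
  ⨁-++ (x ∷ xs) ys f = trans (cong (f x ∙_) (⨁-++ xs ys f)) (sym (assoc (f x) _ _))

  ⨁-map : (g : B′ → B) (xs : List B′) (f : B → A) → ⨁ (map g xs) f ≡ ⨁ xs (f ∘ g)
  ⨁-map g []       f = refl
  ⨁-map g (x ∷ xs) f = cong (f (g x) ∙_) (⨁-map g xs f)

  ⨁-concatMap : (g : B′ → List B) (xs : List B′) (f : B → A) →
                ⨁ (concatMap g xs) f ≡ ⨁ xs (λ x → ⨁ (g x) f)
  ⨁-concatMap g []       f = refl
  ⨁-concatMap g (x ∷ xs) f =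
    trans (⨁-++ (g x) (concatMap g xs) f) (cong (⨁ (g x) f ∙_) (⨁-concatMap g xs f))

  ⨁-mapMaybe : (g : B′ → Maybe B) (xs : List B′) (f : B → A) →
               ⨁ (mapMaybe g xs) f ≡ ⨁ xs (λ x → maybe′ f ε (g x))
  ⨁-mapMaybe g []       f = refl
  ⨁-mapMaybe g (x ∷ xs) f with g x
  ... | just y  = cong (f y ∙_) (⨁-mapMaybe g xs f)
  ... | nothing = trans (⨁-mapMaybe g xs f) (sym (identityˡ _))

  ⨁-filter : ∀ {p} {P : B → Set p} (P? : ∀ x → Dec (P x)) (xs : List B) (f : B → A) →
             ⨁ (filter P? xs) f ≡ ⨁ xs (λ x → if does (P? x) then f x else ε)
  ⨁-filter P? []       f = refl
  ⨁-filter P? (x ∷ xs) f with does (P? x)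
  ... | true  = cong (f x ∙_) (⨁-filter P? xs f)
  ... | false = trans (⨁-filter P? xs f) (sym (identityˡ _))

  ⨁-cartesianProductWith : ∀ {b″} {B″ : Set b″} (g : B → B′ → B″) (xs : List B) (ys : List B′) (f : B″ → A) →
                           ⨁ (cartesianProductWith g xs ys) f ≡ ⨁ xs (λ x → ⨁ ys (λ y → f (g x y)))
  ⨁-cartesianProductWith g []       ys f = refl
  ⨁-cartesianProductWith g (x ∷ xs) ys f =
    trans (⨁-++ (map (g x) ys) _ f) (cong₂ _∙_ (⨁-map (g x) ys f) (⨁-cartesianProductWith g xs ys f))

  when : {P : Set b} → Dec P → A → A
  when P? x = if does P? then x else ε

  when-yes : {P : Set b} (P? : Dec P) {x : A} → P → when P? x ≡ x
  when-yes (yes _) p = refl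
  when-yes (no ¬p) p = contradiction p ¬p

  when-no : {P : Set b} (P? : Dec P) {x : A} → ¬ P → when P? x ≡ ε
  when-no (yes p) ¬p = contradiction p ¬p
  when-no (no _)  ¬p = refl

  when-⇔ : {P : Set b} {Q : Set b′} (P? : Dec P) (Q? : Dec Q) {x : A} → (P → Q) → (Q → P) → when P? x ≡ when Q? x
  when-⇔ (yes p) Q? f g = sym (when-yes Q? (f p))
  when-⇔ (no ¬p) Q? f g = sym (when-no Q? (¬p ∘ g))

  ⨁-allFin-≟ : ∀ n (j : Fin n) (x : A) → ⨁ (allFin n) (λ i → when (i Fin.≟ j) x) ≡ x
  ⨁-allFin-≟ (suc n) j x = begin
    when (zero Fin.≟ j) x ∙ ⨁ (tabulate suc) (λ i → when (i Fin.≟ j) x)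
      ≡⟨ cong (λ l → when (zero Fin.≟ j) x ∙ ⨁ l (λ i → when (i Fin.≟ j) x)) (map-tabulate id suc) ⟨
    when (zero Fin.≟ j) x ∙ ⨁ (map suc (allFin n)) (λ i → when (i Fin.≟ j) x)
      ≡⟨ cong (when (zero Fin.≟ j) x ∙_) (⨁-map suc (allFin n) (λ i → when (i Fin.≟ j) x)) ⟩
    when (zero Fin.≟ j) x ∙ ⨁ (allFin n) (λ i → when (suc i Fin.≟ j) x)
      ≡⟨ split j ⟩
    x ∎
    where
    open ≡-Reasoning
    split : ∀ j → when (zero Fin.≟ j) x ∙ ⨁ (allFin n) (λ i → when (suc i Fin.≟ j) x) ≡ x
    split zero    = trans (cong (x ∙_) (trans (⨁-cong (allFin n) (λ i → when-no (suc i Fin.≟ zero) {x} λ ()))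
        (⨁-ε (allFin n)))) (identityʳ x)
    split (suc j) = trans (identityˡ _)
      (trans (⨁-cong (allFin n) (λ i → when-⇔ (suc i Fin.≟ suc j) (i Fin.≟ j) {x} Fin.suc-injective (cong suc))) (⨁-allFin-≟ n j x))

-- The integers lo + k, …, lo + 1.
interval : ℕ → ℕ → List ℕ
interval lo zero    = []
interval lo (suc k) = lo ℕ.+ suc k ∷ interval lo k

interval-++ : ∀ lo k l → interval lo (k ℕ.+ l) ≡ interval (lo ℕ.+ k) l ++ interval lo k
interval-++ lo k zero    = cong (interval lo) (ℕ.+-identityʳ k)
interval-++ lo k (suc l) rewrite ℕ.+-suc k l =
  cong₂ _∷_ (trans (cong (lo ℕ.+_) (sym (ℕ.+-suc k l))) (sym (ℕ.+-assoc lo k (suc l)))) (interval-++ lo k l)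

interval-bounds : ∀ lo k → All (λ i → lo ℕ.< i × i ℕ.≤ lo ℕ.+ k) (interval lo k)
interval-bounds lo zero    = []
interval-bounds lo (suc k) =
  (ℕ.m<m+n lo (s≤s z≤n) , ℕ.≤-refl) ∷
  All.map (λ (l , u) → l , ℕ.≤-trans u (ℕ.+-monoʳ-≤ lo (ℕ.n≤1+n k))) (interval-bounds lo k)

length-interval : ∀ lo k → length (interval lo k) ≡ k
length-interval lo zero    = refl
length-interval lo (suc k) = cong suc (length-interval lo k)

-- Inequalities for finite sums and products of rationals

module RationalSums where
  open import Data.Rational.Base using (_+_; _*_; _-_; -_; _≤_; ∣_∣)
  open RationalOrder

  private
    variable
      b : Level
      B : Set b

  module Sum = ListFold ℚ._+_ 0ℚ ℚ.+-0-isCommutativeMonoid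
  module Product = ListFold ℚ._*_ 1ℚ ℚ.*-1-isCommutativeMonoid
  open Sum public using () renaming (⨁ to ∑)
  open Product public using () renaming (⨁ to ∏)

  ∑-mono : {f g : B → ℚ} {xs : List B} → All (λ x → f x ≤ g x) xs → ∑ xs f ≤ ∑ xs g
  ∑-mono []       = ℚ.≤-refl
  ∑-mono (p ∷ ps) = ℚ.+-mono-≤ p (∑-mono ps)

  ∑-nonneg : {f : B → ℚ} (xs : List B) → (∀ x → 0ℚ ≤ f x) → 0ℚ ≤ ∑ xs f
  ∑-nonneg []       _ = ℚ.≤-refl
  ∑-nonneg (x ∷ xs) p = +-nonneg (p x) (∑-nonneg xs p)

  ∑-*ˡ : (c : ℚ) (xs : List B) (f : B → ℚ) → ∑ xs (λ x → c * f x) ≡ c * ∑ xs f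
  ∑-*ˡ c []       f = sym (ℚ.*-zeroʳ c)
  ∑-*ˡ c (x ∷ xs) f = trans (cong (λ y → c * f x + y) (∑-*ˡ c xs f)) (sym (ℚ.*-distribˡ-+ c (f x) (∑ xs f)))

  ∑-*ʳ : (c : ℚ) (xs : List B) (f : B → ℚ) → ∑ xs (λ x → f x * c) ≡ ∑ xs f * c
  ∑-*ʳ c xs f =
    trans (Sum.⨁-cong xs (λ x → ℚ.*-comm (f x) c)) (trans (∑-*ˡ c xs f) (ℚ.*-comm c (∑ xs f)))

  ∑-neg : (xs : List B) (f : B → ℚ) → ∑ xs (λ x → - f x) ≡ - ∑ xs f
  ∑-neg []       f = refl
  ∑-neg (x ∷ xs) f = trans (cong (λ y → - f x + y) (∑-neg xs f)) (sym (ℚ.neg-distrib-+ (f x) (∑ xs f)))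

  ∑-minus : (xs : List B) (f g : B → ℚ) → ∑ xs (λ x → f x - g x) ≡ ∑ xs f - ∑ xs g
  ∑-minus xs f g =
    trans (Sum.⨁-distrib xs f (λ x → - g x)) (cong (λ y → ∑ xs f + y) (∑-neg xs g))

  ∣∑∣-≤ : (xs : List B) (f : B → ℚ) → ∣ ∑ xs f ∣ ≤ ∑ xs (λ x → ∣ f x ∣)
  ∣∑∣-≤ []       f = ℚ.≤-refl
  ∣∑∣-≤ (x ∷ xs) f =
    ℚ.≤-trans (ℚ.∣p+q∣≤∣p∣+∣q∣ (f x) (∑ xs f)) (ℚ.+-monoʳ-≤ ∣ f x ∣ (∣∑∣-≤ xs f))

  ∑-const : (c : ℚ) (xs : List B) → ∑ xs (λ _ → c) ≡ ι (length xs) * c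
  ∑-const c []       = sym (trans (cong (_* c) ι-0) (ℚ.*-zeroˡ c))
  ∑-const c (x ∷ xs) = begin
    c + ∑ xs (λ _ → c)          ≡⟨ cong (λ y → c + y) (∑-const c xs) ⟩
    c + ι (length xs) * c       ≡⟨ identity c (ι (length xs)) ⟩
    (1ℚ + ι (length xs)) * c    ≡⟨ cong (_* c) (ι-suc (length xs)) ⟨
    ι (suc (length xs)) * c     ∎
    where
    open ≡-Reasoning
    identity : ∀ c m → c + m * c ≡ (1ℚ + m) * c
    identity = solve-∀ ℚ-ring

  ∑-≤-const : {f : B → ℚ} {c : ℚ} {xs : List B} → All (λ x → f x ≤ c) xs → ∑ xs f ≤ ι (length xs) * c
  ∑-≤-const {c = c} {xs} ps = ℚ.≤-trans (∑-mono ps) (ℚ.≤-reflexive (∑-const c xs))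

  ∏-nonneg : {f : B → ℚ} {xs : List B} → All (λ x → 0ℚ ≤ f x) xs → 0ℚ ≤ ∏ xs f
  ∏-nonneg []       = 0≤1
  ∏-nonneg (p ∷ ps) = *-nonneg p (∏-nonneg ps)

  ∏-≤1 : {f : B → ℚ} {xs : List B} → All (λ x → 0ℚ ≤ f x × f x ≤ 1ℚ) xs → ∏ xs f ≤ 1ℚ
  ∏-≤1 []             = ℚ.≤-refl
  ∏-≤1 ((p , q) ∷ ps) = *-≤1 p q (∏-≤1 ps)

  -- Weierstrass' product inequality: splitting off the factor 1 - f x costs f x times a product
  -- that is at most 1.
  ∏-≥1-∑ : {f : B → ℚ} {xs : List B} → All (λ x → 0ℚ ≤ f x × f x ≤ 1ℚ) xs →
           1ℚ - ∑ xs f ≤ ∏ xs (λ x → 1ℚ - f x)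
  ∏-≥1-∑ []                                    = ℚ.≤-refl
  ∏-≥1-∑ {f = f} {x ∷ xs} ((f≥0 , f≤1) ∷ ps) = begin
    1ℚ - (f x + ∑ xs f)                     ≡⟨ identity (f x) (∑ xs f) ⟩
    1ℚ - ∑ xs f - f x * 1ℚ                  ≤⟨ ℚ.+-mono-≤ (∏-≥1-∑ ps) (ℚ.neg-antimono-≤ (*-monoˡ f≥0 Π≤1)) ⟩
    Π - f x * Π                             ≡⟨ identity′ (f x) Π ⟩
    (1ℚ - f x) * Π                          ∎
    where
    open ℚ.≤-Reasoning
    Π = ∏ xs (λ y → 1ℚ - f y)
    Π≤1 : Π ≤ 1ℚ
    Π≤1 = ∏-≤1 (All.map (λ {y} (p , q) → ≤⇒0≤- q , +-nonneg-≤ (f y) p (identity″ (f y))) ps)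
      where
      identity″ : ∀ a → 1ℚ - a + a ≡ 1ℚ
      identity″ = solve-∀ ℚ-ring
    identity : ∀ a s → 1ℚ - (a + s) ≡ 1ℚ - s - a * 1ℚ
    identity = solve-∀ ℚ-ring
    identity′ : ∀ a p → p - a * p ≡ (1ℚ - a) * p
    identity′ = solve-∀ ℚ-ring

  ∣∏∣-≤1 : {f : B → ℚ} (xs : List B) → (∀ x → ∣ f x ∣ ≤ 1ℚ) → ∣ ∏ xs f ∣ ≤ 1ℚ
  ∣∏∣-≤1         []       _ = ℚ.≤-refl
  ∣∏∣-≤1 {f = f} (x ∷ xs) p =
    subst (_≤ 1ℚ) (sym (ℚ.∣p*q∣≡∣p∣*∣q∣ (f x) (∏ xs f))) (*-≤1 (ℚ.0≤∣p∣ (f x)) (p x) (∣∏∣-≤1 xs p))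

  ∣*-*∣-≤ : ∀ a b c d → ∣ a ∣ ≤ 1ℚ → ∣ d ∣ ≤ 1ℚ → ∣ a * c - b * d ∣ ≤ ∣ a - b ∣ + ∣ c - d ∣
  ∣*-*∣-≤ a b c d a≤1 d≤1 = begin
    ∣ a * c - b * d ∣                     ≡⟨ cong ∣_∣ (identity a b c d) ⟩
    ∣ (a - b) * d + a * (c - d) ∣         ≤⟨ ℚ.∣p+q∣≤∣p∣+∣q∣ ((a - b) * d) (a * (c - d)) ⟩
    ∣ (a - b) * d ∣ + ∣ a * (c - d) ∣     ≡⟨ cong₂ _+_ (ℚ.∣p*q∣≡∣p∣*∣q∣ (a - b) d) (ℚ.∣p*q∣≡∣p∣*∣q∣ a (c - d)) ⟩
    ∣ a - b ∣ * ∣ d ∣ + ∣ a ∣ * ∣ c - d ∣ ≤⟨ ℚ.+-mono-≤ (*-≤ʳ (ℚ.0≤∣p∣ (a - b)) d≤1)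
                                                (ℚ.≤-trans (*-monoʳ (ℚ.0≤∣p∣ (c - d)) a≤1) (ℚ.≤-reflexive (ℚ.*-identityˡ _))) ⟩
    ∣ a - b ∣ + ∣ c - d ∣                 ∎
    where
    open ℚ.≤-Reasoning
    identity : ∀ a b c d → a * c - b * d ≡ (a - b) * d + a * (c - d)
    identity = solve-∀ ℚ-ring

  -- Factors are exchanged one at a time while all others are bounded by 1. This turns a
  -- modification of the local factors of λ into a union bound over primes.
  ∣∏-∏∣-≤ : {f g : B → ℚ} (xs : List B) → (∀ x → ∣ f x ∣ ≤ 1ℚ) → (∀ x → ∣ g x ∣ ≤ 1ℚ) →
            ∣ ∏ xs f - ∏ xs g ∣ ≤ ∑ xs (λ x → ∣ f x - g x ∣)
  ∣∏-∏∣-≤                 []       _  _  = ℚ.≤-refl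
  ∣∏-∏∣-≤ {f = f} {g = g} (x ∷ xs) f≤ g≤ =
    ℚ.≤-trans (∣*-*∣-≤ (f x) (g x) (∏ xs f) (∏ xs g) (f≤ x) (∣∏∣-≤1 xs g≤))
      (ℚ.+-monoʳ-≤ ∣ f x - g x ∣ (∣∏-∏∣-≤ xs f≤ g≤))


  fromℤ-∑ : (φ : B → ℤ) (xs : List B) → fromℤ (foldr ℤ._+_ 0ℤ (map φ xs)) ≡ ∑ xs (fromℤ ∘ φ)
  fromℤ-∑ φ []       = fromℤ-0
  fromℤ-∑ φ (x ∷ xs) = trans (fromℤ-+ (φ x) _) (cong (λ y → fromℤ (φ x) + y) (fromℤ-∑ φ xs))

-- Inclusion and exclusion for ∏ (1 - 2 u), truncated at a level r

module TruncatedProducts where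
  open import Data.Rational.Base using (_+_; _*_; _-_; -_; _≤_; _<_; ∣_∣)
  open RationalOrder
  open RationalSums

  private
    variable
      b : Level
      B : Set b

  -- The elementary symmetric polynomial e_j of the values of u; a new entry x is either omitted or
  -- chosen. In these terms ∏ (1 - 2 u) is the sum of (-2)^j e_j.
  elementary : ℕ → List B → (B → ℚ) → ℚ
  elementary zero    L       u = 1ℚ
  elementary (suc j) []      u = 0ℚ
  elementary (suc j) (x ∷ L) u = elementary (suc j) L u + u x * elementary j L u

  -- The expansion of ∏ (1 - 2 u) up to degree r.
  truncation : ℕ → List B → (B → ℚ) → ℚ
  truncation zero    L u = 1ℚ
  truncation (suc r) L u = truncation r L u + (- 2ℚ) ^ suc r * elementary (suc r) L u

  truncation-[] : ∀ r (u : B → ℚ) → truncation r [] u ≡ 1ℚ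
  truncation-[] zero    u = refl
  truncation-[] (suc r) u = trans (cong₂ _+_ (truncation-[] r u) (ℚ.*-zeroʳ ((- 2ℚ) ^ suc r))) (ℚ.+-identityʳ 1ℚ)

  -- The analogue of multiplying by 1 - 2 u x, with the level lowered in the second term. The full
  -- product obeys the same recursion, so their difference does too.
  truncation-∷ : ∀ r x (L : List B) u → truncation (suc r) (x ∷ L) u ≡ truncation (suc r) L u - 2ℚ * u x * truncation r L u
  truncation-∷ zero    x L u = identity (elementary 1 L u) (u x)
    where
    identity : ∀ e a → 1ℚ + (- 2ℚ * 1ℚ) * (e + a * 1ℚ) ≡ 1ℚ + (- 2ℚ * 1ℚ) * e - 2ℚ * a * 1ℚ
    identity = solve-∀ ℚ-ring
  truncation-∷ (suc r) x L u =
    trans (cong (λ t → t + (- 2ℚ) ^ suc (suc r) * elementary (suc (suc r)) (x ∷ L) u) (truncation-∷ r x L u))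
      (identity (truncation (suc r) L u) (truncation r L u) (u x) ((- 2ℚ) ^ suc r) (elementary (suc (suc r)) L u)
          (elementary (suc r) L u))
    where
    identity : ∀ t′ t a p e′ e → t′ - 2ℚ * a * t + (- 2ℚ * p) * (e′ + a * e) ≡ t′ + (- 2ℚ * p) * e′ - 2ℚ * a * (t + p * e)
    identity = solve-∀ ℚ-ring

  elementary-nonneg : ∀ j {L : List B} {u} → All (λ x → 0ℚ ≤ u x) L → 0ℚ ≤ elementary j L u
  elementary-nonneg zero    _        = 0≤1
  elementary-nonneg (suc j) []       = ℚ.≤-refl
  elementary-nonneg (suc j) (p ∷ ps) = +-nonneg (elementary-nonneg (suc j) ps) (*-nonneg p (elementary-nonneg j ps))

  ∣1-2u∣≤1 : ∀ {a} → 0ℚ ≤ a → a ≤ 1ℚ → ∣ 1ℚ - 2ℚ * a ∣ ≤ 1ℚ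
  ∣1-2u∣≤1 {a} a≥0 a≤1 = ∣∣-≤
    (+-nonneg-≤ (2ℚ * a) (*-nonneg 0≤2 a≥0) (identity a))
    (+-nonneg-≤ (2ℚ * (1ℚ - a)) (*-nonneg 0≤2 (≤⇒0≤- a≤1)) (identity′ a))
    where
    identity : ∀ a → 1ℚ - 2ℚ * a + 2ℚ * a ≡ 1ℚ
    identity = solve-∀ ℚ-ring
    identity′ : ∀ a → - (1ℚ - 2ℚ * a) + 2ℚ * (1ℚ - a) ≡ 1ℚ
    identity′ = solve-∀ ℚ-ring

  ∣∏1-2u∣≤1 : {L : List B} (u : B → ℚ) → All (λ x → 0ℚ ≤ u x × u x ≤ 1ℚ) L → ∣ ∏ L (λ x → 1ℚ - 2ℚ * u x) ∣ ≤ 1ℚ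
  ∣∏1-2u∣≤1             u []             = ℚ.≤-refl
  ∣∏1-2u∣≤1 {L = x ∷ L} u ((p , q) ∷ ps) =
    subst (_≤ 1ℚ) (sym (ℚ.∣p*q∣≡∣p∣*∣q∣ (1ℚ - 2ℚ * u x) _)) (*-≤1 (ℚ.0≤∣p∣ _) (∣1-2u∣≤1 p q) (∣∏1-2u∣≤1 u ps))

  -- For both parities of r: the error at level r + 1 for x ∷ L is the error for L minus 2 u x times
  -- the error at level r, and 2^(r+1) e_(r+1) satisfies this recursion with a plus sign. At level 0
  -- the bound |∏ (1 - 2 u)| ≤ 1 plays the part of the lower error.
  truncation-error : ∀ r {L : List B} {u} → All (λ x → 0ℚ ≤ u x × u x ≤ 1ℚ) L →
    ∣ ∏ L (λ x → 1ℚ - 2ℚ * u x) - truncation r L u ∣ ≤ 2ℚ ^ suc r * elementary (suc r) L u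
  truncation-error r {[]} {u} [] = ℚ.≤-reflexive
    (trans (cong (λ t → ∣ 1ℚ - t ∣) (truncation-[] r u)) (sym (ℚ.*-zeroʳ (2ℚ ^ suc r))))
  truncation-error zero {x ∷ L} {u} ((p , q) ∷ ps) = begin
    ∣ (1ℚ - 2ℚ * u x) * W - 1ℚ ∣                       ≡⟨ cong ∣_∣ (identity (u x) W) ⟩
    ∣ (W - 1ℚ) - (2ℚ * u x) * W ∣                       ≤⟨ ℚ.∣p-q∣≤∣p∣+∣q∣ (W - 1ℚ) _ ⟩
    ∣ W - 1ℚ ∣ + ∣ (2ℚ * u x) * W ∣                     ≤⟨ ℚ.+-mono-≤ (truncation-error zero ps) product ⟩
    2ℚ * 1ℚ * elementary 1 L u + 2ℚ * u x               ≡⟨ identity′ (elementary 1 L u) (u x) ⟩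
    2ℚ * 1ℚ * (elementary 1 L u + u x * 1ℚ)             ∎
    where
    open ℚ.≤-Reasoning
    W = ∏ L (λ y → 1ℚ - 2ℚ * u y)
    2u≥0 : 0ℚ ≤ 2ℚ * u x
    2u≥0 = *-nonneg 0≤2 p
    product : ∣ (2ℚ * u x) * W ∣ ≤ 2ℚ * u x
    product = ℚ.≤-trans (ℚ.≤-reflexive (trans (ℚ.∣p*q∣≡∣p∣*∣q∣ (2ℚ * u x) W) (cong (_* ∣ W ∣) (ℚ.0≤p⇒∣p∣≡p 2u≥0))))
        (*-≤ʳ 2u≥0 (∣∏1-2u∣≤1 u ps))
    identity : ∀ a w → (1ℚ - 2ℚ * a) * w - 1ℚ ≡ (w - 1ℚ) - (2ℚ * a) * w
    identity = solve-∀ ℚ-ring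
    identity′ : ∀ e a → 2ℚ * 1ℚ * e + 2ℚ * a ≡ 2ℚ * 1ℚ * (e + a * 1ℚ)
    identity′ = solve-∀ ℚ-ring
  truncation-error (suc r) {x ∷ L} {u} ((p , q) ∷ ps) = begin
    ∣ (1ℚ - 2ℚ * u x) * W - truncation (suc r) (x ∷ L) u ∣         ≡⟨ cong (λ t → ∣ (1ℚ - 2ℚ * u x) * W - t ∣) (truncation-∷ r x L u) ⟩
    ∣ (1ℚ - 2ℚ * u x) * W - (t′ - 2ℚ * u x * t) ∣                  ≡⟨ cong ∣_∣ (identity (u x) W t′ t) ⟩
    ∣ (W - t′) - (2ℚ * u x) * (W - t) ∣                            ≤⟨ ℚ.∣p-q∣≤∣p∣+∣q∣ (W - t′) _ ⟩
    ∣ W - t′ ∣ + ∣ (2ℚ * u x) * (W - t) ∣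
        ≡⟨ cong (λ y → ∣ W - t′ ∣ + y) (trans (ℚ.∣p*q∣≡∣p∣*∣q∣ (2ℚ * u x) (W - t)) (cong (_* ∣ W - t ∣) (ℚ.0≤p⇒∣p∣≡p 2u≥0))) ⟩
    ∣ W - t′ ∣ + 2ℚ * u x * ∣ W - t ∣
        ≤⟨ ℚ.+-mono-≤ (truncation-error (suc r) ps) (*-monoˡ 2u≥0 (truncation-error r ps)) ⟩
    (2ℚ * P) * e′ + 2ℚ * u x * (P * e)                             ≡⟨ identity′ P e′ e (u x) ⟩
    (2ℚ * P) * (e′ + u x * e)                                      ∎
    where
    open ℚ.≤-Reasoning
    W = ∏ L (λ y → 1ℚ - 2ℚ * u y)
    t′ = truncation (suc r) L u
    t = truncation r L u
    P = 2ℚ ^ suc r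
    e′ = elementary (suc (suc r)) L u
    e = elementary (suc r) L u
    2u≥0 : 0ℚ ≤ 2ℚ * u x
    2u≥0 = *-nonneg 0≤2 p
    identity : ∀ a w t′ t → (1ℚ - 2ℚ * a) * w - (t′ - 2ℚ * a * t) ≡ (w - t′) - (2ℚ * a) * (w - t)
    identity = solve-∀ ℚ-ring
    identity′ : ∀ P e′ e a → (2ℚ * P) * e′ + 2ℚ * a * (P * e) ≡ (2ℚ * P) * (e′ + a * e)
    identity′ = solve-∀ ℚ-ring

  -- In e_1 e_j each product of j + 1 different entries arises j + 1 times, and the products with a
  -- repeated entry are nonnegative.
  elementary-step : ∀ j {L : List B} {u} → All (λ x → 0ℚ ≤ u x) L →
                    ι (suc j) * elementary (suc j) L u ≤ ∑ L u * elementary j L u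
  elementary-step j {[]} {u} [] = ℚ.≤-reflexive (trans (ℚ.*-zeroʳ (ι (suc j))) (sym (ℚ.*-zeroˡ (elementary j [] u))))
  elementary-step zero {x ∷ L} {u} (p ∷ ps) = begin
    ι 1 * (e + u x * 1ℚ)          ≡⟨ cong (_* (e + u x * 1ℚ)) ι-1 ⟩
    1ℚ * (e + u x * 1ℚ)           ≡⟨ identity e (u x) ⟩
    1ℚ * e + u x                  ≡⟨ cong (λ y → y * e + u x) ι-1 ⟨
    ι 1 * e + u x                 ≤⟨ ℚ.+-monoˡ-≤ (u x) (elementary-step zero ps) ⟩
    ∑ L u * 1ℚ + u x              ≡⟨ identity′ (∑ L u) (u x) ⟩
    (u x + ∑ L u) * 1ℚ            ∎
    where
    open ℚ.≤-Reasoning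
    e = elementary 1 L u
    identity : ∀ e a → 1ℚ * (e + a * 1ℚ) ≡ 1ℚ * e + a
    identity = solve-∀ ℚ-ring
    identity′ : ∀ s a → s * 1ℚ + a ≡ (a + s) * 1ℚ
    identity′ = solve-∀ ℚ-ring
  elementary-step (suc j) {x ∷ L} {u} (p ∷ ps) = begin
    ι (suc (suc j)) * (e″ + u x * e′)                           ≡⟨ cong (_* (e″ + u x * e′)) (ι-suc (suc j)) ⟩
    (1ℚ + ι (suc j)) * (e″ + u x * e′)                          ≡⟨ identity (ι (suc j)) e″ e′ (u x) ⟩
    (1ℚ + ι (suc j)) * e″ + u x * (ι (suc j) * e′) + u x * e′
        ≡⟨ cong (λ y → y * e″ + u x * (ι (suc j) * e′) + u x * e′) (ι-suc (suc j)) ⟨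
    ι (suc (suc j)) * e″ + u x * (ι (suc j) * e′) + u x * e′
        ≤⟨ ℚ.+-monoˡ-≤ (u x * e′) (ℚ.+-mono-≤ (elementary-step (suc j) ps) (*-monoˡ p (elementary-step j ps))) ⟩
    s * e′ + u x * (s * e) + u x * e′
        ≤⟨ +-nonneg-≤ (u x * (u x * e)) (*-nonneg p (*-nonneg p (elementary-nonneg j ps))) (identity′ s e′ e (u x)) ⟩
    (u x + s) * (e′ + u x * e)                                  ∎
    where
    open ℚ.≤-Reasoning
    s = ∑ L u
    e″ = elementary (suc (suc j)) L u
    e′ = elementary (suc j) L u
    e = elementary j L u
    identity : ∀ m e″ e′ a → (1ℚ + m) * (e″ + a * e′) ≡ (1ℚ + m) * e″ + a * (m * e′) + a * e′
    identity = solve-∀ ℚ-ring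
    identity′ : ∀ s e′ e a → s * e′ + a * (s * e) + a * e′ + a * (a * e) ≡ (a + s) * (e′ + a * e)
    identity′ = solve-∀ ℚ-ring

  module _ {L : List B} {u : B → ℚ} (u≥0 : All (λ x → 0ℚ ≤ u x) L) (a : ℕ) (bound : 2ℚ * ∑ L u ≤ ι a) where
    private
      ê : ℕ → ℚ
      ê j = 2ℚ ^ j * elementary j L u

      ê≥0 : ∀ j → 0ℚ ≤ ê j
      ê≥0 j = *-nonneg (^-nonneg j 0≤2) (elementary-nonneg j u≥0)

      step : ∀ j → ι (suc j) * ê (suc j) ≤ ι a * ê j
      step j = begin
        ι (suc j) * (2ℚ * 2ℚ ^ j * elementary (suc j) L u)      ≡⟨ identity (ι (suc j)) (2ℚ ^ j) (elementary (suc j) L u) ⟩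
        (2ℚ * 2ℚ ^ j) * (ι (suc j) * elementary (suc j) L u)    ≤⟨ *-monoˡ (^-nonneg (suc j) 0≤2) (elementary-step j u≥0) ⟩
        (2ℚ * 2ℚ ^ j) * (∑ L u * elementary j L u)              ≡⟨ identity′ (2ℚ ^ j) (∑ L u) (elementary j L u) ⟩
        (2ℚ * ∑ L u) * ê j                                      ≤⟨ *-monoʳ (ê≥0 j) bound ⟩
        ι a * ê j                                               ∎
        where
        open ℚ.≤-Reasoning
        identity : ∀ m p e → m * (2ℚ * p * e) ≡ (2ℚ * p) * (m * e)
        identity = solve-∀ ℚ-ring
        identity′ : ∀ p s e → (2ℚ * p) * (s * e) ≡ (2ℚ * s) * (p * e)
        identity′ = solve-∀ ℚ-ring

      growth : ∀ j → ê j ≤ ι a ^ j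
      growth zero    = ℚ.≤-refl
      growth (suc j) = begin
        ê (suc j)                ≡⟨ trans (sym (ℚ.*-identityˡ _)) (cong (_* ê (suc j)) (sym ι-1)) ⟩
        ι 1 * ê (suc j)          ≤⟨ *-monoʳ (ê≥0 (suc j)) (ι-mono {1} {suc j} (s≤s z≤n)) ⟩
        ι (suc j) * ê (suc j)    ≤⟨ step j ⟩
        ι a * ê j                ≤⟨ *-monoˡ (ι-nonneg a) (growth j) ⟩
        ι a * ι a ^ j            ∎
        where open ℚ.≤-Reasoning

      decay : 0 ℕ.< a → ∀ m → 2ℚ ^ m * ê (2 ℕ.* a ℕ.+ m) ≤ ê (2 ℕ.* a)
      decay a>0 zero    = ℚ.≤-reflexive (trans (ℚ.*-identityˡ _) (cong ê (ℕ.+-identityʳ (2 ℕ.* a))))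
      decay a>0 (suc m) = begin
        2ℚ * 2ℚ ^ m * ê (2 ℕ.* a ℕ.+ suc m)      ≡⟨ identity (2ℚ ^ m) _ ⟩
        2ℚ ^ m * (2ℚ * ê (2 ℕ.* a ℕ.+ suc m))    ≡⟨ cong (λ k → 2ℚ ^ m * (2ℚ * ê k)) (ℕ.+-suc (2 ℕ.* a) m) ⟩
        2ℚ ^ m * (2ℚ * ê (suc k))                ≤⟨ *-monoˡ (^-nonneg m 0≤2) halve ⟩
        2ℚ ^ m * ê k                             ≤⟨ decay a>0 m ⟩
        ê (2 ℕ.* a)                              ∎
        where
        open ℚ.≤-Reasoning
        k = 2 ℕ.* a ℕ.+ m
        identity : ∀ p e → 2ℚ * p * e ≡ p * (2ℚ * e)
        identity = solve-∀ ℚ-ring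
        halve : 2ℚ * ê (suc k) ≤ ê k
        halve = *-cancelˡ {c = ι a} (ℚ.<-≤-trans (ι-pos 0) (ι-mono a>0)) (begin
          ι a * (2ℚ * ê (suc k))          ≡⟨ identity″ (ι a) (ê (suc k)) ⟩
          (2ℚ * ι a) * ê (suc k)          ≡⟨ cong (_* ê (suc k)) (trans (cong (_* ι a) (sym ι-2)) (sym (ι-* 2 a))) ⟩
          ι (2 ℕ.* a) * ê (suc k)         ≤⟨ *-monoʳ (ê≥0 (suc k)) (ι-mono (ℕ.≤-trans (ℕ.m≤m+n (2 ℕ.* a) m) (ℕ.n≤1+n k))) ⟩
          ι (suc k) * ê (suc k)           ≤⟨ step k ⟩
          ι a * ê k                       ∎)
          where
          identity″ : ∀ c e → c * (2ℚ * e) ≡ (2ℚ * c) * e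
          identity″ = solve-∀ ℚ-ring

    -- Up to constants 2^j e_j ≤ a^j / j!, whose successive quotients are at most 1/2 from j = 2a on.
    elementary-decay : 0 ℕ.< a → ∀ m → 2ℚ ^ m * (2ℚ ^ (2 ℕ.* a ℕ.+ m) * elementary (2 ℕ.* a ℕ.+ m) L u) ≤ ι a ^ (2 ℕ.* a)
    elementary-decay a>0 m = ℚ.≤-trans (decay a>0 m) (growth (2 ℕ.* a))

-- The commutative ring of polynomials as coefficient lists

module PolynomialRing {c ℓ : Level} (F : FiniteField c ℓ) where
  open Polynomials F public
  private
    module F = FiniteField F
    module FP = RingProperties F.ring
  open F using (_≈_; _+_; _*_; -_; 0#; 1#)

  private
    interchange : ∀ a b x y → (a + b) + (x + y) ≈ (a + x) + (b + y)
    interchange = CommutativeSemigroupProperties.interchange F.+-commutativeSemigroup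

  -- A record, so that both sides can be inferred from a proof.
  infix 4 _≃_
  record _≃_ (f g : Poly) : Set ℓ where
    constructor mk
    field at : f ≋ g
  open _≃_ public

  ≃-refl : ∀ {f} → f ≃ f
  ≃-refl = mk λ i → F.refl

  ≃-sym : ∀ {f g} → f ≃ g → g ≃ f
  ≃-sym e = mk λ i → F.sym (at e i)

  ≃-trans : ∀ {f g h} → f ≃ g → g ≃ h → f ≃ h
  ≃-trans e e′ = mk λ i → F.trans (at e i) (at e′ i)

  ∷-cong : ∀ {a b f g} → a ≈ b → f ≃ g → a ∷ f ≃ b ∷ g
  ∷-cong a≈b f≃g = mk λ { zero → a≈b ; (suc i) → at f≃g i }

  ≃-tail : ∀ {a b f g} → a ∷ f ≃ b ∷ g → f ≃ g
  ≃-tail e = mk λ i → at e (suc i)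

  ≃[]-tail : ∀ {a f} → a ∷ f ≃ [] → f ≃ []
  ≃[]-tail e = mk λ i → at e (suc i)

  infixl 8 _·_
  _·_ : F.Carrier → Poly → Poly
  a · f = map (a *_) f

  -ₚ_ : Poly → Poly
  -ₚ f = map -_ f

  coeff-+ : ∀ f g i → coeff (f +ₚ g) i ≈ coeff f i + coeff g i
  coeff-+ []      g       i       = F.sym (F.+-identityˡ _)
  coeff-+ (a ∷ f) []      i       = F.sym (F.+-identityʳ _)
  coeff-+ (a ∷ f) (b ∷ g) zero    = F.refl
  coeff-+ (a ∷ f) (b ∷ g) (suc i) = coeff-+ f g i

  coeff-· : ∀ a f i → coeff (a · f) i ≈ a * coeff f i
  coeff-· a []      i       = F.sym (F.zeroʳ a)
  coeff-· a (b ∷ f) zero    = F.refl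
  coeff-· a (b ∷ f) (suc i) = coeff-· a f i

  coeff-neg : ∀ f i → coeff (-ₚ f) i ≈ - coeff f i
  coeff-neg []      i       = F.sym FP.-0#≈0#
  coeff-neg (b ∷ f) zero    = F.refl
  coeff-neg (b ∷ f) (suc i) = coeff-neg f i

  open SetoidReasoning F.setoid

  +ₚ-cong : ∀ {f f′ g g′} → f ≃ f′ → g ≃ g′ → f +ₚ g ≃ f′ +ₚ g′
  +ₚ-cong {f} {f′} {g} {g′} e e′ = mk λ i → begin
    coeff (f +ₚ g) i         ≈⟨ coeff-+ f g i ⟩
    coeff f i + coeff g i    ≈⟨ F.+-cong (at e i) (at e′ i) ⟩
    coeff f′ i + coeff g′ i  ≈⟨ coeff-+ f′ g′ i ⟨
    coeff (f′ +ₚ g′) i       ∎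

  +ₚ-assoc : ∀ f g h → (f +ₚ g) +ₚ h ≃ f +ₚ (g +ₚ h)
  +ₚ-assoc f g h = mk λ i → begin
    coeff ((f +ₚ g) +ₚ h) i              ≈⟨ coeff-+ (f +ₚ g) h i ⟩
    coeff (f +ₚ g) i + coeff h i         ≈⟨ F.+-congʳ (coeff-+ f g i) ⟩
    coeff f i + coeff g i + coeff h i    ≈⟨ F.+-assoc _ _ _ ⟩
    coeff f i + (coeff g i + coeff h i)  ≈⟨ F.+-congˡ (coeff-+ g h i) ⟨
    coeff f i + coeff (g +ₚ h) i         ≈⟨ coeff-+ f (g +ₚ h) i ⟨
    coeff (f +ₚ (g +ₚ h)) i              ∎

  +ₚ-comm : ∀ f g → f +ₚ g ≃ g +ₚ f
  +ₚ-comm f g = mk λ i → F.trans (coeff-+ f g i) (F.trans (F.+-comm _ _) (F.sym (coeff-+ g f i)))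

  +ₚ-identityʳ : ∀ f → f +ₚ [] ≃ f
  +ₚ-identityʳ f = mk λ i → F.trans (coeff-+ f [] i) (F.+-identityʳ _)

  -ₚ-cong : ∀ {f g} → f ≃ g → -ₚ f ≃ -ₚ g
  -ₚ-cong {f} {g} e = mk λ i → F.trans (coeff-neg f i) (F.trans (F.-‿cong (at e i)) (F.sym (coeff-neg g i)))

  -ₚ-inverseˡ : ∀ f → -ₚ f +ₚ f ≃ []
  -ₚ-inverseˡ f = mk λ i →
    F.trans (coeff-+ (-ₚ f) f i) (F.trans (F.+-congʳ (coeff-neg f i)) (F.-‿inverseˡ _))

  -ₚ-inverseʳ : ∀ f → f +ₚ -ₚ f ≃ []
  -ₚ-inverseʳ f = ≃-trans (+ₚ-comm f (-ₚ f)) (-ₚ-inverseˡ f)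

  ·-cong : ∀ {a b f g} → a ≈ b → f ≃ g → a · f ≃ b · g
  ·-cong {a} {b} {f} {g} e e′ = mk λ i →
    F.trans (coeff-· a f i) (F.trans (F.*-cong e (at e′ i)) (F.sym (coeff-· b g i)))

  ·-distribˡ : ∀ a f g → a · (f +ₚ g) ≃ a · f +ₚ a · g
  ·-distribˡ a f g = mk λ i → begin
    coeff (a · (f +ₚ g)) i               ≈⟨ coeff-· a (f +ₚ g) i ⟩
    a * coeff (f +ₚ g) i                 ≈⟨ F.*-congˡ (coeff-+ f g i) ⟩
    a * (coeff f i + coeff g i)          ≈⟨ F.distribˡ a _ _ ⟩
    a * coeff f i + a * coeff g i        ≈⟨ F.+-cong (coeff-· a f i) (coeff-· a g i) ⟨
    coeff (a · f) i + coeff (a · g) i    ≈⟨ coeff-+ (a · f) (a · g) i ⟨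
    coeff (a · f +ₚ a · g) i             ∎

  ·-distribʳ : ∀ a b f → (a + b) · f ≃ a · f +ₚ b · f
  ·-distribʳ a b f = mk λ i → begin
    coeff ((a + b) · f) i                ≈⟨ coeff-· (a + b) f i ⟩
    (a + b) * coeff f i                  ≈⟨ F.distribʳ _ a b ⟩
    a * coeff f i + b * coeff f i        ≈⟨ F.+-cong (coeff-· a f i) (coeff-· b f i) ⟨
    coeff (a · f) i + coeff (b · f) i    ≈⟨ coeff-+ (a · f) (b · f) i ⟨
    coeff (a · f +ₚ b · f) i             ∎

  ·-· : ∀ a b f → (a * b) · f ≃ a · (b · f)
  ·-· a b f = mk λ i → begin
    coeff ((a * b) · f) i   ≈⟨ coeff-· (a * b) f i ⟩
    (a * b) * coeff f i     ≈⟨ F.*-assoc a b _ ⟩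
    a * (b * coeff f i)     ≈⟨ F.*-congˡ (coeff-· b f i) ⟨
    a * coeff (b · f) i     ≈⟨ coeff-· a (b · f) i ⟨
    coeff (a · (b · f)) i   ∎

  0·  : ∀ {a} f → a ≈ 0# → a · f ≃ []
  0· {a} f e = mk λ i → F.trans (coeff-· a f i) (F.trans (F.*-congʳ e) (F.zeroˡ _))

  1· : ∀ f → 1# · f ≃ f
  1· f = mk λ i → F.trans (coeff-· 1# f i) (F.*-identityˡ _)

  shift-+ : ∀ f g → 0# ∷ (f +ₚ g) ≃ (0# ∷ f) +ₚ (0# ∷ g)
  shift-+ f g = ∷-cong (F.sym (F.+-identityˡ 0#)) ≃-refl

  shift-[] : 0# ∷ [] ≃ []
  shift-[] = mk λ { zero → F.refl ; (suc i) → F.refl }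

  +ₚ-interchange : ∀ f g h k → (f +ₚ g) +ₚ (h +ₚ k) ≃ (f +ₚ h) +ₚ (g +ₚ k)
  +ₚ-interchange f g h k = mk λ i → begin
    coeff ((f +ₚ g) +ₚ (h +ₚ k)) i                         ≈⟨ coeff-+ (f +ₚ g) (h +ₚ k) i ⟩
    coeff (f +ₚ g) i + coeff (h +ₚ k) i                    ≈⟨ F.+-cong (coeff-+ f g i) (coeff-+ h k i) ⟩
    (coeff f i + coeff g i) + (coeff h i + coeff k i)      ≈⟨ interchange _ _ _ _ ⟩
    (coeff f i + coeff h i) + (coeff g i + coeff k i)      ≈⟨ F.+-cong (coeff-+ f h i) (coeff-+ g k i) ⟨
    coeff (f +ₚ h) i + coeff (g +ₚ k) i                    ≈⟨ coeff-+ (f +ₚ h) (g +ₚ k) i ⟨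
    coeff ((f +ₚ h) +ₚ (g +ₚ k)) i                         ∎

  *ₚ-congˡ : ∀ f {g g′} → g ≃ g′ → f *ₚ g ≃ f *ₚ g′
  *ₚ-congˡ []      e = ≃-refl
  *ₚ-congˡ (a ∷ f) {g} {g′} e =
    +ₚ-cong (·-cong F.refl e) (∷-cong F.refl (*ₚ-congˡ f e))

  *ₚ-zeroʳ : ∀ f → f *ₚ [] ≃ []
  *ₚ-zeroʳ []      = ≃-refl
  *ₚ-zeroʳ (a ∷ f) = ≃-trans (∷-cong F.refl (*ₚ-zeroʳ f)) shift-[]

  *ₚ-zeroˡ : ∀ f g → f ≃ [] → f *ₚ g ≃ []
  *ₚ-zeroˡ []      g e = ≃-refl
  *ₚ-zeroˡ (a ∷ f) g e =
    ≃-trans (+ₚ-cong (0· g (at e 0)) (∷-cong F.refl (*ₚ-zeroˡ f g (≃[]-tail e)))) shift-[]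

  *ₚ-congʳ : ∀ {f f′} g → f ≃ f′ → f *ₚ g ≃ f′ *ₚ g
  *ₚ-congʳ {[]}    {f′}     g e = ≃-sym (*ₚ-zeroˡ f′ g (≃-sym e))
  *ₚ-congʳ {a ∷ f} {[]}     g e = *ₚ-zeroˡ (a ∷ f) g e
  *ₚ-congʳ {a ∷ f} {b ∷ f′} g e =
    +ₚ-cong (·-cong (at e 0) ≃-refl)
      (∷-cong F.refl (*ₚ-congʳ g (≃-tail e)))

  *ₚ-distribʳ : ∀ h f g → (f +ₚ g) *ₚ h ≃ f *ₚ h +ₚ g *ₚ h
  *ₚ-distribʳ h []      g       = ≃-refl
  *ₚ-distribʳ h (a ∷ f) []      = ≃-sym (+ₚ-identityʳ ((a ∷ f) *ₚ h))
  *ₚ-distribʳ h (a ∷ f) (b ∷ g) =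
    ≃-trans
      (+ₚ-cong (·-distribʳ a b h)
        (≃-trans (∷-cong F.refl (*ₚ-distribʳ h f g)) (shift-+ (f *ₚ h) (g *ₚ h))))
      (+ₚ-interchange (a · h) (b · h) (0# ∷ f *ₚ h) (0# ∷ g *ₚ h))

  -- Mirrors the defining recursion in the other argument, so that commutativity follows by
  -- induction.
  *ₚ-∷ʳ : ∀ g a f → g *ₚ (a ∷ f) ≃ a · g +ₚ (0# ∷ g *ₚ f)
  *ₚ-∷ʳ []      a f = ≃-sym shift-[]
  *ₚ-∷ʳ (b ∷ g) a f = ∷-cong (F.+-congʳ (F.*-comm b a)) tail
    where
    tail : b · f +ₚ g *ₚ (a ∷ f) ≃ a · g +ₚ (b · f +ₚ (0# ∷ g *ₚ f))
    tail = ≃-trans (+ₚ-cong ≃-refl (*ₚ-∷ʳ g a f))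
      (≃-trans (≃-sym (+ₚ-assoc (b · f) (a · g) _))
        (≃-trans (+ₚ-cong (+ₚ-comm (b · f) (a · g)) ≃-refl) (+ₚ-assoc (a · g) (b · f) _)))

  *ₚ-comm : ∀ f g → f *ₚ g ≃ g *ₚ f
  *ₚ-comm []      g = ≃-sym (*ₚ-zeroʳ g)
  *ₚ-comm (a ∷ f) g =
    ≃-trans (+ₚ-cong ≃-refl (∷-cong F.refl (*ₚ-comm f g))) (≃-sym (*ₚ-∷ʳ g a f))

  *ₚ-distribˡ : ∀ h f g → h *ₚ (f +ₚ g) ≃ h *ₚ f +ₚ h *ₚ g
  *ₚ-distribˡ h f g =
    ≃-trans (*ₚ-comm h (f +ₚ g)) (≃-trans (*ₚ-distribʳ h f g) (+ₚ-cong (*ₚ-comm f h) (*ₚ-comm g h)))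

  ·-*ₚ : ∀ a f g → (a · f) *ₚ g ≃ a · (f *ₚ g)
  ·-*ₚ a []      g = ≃-refl
  ·-*ₚ a (b ∷ f) g =
    ≃-trans
      (+ₚ-cong (·-· a b g) (∷-cong (F.sym (F.zeroʳ a)) (·-*ₚ a f g)))
      (≃-sym (·-distribˡ a (b · g) (0# ∷ f *ₚ g)))

  shift-*ₚ : ∀ f g → (0# ∷ f) *ₚ g ≃ 0# ∷ (f *ₚ g)
  shift-*ₚ f g = +ₚ-cong (0· g F.refl) ≃-refl

  *ₚ-assoc : ∀ f g h → (f *ₚ g) *ₚ h ≃ f *ₚ (g *ₚ h)
  *ₚ-assoc []      g h = ≃-refl
  *ₚ-assoc (a ∷ f) g h =
    ≃-trans (*ₚ-distribʳ h (a · g) (0# ∷ f *ₚ g))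
      (+ₚ-cong (·-*ₚ a g h)
        (≃-trans (shift-*ₚ (f *ₚ g) h) (∷-cong F.refl (*ₚ-assoc f g h))))

  constant-*ₚ : ∀ a g → (a ∷ []) *ₚ g ≃ a · g
  constant-*ₚ a g =
    ≃-trans (+ₚ-cong ≃-refl shift-[]) (+ₚ-identityʳ (a · g))

  *ₚ-identityˡ : ∀ g → 1ₚ *ₚ g ≃ g
  *ₚ-identityˡ g = ≃-trans (constant-*ₚ 1# g) (1· g)

  -- Opaque copies of the operations, so that unification does not look into the recursions.
  infixl 6 _⊕_
  infixl 7 _⊗_
  infix  8 ⊖_
  opaque
    _⊕_ _⊗_ : Poly → Poly → Poly
    f ⊕ g = f +ₚ g
    f ⊗ g = f *ₚ g

    ⊖_ : Poly → Poly
    ⊖ f = -ₚ f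

    ⊕-def : ∀ f g → f ⊕ g ≡ f +ₚ g
    ⊕-def f g = refl

    ⊗-def : ∀ f g → f ⊗ g ≡ f *ₚ g
    ⊗-def f g = refl

    coeff-⊕ : ∀ f g i → coeff (f ⊕ g) i ≈ coeff f i + coeff g i
    coeff-⊕ = coeff-+

    coeff-⊖ : ∀ f i → coeff (⊖ f) i ≈ - coeff f i
    coeff-⊖ = coeff-neg

    ∷-⊗ : ∀ a f g → (a ∷ f) ⊗ g ≃ a · g ⊕ (0# ∷ f ⊗ g)
    ∷-⊗ a f g = ≃-refl

    constant-⊗ : ∀ a g → (a ∷ []) ⊗ g ≃ a · g
    constant-⊗ = constant-*ₚ

    ⊗-zeroˡ : ∀ f g → f ≃ [] → f ⊗ g ≃ []
    ⊗-zeroˡ = *ₚ-zeroˡ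

    isCommutativeRing : IsCommutativeRing _≃_ _⊕_ _⊗_ ⊖_ 0ₚ 1ₚ
    isCommutativeRing = record
      { isRing = record
        { +-isAbelianGroup = record
          { isGroup = record
            { isMonoid = record
              { isSemigroup = record
                { isMagma = record
                  { isEquivalence = record { refl = ≃-refl ; sym = ≃-sym ; trans = ≃-trans }
                  ; ∙-cong = +ₚ-cong }
                ; assoc = +ₚ-assoc }
              ; identity = (λ f → ≃-refl) , +ₚ-identityʳ }
            ; inverse = -ₚ-inverseˡ , -ₚ-inverseʳ
            ; ⁻¹-cong = -ₚ-cong }
          ; comm = +ₚ-comm }
        ; *-cong = λ {_} {f′} {g} e e′ → ≃-trans (*ₚ-congʳ g e) (*ₚ-congˡ f′ e′)
        ; *-assoc = *ₚ-assoc
        ; *-identity = *ₚ-identityˡ , λ f → ≃-trans (*ₚ-comm f 1ₚ) (*ₚ-identityˡ f)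
        ; distrib = *ₚ-distribˡ , *ₚ-distribʳ }
      ; *-comm = *ₚ-comm }

  polynomialRing : CommutativeRing c ℓ
  polynomialRing = record { isCommutativeRing = isCommutativeRing }

  module R = CommutativeRing polynomialRing

-- Degrees, division, Bézout identities and the Chinese remainder theorem

module PolynomialArithmetic {c ℓ : Level} (F : FiniteField c ℓ) where
  open PolynomialRing F public
  private
    module F = FiniteField F
    module FP = RingProperties F.ring
    module RP = RingProperties R.ring
    module D = SemiringDefs polyRawSemiring
  open F using (_≈_; _+_; _*_; -_; 0#; 1#)
  open SemiringDefs (CommutativeSemiring.rawSemiring R.commutativeSemiring) public using (_∣_; _∤_) renaming (_^_ to _^ᵖ_)
  open NaturalCoefficients R.commutativeSemiring using (_:+_; _:*_; _:=_; con) renaming (solve to solveₚ)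

  private
    module Enum = Inverse F.enum

  infix 4 _≟ᶠ_
  -- Equality in the field is an arbitrary equivalence; comparing indices in the finite enumeration
  -- decides it.
  _≟ᶠ_ : ∀ x y → Dec (x ≈ y)
  x ≟ᶠ y with Enum.from x Fin.≟ Enum.from y
  ... | yes e = yes (F.trans (F.sym (Enum.strictlyInverseˡ x)) (F.trans (Enum.to-cong e) (Enum.strictlyInverseˡ y)))
  ... | no ne = no λ x≈y → ne (Enum.from-cong x≈y)

  no-zero-divisors : ∀ {a b} → ¬ a ≈ 0# → ¬ b ≈ 0# → ¬ a * b ≈ 0#
  no-zero-divisors {a} {b} a≉0 b≉0 ab≈0 = let (a⁻¹ , aa⁻¹≈1) = F.inverse a a≉0 in b≉0 (begin
    b                ≈⟨ F.*-identityˡ b ⟨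
    1# * b           ≈⟨ F.*-congʳ aa⁻¹≈1 ⟨
    a * a⁻¹ * b      ≈⟨ F.*-congʳ (F.*-comm a a⁻¹) ⟩
    a⁻¹ * a * b      ≈⟨ F.*-assoc a⁻¹ a b ⟩
    a⁻¹ * (a * b)    ≈⟨ F.*-congˡ ab≈0 ⟩
    a⁻¹ * 0#         ≈⟨ F.zeroʳ a⁻¹ ⟩
    0#               ∎)
    where open SetoidReasoning F.setoid

  -- Records in place of MonicOfDegree and HasDegree, so that the polynomial can be inferred.
  record Below (m : ℕ) (p : Poly) : Set ℓ where
    constructor mkBelow
    field vanish : ∀ i → m ℕ.≤ i → coeff p i ≈ 0#
  open Below public

  record IsMonic (m : ℕ) (p : Poly) : Set ℓ where
    constructor mkMonic
    field
      leading : coeff p m ≈ 1#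
      bounded : Below (suc m) p

  record IsDegree (p : Poly) (m : ℕ) : Set ℓ where
    constructor mkDegree
    field
      nonzero : ¬ coeff p m ≈ 0#
      bounded : Below (suc m) p

  fromMonic : ∀ {m p} → IsMonic m p → MonicOfDegree m p
  fromMonic (mkMonic t (mkBelow b)) = t , b

  below-resp : ∀ {m p p′} → p ≃ p′ → Below m p → Below m p′
  below-resp e (mkBelow b) = mkBelow λ i m≤i → F.trans (F.sym (at e i)) (b i m≤i)

  below-weaken : ∀ {m n p} → m ℕ.≤ n → Below m p → Below n p
  below-weaken m≤n (mkBelow b) = mkBelow λ i n≤i → b i (ℕ.≤-trans m≤n n≤i)

  below-+ : ∀ {m p p′} → Below m p → Below m p′ → Below m (p ⊕ p′)
  below-+ {p = p} {p′} (mkBelow b) (mkBelow b′) = mkBelow λ i m≤i →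
    F.trans (coeff-⊕ p p′ i) (F.trans (F.+-cong (b i m≤i) (b′ i m≤i)) (F.+-identityˡ 0#))

  below-0 : ∀ {p} → Below 0 p → p ≃ []
  below-0 (mkBelow b) = mk λ i → b i z≤n

  private
    below-tail : ∀ {m a f} → Below (suc m) (a ∷ f) → Below m f
    below-tail (mkBelow b) = mkBelow λ i m≤i → b (suc i) (s≤s m≤i)

    ∷-⊗-zero : ∀ a {f} g → f ≃ [] → (a ∷ f) ⊗ g ≃ a · g
    ∷-⊗-zero a {f} g e = ≃-trans (∷-⊗ a f g) (≃-trans (R.+-cong ≃-refl
        (≃-trans (∷-cong F.refl (⊗-zeroˡ f g e)) shift-[])) (R.+-identityʳ (a · g)))

    coeff-*-suc : ∀ a f g i → coeff ((a ∷ f) ⊗ g) (suc i) ≈ a * coeff g (suc i) + coeff (f ⊗ g) i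
    coeff-*-suc a f g i = F.trans (at (∷-⊗ a f g) (suc i)) (F.trans (coeff-⊕ (a · g) (0# ∷ f ⊗ g) (suc i))
        (F.+-congʳ (coeff-· a g (suc i))))

    *0+ : ∀ a {b} x → b ≈ 0# → a * b + x ≈ x
    *0+ a x b≈0 = F.trans (F.+-congʳ (F.trans (F.*-congˡ b≈0) (F.zeroʳ a))) (F.+-identityˡ x)

  coeff-*-top : ∀ m n f g → Below (suc m) f → Below (suc n) g → coeff (f ⊗ g) (m ℕ.+ n) ≈ coeff f m * coeff g n
  coeff-*-top m       n []      g bf bg = F.trans (at (⊗-zeroˡ [] g ≃-refl) (m ℕ.+ n)) (F.sym (F.zeroˡ _))
  coeff-*-top zero    n (a ∷ f) g bf bg =
    F.trans (at (∷-⊗-zero a g (below-0 (below-tail bf))) n) (coeff-· a g n)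
  coeff-*-top (suc m) n (a ∷ f) g bf bg =
    F.trans (coeff-*-suc a f g (m ℕ.+ n))
      (F.trans (*0+ a _ (vanish bg (suc (m ℕ.+ n)) (s≤s (ℕ.m≤n+m n m)))) (coeff-*-top m n f g (below-tail bf) bg))

  below-* : ∀ m n f g → Below (suc m) f → Below (suc n) g → Below (suc (m ℕ.+ n)) (f ⊗ g)
  below-* m       n []      g bf bg = mkBelow λ i _ → at (⊗-zeroˡ [] g ≃-refl) i
  below-* zero    n (a ∷ f) g bf bg = mkBelow λ i h →
    F.trans (at (∷-⊗-zero a g (below-0 (below-tail bf))) i)
      (F.trans (coeff-· a g i) (F.trans (F.*-congˡ (vanish bg i h)) (F.zeroʳ a)))
  below-* (suc m) n (a ∷ f) g bf bg = mkBelow λ { (suc i) (s≤s h) →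
    F.trans (coeff-*-suc a f g i)
      (F.trans (*0+ a _ (vanish bg (suc i) (s≤s (ℕ.≤-trans (ℕ.m≤n+m n (suc m)) h))))
        (vanish (below-* m n f g (below-tail bf) bg) i h)) }

  monic-resp : ∀ {n f f′} → f ≃ f′ → IsMonic n f → IsMonic n f′
  monic-resp {n} e (mkMonic t b) = mkMonic (F.trans (F.sym (at e n)) t) (below-resp e b)

  monic-1 : IsMonic 0 1ₚ
  monic-1 = mkMonic F.refl (mkBelow λ { (suc i) _ → F.refl })

  monic-* : ∀ {m n f g} → IsMonic m f → IsMonic n g → IsMonic (m ℕ.+ n) (f ⊗ g)
  monic-* {m} {n} {f} {g} (mkMonic tf bf) (mkMonic tg bg) =
    mkMonic (F.trans (coeff-*-top m n f g bf bg) (F.trans (F.*-cong tf tg) (F.*-identityˡ 1#))) (below-* m n f g bf bg)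

  monic-^ : ∀ {m f} k → IsMonic m f → IsMonic (k ℕ.* m) (f ^ᵖ k)
  monic-^ zero    mf = monic-1
  monic-^ (suc k) mf = monic-* mf (monic-^ k mf)

  monic-0 : ∀ {f} → IsMonic 0 f → f ≃ 1ₚ
  monic-0 (mkMonic t (mkBelow b)) = mk λ { zero → t ; (suc i) → b (suc i) (s≤s z≤n) }

  monic⇒degree : ∀ {m f} → IsMonic m f → IsDegree f m
  monic⇒degree (mkMonic t b) = mkDegree (λ t≈0 → F.0≉1 (F.trans (F.sym t≈0) t)) b

  monic-+-below : ∀ {m f h} → IsMonic m f → Below m h → IsMonic m (f ⊕ h)
  monic-+-below {m} {f} {h} (mkMonic t b) bh =
    mkMonic (F.trans (coeff-⊕ f h m) (F.trans (F.+-cong t (vanish bh m ℕ.≤-refl)) (F.+-identityʳ 1#)))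
      (below-+ b (below-weaken (ℕ.n≤1+n m) bh))

  degree-unique : ∀ {m n f g} → IsDegree f m → IsDegree g n → f ≃ g → m ≡ n
  degree-unique {m} {n} (mkDegree tf bf) (mkDegree tg bg) e with ℕ.<-cmp m n
  ... | tri< m<n _ _ = contradiction (F.trans (F.sym (at e n)) (vanish bf n m<n)) tg
  ... | tri≈ _ m≡n _ = m≡n
  ... | tri> _ _ n<m = contradiction (F.trans (at e m) (vanish bg m n<m)) tf

  degree-* : ∀ {m n f g} → IsDegree f m → IsDegree g n → IsDegree (f ⊗ g) (m ℕ.+ n)
  degree-* {m} {n} {f} {g} (mkDegree tf bf) (mkDegree tg bg) =
    mkDegree (λ e → no-zero-divisors tf tg (F.trans (F.sym (coeff-*-top m n f g bf bg)) e)) (below-* m n f g bf bg)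

  degree? : ∀ p → p ≃ [] ⊎ ∃[ d ] IsDegree p d
  degree? [] = inj₁ ≃-refl
  degree? (a ∷ p) with degree? p
  ... | inj₂ (d , mkDegree t (mkBelow b)) = inj₂ (suc d , mkDegree t (mkBelow λ { (suc i) (s≤s h) → b i h }))
  ... | inj₁ e with a ≟ᶠ 0#
  ...   | yes a≈0 = inj₁ (≃-trans (∷-cong a≈0 e) shift-[])
  ...   | no  a≉0 = inj₂ (0 , mkDegree a≉0 (mkBelow λ { (suc i) _ → at e i }))

  degree<-below : ∀ {m d p} → IsDegree p d → Below m p → d ℕ.< m
  degree<-below {m} {d} (mkDegree t b) bp with suc d ℕ.≤? m
  ... | yes h = h
  ... | no ¬h = contradiction (vanish bp d (ℕ.s≤s⁻¹ (ℕ.≰⇒> ¬h))) t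

  normalise : ∀ {p d} → IsDegree p d → ∃[ a ] ∃[ b ] a * b ≈ 1# × IsMonic d (b · p)
  normalise {p} {d} (mkDegree t bp) =
    let (b , ab≈1) = F.inverse (coeff p d) t in
    coeff p d , b , ab≈1 ,
    mkMonic (F.trans (coeff-· b p d) (F.trans (F.*-comm b _) ab≈1))
      (mkBelow λ i d<i → F.trans (coeff-· b p i) (F.trans (F.*-congˡ (vanish bp i d<i)) (F.zeroʳ b)))

  ∣-refl : ∀ {x} → x ∣ x
  ∣-refl {x} = 1ₚ Div., R.*-identityˡ x

  ∣-trans : ∀ {x y z} → x ∣ y → y ∣ z → x ∣ z
  ∣-trans {x} (q Div., e) (q′ Div., e′) =
    (q′ ⊗ q) Div., R.trans (R.*-assoc q′ q x) (R.trans (R.*-congˡ e) e′)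

  ∣-respʳ : ∀ {x y z} → y ≃ z → x ∣ y → x ∣ z
  ∣-respʳ e (q Div., e′) = q Div., R.trans e′ e

  ∣-respˡ : ∀ {x y z} → x ≃ y → x ∣ z → y ∣ z
  ∣-respˡ e (q Div., e′) = q Div., R.trans (R.*-congˡ (R.sym e)) e′

  ∣-*ˡ : ∀ {x y} z → x ∣ y → x ∣ z ⊗ y
  ∣-*ˡ {x} z (q Div., e) = (z ⊗ q) Div., R.trans (R.*-assoc z q x) (R.*-congˡ e)

  ∣-*ʳ : ∀ {x y} z → x ∣ y → x ∣ y ⊗ z
  ∣-*ʳ {x} {y} z d = ∣-respʳ (R.*-comm z y) (∣-*ˡ z d)

  ∣-+ : ∀ {x y z} → x ∣ y → x ∣ z → x ∣ y ⊕ z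
  ∣-+ {x} (q Div., e) (q′ Div., e′) = (q ⊕ q′) Div., R.trans (R.distribʳ x q q′) (R.+-cong e e′)

  ∣-neg : ∀ {x y} → x ∣ y → x ∣ ⊖ y
  ∣-neg {x} (q Div., e) = (⊖ q) Div., R.trans (R.sym (RP.-‿distribˡ-* q x)) (R.-‿cong e)

  ∣-0 : ∀ {x} → x ∣ []
  ∣-0 {x} = [] Div., R.zeroˡ x

  ⊕-cancel-neg : ∀ y z → (y ⊕ z) ⊕ ⊖ y ≃ z
  ⊕-cancel-neg y z = R.trans (rearrange y z (⊖ y)) (R.trans (R.+-congˡ (R.-‿inverseʳ y)) (R.+-identityʳ z))
    where
    rearrange : ∀ y z w → (y ⊕ z) ⊕ w ≃ z ⊕ (y ⊕ w)
    rearrange = solveₚ 3 (λ y z w → (y :+ z) :+ w := z :+ (y :+ w)) ≃-refl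

  ∣-+-cancel : ∀ {x y z} → x ∣ y ⊕ z → x ∣ y → x ∣ z
  ∣-+-cancel {x} {y} {z} d d′ = ∣-respʳ (⊕-cancel-neg y z) (∣-+ d (∣-neg d′))

  -- Horner's scheme: from p = t D + r follows a + x p = x t D + (a + x r), and a + x r has degree
  -- at most m, so subtracting `lead` times D restores the bound on the remainder.
  divide : ∀ {m D} → IsMonic m D → ∀ p → ∃[ t ] ∃[ r ] p ≃ t ⊗ D ⊕ r × Below m r
  divide mon [] = [] , [] , R.sym (R.trans (R.+-identityʳ _) (⊗-zeroˡ [] _ ≃-refl)) , mkBelow λ _ _ → F.refl
  divide {m} {D} mon@(mkMonic top bD) (a ∷ p) with divide mon p
  ... | t , r , e , b = (lead ∷ t) , s ⊕ ⊖ (lead · D) , equation , mkBelow remainder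
    where
    s = a ∷ r
    lead = coeff s m

    rearrange : ∀ x y s w → (x ⊕ y) ⊕ (s ⊕ w) ≃ (y ⊕ s) ⊕ (x ⊕ w)
    rearrange = solveₚ 4 (λ x y s w → (x :+ y) :+ (s :+ w) := (y :+ s) :+ (x :+ w)) ≃-refl

    decompose : a ∷ p ≃ (0# ∷ t ⊗ D) ⊕ s
    decompose = mk λ
      { zero → F.sym (F.trans (coeff-⊕ (0# ∷ t ⊗ D) s 0) (F.+-identityˡ a))
      ; (suc i) → F.trans (at e i) (F.trans (coeff-⊕ (t ⊗ D) r i) (F.sym (coeff-⊕ (0# ∷ t ⊗ D) s (suc i)))) }

    equation : a ∷ p ≃ (lead ∷ t) ⊗ D ⊕ (s ⊕ ⊖ (lead · D))
    equation = begin
      a ∷ p                                                        ≈⟨ decompose ⟩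
      (0# ∷ t ⊗ D) ⊕ s                                           ≈⟨ R.+-identityʳ _ ⟨
      ((0# ∷ t ⊗ D) ⊕ s) ⊕ []                                   ≈⟨ R.+-congˡ (R.-‿inverseʳ (lead · D)) ⟨
      ((0# ∷ t ⊗ D) ⊕ s) ⊕ (lead · D ⊕ ⊖ (lead · D))          ≈⟨ rearrange (lead · D) (0# ∷ t ⊗ D) s (⊖ (lead · D)) ⟨
      (lead · D ⊕ (0# ∷ t ⊗ D)) ⊕ (s ⊕ ⊖ (lead · D))          ≈⟨ R.+-congʳ (∷-⊗ lead t D) ⟨
      (lead ∷ t) ⊗ D ⊕ (s ⊕ ⊖ (lead · D))                     ∎
      where open SetoidReasoning R.setoid

    coeff-r : ∀ i → coeff (s ⊕ ⊖ (lead · D)) i ≈ coeff s i + - (lead * coeff D i)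
    coeff-r i = F.trans (coeff-⊕ s (⊖ (lead · D)) i)
      (F.+-congˡ (F.trans (coeff-⊖ (lead · D) i) (F.-‿cong (coeff-· lead D i))))

    remainder : ∀ i → m ℕ.≤ i → coeff (s ⊕ ⊖ (lead · D)) i ≈ 0#
    remainder i m≤i with ℕ.m≤n⇒m<n∨m≡n m≤i
    ... | inj₂ refl = F.trans (coeff-r m)
            (F.trans (F.+-congˡ (F.-‿cong (F.trans (F.*-congˡ top) (F.*-identityʳ lead)))) (F.-‿inverseʳ lead))
    remainder (suc i) m≤i | inj₁ (s≤s m≤i′) = F.trans (coeff-r (suc i))
            (F.trans (F.+-cong (vanish b i m≤i′) (F.trans (F.-‿cong
                (F.trans (F.*-congˡ (vanish bD (suc i) (s≤s m≤i′))) (F.zeroʳ lead))) FP.-0#≈0#))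
              (F.+-identityˡ 0#))

  ∣-below : ∀ {m D r} → IsMonic m D → D ∣ r → Below m r → r ≃ []
  ∣-below {m} {D} {r} mon (t Div., e) b with degree? t
  ... | inj₁ t≃0 = R.trans (R.sym e) (⊗-zeroˡ t D t≃0)
  ... | inj₂ (k , dt) = contradiction
          (degree<-below (degree-* dt (monic⇒degree mon)) (below-resp (R.sym e) b))
          (ℕ.≤⇒≯ (ℕ.m≤n+m m k))

  opaque
    divides? : ∀ {m D} → IsMonic m D → ∀ p → Dec (D ∣ p)
    divides? {m} {D} mon p with divide mon p
    ... | t , r , e , b with degree? r
    ...   | inj₁ r≃0 = yes (t Div., R.trans (R.sym (R.trans (R.+-congˡ r≃0) (R.+-identityʳ _))) (R.sym e))
    ...   | inj₂ (k , dr) = no λ D∣p →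
              IsDegree.nonzero dr (at (∣-below mon (∣-+-cancel (∣-respʳ e D∣p) (t Div., R.refl)) b) k)

  -- `toᴿ` and `fromᴿ` translate between divisibility as used in the statement and divisibility in
  -- terms of the opaque product.
  toᴿ : ∀ {x y} → x D.∣ y → x ∣ y
  toᴿ {x} (q Div., e) = q Div., subst (_≃ _) (sym (⊗-def q x)) (mk e)

  fromᴿ : ∀ {x y} → x ∣ y → x D.∣ y
  fromᴿ {x} (q Div., e) = q Div., at (subst (_≃ _) (⊗-def q x) e)

  unit-degree : ∀ {x d} → IsDegree x d → x ∣ 1ₚ → d ≡ 0
  unit-degree {x} {d} dx (y Div., e) with degree? y
  ... | inj₁ y≃0 = contradiction (F.trans (F.sym (at (⊗-zeroˡ y x y≃0) 0)) (at e 0)) F.0≉1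
  ... | inj₂ (k , dy) = ℕ.m+n≡0⇒n≡0 k (degree-unique (degree-* dy dx) (monic⇒degree monic-1) e)

  constant-unit : ∀ {x} → IsDegree x 0 → x ∣ 1ₚ
  constant-unit {x} (mkDegree t b) = let (y , xy≈1) = F.inverse _ t in
    (y ∷ []) Div., R.trans (constant-⊗ y x) (mk λ
      { zero → F.trans (coeff-· y x 0) (F.trans (F.*-comm y _) xy≈1)
      ; (suc i) → F.trans (coeff-· y x (suc i)) (F.trans (F.*-congˡ (vanish b (suc i) (s≤s z≤n))) (F.zeroʳ y)) })

  -- Coprimality as a Bézout identity. It carries its own witness, passes to products and powers,
  -- and gives Gauss's lemma and the Chinese remainder theorem by ring identities.
  record Comaximal (a b : Poly) : Set (c ⊔ ℓ) where
    constructor comaximal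
    field
      u v    : Poly
      bezout : u ⊗ a ⊕ v ⊗ b ≃ 1ₚ

  comaximal-sym : ∀ {a b} → Comaximal a b → Comaximal b a
  comaximal-sym (comaximal u v e) = comaximal v u (R.trans (R.+-comm _ _) e)

  comaximal-unit : ∀ {a b} → b ∣ 1ₚ → Comaximal a b
  comaximal-unit {a} (y Div., e) =
    comaximal [] y (R.trans (R.+-congʳ (⊗-zeroˡ [] a ≃-refl)) (R.trans (R.+-identityˡ _) e))

  comaximal-1 : ∀ {a} → Comaximal a 1ₚ
  comaximal-1 = comaximal-unit ∣-refl

  -- The product of the two Bézout identities, with all terms divisible by a collected in the first
  -- coefficient.
  comaximal-* : ∀ {a b b′} → Comaximal a b → Comaximal a b′ → Comaximal a (b ⊗ b′)
  comaximal-* {a} {b} {b′} (comaximal u v e) (comaximal u′ v′ e′) =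
    comaximal (u ⊗ u′ ⊗ a ⊕ (u ⊗ v′ ⊗ b′ ⊕ v ⊗ b ⊗ u′)) (v ⊗ v′)
      (R.trans (expand a b b′ u v u′ v′) (R.trans (R.*-cong e e′) (R.*-identityˡ 1ₚ)))
    where
    expand : ∀ a b b′ u v u′ v′ →
      (u ⊗ u′ ⊗ a ⊕ (u ⊗ v′ ⊗ b′ ⊕ v ⊗ b ⊗ u′)) ⊗ a ⊕ (v ⊗ v′) ⊗ (b ⊗ b′) ≃
      (u ⊗ a ⊕ v ⊗ b) ⊗ (u′ ⊗ a ⊕ v′ ⊗ b′)
    expand = solveₚ 7 (λ a b b′ u v u′ v′ →
      (u :* u′ :* a :+ (u :* v′ :* b′ :+ v :* b :* u′)) :* a :+ (v :* v′) :* (b :* b′) :=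
      (u :* a :+ v :* b) :* (u′ :* a :+ v′ :* b′)) ≃-refl

  comaximal-^ : ∀ {a b} k → Comaximal a b → Comaximal a (b ^ᵖ k)
  comaximal-^ zero    h = comaximal-1
  comaximal-^ (suc k) h = comaximal-* h (comaximal-^ k h)

  comaximal-^^ : ∀ {a b} j k → Comaximal a b → Comaximal (a ^ᵖ j) (b ^ᵖ k)
  comaximal-^^ j k h = comaximal-sym (comaximal-^ j (comaximal-sym (comaximal-^ k h)))

  private
    bezout-* : ∀ {a b} u v x → u ⊗ a ⊕ v ⊗ b ≃ 1ₚ → u ⊗ x ⊗ a ⊕ v ⊗ (b ⊗ x) ≃ x
    bezout-* {a} {b} u v x e = R.trans (expand a b u v x) (R.trans (R.*-congʳ e) (R.*-identityˡ x))
      where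
      expand : ∀ a b u v x → u ⊗ x ⊗ a ⊕ v ⊗ (b ⊗ x) ≃ (u ⊗ a ⊕ v ⊗ b) ⊗ x
      expand = solveₚ 5 (λ a b u v x → u :* x :* a :+ v :* (b :* x) := (u :* a :+ v :* b) :* x) ≃-refl

  gauss : ∀ {a b x} → Comaximal a b → a ∣ b ⊗ x → a ∣ x
  gauss {a} {b} {x} (comaximal u v e) d =
    ∣-respʳ (bezout-* u v x e) (∣-+ (∣-*ˡ (u ⊗ x) ∣-refl) (∣-*ˡ v d))

  ∣-product : ∀ {a b x} → Comaximal a b → a ∣ x → b ∣ x → a ⊗ b ∣ x
  ∣-product {a} {b} {x} (comaximal u v e) (q Div., e₁) (q′ Div., e₂) =
    (u ⊗ q′ ⊕ v ⊗ q) Div., R.trans (expand a b u v q q′)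
      (R.trans (R.+-cong (R.*-congʳ (R.*-congˡ e₂)) (R.*-congˡ (R.*-congˡ e₁))) (bezout-* u v x e))
    where
    expand : ∀ a b u v q q′ → (u ⊗ q′ ⊕ v ⊗ q) ⊗ (a ⊗ b) ≃ u ⊗ (q′ ⊗ b) ⊗ a ⊕ v ⊗ (b ⊗ (q ⊗ a))
    expand = solveₚ 6 (λ a b u v q q′ →
      (u :* q′ :+ v :* q) :* (a :* b) := u :* (q′ :* b) :* a :+ v :* (b :* (q :* a))) ≃-refl

  comaximal⇒coprime : ∀ {a b} → Comaximal a b → Coprime a b
  comaximal⇒coprime (comaximal u v e) z∣a z∣b =
    fromᴿ (∣-respʳ e (∣-+ (∣-*ˡ u (toᴿ z∣a)) (∣-*ˡ v (toᴿ z∣b))))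

  -- A residue class is written as divisibility of f ⊕ w, so its residue is -w. The witness is the
  -- usual solution v b x + u a y.
  chineseRemainder : ∀ {a b} → Comaximal a b → ∀ x y →
    ∃[ w ] (∀ f → a ⊗ b ∣ f ⊕ w → a ∣ f ⊕ x × b ∣ f ⊕ y) ×
           (∀ f → a ∣ f ⊕ x → b ∣ f ⊕ y → a ⊗ b ∣ f ⊕ w)
  chineseRemainder {a} {b} h@(comaximal u v e) x y = w ,
    (λ f d → ∣-+-cancel (∣-respʳ (shiftˣ f) (∣-+ (∣-*ˡ (u ⊗ x) ∣-refl) (∣-trans (∣-*ʳ b ∣-refl) d))) (∣-*ˡ (u ⊗ y) ∣-refl)
           , ∣-+-cancel (∣-respʳ (shiftʸ f) (∣-+ (∣-*ˡ (v ⊗ y) ∣-refl) (∣-trans (∣-*ˡ a ∣-refl) d))) (∣-*ˡ (v ⊗ x) ∣-refl)) ,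
    (λ f d d′ → ∣-product h
      (∣-+-cancel (∣-respʳ (R.sym (shiftˣ f)) (∣-+ (∣-*ˡ (u ⊗ y) ∣-refl) d)) (∣-*ˡ (u ⊗ x) ∣-refl))
      (∣-+-cancel (∣-respʳ (R.sym (shiftʸ f)) (∣-+ (∣-*ˡ (v ⊗ x) ∣-refl) d′)) (∣-*ˡ (v ⊗ y) ∣-refl)))
    where
    w = v ⊗ b ⊗ x ⊕ u ⊗ a ⊗ y

    scale : ∀ x → (u ⊗ a ⊕ v ⊗ b) ⊗ x ≃ x
    scale x = R.trans (R.*-congʳ e) (R.*-identityˡ x)

    shiftˣ : ∀ f → (u ⊗ x) ⊗ a ⊕ (f ⊕ w) ≃ (u ⊗ y) ⊗ a ⊕ (f ⊕ x)
    shiftˣ f = R.trans (rearrange a b f u v x y) (R.+-congˡ (R.+-congˡ (scale x)))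
      where
      rearrange : ∀ a b f u v x y → (u ⊗ x) ⊗ a ⊕ (f ⊕ (v ⊗ b ⊗ x ⊕ u ⊗ a ⊗ y)) ≃
                  (u ⊗ y) ⊗ a ⊕ (f ⊕ (u ⊗ a ⊕ v ⊗ b) ⊗ x)
      rearrange = solveₚ 7 (λ a b f u v x y → (u :* x) :* a :+ (f :+ (v :* b :* x :+ u :* a :* y)) :=
                  (u :* y) :* a :+ (f :+ (u :* a :+ v :* b) :* x)) ≃-refl

    shiftʸ : ∀ f → (v ⊗ y) ⊗ b ⊕ (f ⊕ w) ≃ (v ⊗ x) ⊗ b ⊕ (f ⊕ y)
    shiftʸ f = R.trans (rearrange a b f u v x y) (R.+-congˡ (R.+-congˡ (scale y)))
      where
      rearrange : ∀ a b f u v x y → (v ⊗ y) ⊗ b ⊕ (f ⊕ (v ⊗ b ⊗ x ⊕ u ⊗ a ⊗ y)) ≃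
                  (v ⊗ x) ⊗ b ⊕ (f ⊕ (u ⊗ a ⊕ v ⊗ b) ⊗ y)
      rearrange = solveₚ 7 (λ a b f u v x y → (v :* y) :* b :+ (f :+ (v :* b :* x :+ u :* a :* y)) :=
                  (v :* x) :* b :+ (f :+ (u :* a :+ v :* b) :* y)) ≃-refl

  irreducible-split : ∀ {P x y} → Irreducible P → P ≃ x ⊗ y → x ∣ 1ₚ ⊎ y ∣ 1ₚ
  irreducible-split {x = x} {y} irr e with D.Irreducible.split-∣1 irr (at (subst (_ ≃_) (⊗-def x y) e))
  ... | inj₁ d = inj₁ (toᴿ d)
  ... | inj₂ d = inj₂ (toᴿ d)

  irreducible-∤1 : ∀ {P} → Irreducible P → P ∤ 1ₚ
  irreducible-∤1 irr d = D.Irreducible.p∤1 irr (fromᴿ d)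

  -- A Euclidean descent in which P itself is divided by g at every step, so that the remainder s
  -- replaces g. If P divided s, then s = 0 by degrees and g, made monic, would be a nontrivial
  -- factor of P or a multiple of P.
  irreducible-comaximal : ∀ {p P} → IsMonic p P → Irreducible P → ∀ {g} → P ∤ g → Comaximal P g
  irreducible-comaximal {p} {P} mP irr {g} P∤g with divide mP g
  ... | t , r , e , b = comaximal-shift (euclid p ℕ.≤-refl r b λ P∣r → P∤g (∣-respʳ (R.sym e) (∣-+ (∣-*ˡ t ∣-refl) P∣r)))
    where
    comaximal-shift : Comaximal P r → Comaximal P g
    comaximal-shift (comaximal u v e′) = comaximal (u ⊕ ⊖ (v ⊗ t)) v (begin
      (u ⊕ ⊖ (v ⊗ t)) ⊗ P ⊕ v ⊗ g                  ≈⟨ R.+-congˡ (R.*-congˡ e) ⟩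
      (u ⊕ ⊖ (v ⊗ t)) ⊗ P ⊕ v ⊗ (t ⊗ P ⊕ r)      ≈⟨ rearrange P r t u v (⊖ (v ⊗ t)) ⟩
      (u ⊗ P ⊕ v ⊗ r) ⊕ (v ⊗ t ⊕ ⊖ (v ⊗ t)) ⊗ P ≈⟨ R.+-cong e′ (⊗-zeroˡ _ P (R.-‿inverseʳ (v ⊗ t))) ⟩
      1ₚ ⊕ []                                           ≈⟨ R.+-identityʳ 1ₚ ⟩
      1ₚ                                                 ∎)
      where
      open SetoidReasoning R.setoid
      rearrange : ∀ P r t u v w → (u ⊕ w) ⊗ P ⊕ v ⊗ (t ⊗ P ⊕ r) ≃ (u ⊗ P ⊕ v ⊗ r) ⊕ (v ⊗ t ⊕ w) ⊗ P
      rearrange = solveₚ 6 (λ P r t u v w → (u :+ w) :* P :+ v :* (t :* P :+ r) := (u :* P :+ v :* r) :+ (v :* t :+ w) :* P) ≃-refl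

    euclid : ∀ n → n ℕ.≤ p → ∀ g → Below n g → P ∤ g → Comaximal P g
    euclid zero    n≤p g b P∤g = contradiction (∣-respʳ (R.sym (below-0 b)) ∣-0) P∤g
    euclid (suc n) n≤p g b P∤g with degree? g
    ... | inj₁ g≃0 = contradiction (∣-respʳ (R.sym g≃0) ∣-0) P∤g
    ... | inj₂ (zero , dg) = comaximal-unit (constant-unit dg)
    ... | inj₂ (suc d , dg) with normalise dg
    ...   | a , a⁻¹ , aa⁻¹≈1 , mg with divide mg P
    ...     | t , s , e , bs = combine (euclid n (ℕ.<⇒≤ n≤p) s bs′ P∤s)
      where
      g′ = a⁻¹ · g

      bs′ : Below n s
      bs′ = below-weaken (ℕ.s≤s⁻¹ (degree<-below dg b)) bs

      g≃a·g′ : g ≃ a · g′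
      g≃a·g′ = R.trans (R.sym (1· g)) (R.trans (·-cong (F.sym aa⁻¹≈1) ≃-refl) (·-· a a⁻¹ g))

      P∤g′ : P ∤ g′
      P∤g′ P∣g′ = P∤g (∣-respʳ (R.trans (constant-⊗ a g′) (R.sym g≃a·g′)) (∣-*ˡ (a ∷ []) P∣g′))

      P∤s : P ∤ s
      P∤s P∣s = nonunit (irreducible-split irr P≃)
        where
        P≃ : P ≃ t ⊗ g′
        P≃ = R.trans e (R.trans (R.+-congˡ (∣-below mP P∣s (below-weaken (ℕ.<⇒≤ n≤p) bs′))) (R.+-identityʳ _))
        nonunit : ¬ (t ∣ 1ₚ ⊎ g′ ∣ 1ₚ)
        nonunit (inj₂ g′∣1) = contradiction (unit-degree (monic⇒degree mg) g′∣1) λ ()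
        nonunit (inj₁ (y Div., yt≃1)) = P∤g′ (y Div., (begin
          y ⊗ P           ≈⟨ R.*-congˡ P≃ ⟩
          y ⊗ (t ⊗ g′)   ≈⟨ R.*-assoc y t g′ ⟨
          y ⊗ t ⊗ g′     ≈⟨ R.*-congʳ yt≃1 ⟩
          1ₚ ⊗ g′         ≈⟨ R.*-identityˡ g′ ⟩
          g′               ∎))
          where open SetoidReasoning R.setoid

      combine : Comaximal P s → Comaximal P g
      combine (comaximal u v e′) = comaximal (u ⊕ v) (⊖ (v ⊗ t) ⊗ (a⁻¹ ∷ [])) (begin
        (u ⊕ v) ⊗ P ⊕ w ⊗ (a⁻¹ ∷ []) ⊗ g              ≈⟨ R.+-cong (R.*-congˡ e)
            (R.trans (R.*-assoc w _ g) (R.*-congˡ (constant-⊗ a⁻¹ g))) ⟩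
        (u ⊕ v) ⊗ (t ⊗ g′ ⊕ s) ⊕ w ⊗ g′              ≈⟨ rearrange u v t g′ s w ⟩
        (u ⊗ (t ⊗ g′ ⊕ s) ⊕ v ⊗ s) ⊕ (v ⊗ t ⊕ w) ⊗ g′ ≈⟨ R.+-cong (R.trans (R.+-congʳ (R.*-congˡ (R.sym e))) e′)
            (⊗-zeroˡ _ g′ (R.-‿inverseʳ (v ⊗ t))) ⟩
        1ₚ ⊕ []                                           ≈⟨ R.+-identityʳ 1ₚ ⟩
        1ₚ                                                 ∎)
        where
        open SetoidReasoning R.setoid
        w = ⊖ (v ⊗ t)
        rearrange : ∀ u v t g s w → (u ⊕ v) ⊗ (t ⊗ g ⊕ s) ⊕ w ⊗ g ≃ (u ⊗ (t ⊗ g ⊕ s) ⊕ v ⊗ s) ⊕ (v ⊗ t ⊕ w) ⊗ g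
        rearrange = solveₚ 6 (λ u v t g s w → (u :+ v) :* (t :* g :+ s) :+ w :* g := (u :* (t :* g :+ s) :+ v :* s) :+
            (v :* t :+ w) :* g) ≃-refl

  -- In Q = t P one factor is a unit and P is not one, so t is constant; comparing leading
  -- coefficients gives t = 1.
  monic-∣⇒≃ : ∀ {p q P Q} → IsMonic p P → IsMonic q Q → Irreducible P → Irreducible Q → P ∣ Q → P ≃ Q
  monic-∣⇒≃ {p} {q} {P} {Q} mP mQ irrP irrQ (t Div., e) with irreducible-split irrQ (R.sym e)
  ... | inj₂ P∣1 = contradiction P∣1 (irreducible-∤1 irrP)
  ... | inj₁ t∣1 with degree? t
  ...   | inj₁ t≃0 = contradiction (at (R.trans (R.sym e) (⊗-zeroˡ t P t≃0)) q) (IsDegree.nonzero (monic⇒degree mQ))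
  ...   | inj₂ (k , dt) with unit-degree dt t∣1
  ...     | refl with degree-unique (degree-* dt (monic⇒degree mP)) (monic⇒degree mQ) e
  ...       | refl = R.trans (R.sym (R.*-identityˡ P)) (R.trans (R.*-congʳ (R.sym t≃1)) e)
    where
    t≃1 : t ≃ 1ₚ
    t≃1 = mk λ
      { zero → F.trans (F.sym (F.trans (F.*-congˡ (IsMonic.leading mP)) (F.*-identityʳ _)))
                 (F.trans (F.sym (coeff-*-top 0 p t P (IsDegree.bounded dt) (IsMonic.bounded mP)))
                     (F.trans (at e p) (IsMonic.leading mQ)))
      ; (suc i) → vanish (IsDegree.bounded dt) (suc i) (s≤s z≤n) }

  monic-quotient : ∀ {m n D p t} → IsMonic m D → IsMonic n p → t ⊗ D ≃ p →
                   ∃[ k ] IsMonic k t × k ℕ.+ m ≡ n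
  monic-quotient {m} {n} {D} {p} {t} mD mp e with degree? t
  ... | inj₁ t≃0 = contradiction (at (R.trans (R.sym e) (⊗-zeroˡ t D t≃0)) n) (IsDegree.nonzero (monic⇒degree mp))
  ... | inj₂ (k , dt) with degree-unique (degree-* dt (monic⇒degree mD)) (monic⇒degree mp) e
  ...   | refl = k , mkMonic (F.trans (F.sym (F.trans (F.*-congˡ (IsMonic.leading mD)) (F.*-identityʳ _)))
                     (F.trans (F.sym (coeff-*-top k m t D (IsDegree.bounded dt) (IsMonic.bounded mD)))
                       (F.trans (at e (k ℕ.+ m)) (IsMonic.leading mp)))) (IsDegree.bounded dt) , refl

-- Enumeration of monic polynomials and exact counts in residue classes

module Enumeration {c ℓ : Level} (F : FiniteField c ℓ) where
  open PolynomialArithmetic F public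
  open RationalOrder
  open RationalSums
  private
    module F = FiniteField F
    module Enum = Inverse F.enum
  open F using (_≈_; 0#; 1#)

  elements : List F.Carrier
  elements = map Enum.to (allFin q)

  -- All choices of the n lowest coefficients above a fixed top part. The top part 1 gives the monic
  -- polynomials of degree n, the empty one a full residue system modulo any polynomial of degree n.
  words : Poly → ℕ → List Poly
  words top zero    = top ∷ []
  words top (suc n) = cartesianProductWith _∷_ elements (words top n)

  monics-words : ∀ n → monics n ≡ words 1ₚ n
  monics-words zero    = refl
  monics-words (suc n) = cong (cartesianProductWith _∷_ elements) (monics-words n)

  infix 4 _≃?_
  _≃?_ : ∀ f g → Dec (f ≃ g)
  f ≃? g with degree? (f ⊕ ⊖ g)
  ... | inj₁ e       = yes (R.trans (R.sym (R.trans (R.+-congˡ (R.-‿inverseˡ g)) (R.+-identityʳ f)))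
                         (R.trans (R.sym (R.+-assoc f (⊖ g) g)) (R.trans (R.+-congʳ e) (R.+-identityˡ g))))
  ... | inj₂ (d , h) = no λ f≃g → IsDegree.nonzero h (at (R.trans (R.+-congʳ f≃g) (R.-‿inverseʳ g)) d)

  private
    cartesian-All : ∀ {p r} {P : Poly → Set p} {R : Poly → Set r} → (∀ a {w} → P w → R (a ∷ w)) →
                    ∀ as {ws} → All P ws → All R (cartesianProductWith _∷_ as ws)
    cartesian-All h []       ps = []
    cartesian-All h (a ∷ as) ps = All.++⁺ (All.map⁺ (All.map (h a) ps)) (cartesian-All h as ps)

  words-coeff : ∀ top n → All (λ w → ∀ i → coeff w (n ℕ.+ i) ≡ coeff top i) (words top n)
  words-coeff top zero    = (λ i → refl) ∷ []
  words-coeff top (suc n) = cartesian-All (λ a h → h) elements (words-coeff top n)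

  words-length : ∀ n → All (λ w → length w ≡ n) (words [] n)
  words-length zero    = refl ∷ []
  words-length (suc n) = cartesian-All (λ a → cong suc) elements (words-length n)

  words-below : ∀ n → All (Below n) (words [] n)
  words-below n = All.map (λ {w} h → mkBelow λ i n≤i → F.reflexive (subst (λ j → coeff w j ≡ 0#) (ℕ.m+[n∸m]≡n n≤i) (h (i ℕ.∸ n))))
    (words-coeff [] n)

  monics-monic : ∀ n → All (IsMonic n) (monics n)
  monics-monic n = subst (All (IsMonic n)) (sym (monics-words n)) (All.map isMonic (words-coeff 1ₚ n))
    where
    isMonic : ∀ {w} → (∀ i → coeff w (n ℕ.+ i) ≡ coeff 1ₚ i) → IsMonic n w
    isMonic {w} h = mkMonic (F.reflexive (subst (λ j → coeff w j ≡ 1#) (ℕ.+-identityʳ n) (h 0)))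
      (mkBelow λ i n<i → F.reflexive (subst (λ j → coeff w j ≡ 0#) (trans (ℕ.+-suc n _) (ℕ.m+[n∸m]≡n n<i)) (h (suc (i ℕ.∸ suc n)))))

  module Selection {a} {A : Set a} (_∙_ : A → A → A) (ε : A) (isCommutativeMonoid : IsCommutativeMonoid _≡_ _∙_ ε) where
    open ListFold _∙_ ε isCommutativeMonoid
    open IsCommutativeMonoid isCommutativeMonoid using (identityʳ)

    elements-≟ : ∀ y (x : A) → ⨁ elements (λ a → when (a ≟ᶠ y) x) ≡ x
    elements-≟ y x = begin
      ⨁ elements (λ a → when (a ≟ᶠ y) x)                    ≡⟨ ⨁-map Enum.to (allFin q) _ ⟩
      ⨁ (allFin q) (λ i → when (Enum.to i ≟ᶠ y) x)          ≡⟨ ⨁-cong (allFin q) (λ i → when-⇔ (Enum.to i ≟ᶠ y) (i Fin.≟ Enum.from y)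
                                                                    (λ e → trans (sym (Enum.strictlyInverseʳ i)) (Enum.from-cong e))
                                                                    (λ e → F.trans (Enum.to-cong e) (Enum.strictlyInverseˡ y))) ⟩
      ⨁ (allFin q) (λ i → when (i Fin.≟ Enum.from y) x)     ≡⟨ ⨁-allFin-≟ q (Enum.from y) x ⟩
      x                                                     ∎
      where open ≡-Reasoning

    -- A single equation says that p occurs in the list and occurs only once, up to ≃. The monoid is
    -- left open so that the same fact serves sums and products.
    words-≃ : ∀ top n p (x : A) → (∀ i → coeff p (n ℕ.+ i) ≈ coeff top i) → ⨁ (words top n) (λ w → when (w ≃? p) x) ≡ x
    words-≃ top zero    p x h = trans (cong (_∙ ε) (when-yes (top ≃? p) (mk λ i → F.sym (h i)))) (identityʳ x)
    words-≃ top (suc n) p x h = begin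
      ⨁ (words top (suc n)) (λ w → when (w ≃? p) x)
        ≡⟨ ⨁-cartesianProductWith _∷_ elements (words top n) _ ⟩
      ⨁ elements (λ a → ⨁ (words top n) (λ w → when ((a ∷ w) ≃? p) x))
        ≡⟨ ⨁-cong elements first ⟩
      ⨁ elements (λ a → when (a ≟ᶠ coeff p 0) x)
        ≡⟨ elements-≟ (coeff p 0) x ⟩
      x ∎
      where
      open ≡-Reasoning
      tail : Poly → Poly
      tail []      = []
      tail (_ ∷ f) = f
      coeff-tail : ∀ f i → coeff (tail f) i ≡ coeff f (suc i)
      coeff-tail []      i = refl
      coeff-tail (_ ∷ f) i = refl
      first : ∀ a → ⨁ (words top n) (λ w → when ((a ∷ w) ≃? p) x) ≡ when (a ≟ᶠ coeff p 0) x
      first a with a ≟ᶠ coeff p 0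
      ... | no  a≉ = trans (⨁-cong (words top n) (λ w → when-no ((a ∷ w) ≃? p) (λ e → a≉ (at e 0)))) (⨁-ε (words top n))
      ... | yes a≈ = trans
        (⨁-cong (words top n) (λ w → when-⇔ ((a ∷ w) ≃? p) (w ≃? tail p)
          (λ e → mk λ i → F.trans (at e (suc i)) (F.reflexive (sym (coeff-tail p i))))
          (λ e → mk λ { zero → a≈ ; (suc i) → F.trans (at e i) (F.reflexive (coeff-tail p i)) })))
        (words-≃ top n (tail p) x (λ i → F.trans (F.reflexive (coeff-tail p (n ℕ.+ i))) (h i)))

    monics-≃ : ∀ n {p} (x : A) → IsMonic n p → ⨁ (monics n) (λ w → when (w ≃? p) x) ≡ x
    monics-≃ n {p} x (mkMonic t b) =
      trans (cong (λ l → ⨁ l (λ w → when (w ≃? p) x)) (monics-words n)) (words-≃ 1ₚ n p x match)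
      where
      match : ∀ i → coeff p (n ℕ.+ i) ≈ coeff 1ₚ i
      match zero    = F.trans (F.reflexive (cong (coeff p) (ℕ.+-identityʳ n))) t
      match (suc i) = vanish b _ (ℕ.m<m+n n (s≤s z≤n))

  private module SumSelection = Selection ℚ._+_ 0ℚ ℚ.+-0-isCommutativeMonoid

  -- Separates the m lowest coefficients from the others, which isolates a residue system modulo a
  -- polynomial of degree m.
  ∑-words-++ : ∀ top m k (φ : Poly → ℚ) →
               ∑ (words top (m ℕ.+ k)) φ ≡ ∑ (words top k) (λ g → ∑ (words [] m) (λ w → φ (w ++ g)))
  ∑-words-++ top zero    k φ = Sum.⨁-cong (words top k) (λ g → sym (ℚ.+-identityʳ (φ g)))
  ∑-words-++ top (suc m) k φ = begin
    ∑ (words top (suc m ℕ.+ k)) φ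
      ≡⟨ Sum.⨁-cartesianProductWith _∷_ elements (words top (m ℕ.+ k)) φ ⟩
    ∑ elements (λ a → ∑ (words top (m ℕ.+ k)) (λ w → φ (a ∷ w)))
      ≡⟨ Sum.⨁-cong elements (λ a → ∑-words-++ top m k (λ w → φ (a ∷ w))) ⟩
    ∑ elements (λ a → ∑ (words top k) (λ g → ∑ (words [] m) (λ w → φ (a ∷ w ++ g))))
      ≡⟨ Sum.⨁-swap elements (words top k) _ ⟩
    ∑ (words top k) (λ g → ∑ elements (λ a → ∑ (words [] m) (λ w → φ (a ∷ w ++ g))))
      ≡⟨ Sum.⨁-cong (words top k) (λ g → sym (Sum.⨁-cartesianProductWith _∷_ elements (words [] m) (λ w → φ (w ++ g)))) ⟩
    ∑ (words top k) (λ g → ∑ (words [] (suc m)) (λ w → φ (w ++ g))) ∎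
    where open ≡-Reasoning

  ++-≃-⊕ : ∀ w g → w ++ g ≃ w ⊕ (replicate (length w) 0# ++ g)
  ++-≃-⊕ []      g = R.sym (R.+-identityˡ g)
  ++-≃-⊕ (a ∷ w) g = mk λ
    { zero    → F.sym (F.trans (coeff-⊕ (a ∷ w) _ 0) (F.+-identityʳ a))
    ; (suc i) → F.trans (at (++-≃-⊕ w g) i) (F.trans (coeff-⊕ w _ i)
        (F.sym (coeff-⊕ (a ∷ w) (0# ∷ replicate (length w) 0# ++ g) (suc i)))) }

  [_] : ∀ {a} {P : Set a} → Dec P → ℚ
  [ P? ] = Sum.when P? 1ℚ

  -- With b = t D + r, the only w of degree below m that makes w ⊕ b divisible by D is -r.
  residues : ∀ {m D} (mD : IsMonic m D) (b : Poly) → ∑ (words [] m) (λ w → [ divides? mD (w ⊕ b) ]) ≡ 1ℚ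
  residues {m} {D} mD b with divide mD b
  ... | t , r , e , br = trans
        (Sum.⨁-congAll (All.map (λ {w} bw → Sum.when-⇔ (divides? mD (w ⊕ b)) (w ≃? ⊖ r) (to w bw) (from w)) (words-below m)))
        (SumSelection.words-≃ [] m (⊖ r) 1ℚ (λ i → vanish below-⊖r (m ℕ.+ i) (ℕ.m≤m+n m i)))
    where
    module RP = RingProperties R.ring
    below-⊖r : Below m (⊖ r)
    below-⊖r = mkBelow λ i h → F.trans (coeff-⊖ r i) (F.trans (F.-‿cong (vanish br i h)) (RingProperties.-0#≈0# F.ring))

    rearrange : ∀ w → w ⊕ b ≃ t ⊗ D ⊕ (w ⊕ r)
    rearrange w = R.trans (R.+-congˡ e) (R.trans (R.sym (R.+-assoc w (t ⊗ D) r))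
      (R.trans (R.+-congʳ (R.+-comm w (t ⊗ D))) (R.+-assoc (t ⊗ D) w r)))

    to : ∀ w → Below m w → D ∣ w ⊕ b → w ≃ ⊖ r
    to w bw d = RP.+-inverseˡ-unique w r (∣-below mD (∣-+-cancel (∣-respʳ (rearrange w) d) (∣-*ˡ t ∣-refl)) (below-+ bw br))

    from : ∀ w → w ≃ ⊖ r → D ∣ w ⊕ b
    from w w≃ = ∣-respʳ (R.sym (rearrange w)) (∣-+ (∣-*ˡ t ∣-refl) (∣-respʳ (R.sym (R.trans (R.+-congʳ w≃) (R.-‿inverseˡ r))) ∣-0))

  q≥2 : 2 ℕ.≤ q
  q≥2 = go q (Enum.from 0#) (Enum.from 1#) (λ e → F.0≉1 (F.trans (F.sym (Enum.strictlyInverseˡ 0#))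
      (F.trans (Enum.to-cong e) (Enum.strictlyInverseˡ 1#))))
    where
    go : ∀ n (i j : Fin n) → i ≢ j → 2 ℕ.≤ n
    go (suc zero)    zero zero i≢j = contradiction refl i≢j
    go (suc (suc n)) i    j    i≢j = s≤s (s≤s z≤n)

  private
    ιq>0 : 0ℚ ℚ.< ι q
    ιq>0 = ℚ.<-≤-trans (ι-pos 1) (ι-mono q≥2)

  ρ : ℚ
  ρ = ℚ.1/_ (ι q) {{ℚ.pos⇒nonZero (ι q) {{ℚ.positive ιq>0}}}}

  ρ*q : ρ ℚ.* ι q ≡ 1ℚ
  ρ*q = ℚ.*-inverseˡ (ι q) {{ℚ.pos⇒nonZero (ι q) {{ℚ.positive ιq>0}}}}

  ρ>0 : 0ℚ ℚ.< ρ
  ρ>0 = ℚ.positive⁻¹ ρ {{ℚ.1/pos⇒pos (ι q) {{ℚ.positive ιq>0}}}}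

  ρ≥0 : 0ℚ ℚ.≤ ρ
  ρ≥0 = ℚ.<⇒≤ ρ>0

  2ρ≤1 : ι 2 ℚ.* ρ ℚ.≤ 1ℚ
  2ρ≤1 = ℚ.≤-trans (*-monoʳ ρ≥0 (ι-mono q≥2)) (ℚ.≤-reflexive (trans (ℚ.*-comm (ι q) ρ) ρ*q))

  ρ≤1 : ρ ℚ.≤ 1ℚ
  ρ≤1 = ℚ.≤-trans (ℚ.≤-trans (ℚ.≤-reflexive (sym (trans (cong (ℚ._* ρ) ι-1) (ℚ.*-identityˡ ρ))))
      (*-monoʳ ρ≥0 (ι-mono {1} {2} (s≤s z≤n)))) 2ρ≤1

  size : ℕ → ℚ
  size n = ι (q ℕ.^ n)

  size≥0 : ∀ n → 0ℚ ℚ.≤ size n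
  size≥0 n = ι-nonneg (q ℕ.^ n)

  ρ^*size : ∀ n → ρ ^ n ℚ.* size n ≡ 1ℚ
  ρ^*size n = trans (cong (ρ ^ n ℚ.*_) (ι-^ q n)) (trans (sym (^-distrib ρ (ι q) n)) (trans (cong (_^ n) ρ*q) (1^ n)))

  size-+ : ∀ m n → size (m ℕ.+ n) ≡ size m ℚ.* size n
  size-+ m n = trans (cong ι (ℕ.^-distribˡ-+-* q m n)) (ι-* (q ℕ.^ m) (q ℕ.^ n))

  size-cancel : ∀ m k → size (m ℕ.+ k) ℚ.* ρ ^ m ≡ size k
  size-cancel m k = begin
    size (m ℕ.+ k) ℚ.* ρ ^ m           ≡⟨ cong (ℚ._* ρ ^ m) (size-+ m k) ⟩
    size m ℚ.* size k ℚ.* ρ ^ m        ≡⟨ identity (size m) (size k) (ρ ^ m) ⟩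
    ρ ^ m ℚ.* size m ℚ.* size k        ≡⟨ cong (ℚ._* size k) (ρ^*size m) ⟩
    1ℚ ℚ.* size k                      ≡⟨ ℚ.*-identityˡ (size k) ⟩
    size k                             ∎
    where
    open ≡-Reasoning
    identity : ∀ a b c → a ℚ.* b ℚ.* c ≡ c ℚ.* a ℚ.* b
    identity = solve-∀ ℚ-ring

  ∑-words-1 : ∀ top n → ∑ (words top n) (λ _ → 1ℚ) ≡ size n
  ∑-words-1 top zero    = trans (ℚ.+-identityʳ 1ℚ) (sym ι-1)
  ∑-words-1 top (suc n) = begin
    ∑ (words top (suc n)) (λ _ → 1ℚ)                        ≡⟨ Sum.⨁-cartesianProductWith _∷_ elements (words top n) _ ⟩
    ∑ elements (λ _ → ∑ (words top n) (λ _ → 1ℚ))           ≡⟨ ∑-const _ elements ⟩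
    ι (length elements) ℚ.* ∑ (words top n) (λ _ → 1ℚ)      ≡⟨ cong₂ (λ l s → ι l ℚ.* s)
        (trans (length-map Enum.to (allFin q)) (length-tabulate id)) (∑-words-1 top n) ⟩
    ι q ℚ.* size n                                          ≡⟨ ι-* q (q ℕ.^ n) ⟨
    size (suc n)                                            ∎
    where open ≡-Reasoning

  ∑-monics-1 : ∀ n → ∑ (monics n) (λ _ → 1ℚ) ≡ size n
  ∑-monics-1 n = trans (cong (λ l → ∑ l (λ _ → 1ℚ)) (monics-words n)) (∑-words-1 1ₚ n)

  -- Once the upper n - m coefficients are fixed, the lower m ones run through a full residue system
  -- modulo D. This is why the count has no error term, and why every modulus must have degree at
  -- most n.
  divisible-monics : ∀ {m n D} (mD : IsMonic m D) (b : Poly) → m ℕ.≤ n →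
                     ∑ (monics n) (λ f → [ divides? mD (f ⊕ b) ]) ≡ size n ℚ.* ρ ^ m
  divisible-monics {m} {n} {D} mD b m≤n = begin
    ∑ (monics n) φ
      ≡⟨ cong (λ l → ∑ l φ) (trans (monics-words n) (cong (words 1ₚ) (sym (ℕ.m+[n∸m]≡n m≤n)))) ⟩
    ∑ (words 1ₚ (m ℕ.+ k)) φ
      ≡⟨ ∑-words-++ 1ₚ m k φ ⟩
    ∑ (words 1ₚ k) (λ g → ∑ (words [] m) (λ w → φ (w ++ g)))
      ≡⟨ Sum.⨁-cong (words 1ₚ k) (λ g → trans (Sum.⨁-congAll (All.map (λ {w} → shift g w) (words-length m))) (residues mD _)) ⟩
    ∑ (words 1ₚ k) (λ _ → 1ℚ)
      ≡⟨ ∑-words-1 1ₚ k ⟩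
    size k
      ≡⟨ size-cancel m k ⟨
    size (m ℕ.+ k) ℚ.* ρ ^ m
      ≡⟨ cong (λ j → size j ℚ.* ρ ^ m) (ℕ.m+[n∸m]≡n m≤n) ⟩
    size n ℚ.* ρ ^ m ∎
    where
    open ≡-Reasoning
    k = n ℕ.∸ m
    φ : Poly → ℚ
    φ f = [ divides? mD (f ⊕ b) ]
    shift : ∀ g w → length w ≡ m → φ (w ++ g) ≡ [ divides? mD (w ⊕ ((replicate m 0# ++ g) ⊕ b)) ]
    shift g w refl = Sum.when-⇔ (divides? mD _) (divides? mD _) (∣-respʳ e) (∣-respʳ (R.sym e))
      where
      e : (w ++ g) ⊕ b ≃ w ⊕ ((replicate (length w) 0# ++ g) ⊕ b)
      e = R.trans (R.+-congʳ (++-≃-⊕ w g)) (R.+-assoc w _ b)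

-- Monic irreducible polynomials and unique factorisation

module Primes {c ℓ : Level} (F : FiniteField c ℓ) where
  open Enumeration F public
  open RationalOrder using (ι; ι-0; ι-1; 0≤1)
  open RationalSums
  private
    module F = FiniteField F
  open F using (_≈_; 0#; 1#)

  ⊗-cancel-0 : ∀ {m x y} → IsMonic m x → x ⊗ y ≃ [] → y ≃ []
  ⊗-cancel-0 {m} {x} {y} mx e with degree? y
  ... | inj₁ y≃0      = y≃0
  ... | inj₂ (k , dy) = contradiction (at e (m ℕ.+ k)) (IsDegree.nonzero (degree-* (monic⇒degree mx) dy))

  ∣-cancelˡ : ∀ {m x y z} → IsMonic m x → x ⊗ y ∣ x ⊗ z → y ∣ z
  ∣-cancelˡ {m} {x} {y} {z} mx (t Div., e) = t Div., RP.x∙y⁻¹≈ε⇒x≈y (t ⊗ y) z (⊗-cancel-0 mx (begin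
    x ⊗ (t ⊗ y ⊕ ⊖ z)          ≈⟨ R.distribˡ x (t ⊗ y) (⊖ z) ⟩
    x ⊗ (t ⊗ y) ⊕ x ⊗ ⊖ z      ≈⟨ R.+-cong (rearrange x t y) (R.sym (RR.-‿distribʳ-* x z)) ⟩
    t ⊗ (x ⊗ y) ⊕ ⊖ (x ⊗ z)    ≈⟨ R.+-congʳ e ⟩
    x ⊗ z ⊕ ⊖ (x ⊗ z)          ≈⟨ R.-‿inverseʳ (x ⊗ z) ⟩
    []                         ∎))
    where
    module RP = GroupProperties R.+-group
    module RR = RingProperties R.ring
    open SetoidReasoning R.setoid
    open NaturalCoefficients R.commutativeSemiring using (_:*_; _:=_) renaming (solve to solveₚ)
    rearrange : ∀ x t y → x ⊗ (t ⊗ y) ≃ t ⊗ (x ⊗ y)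
    rearrange = solveₚ 3 (λ x t y → x :* (t :* y) := t :* (x :* y)) ≃-refl

  monic? : ∀ d p → Dec (IsMonic d p)
  monic? d p with degree? p
  ... | inj₁ e = no λ mp → IsDegree.nonzero (monic⇒degree mp) (at e d)
  ... | inj₂ (k , dp) with k ℕ.≟ d
  ...   | no  k≢d = no λ mp → k≢d (degree-unique dp (monic⇒degree mp) R.refl)
  ...   | yes refl with coeff p k ≟ᶠ 1#
  ...     | yes t = yes (mkMonic t (IsDegree.bounded dp))
  ...     | no ¬t = no λ mp → ¬t (IsMonic.leading mp)

  monics-complete : ∀ {n p} → IsMonic n p → Any (_≃ p) (monics n)
  monics-complete {n} {p} mp with Any.any? (_≃? p) (monics n)
  ... | yes found = found
  ... | no  none  = contradiction (trans (sym (Sel.monics-≃ n 1ℚ mp)) (trans (Sum.⨁-congAll (All.map (λ {w} ne → Sum.when-no (w ≃? p) ne) (All.¬Any⇒All¬ (monics n) none))) (Sum.⨁-ε (monics n)))) λ ()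
    where module Sel = Selection ℚ._+_ 0ℚ ℚ.+-0-isCommutativeMonoid

  private
    interval-complete : ∀ lo k {i} → lo ℕ.< i → i ℕ.≤ lo ℕ.+ k → i ∈ interval lo k
    interval-complete lo zero    l u = contradiction (ℕ.≤-trans l u) (ℕ.≤⇒≯ (ℕ.≤-reflexive (ℕ.+-identityʳ lo)))
    interval-complete lo (suc k) {i} l u with ℕ.m≤n⇒m<n∨m≡n u
    ... | inj₂ refl = here refl
    ... | inj₁ i<   = there (interval-complete lo k l (ℕ.s≤s⁻¹ (subst (suc i ℕ.≤_) (ℕ.+-suc lo k) i<)))

    divisor? : ∀ k g p → Dec (IsMonic k g × g ∣ p)
    divisor? k g p with monic? k g
    ... | no ¬m = no λ (m , _) → ¬m m
    ... | yes m with divides? m p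
    ...   | yes d = yes (m , d)
    ...   | no ¬d = no λ (_ , d) → ¬d d

  -- A finite search: a factorisation into two nonconstant factors, one of them scaled to be monic,
  -- shows up among the monic polynomials of degree 1 to d.
  irreducible-or-divisor : ∀ {d p} → IsMonic (suc d) p →
    Irreducible p ⊎ ∃[ k ] ∃[ g ] IsMonic k g × g ∣ p × 0 ℕ.< k × k ℕ.≤ d
  irreducible-or-divisor {d} {p} mp
    with Any.any? (λ k → Any.any? (λ g → divisor? k g p) (monics k)) (interval 0 d)
  ... | yes found with find found
  ...   | k , k∈ , found′ with find found′
  ...     | g , _ , (mg , g∣p) = let (l , u) = All.lookup (interval-bounds 0 d) k∈ in inj₂ (k , g , mg , g∣p , l , u)
  irreducible-or-divisor {d} {p} mp | no none = inj₁ (record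
    { p∤1      = λ u → contradiction (unit-degree (monic⇒degree mp) (toᴿ u)) λ ()
    ; split-∣1 = λ {x} {y} e → split x y (subst (p ≃_) (sym (⊗-def x y)) (mk e)) })
    where
    module D = SemiringDefs polyRawSemiring
    nonzero : ¬ p ≃ []
    nonzero e = IsDegree.nonzero (monic⇒degree mp) (at e (suc d))

    split : ∀ x y → p ≃ x ⊗ y → x D.∣ 1ₚ ⊎ y D.∣ 1ₚ
    split x y e with degree? x | degree? y
    ... | inj₁ x≃0 | _                = contradiction (R.trans e (⊗-zeroˡ x y x≃0)) nonzero
    ... | _        | inj₁ y≃0         = contradiction (R.trans e (R.trans (R.*-comm x y) (⊗-zeroˡ y x y≃0))) nonzero
    ... | inj₂ (zero , dx)  | _                 = inj₁ (fromᴿ (constant-unit dx))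
    ... | inj₂ (suc k , dx) | inj₂ (zero , dy)  = inj₂ (fromᴿ (constant-unit dy))
    ... | inj₂ (suc k , dx) | inj₂ (suc l , dy) with normalise dy
    ...   | a , a⁻¹ , aa⁻¹≈1 , my =
          contradiction (lose (interval-complete 0 d (s≤s z≤n) l<d)
              (Any.map (λ w≃ → monic-resp (R.sym w≃) my , ∣-respˡ (R.sym w≃) y′∣p) (monics-complete my))) none
      where
      l<d : suc l ℕ.≤ d
      l<d = ℕ.≤-trans (ℕ.m≤n+m (suc l) k) (ℕ.≤-reflexive (ℕ.suc-injective
          (degree-unique (degree-* dx dy) (monic⇒degree mp) (R.sym e))))
      y≃ : y ≃ (a ∷ []) ⊗ (a⁻¹ · y)
      y≃ = R.trans (R.sym (1· y)) (R.trans (·-cong (F.sym aa⁻¹≈1) ≃-refl) (R.trans (·-· a a⁻¹ y) (R.sym (constant-⊗ a (a⁻¹ · y)))))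
      y′∣p : a⁻¹ · y ∣ p
      y′∣p = ∣-respʳ (R.sym (R.trans e (R.*-congˡ y≃))) (∣-*ˡ x (∣-*ˡ (a ∷ []) ∣-refl))

  record Prime : Set (c ⊔ ℓ) where
    constructor mkPrime
    field
      poly          : Poly
      degree        : ℕ
      isMonic       : IsMonic degree poly
      isIrreducible : Irreducible poly
  open Prime public

  degree-positive : ∀ P → 0 ℕ.< degree P
  degree-positive (mkPrime f zero    m i) = contradiction (∣-respˡ (R.sym (monic-0 m)) ∣-refl) (irreducible-∤1 i)
  degree-positive (mkPrime f (suc d) m i) = s≤s z≤n

  degree-cong : ∀ P Q → poly P ≃ poly Q → degree P ≡ degree Q
  degree-cong P Q = degree-unique (monic⇒degree (isMonic P)) (monic⇒degree (isMonic Q))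

  primes-comaximal : ∀ P Q → ¬ poly P ≃ poly Q → Comaximal (poly P) (poly Q)
  primes-comaximal P Q ne = irreducible-comaximal (isMonic P) (isIrreducible P)
    (λ d → ne (monic-∣⇒≃ (isMonic P) (isMonic Q) (isIrreducible P) (isIrreducible Q) d))

  prime? : ∀ d p → Dec (IsMonic d p × Irreducible p)
  prime? d p with monic? d p
  ... | no ¬m = no λ (m , _) → ¬m m
  prime? zero    p | yes m = no λ (_ , i) → irreducible-∤1 i (∣-respˡ (R.sym (monic-0 m)) ∣-refl)
  prime? (suc d) p | yes m with irreducible-or-divisor m
  ... | inj₁ i = yes (m , i)
  ... | inj₂ (k , g , mg , (t Div., e) , 0<k , k≤d) = no λ (_ , i) → reducible i
    where
    reducible : ¬ Irreducible p
    reducible i with irreducible-split i (R.sym e)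
    ... | inj₂ g∣1 = ℕ.n≮0 (subst (0 ℕ.<_) (unit-degree (monic⇒degree mg) g∣1) 0<k)
    ... | inj₁ t∣1 with monic-quotient mg m e
    ...   | j , mt , j+k≡ with unit-degree (monic⇒degree mt) t∣1
    ...     | refl = ℕ.<-irrefl j+k≡ (s≤s k≤d)

  prime-divisor : ∀ d {f} → IsMonic (suc d) f → ∃[ P ] poly P ∣ f
  prime-divisor d mf = go d ℕ.≤-refl mf
    where
    go : ∀ fuel {d f} → d ℕ.≤ fuel → IsMonic (suc d) f → ∃[ P ] poly P ∣ f
    go fuel {d} {f} d≤ mf with irreducible-or-divisor mf
    ... | inj₁ i = mkPrime f (suc d) mf i , ∣-refl
    go zero    z≤n mf | inj₂ (suc k , g , mg , g∣f , 0<k , ())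
    go (suc n) d≤  mf | inj₂ (suc k , g , mg , g∣f , 0<k , k≤d) =
      let (P , P∣g) = go n (ℕ.s≤s⁻¹ (ℕ.≤-trans k≤d d≤)) mg in P , ∣-trans P∣g g∣f

  toPrime : ℕ → Poly → Maybe Prime
  toPrime d f with prime? d f
  ... | yes (m , i) = just (mkPrime f d m i)
  ... | no _        = nothing

  primesOfDegree : ℕ → List Prime
  primesOfDegree d = mapMaybe (toPrime d) (monics d)

  -- The degrees are lo + 1 to lo + k: the second argument is the number of degrees, not the upper
  -- end.
  primesBetween : ℕ → ℕ → List Prime
  primesBetween lo k = concatMap primesOfDegree (interval lo k)

  primesBetween-+ : ∀ k l → primesBetween 0 (k ℕ.+ l) ≡ primesBetween k l ++ primesBetween 0 k
  primesBetween-+ k l = trans (cong (concatMap primesOfDegree) (interval-++ 0 k l))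
      (concatMap-++ primesOfDegree (interval k l) (interval 0 k))

  primesOfDegree-degree : ∀ d → All (λ P → degree P ≡ d) (primesOfDegree d)
  primesOfDegree-degree d = go (monics d)
    where
    go : ∀ fs → All (λ P → degree P ≡ d) (mapMaybe (toPrime d) fs)
    go []       = []
    go (f ∷ fs) with prime? d f
    ... | yes _ = refl ∷ go fs
    ... | no _  = go fs

  primesBetween-bounds : ∀ lo k → All (λ P → lo ℕ.< degree P × degree P ℕ.≤ lo ℕ.+ k) (primesBetween lo k)
  primesBetween-bounds lo k = go (interval lo k) (interval-bounds lo k)
    where
    go : ∀ ds → All (λ i → lo ℕ.< i × i ℕ.≤ lo ℕ.+ k) ds → All (λ P → lo ℕ.< degree P × degree P ℕ.≤ lo ℕ.+ k)
        (concatMap primesOfDegree ds)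
    go []       []       = []
    go (d ∷ ds) (b ∷ bs) = All.++⁺ (All.map (λ { refl → b }) (primesOfDegree-degree d)) (go ds bs)

  ∑-primesOfDegree-1 : ∀ d → ∑ (primesOfDegree d) (λ _ → 1ℚ) ℚ.≤ size d
  ∑-primesOfDegree-1 d = ℚ.≤-trans (ℚ.≤-reflexive (Sum.⨁-mapMaybe (toPrime d) (monics d) _))
    (ℚ.≤-trans (∑-mono (All.universal (λ f → bound (toPrime d f)) (monics d))) (ℚ.≤-reflexive (∑-monics-1 d)))
    where
    bound : (x : Maybe Prime) → maybe′ (λ _ → 1ℚ) 0ℚ x ℚ.≤ 1ℚ
    bound (just _) = ℚ.≤-refl
    bound nothing  = 0≤1

  power∣? : ∀ P i f → Dec (poly P ^ᵖ i ∣ f)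
  power∣? P i f = divides? (monic-^ i (isMonic P)) f

  ^ᵖ-cong : ∀ {f g} i → f ≃ g → f ^ᵖ i ≃ g ^ᵖ i
  ^ᵖ-cong i e = SemiringExp.^-congˡ R.semiring i e

  ^ᵖ-+ : ∀ f i j → f ^ᵖ (i ℕ.+ j) ≃ f ^ᵖ i ⊗ f ^ᵖ j
  ^ᵖ-+ = SemiringExp.^-homo-* R.semiring

  ^ᵖ-∣ : ∀ f {i j} → i ℕ.≤ j → f ^ᵖ i ∣ f ^ᵖ j
  ^ᵖ-∣ f {i} {j} i≤j = ∣-respʳ (R.sym (R.trans (R.reflexive (cong (f ^ᵖ_) (sym (ℕ.m+[n∸m]≡n i≤j)))) (^ᵖ-+ f i (j ℕ.∸ i))))
    (∣-*ʳ (f ^ᵖ (j ℕ.∸ i)) ∣-refl)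

  ∣-^ᵖ-suc : ∀ f i → f ∣ f ^ᵖ suc i
  ∣-^ᵖ-suc f i = ∣-*ʳ (f ^ᵖ i) ∣-refl

  -- If P^(s+1) divided P^s g, cancelling P^s would make P divide g.
  power-∣-iff : ∀ P s {g} → poly P ∤ g → ∀ i → poly P ^ᵖ i ∣ poly P ^ᵖ s ⊗ g → i ℕ.≤ s
  power-∣-iff P s {g} P∤g i d with i ℕ.≤? s
  ... | yes i≤s = i≤s
  ... | no  i≰s = contradiction
        (∣-cancelˡ (monic-^ s (isMonic P)) (∣-respˡ (R.*-comm (poly P) (poly P ^ᵖ s)) (∣-trans (^ᵖ-∣ (poly P) (ℕ.≰⇒> i≰s)) d))) P∤g

  -- The full power of P in f. The field `exponent` is one less than the multiplicity, which is
  -- therefore positive.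
  record Extraction (P : Prime) (n : ℕ) (f : Poly) : Set (c ⊔ ℓ) where
    constructor extraction
    field
      exponent   : ℕ
      cofactor   : Poly
      codegree   : ℕ
      monic      : IsMonic codegree cofactor
      degrees    : suc exponent ℕ.* degree P ℕ.+ codegree ≡ n
      coprime    : poly P ∤ cofactor
      equation   : f ≃ poly P ^ᵖ suc exponent ⊗ cofactor

  extract : ∀ P {n f} → IsMonic n f → poly P ∣ f → Extraction P n f
  extract P {n} mf d = go n ℕ.≤-refl mf d
    where
    go : ∀ fuel {n f} → n ℕ.≤ fuel → IsMonic n f → poly P ∣ f → Extraction P n f
    go fuel {n} {f} n≤ mf (t Div., e) with monic-quotient (isMonic P) mf e
    ... | k , mt , k+d≡n with divides? (isMonic P) t
    ...   | no P∤t = extraction 0 t k mt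
              (trans (cong (ℕ._+ k) (ℕ.*-identityˡ (degree P))) (trans (ℕ.+-comm (degree P) k) k+d≡n)) P∤t
              (R.trans (R.sym e) (R.trans (R.*-comm t (poly P)) (R.*-congʳ (R.sym (R.*-identityʳ (poly P))))))
    go zero {n} n≤ mf (t Div., e) | k , mt , k+d≡n | yes P∣t =
      contradiction (ℕ.≤-trans (ℕ.≤-trans (degree-positive P) (ℕ.m≤n+m (degree P) k)) (ℕ.≤-trans (ℕ.≤-reflexive k+d≡n) n≤)) λ ()
    go (suc fuel) {n} n≤ mf (t Div., e) | k , mt , k+d≡n | yes P∣t
      with go fuel (ℕ.s≤s⁻¹ (ℕ.≤-trans (ℕ.≤-trans (ℕ.m<m+n k (degree-positive P)) (ℕ.≤-reflexive k+d≡n)) n≤)) mt P∣t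
    ... | extraction s g j mg degs P∤g eq = extraction (suc s) g j mg
            (trans (ℕ.+-assoc (degree P) (suc s ℕ.* degree P) j)
                (trans (cong (degree P ℕ.+_) degs) (trans (ℕ.+-comm (degree P) k) k+d≡n))) P∤g
            (R.trans (R.sym e) (R.trans (R.*-comm t (poly P)) (R.trans (R.*-congˡ eq) (R.sym (R.*-assoc (poly P) _ g)))))

  module PrimeSums {a} {A : Set a} (_∙_ : A → A → A) (ε : A) (isCommutativeMonoid : IsCommutativeMonoid _≡_ _∙_ ε) where
    open ListFold _∙_ ε isCommutativeMonoid
    open Selection _∙_ ε isCommutativeMonoid
    open IsCommutativeMonoid isCommutativeMonoid using (identityˡ; identityʳ)

    primesOfDegree-≃ : ∀ d P (x : A) → ⨁ (primesOfDegree d) (λ Q → when (poly Q ≃? poly P) x) ≡ when (degree P ℕ.≟ d) x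
    primesOfDegree-≃ d P x with degree P ℕ.≟ d
    ... | no  P≢d = trans (⨁-congAll (All.map (λ {Q} Q≡d → when-no (poly Q ≃? poly P) (λ e → P≢d (trans (sym (degree-cong Q P e)) Q≡d))) (primesOfDegree-degree d)))
                      (trans (⨁-ε (primesOfDegree d)) (sym (when-no (degree P ℕ.≟ d) P≢d)))
    ... | yes refl = trans (⨁-mapMaybe (toPrime d) (monics d) _)
                       (trans (⨁-cong (monics d) pointwise) (trans (monics-≃ d x (isMonic P)) (sym (when-yes (degree P ℕ.≟ d) refl))))
      where
      pointwise : ∀ f → maybe′ (λ Q → when (poly Q ≃? poly P) x) ε (toPrime d f) ≡ when (f ≃? poly P) x
      pointwise f with prime? d f
      ... | yes _ = refl
      ... | no ¬p = sym (when-no (f ≃? poly P) (λ e → ¬p (monic-resp (R.sym e) (isMonic P) , irreducible-resp e)))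
        where
        module D = SemiringDefs polyRawSemiring
        irreducible-resp : f ≃ poly P → Irreducible f
        irreducible-resp e = record
          { p∤1      = λ u → irreducible-∤1 (isIrreducible P) (∣-respˡ e (toᴿ u))
          ; split-∣1 = λ e′ → D.Irreducible.split-∣1 (isIrreducible P) (λ i → F.trans (F.sym (at e i)) (e′ i)) }

    primesBetween-≃ : ∀ lo k P (x : A) → lo ℕ.< degree P → degree P ℕ.≤ lo ℕ.+ k →
                      ⨁ (primesBetween lo k) (λ Q → when (poly Q ≃? poly P) x) ≡ x
    primesBetween-≃ lo k P x l u =
      trans (⨁-concatMap primesOfDegree (interval lo k) _) (trans (⨁-cong (interval lo k) (λ d → primesOfDegree-≃ d P x)) (go k u))
      where
      none : ∀ k → lo ℕ.+ k ℕ.< degree P → ⨁ (interval lo k) (λ d → when (degree P ℕ.≟ d) x) ≡ ε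
      none k h = trans (⨁-congAll (All.map (λ {i} (_ , v) → when-no (degree P ℕ.≟ i) (λ e → ℕ.<⇒≱ h (subst (ℕ._≤ lo ℕ.+ k) (sym e) v))) (interval-bounds lo k)))
                   (⨁-ε (interval lo k))
      go : ∀ k → degree P ℕ.≤ lo ℕ.+ k → ⨁ (interval lo k) (λ d → when (degree P ℕ.≟ d) x) ≡ x
      go zero    u = contradiction (ℕ.≤-trans l u) (ℕ.≤⇒≯ (ℕ.≤-reflexive (ℕ.+-identityʳ lo)))
      go (suc k) u with ℕ.m≤n⇒m<n∨m≡n u
      ... | inj₂ e  = trans (cong₂ _∙_ (when-yes (degree P ℕ.≟ lo ℕ.+ suc k) e)
          (none k (subst (lo ℕ.+ k ℕ.<_) (sym e) (ℕ.+-monoʳ-< lo ℕ.≤-refl)))) (identityʳ x)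
      ... | inj₁ u′ = trans (cong₂ _∙_ (when-no (degree P ℕ.≟ lo ℕ.+ suc k) (λ e → ℕ.<-irrefl e u′))
                        (go k (ℕ.s≤s⁻¹ (subst (suc (degree P) ℕ.≤_) (ℕ.+-suc lo k) u′)))) (identityˡ x)

    power : A → ℕ → A
    power x zero    = ε
    power x (suc n) = x ∙ power x n

    interval-≤ : ∀ J s (x : A) → s ℕ.≤ J → ⨁ (interval 0 J) (λ i → when (i ℕ.≤? s) x) ≡ power x s
    interval-≤ zero    zero x z≤n = refl
    interval-≤ (suc J) s    x s≤J with ℕ.m≤n⇒m<n∨m≡n s≤J
    ... | inj₁ (s≤s s≤J′) = trans (cong (_∙ ⨁ (interval 0 J) (λ i → when (i ℕ.≤? s) x)) (when-no (suc J ℕ.≤? s) (ℕ.<⇒≱ (s≤s s≤J′))))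
                              (trans (identityˡ _) (interval-≤ J s x s≤J′))
    ... | inj₂ refl = cong₂ _∙_ (when-yes (suc J ℕ.≤? suc J) ℕ.≤-refl)
                        (trans (⨁-congAll (All.map (λ {i} (_ , i≤J) → when-⇔ (i ℕ.≤? suc J) (i ℕ.≤? J) (λ _ → i≤J) (λ _ → ℕ.m≤n⇒m≤1+n i≤J)) (interval-bounds 0 J)))
                          (interval-≤ J J x ℕ.≤-refl))

    module Factorisation
      (Φ : Poly → A) (w : ℕ → A)
      (Φ-cong : ∀ {f g} → f ≃ g → Φ f ≡ Φ g)
      (Φ-1 : Φ 1ₚ ≡ ε)
      (Φ-split : ∀ P t {n g} → IsMonic n g → poly P ∤ g → Φ (poly P ^ᵖ suc t ⊗ g) ≡ power (w (degree P)) (suc t) ∙ Φ g)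
      where

      local : ℕ → Poly → Prime → A
      local J f P = ⨁ (interval 0 J) (λ i → when (power∣? P i f) (w (degree P)))

      -- Induction on the degree, stripping the full power of one prime divisor. The multiplicity of
      -- P is encoded as the number of i ≥ 1 with P^i ∣ f, so that it can later be averaged over f.
      -- In an additive monoid the result yields the degree of f, in the multiplicative one the
      -- factorisation of λ.
      factorisation : ∀ J {n f} → IsMonic n f → n ℕ.≤ J → Φ f ≡ ⨁ (primesBetween 0 J) (local J f)
      factorisation J {n} mf = go n ℕ.≤-refl mf
        where
        trivial : ∀ {P f} → poly P ∤ f → local J f P ≡ ε
        trivial {P} {f} P∤f = trans (⨁-congAll (All.map (λ { {suc i} _ → when-no (power∣? P (suc i) f) (λ d → P∤f (∣-trans (∣-^ᵖ-suc (poly P) i) d)) }) (interval-bounds 0 J)))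
          (⨁-ε (interval 0 J))

        go : ∀ fuel {n f} → n ℕ.≤ fuel → IsMonic n f → n ℕ.≤ J → Φ f ≡ ⨁ (primesBetween 0 J) (local J f)
        go fuel {zero} {f} _ mf _ = trans (trans (Φ-cong (monic-0 mf)) Φ-1)
          (sym (trans (⨁-cong (primesBetween 0 J) (λ P → trivial {P}
              (λ d → irreducible-∤1 (isIrreducible P) (∣-respʳ (monic-0 mf) d)))) (⨁-ε (primesBetween 0 J))))
        go (suc fuel) {suc n} {f} (s≤s n≤) mf n≤J with prime-divisor n mf
        ... | P , P∣f with extract P mf P∣f
        ...   | extraction t g k mg degs P∤g eq = begin
          Φ f                                                                              ≡⟨ Φ-cong eq ⟩
          Φ (poly P ^ᵖ suc t ⊗ g)                                                          ≡⟨ Φ-split P t mg P∤g ⟩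
          y ∙ Φ g
              ≡⟨ cong (y ∙_) (go fuel (ℕ.s≤s⁻¹ (ℕ.≤-trans k<n (s≤s n≤))) mg (ℕ.≤-trans (ℕ.<⇒≤ k<n) n≤J)) ⟩
          y ∙ ⨁ (primesBetween 0 J) (local J g)
              ≡⟨ cong (_∙ ⨁ (primesBetween 0 J) (local J g)) (primesBetween-≃ 0 J P y (degree-positive P) P≤J) ⟨
          ⨁ (primesBetween 0 J) (λ Q → when (poly Q ≃? poly P) y) ∙ ⨁ (primesBetween 0 J)
              (local J g) ≡⟨ ⨁-distrib (primesBetween 0 J) _ (local J g) ⟨
          ⨁ (primesBetween 0 J) (λ Q → when (poly Q ≃? poly P) y ∙ local J g Q)            ≡⟨ ⨁-cong (primesBetween 0 J) pointwise ⟨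
          ⨁ (primesBetween 0 J) (local J f)                                                ∎
          where
          open ≡-Reasoning
          s = suc t
          y = power (w (degree P)) s

          P≤ : degree P ℕ.≤ s ℕ.* degree P
          P≤ = ℕ.m≤m+n (degree P) (t ℕ.* degree P)

          k<n : k ℕ.< suc n
          k<n = ℕ.≤-trans (ℕ.+-monoˡ-≤ k (ℕ.≤-trans (degree-positive P) P≤)) (ℕ.≤-reflexive degs)

          P≤J : degree P ℕ.≤ J
          P≤J = ℕ.≤-trans (ℕ.≤-trans P≤ (ℕ.m≤m+n _ k)) (ℕ.≤-trans (ℕ.≤-reflexive degs) n≤J)

          s≤J : s ℕ.≤ J
          s≤J = ℕ.≤-trans (ℕ.≤-trans (ℕ.≤-trans (ℕ.≤-reflexive (sym (ℕ.*-identityʳ s)))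
              (ℕ.*-monoʳ-≤ s (degree-positive P))) (ℕ.m≤m+n _ k))
                  (ℕ.≤-trans (ℕ.≤-reflexive degs) n≤J)

          -- At Q = P exactly the powers i ≤ s divide f and none divides g; at any other Q Gauss's
          -- lemma cancels P^s.
          pointwise : ∀ Q → local J f Q ≡ when (poly Q ≃? poly P) y ∙ local J g Q
          pointwise Q with poly Q ≃? poly P
          ... | yes Q≃P = begin
            local J f Q
                ≡⟨ ⨁-cong (interval 0 J) (λ i → when-⇔ (power∣? Q i f) (i ℕ.≤? s) (forward i) (backward i)) ⟩
            ⨁ (interval 0 J) (λ i → when (i ℕ.≤? s) (w (degree Q))) ≡⟨ interval-≤ J s (w (degree Q)) s≤J ⟩
            power (w (degree Q)) s                                  ≡⟨ cong (λ d → power (w d) s) (degree-cong Q P Q≃P) ⟩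
            y                                                       ≡⟨ identityʳ y ⟨
            y ∙ ε                                                   ≡⟨ cong (y ∙_) (trivial {Q} (λ d → P∤g (∣-respˡ Q≃P d))) ⟨
            y ∙ local J g Q                                         ∎
            where
            forward : ∀ i → poly Q ^ᵖ i ∣ f → i ℕ.≤ s
            forward i d = power-∣-iff P s P∤g i (∣-respˡ (^ᵖ-cong i Q≃P) (∣-respʳ eq d))
            backward : ∀ i → i ℕ.≤ s → poly Q ^ᵖ i ∣ f
            backward i i≤s = ∣-respˡ (^ᵖ-cong i (R.sym Q≃P)) (∣-respʳ (R.sym eq) (∣-*ʳ g (^ᵖ-∣ (poly P) i≤s)))
          ... | no Q≄P = trans
            (⨁-cong (interval 0 J) (λ i → when-⇔ (power∣? Q i f) (power∣? Q i g)
              (λ d → gauss (comaximal-^^ i s (primes-comaximal Q P Q≄P)) (∣-respʳ eq d))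
              (λ d → ∣-respʳ (R.sym eq) (∣-*ˡ (poly P ^ᵖ s) d))))
            (sym (identityˡ _))

-- Brun's pure sieve for the primes dividing f (f + h)

module Sieve {c ℓ : Level} (F : FiniteField c ℓ) where
  open Primes F public
  open RationalOrder
  open RationalSums
  open TruncatedProducts

  private
    variable
      p : Level

  indicator-nonneg : {A : Set p} (A? : Dec A) → 0ℚ ℚ.≤ [ A? ]
  indicator-nonneg (yes _) = 0≤1
  indicator-nonneg (no _)  = ℚ.≤-refl

  indicator-≤1 : {A : Set p} (A? : Dec A) → [ A? ] ℚ.≤ 1ℚ
  indicator-≤1 (yes _) = ℚ.≤-refl
  indicator-≤1 (no _)  = 0≤1

  indicator-× : ∀ {p q r} {A : Set p} {B : Set q} {C : Set r} (A? : Dec A) (B? : Dec B) (C? : Dec C) →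
                (C → A × B) → (A → B → C) → [ A? ] ℚ.* [ B? ] ≡ [ C? ]
  indicator-× (no ¬a) B?      C? f g = trans (ℚ.*-zeroˡ [ B? ]) (sym (Sum.when-no C? (λ c → ¬a (proj₁ (f c)))))
  indicator-× (yes a) (no ¬b) C? f g = trans (ℚ.*-zeroʳ 1ℚ) (sym (Sum.when-no C? (λ c → ¬b (proj₂ (f c)))))
  indicator-× (yes a) (yes b) C? f g = trans (ℚ.*-identityˡ 1ℚ) (sym (Sum.when-yes C? (g a b)))

  private
    vanishing : ∀ {x} (xs : List Prime) → ∑ xs (λ Q → [ poly Q ≃? x ]) ℚ.≤ 0ℚ → All (λ Q → ¬ poly Q ≃ x) xs
    vanishing []       h = []
    vanishing {x} (Q ∷ xs) h with poly Q ≃? x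
    ... | no ne = ne ∷ vanishing xs (ℚ.≤-trans (ℚ.≤-reflexive (sym (ℚ.+-identityˡ _))) h)
    ... | yes _ = contradiction
            (ℚ.<-≤-trans (ℚ.positive⁻¹ 1ℚ) (ℚ.≤-trans (≤-+ʳ (∑-nonneg xs (λ R → indicator-nonneg (poly R ≃? x)))) h)) (ℚ.<-irrefl refl)

    distinct : (L : List Prime) → All (λ P → ∑ L (λ Q → [ poly Q ≃? poly P ]) ℚ.≤ 1ℚ) L →
               AllPairs (λ P Q → Comaximal (poly P) (poly Q)) L
    distinct []      _        = []
    distinct (P ∷ L) (h ∷ hs) =
      All.map (λ {Q} ne → comaximal-sym (primes-comaximal Q P ne)) (vanishing L rest) ∷
      distinct L (All.map (λ {Q} → ℚ.≤-trans (ℚ.≤-trans (ℚ.≤-reflexive (sym (ℚ.+-identityˡ _))) (ℚ.+-monoˡ-≤ _ (indicator-nonneg (poly P ≃? poly Q))))) hs)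
      where
      identity : ∀ s → s ≡ 1ℚ ℚ.+ s ℚ.- 1ℚ
      identity = solve-∀ ℚ-ring
      rest : ∑ L (λ Q → [ poly Q ≃? poly P ]) ℚ.≤ 0ℚ
      rest = ℚ.≤-trans (ℚ.≤-reflexive (identity _))
        (ℚ.+-monoˡ-≤ (ℚ.- 1ℚ) (ℚ.≤-trans (ℚ.≤-reflexive (cong (ℚ._+ ∑ L (λ Q → [ poly Q ≃? poly P ]))
            (sym (Sum.when-yes (poly P ≃? poly P) R.refl)))) h))

  -- Each prime of the range is counted exactly once in the list, so no two positions hold the same
  -- prime, and different primes are comaximal.
  primesBetween-comaximal : ∀ lo k → AllPairs (λ P Q → Comaximal (poly P) (poly Q)) (primesBetween lo k)
  primesBetween-comaximal lo k = distinct (primesBetween lo k)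
    (All.map (λ {P} (l , u) → ℚ.≤-reflexive (PS.primesBetween-≃ lo k P 1ℚ l u)) (primesBetween-bounds lo k))
    where module PS = PrimeSums ℚ._+_ 0ℚ ℚ.+-0-isCommutativeMonoid

  -- The density of the f with P ∣ f (f + h) when P does not divide h: two residue classes out of
  -- q^(deg P).
  weight : Prime → ℚ
  weight P = 2ℚ ℚ.* ρ ^ degree P

  weight-nonneg : ∀ P → 0ℚ ℚ.≤ weight P
  weight-nonneg P = *-nonneg 0≤2 (^-nonneg (degree P) ρ≥0)

  weight-≤1 : ∀ P → weight P ℚ.≤ 1ℚ
  weight-≤1 P = ℚ.≤-trans (*-monoˡ 0≤2 (ℚ.≤-trans (^-antimono ρ≥0 ρ≤1 (degree-positive P)) (ℚ.≤-reflexive (ℚ.*-identityʳ ρ))))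
    (ℚ.≤-trans (ℚ.≤-reflexive (cong (ℚ._* ρ) (sym ι-2))) 2ρ≤1)

  module Shifted (h : Poly) (n : ℕ) where

    hits : Poly → Prime → ℚ
    hits f P = [ divides? (isMonic P) f ] ℚ.+ [ divides? (isMonic P) (f ⊕ h) ]

    -- The two indicators exclude each other, since P dividing f and f ⊕ h would divide h.
    hits-bounds : ∀ f P → poly P ∤ h → 0ℚ ℚ.≤ hits f P × hits f P ℚ.≤ 1ℚ
    hits-bounds f P P∤h = +-nonneg (indicator-nonneg (divides? (isMonic P) f))
        (indicator-nonneg (divides? (isMonic P) (f ⊕ h))) , upper
      where
      upper : hits f P ℚ.≤ 1ℚ
      upper with divides? (isMonic P) f | divides? (isMonic P) (f ⊕ h)
      ... | no _  | d?    = ℚ.≤-trans (ℚ.≤-reflexive (ℚ.+-identityˡ _)) (indicator-≤1 d?)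
      ... | yes _ | no _  = ℚ.≤-refl
      ... | yes d | yes d′ = contradiction (∣-+-cancel d′ d) P∤h

    -- Choosing P splits `hits` into the classes f ≡ 0 and f ≡ -h modulo P, and the Chinese
    -- remainder theorem merges each with the class modulo D into one class modulo D P. The general
    -- modulus D serves this induction. Each of the j choices raises the degree by at most Y, so all
    -- counts are exact while m + j Y ≤ n.
    equidistribution : ∀ {Y} L j {m D} (mD : IsMonic m D) b →
      All (λ P → degree P ℕ.≤ Y × Comaximal (poly P) D) L → AllPairs (λ P Q → Comaximal (poly P) (poly Q)) L →
      m ℕ.+ j ℕ.* Y ℕ.≤ n →
      ∑ (monics n) (λ f → [ divides? mD (f ⊕ b) ] ℚ.* elementary j L (hits f)) ≡ size n ℚ.* (ρ ^ m ℚ.* elementary j L weight)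
    equidistribution L zero {m} mD b _ _ bound = begin
      ∑ (monics n) (λ f → [ divides? mD (f ⊕ b) ] ℚ.* 1ℚ)   ≡⟨ Sum.⨁-cong (monics n) (λ f → ℚ.*-identityʳ [ divides? mD (f ⊕ b) ]) ⟩
      ∑ (monics n) (λ f → [ divides? mD (f ⊕ b) ])          ≡⟨ divisible-monics mD b
          (ℕ.≤-trans (ℕ.≤-reflexive (sym (ℕ.+-identityʳ m))) bound) ⟩
      size n ℚ.* ρ ^ m                                      ≡⟨ cong (size n ℚ.*_) (ℚ.*-identityʳ (ρ ^ m)) ⟨
      size n ℚ.* (ρ ^ m ℚ.* 1ℚ)                             ∎
      where open ≡-Reasoning
    equidistribution [] (suc j) {m} mD b _ _ bound = begin
      ∑ (monics n) (λ f → [ divides? mD (f ⊕ b) ] ℚ.* 0ℚ)   ≡⟨ Sum.⨁-cong (monics n) (λ f → ℚ.*-zeroʳ [ divides? mD (f ⊕ b) ]) ⟩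
      ∑ (monics n) (λ f → 0ℚ)                               ≡⟨ Sum.⨁-ε (monics n) ⟩
      0ℚ                                                    ≡⟨ ℚ.*-zeroʳ (size n) ⟨
      size n ℚ.* 0ℚ                                         ≡⟨ cong (size n ℚ.*_) (ℚ.*-zeroʳ (ρ ^ m)) ⟨
      size n ℚ.* (ρ ^ m ℚ.* 0ℚ)                             ∎
      where open ≡-Reasoning
    equidistribution {Y} (P ∷ L) (suc j) {m} {D} mD b ((P≤Y , cPD) ∷ cs) (cP ∷ pairs) bound = begin
      ∑ (monics n) (λ f → d f ℚ.* (E′ f ℚ.+ hits f P ℚ.* E f))
        ≡⟨ Sum.⨁-cong (monics n) expand ⟩
      ∑ (monics n) (λ f → d f ℚ.* E′ f ℚ.+ (d₁ f ℚ.* E f ℚ.+ d₂ f ℚ.* E f))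
        ≡⟨ trans (Sum.⨁-distrib (monics n) _ _) (cong (λ s → ∑ (monics n) (λ f → d f ℚ.* E′ f) ℚ.+ s) (Sum.⨁-distrib (monics n) _ _)) ⟩
      ∑ (monics n) (λ f → d f ℚ.* E′ f) ℚ.+ (∑ (monics n) (λ f → d₁ f ℚ.* E f) ℚ.+ ∑ (monics n) (λ f → d₂ f ℚ.* E f))
        ≡⟨ cong₂ ℚ._+_ (equidistribution L (suc j) mD b cs pairs bound)
             (cong₂ ℚ._+_ (equidistribution L j mDP w₁ cs′ pairs bound′) (equidistribution L j mDP w₂ cs′ pairs bound′)) ⟩
      size n ℚ.* (ρ ^ m ℚ.* X′) ℚ.+ (size n ℚ.* (ρ ^ (m ℕ.+ degree P) ℚ.* X) ℚ.+ size n ℚ.* (ρ ^ (m ℕ.+ degree P) ℚ.* X))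
        ≡⟨ cong (λ y → size n ℚ.* (ρ ^ m ℚ.* X′) ℚ.+ (size n ℚ.* (y ℚ.* X) ℚ.+ size n ℚ.* (y ℚ.* X))) (^-homo ρ m (degree P)) ⟩
      size n ℚ.* (ρ ^ m ℚ.* X′) ℚ.+ (size n ℚ.* (ρ ^ m ℚ.* ρ ^ degree P ℚ.* X) ℚ.+ size n ℚ.* (ρ ^ m ℚ.* ρ ^ degree P ℚ.* X))
        ≡⟨ collect (size n) (ρ ^ m) (ρ ^ degree P) X′ X ⟩
      size n ℚ.* (ρ ^ m ℚ.* (X′ ℚ.+ weight P ℚ.* X)) ∎
      where
      open ≡-Reasoning
      mDP = monic-* mD (isMonic P)
      CRT₁ = chineseRemainder (comaximal-sym cPD) b []
      CRT₂ = chineseRemainder (comaximal-sym cPD) b h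
      w₁ = proj₁ CRT₁
      w₂ = proj₁ CRT₂
      d d₁ d₂ E E′ : Poly → ℚ
      d f = [ divides? mD (f ⊕ b) ]
      d₁ f = [ divides? mDP (f ⊕ w₁) ]
      d₂ f = [ divides? mDP (f ⊕ w₂) ]
      E′ f = elementary (suc j) L (hits f)
      E f = elementary j L (hits f)
      X′ = elementary (suc j) L weight
      X = elementary j L weight

      cs′ : All (λ Q → degree Q ℕ.≤ Y × Comaximal (poly Q) (D ⊗ poly P)) L
      cs′ = All.zipWith (λ ((Q≤Y , cQD) , cPQ) → Q≤Y , comaximal-* cQD (comaximal-sym cPQ)) (cs , cP)

      bound′ : m ℕ.+ degree P ℕ.+ j ℕ.* Y ℕ.≤ n
      bound′ = ℕ.≤-trans (ℕ.≤-reflexive (ℕ.+-assoc m (degree P) (j ℕ.* Y)))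
        (ℕ.≤-trans (ℕ.+-monoʳ-≤ m (ℕ.+-monoˡ-≤ (j ℕ.* Y) P≤Y)) bound)

      product₁ : ∀ f → d f ℚ.* [ divides? (isMonic P) f ] ≡ d₁ f
      product₁ f = indicator-× (divides? mD _) (divides? (isMonic P) f) (divides? mDP _)
        (λ dp → let (x , y) = proj₁ (proj₂ CRT₁) f dp in x , ∣-respʳ (R.+-identityʳ f) y)
        (λ x y → proj₂ (proj₂ CRT₁) f x (∣-respʳ (R.sym (R.+-identityʳ f)) y))

      product₂ : ∀ f → d f ℚ.* [ divides? (isMonic P) (f ⊕ h) ] ≡ d₂ f
      product₂ f = indicator-× (divides? mD _) (divides? (isMonic P) (f ⊕ h)) (divides? mDP _)
        (proj₁ (proj₂ CRT₂) f) (proj₂ (proj₂ CRT₂) f)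

      expand : ∀ f → d f ℚ.* (E′ f ℚ.+ hits f P ℚ.* E f) ≡ d f ℚ.* E′ f ℚ.+ (d₁ f ℚ.* E f ℚ.+ d₂ f ℚ.* E f)
      expand f = trans (identity (d f) (E′ f) [ divides? (isMonic P) f ] [ divides? (isMonic P) (f ⊕ h) ] (E f))
        (cong₂ (λ x y → d f ℚ.* E′ f ℚ.+ (x ℚ.* E f ℚ.+ y ℚ.* E f)) (product₁ f) (product₂ f))
        where
        identity : ∀ d e′ a b e → d ℚ.* (e′ ℚ.+ (a ℚ.+ b) ℚ.* e) ≡ d ℚ.* e′ ℚ.+ (d ℚ.* a ℚ.* e ℚ.+ d ℚ.* b ℚ.* e)
        identity = solve-∀ ℚ-ring

      collect : ∀ s r t x′ x → s ℚ.* (r ℚ.* x′) ℚ.+ (s ℚ.* (r ℚ.* t ℚ.* x) ℚ.+ s ℚ.* (r ℚ.* t ℚ.* x)) ≡ s ℚ.*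
          (r ℚ.* (x′ ℚ.+ 2ℚ ℚ.* t ℚ.* x))
      collect = solve-∀ ℚ-ring

    module _ {Y m : ℕ} {L : List Prime} {M : Poly} (mM : IsMonic m M)
             (coprime : All (λ P → degree P ℕ.≤ Y × Comaximal (poly P) M) L)
             (distinctL : AllPairs (λ P Q → Comaximal (poly P) (poly Q)) L)
             (avoid : All (λ P → poly P ∤ h) L) (r : ℕ) (bound : m ℕ.+ suc r ℕ.* Y ℕ.≤ n) where

      private
        class : Poly → Poly → ℚ
        class f w = [ divides? mM (f ⊕ w) ]

        W T : (Prime → ℚ) → ℚ
        W u = ∏ L (λ P → 1ℚ ℚ.- 2ℚ ℚ.* u P)
        T u = truncation r L u

        C : ℚ
        C = 2ℚ ^ suc r

        tail : (Prime → ℚ) → ℚ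
        tail u = elementary (suc r) L u

        truncation-sum : ∀ r → m ℕ.+ r ℕ.* Y ℕ.≤ n → ∀ w →
          ∑ (monics n) (λ f → class f w ℚ.* truncation r L (hits f)) ≡ size n ℚ.* (ρ ^ m ℚ.* truncation r L weight)
        truncation-sum zero    le w = equidistribution L zero mM w coprime distinctL le
        truncation-sum (suc r) le w = begin
          ∑ (monics n) (λ f → class f w ℚ.* (t f ℚ.+ κ ℚ.* e f))
            ≡⟨ Sum.⨁-cong (monics n) (λ f → identity (class f w) (t f) κ (e f)) ⟩
          ∑ (monics n) (λ f → class f w ℚ.* t f ℚ.+ κ ℚ.* (class f w ℚ.* e f))
            ≡⟨ trans (Sum.⨁-distrib (monics n) _ _) (cong (λ s → ∑ (monics n) (λ f → class f w ℚ.* t f) ℚ.+ s) (∑-*ˡ κ (monics n) _)) ⟩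
          ∑ (monics n) (λ f → class f w ℚ.* t f) ℚ.+ κ ℚ.* ∑ (monics n) (λ f → class f w ℚ.* e f)
            ≡⟨ cong₂ (λ a b → a ℚ.+ κ ℚ.* b) (truncation-sum r (ℕ.≤-trans (ℕ.+-monoʳ-≤ m (ℕ.m≤n+m (r ℕ.* Y) Y)) le) w)
                 (equidistribution L (suc r) mM w coprime distinctL le) ⟩
          size n ℚ.* (ρ ^ m ℚ.* truncation r L weight) ℚ.+ κ ℚ.* (size n ℚ.* (ρ ^ m ℚ.* elementary (suc r) L weight))
            ≡⟨ identity′ (size n) (ρ ^ m) (truncation r L weight) κ (elementary (suc r) L weight) ⟩
          size n ℚ.* (ρ ^ m ℚ.* truncation (suc r) L weight) ∎
          where
          open ≡-Reasoning
          κ = (ℚ.- 2ℚ) ^ suc r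
          t e : Poly → ℚ
          t f = truncation r L (hits f)
          e f = elementary (suc r) L (hits f)
          identity : ∀ a t κ e → a ℚ.* (t ℚ.+ κ ℚ.* e) ≡ a ℚ.* t ℚ.+ κ ℚ.* (a ℚ.* e)
          identity = solve-∀ ℚ-ring
          identity′ : ∀ s p t κ e → s ℚ.* (p ℚ.* t) ℚ.+ κ ℚ.* (s ℚ.* (p ℚ.* e)) ≡ s ℚ.* (p ℚ.* (t ℚ.+ κ ℚ.* e))
          identity′ = solve-∀ ℚ-ring

        hits-ok : ∀ f → All (λ P → 0ℚ ℚ.≤ hits f P × hits f P ℚ.≤ 1ℚ) L
        hits-ok f = All.map (λ {P} → hits-bounds f P) avoid

        weight-ok : All (λ P → 0ℚ ℚ.≤ weight P × weight P ℚ.≤ 1ℚ) L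
        weight-ok = All.universal (λ P → weight-nonneg P , weight-≤1 P) L

      -- The truncation error enters twice: when the product is replaced by its truncation inside
      -- the sum over f, and when the averaged truncation is turned back into the product over the
      -- weights.
      density : ℚ
      density = ℚ.∣ W weight ∣ ℚ.+ 2ℚ ℚ.* (C ℚ.* tail weight)

      -- The truncation and the bound for its error are combinations of elementary symmetric
      -- functions of order at most r + 1, so both have exactly known sums over the class.
      class-sum : ∀ w → ℚ.∣ ∑ (monics n) (λ f → class f w ℚ.* W (hits f)) ∣ ℚ.≤ size n ℚ.* ρ ^ m ℚ.* density
      class-sum w = begin
        ℚ.∣ ∑ (monics n) (λ f → class f w ℚ.* W (hits f)) ∣
          ≡⟨ cong ℚ.∣_∣ (trans (Sum.⨁-cong (monics n) (λ f → split (class f w) (W (hits f)) (T (hits f))))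
              (Sum.⨁-distrib (monics n) _ _)) ⟩
        ℚ.∣ ∑ (monics n) (λ f → class f w ℚ.* (W (hits f) ℚ.- T (hits f))) ℚ.+ ∑ (monics n) (λ f → class f w ℚ.* T (hits f)) ∣
          ≤⟨ ℚ.∣p+q∣≤∣p∣+∣q∣ (∑ (monics n) (λ f → class f w ℚ.* (W (hits f) ℚ.- T (hits f))))
              (∑ (monics n) (λ f → class f w ℚ.* T (hits f))) ⟩
        ℚ.∣ ∑ (monics n) (λ f → class f w ℚ.* (W (hits f) ℚ.- T (hits f))) ∣ ℚ.+ ℚ.∣ ∑ (monics n) (λ f → class f w ℚ.* T (hits f)) ∣
          ≤⟨ ℚ.+-mono-≤ error-part (ℚ.≤-reflexive main-part) ⟩
        C ℚ.* (S ℚ.* tail weight) ℚ.+ S ℚ.* ℚ.∣ T weight ∣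
          ≤⟨ ℚ.+-monoʳ-≤ (C ℚ.* (S ℚ.* tail weight)) (*-monoˡ S≥0 T-bound) ⟩
        C ℚ.* (S ℚ.* tail weight) ℚ.+ S ℚ.* (ℚ.∣ W weight ∣ ℚ.+ C ℚ.* tail weight)
          ≡⟨ collect C S (tail weight) ℚ.∣ W weight ∣ ⟩
        S ℚ.* density ∎
        where
        open ℚ.≤-Reasoning
        S = size n ℚ.* ρ ^ m
        S≥0 : 0ℚ ℚ.≤ S
        S≥0 = *-nonneg (size≥0 n) (^-nonneg m ρ≥0)
        split : ∀ a w t → a ℚ.* w ≡ a ℚ.* (w ℚ.- t) ℚ.+ a ℚ.* t
        split = solve-∀ ℚ-ring
        collect : ∀ c s e x → c ℚ.* (s ℚ.* e) ℚ.+ s ℚ.* (x ℚ.+ c ℚ.* e) ≡ s ℚ.* (x ℚ.+ 2ℚ ℚ.* (c ℚ.* e))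
        collect = solve-∀ ℚ-ring

        T-bound : ℚ.∣ T weight ∣ ℚ.≤ ℚ.∣ W weight ∣ ℚ.+ C ℚ.* tail weight
        T-bound = ℚ.≤-trans (∣∣-triangle (T weight) (W weight))
          (ℚ.+-monoʳ-≤ ℚ.∣ W weight ∣ (ℚ.≤-trans (ℚ.≤-reflexive (∣∣-swap (T weight) (W weight))) (truncation-error r weight-ok)))

        main-part : ℚ.∣ ∑ (monics n) (λ f → class f w ℚ.* T (hits f)) ∣ ≡ S ℚ.* ℚ.∣ T weight ∣
        main-part = trans (cong ℚ.∣_∣ (trans (truncation-sum r
            (ℕ.≤-trans (ℕ.+-monoʳ-≤ m (ℕ.m≤n+m (r ℕ.* Y) Y)) bound) w) (sym (ℚ.*-assoc (size n) (ρ ^ m) (T weight)))))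
          (trans (ℚ.∣p*q∣≡∣p∣*∣q∣ S (T weight)) (cong (ℚ._* ℚ.∣ T weight ∣) (ℚ.0≤p⇒∣p∣≡p S≥0)))

        error-part : ℚ.∣ ∑ (monics n) (λ f → class f w ℚ.* (W (hits f) ℚ.- T (hits f))) ∣ ℚ.≤ C ℚ.* (S ℚ.* tail weight)
        error-part = begin
          ℚ.∣ ∑ (monics n) (λ f → class f w ℚ.* (W (hits f) ℚ.- T (hits f))) ∣
            ≤⟨ ∣∑∣-≤ (monics n) _ ⟩
          ∑ (monics n) (λ f → ℚ.∣ class f w ℚ.* (W (hits f) ℚ.- T (hits f)) ∣)
            ≤⟨ ∑-mono (All.universal termwise (monics n)) ⟩
          ∑ (monics n) (λ f → C ℚ.* (class f w ℚ.* tail (hits f)))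
            ≡⟨ ∑-*ˡ C (monics n) _ ⟩
          C ℚ.* ∑ (monics n) (λ f → class f w ℚ.* tail (hits f))
            ≡⟨ cong (C ℚ.*_) (equidistribution L (suc r) mM w coprime distinctL bound) ⟩
          C ℚ.* (size n ℚ.* (ρ ^ m ℚ.* tail weight))
            ≡⟨ cong (C ℚ.*_) (ℚ.*-assoc (size n) (ρ ^ m) (tail weight)) ⟨
          C ℚ.* (S ℚ.* tail weight) ∎
          where
          swap : ∀ a c e → a ℚ.* (c ℚ.* e) ≡ c ℚ.* (a ℚ.* e)
          swap = solve-∀ ℚ-ring
          termwise : ∀ f → ℚ.∣ class f w ℚ.* (W (hits f) ℚ.- T (hits f)) ∣ ℚ.≤ C ℚ.* (class f w ℚ.* tail (hits f))
          termwise f = begin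
            ℚ.∣ class f w ℚ.* (W (hits f) ℚ.- T (hits f)) ∣          ≡⟨ ℚ.∣p*q∣≡∣p∣*∣q∣ (class f w) _ ⟩
            ℚ.∣ class f w ∣ ℚ.* ℚ.∣ W (hits f) ℚ.- T (hits f) ∣
                ≡⟨ cong (ℚ._* ℚ.∣ W (hits f) ℚ.- T (hits f) ∣) (ℚ.0≤p⇒∣p∣≡p (indicator-nonneg (divides? mM (f ⊕ w)))) ⟩
            class f w ℚ.* ℚ.∣ W (hits f) ℚ.- T (hits f) ∣
                ≤⟨ *-monoˡ (indicator-nonneg (divides? mM (f ⊕ w))) (truncation-error r (hits-ok f)) ⟩
            class f w ℚ.* (C ℚ.* tail (hits f))                      ≡⟨ swap (class f w) C (tail (hits f)) ⟩
            C ℚ.* (class f w ℚ.* tail (hits f))                      ∎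

      sieve : (G G′ : Poly → ℚ) → (∀ f w → M ∣ f ⊕ w → G f ≡ G′ w) → (∀ w → ℚ.∣ G′ w ∣ ℚ.≤ 1ℚ) →
              ℚ.∣ ∑ (monics n) (λ f → G f ℚ.* W (hits f)) ∣ ℚ.≤ size n ℚ.* density
      sieve G G′ G≡G′ G′≤1 = begin
        ℚ.∣ ∑ (monics n) (λ f → G f ℚ.* W (hits f)) ∣
          ≡⟨ cong ℚ.∣_∣ (trans (Sum.⨁-cong (monics n) partition) (Sum.⨁-swap (monics n) (words [] m) _)) ⟩
        ℚ.∣ ∑ (words [] m) (λ w → ∑ (monics n) (λ f → G′ w ℚ.* (class f w ℚ.* W (hits f)))) ∣
          ≤⟨ ∣∑∣-≤ (words [] m) _ ⟩
        ∑ (words [] m) (λ w → ℚ.∣ ∑ (monics n) (λ f → G′ w ℚ.* (class f w ℚ.* W (hits f))) ∣)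
          ≤⟨ ∑-mono (All.universal each (words [] m)) ⟩
        ∑ (words [] m) (λ w → 1ℚ ℚ.* (size n ℚ.* ρ ^ m ℚ.* density))
          ≡⟨ ∑-*ʳ (size n ℚ.* ρ ^ m ℚ.* density) (words [] m) (λ _ → 1ℚ) ⟩
        ∑ (words [] m) (λ w → 1ℚ) ℚ.* (size n ℚ.* ρ ^ m ℚ.* density)
          ≡⟨ cong (ℚ._* (size n ℚ.* ρ ^ m ℚ.* density)) (∑-words-1 [] m) ⟩
        size m ℚ.* (size n ℚ.* ρ ^ m ℚ.* density)
          ≡⟨ rearrange (size m) (size n) (ρ ^ m) density ⟩
        ρ ^ m ℚ.* size m ℚ.* (size n ℚ.* density)
          ≡⟨ trans (cong (ℚ._* (size n ℚ.* density)) (ρ^*size m)) (ℚ.*-identityˡ _) ⟩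
        size n ℚ.* density ∎
        where
        open ℚ.≤-Reasoning
        rearrange : ∀ a b c d → a ℚ.* (b ℚ.* c ℚ.* d) ≡ c ℚ.* a ℚ.* (b ℚ.* d)
        rearrange = solve-∀ ℚ-ring

        partition : ∀ f → G f ℚ.* W (hits f) ≡ ∑ (words [] m) (λ w → G′ w ℚ.* (class f w ℚ.* W (hits f)))
        partition f = begin-equality
          G f ℚ.* W (hits f)                                                ≡⟨ ℚ.*-identityˡ _ ⟨
          1ℚ ℚ.* (G f ℚ.* W (hits f))                                       ≡⟨ cong (ℚ._* (G f ℚ.* W (hits f))) one ⟨
          ∑ (words [] m) (class f) ℚ.* (G f ℚ.* W (hits f))                 ≡⟨ ∑-*ʳ _ (words [] m) (class f) ⟨
          ∑ (words [] m) (λ w → class f w ℚ.* (G f ℚ.* W (hits f)))         ≡⟨ Sum.⨁-cong (words [] m) exchange ⟩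
          ∑ (words [] m) (λ w → G′ w ℚ.* (class f w ℚ.* W (hits f)))        ∎
          where
          one : ∑ (words [] m) (class f) ≡ 1ℚ
          one = trans (Sum.⨁-cong (words [] m) (λ w → Sum.when-⇔ (divides? mM (f ⊕ w)) (divides? mM (w ⊕ f))
              (∣-respʳ (R.+-comm f w)) (∣-respʳ (R.+-comm w f))))
            (residues mM f)
          exchange : ∀ w → class f w ℚ.* (G f ℚ.* W (hits f)) ≡ G′ w ℚ.* (class f w ℚ.* W (hits f))
          exchange w with divides? mM (f ⊕ w)
          ... | yes d = trans (cong (λ g → 1ℚ ℚ.* (g ℚ.* W (hits f))) (G≡G′ f w d)) (swap (G′ w) (W (hits f)))
            where
            swap : ∀ g w → 1ℚ ℚ.* (g ℚ.* w) ≡ g ℚ.* (1ℚ ℚ.* w)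
            swap = solve-∀ ℚ-ring
          ... | no _ = swap (G f) (G′ w) (W (hits f))
            where
            swap : ∀ g g′ w → 0ℚ ℚ.* (g ℚ.* w) ≡ g′ ℚ.* (0ℚ ℚ.* w)
            swap = solve-∀ ℚ-ring

        each : ∀ w → ℚ.∣ ∑ (monics n) (λ f → G′ w ℚ.* (class f w ℚ.* W (hits f))) ∣ ℚ.≤ 1ℚ ℚ.* (size n ℚ.* ρ ^ m ℚ.* density)
        each w = begin
          ℚ.∣ ∑ (monics n) (λ f → G′ w ℚ.* (class f w ℚ.* W (hits f))) ∣          ≡⟨ cong ℚ.∣_∣ (∑-*ˡ (G′ w) (monics n) _) ⟩
          ℚ.∣ G′ w ℚ.* ∑ (monics n) (λ f → class f w ℚ.* W (hits f)) ∣            ≡⟨ ℚ.∣p*q∣≡∣p∣*∣q∣ (G′ w) _ ⟩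
          ℚ.∣ G′ w ∣ ℚ.* ℚ.∣ ∑ (monics n) (λ f → class f w ℚ.* W (hits f)) ∣
              ≤⟨ *-mono (ℚ.0≤∣p∣ (G′ w)) (G′≤1 w) (ℚ.0≤∣p∣ (∑ (monics n) (λ f → class f w ℚ.* W (hits f)))) (class-sum w) ⟩
          1ℚ ℚ.* (size n ℚ.* ρ ^ m ℚ.* density)                                   ∎

-- The prime polynomial theorem and a Mertens bound for the sieve product

module PrimeDensity {c ℓ : Level} (F : FiniteField c ℓ) where
  open Sieve F public
  open import Data.Rational.Base using (_+_; _*_; _-_; -_; _≤_; _<_; ∣_∣)
  open RationalOrder
  open RationalSums
  private
    module PS = PrimeSums ℚ._+_ 0ℚ ℚ.+-0-isCommutativeMonoid

  polyDegree : Poly → ℕ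
  polyDegree f with degree? f
  ... | inj₁ _       = 0
  ... | inj₂ (d , _) = d

  polyDegree-monic : ∀ {n f} → IsMonic n f → polyDegree f ≡ n
  polyDegree-monic {n} {f} mf with degree? f
  ... | inj₁ e        = contradiction (at e n) (IsDegree.nonzero (monic⇒degree mf))
  ... | inj₂ (d , df) = degree-unique df (monic⇒degree mf) R.refl

  power-ι : ∀ d s → PS.power (ι d) s ≡ ι (s ℕ.* d)
  power-ι d zero    = sym ι-0
  power-ι d (suc s) = trans (cong (λ y → ι d + y) (power-ι d s)) (sym (ι-+ d (s ℕ.* d)))

  private
    degree-invariant : ∀ f g → f ≃ g → polyDegree f ≡ polyDegree g
    degree-invariant f g e with degree? f | degree? g
    ... | inj₁ _        | inj₁ _        = refl
    ... | inj₁ f≃0      | inj₂ (d , dg) = contradiction (at (R.trans (R.sym e) f≃0) d) (IsDegree.nonzero dg)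
    ... | inj₂ (d , df) | inj₁ g≃0      = contradiction (at (R.trans e g≃0) d) (IsDegree.nonzero df)
    ... | inj₂ (d , df) | inj₂ (_ , dg) = degree-unique df dg e

    module DegreeSum = PS.Factorisation (λ f → ι (polyDegree f)) ι
      (λ {f} {g} e → cong ι (degree-invariant f g e))
      (trans (cong ι (polyDegree-monic monic-1)) ι-0)
      (λ P t {n} {g} mg _ → trans (cong ι (polyDegree-monic (monic-* (monic-^ (suc t) (isMonic P)) mg)))
        (trans (ι-+ (suc t ℕ.* degree P) n) (sym (cong₂ _+_ (power-ι (degree P) (suc t)) (cong ι (polyDegree-monic mg))))))

  -- The additive instance of the factorisation, the counterpart of log n = ∑ Λ(d) over the divisors
  -- d of n.
  degree-sum : ∀ J {n f} → IsMonic n f → n ℕ.≤ J →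
    ι n ≡ ∑ (primesBetween 0 J) (λ P → ∑ (interval 0 J) (λ i → Sum.when (power∣? P i f) (ι (degree P))))
  degree-sum J mf n≤J = trans (cong ι (sym (polyDegree-monic mf))) (DegreeSum.factorisation J mf n≤J)

  when-nonneg : ∀ {p} {A : Set p} (A? : Dec A) {x} → 0ℚ ≤ x → 0ℚ ≤ Sum.when A? x
  when-nonneg (yes _) h = h
  when-nonneg (no _)  h = ℚ.≤-refl

  first-term : ∀ k (g : ℕ → ℚ) → (∀ i → 0ℚ ≤ g i) → g 1 ≤ ∑ (interval 0 (suc k)) g
  first-term zero    g g≥0 = ≤-+ʳ ℚ.≤-refl
  first-term (suc k) g g≥0 = ℚ.≤-trans (first-term k g g≥0)
    (ℚ.≤-trans (≤-+ʳ (g≥0 (suc (suc k)))) (ℚ.≤-reflexive (ℚ.+-comm _ (g (suc (suc k))))))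

  -- In the degree identity for the monic multiple of h, each prime divisor already contributes its
  -- degree, at least 1, through the term i = 1.
  prime-divisors : ∀ J {d h} → IsDegree h d → d ℕ.≤ suc J →
                   ∑ (primesBetween 0 (suc J)) (λ P → [ divides? (isMonic P) h ]) ≤ ι d
  prime-divisors J {d} {h} dh d≤J with normalise dh
  ... | a , b , ab≈1 , mh′ = ℚ.≤-trans (∑-mono (All.universal pointwise (primesBetween 0 (suc J))))
      (ℚ.≤-reflexive (sym (degree-sum (suc J) mh′ d≤J)))
    where
    term : Prime → ℕ → ℚ
    term P i = Sum.when (power∣? P i (b · h)) (ι (degree P))

    pointwise : ∀ P → [ divides? (isMonic P) h ] ≤ ∑ (interval 0 (suc J)) (term P)
    pointwise P = ℚ.≤-trans (go (divides? (isMonic P) h)) (first-term J (term P)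
        (λ i → when-nonneg (power∣? P i (b · h)) (ι-nonneg (degree P))))
      where
      go : (P? : Dec (poly P ∣ h)) → [ P? ] ≤ term P 1
      go (no _)  = when-nonneg (power∣? P 1 (b · h)) (ι-nonneg (degree P))
      go (yes d) = ℚ.≤-trans (ℚ.≤-reflexive (sym ι-1)) (ℚ.≤-trans (ι-mono (degree-positive P))
        (ℚ.≤-reflexive (sym (Sum.when-yes (power∣? P 1 (b · h))
          (∣-respˡ (R.sym (R.*-identityʳ (poly P))) (∣-respʳ (constant-⊗ b h) (∣-*ˡ (b ∷ []) d)))))))

  divisible-count : ∀ {m D} (mD : IsMonic m D) n → m ℕ.≤ n → ∑ (monics n) (λ f → [ divides? mD f ]) ≡ size n * ρ ^ m
  divisible-count mD n m≤n = trans
    (Sum.⨁-cong (monics n) (λ f → Sum.when-⇔ (divides? mD f) (divides? mD (f ⊕ [])) (∣-respʳ (R.sym (R.+-identityʳ f)))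
        (∣-respʳ (R.+-identityʳ f))))
    (divisible-monics mD [] m≤n)

  when-scale : ∀ {p} {A : Set p} (A? : Dec A) x → Sum.when A? x ≡ x * [ A? ]
  when-scale (yes _) x = sym (ℚ.*-identityʳ x)
  when-scale (no _)  x = sym (ℚ.*-zeroʳ x)

  private
    frequency : ℕ → Prime → ℕ → ℚ
    frequency m P i = Sum.when (i ℕ.* degree P ℕ.≤? m) (ι (degree P) * ρ ^ (i ℕ.* degree P))

    power-count : ∀ m P i → ∑ (monics m) (λ f → Sum.when (power∣? P i f) (ι (degree P))) ≡ size m * frequency m P i
    power-count m P i with i ℕ.* degree P ℕ.≤? m
    ... | yes le = begin
      ∑ (monics m) (λ f → Sum.when (power∣? P i f) (ι (degree P)))
          ≡⟨ Sum.⨁-cong (monics m) (λ f → when-scale (power∣? P i f) (ι (degree P))) ⟩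
      ∑ (monics m) (λ f → ι (degree P) * [ power∣? P i f ])          ≡⟨ ∑-*ˡ (ι (degree P)) (monics m) _ ⟩
      ι (degree P) * ∑ (monics m) (λ f → [ power∣? P i f ])
          ≡⟨ cong (ι (degree P) *_) (divisible-count (monic-^ i (isMonic P)) m le) ⟩
      ι (degree P) * (size m * ρ ^ (i ℕ.* degree P))                 ≡⟨ swap (ι (degree P)) (size m) (ρ ^ (i ℕ.* degree P)) ⟩
      size m * (ι (degree P) * ρ ^ (i ℕ.* degree P))                 ≡⟨ cong (size m *_) (Sum.when-yes (i ℕ.* degree P ℕ.≤? m) le) ⟨
      size m * frequency m P i                                       ∎
      where
      open ≡-Reasoning
      swap : ∀ a b c → a * (b * c) ≡ b * (a * c)
      swap = solve-∀ ℚ-ring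
    ... | no ¬le = trans
      (Sum.⨁-congAll (All.map (λ {f} mf → Sum.when-no (power∣? P i f) (too-big mf)) (monics-monic m)))
      (trans (Sum.⨁-ε (monics m)) (sym (trans (cong (size m *_) (Sum.when-no (i ℕ.* degree P ℕ.≤? m) ¬le)) (ℚ.*-zeroʳ (size m)))))
      where
      too-big : ∀ {f} → IsMonic m f → poly P ^ᵖ i ∤ f
      too-big mf (t Div., e) with monic-quotient (monic-^ i (isMonic P)) mf e
      ... | k , _ , eq = ¬le (ℕ.≤-trans (ℕ.m≤n+m (i ℕ.* degree P) k) (ℕ.≤-reflexive eq))

    -- The degree identity averaged over all monic f of degree m: P^i divides the exact proportion
    -- ρ^(i deg P) of them, or none if its degree exceeds m.
    average-degree : ∀ J m → m ℕ.≤ J → ι m ≡ ∑ (primesBetween 0 J) (λ P → ∑ (interval 0 J) (frequency m P))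
    average-degree J m m≤J = begin
      ι m                                  ≡⟨ trans (sym (ℚ.*-identityˡ (ι m))) (cong (_* ι m) (sym (ρ^*size m))) ⟩
      ρ ^ m * size m * ι m                 ≡⟨ ℚ.*-assoc (ρ ^ m) (size m) (ι m) ⟩
      ρ ^ m * (size m * ι m)               ≡⟨ cong (ρ ^ m *_) total ⟩
      ρ ^ m * (size m * S)                 ≡⟨ ℚ.*-assoc (ρ ^ m) (size m) S ⟨
      ρ ^ m * size m * S                   ≡⟨ trans (cong (_* S) (ρ^*size m)) (ℚ.*-identityˡ S) ⟩
      S                                    ∎
      where
      open ≡-Reasoning
      S = ∑ (primesBetween 0 J) (λ P → ∑ (interval 0 J) (frequency m P))
      total : size m * ι m ≡ size m * S
      total = begin
        size m * ι m
          ≡⟨ trans (cong (_* ι m) (sym (∑-monics-1 m))) (sym (∑-*ʳ (ι m) (monics m) (λ _ → 1ℚ))) ⟩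
        ∑ (monics m) (λ f → 1ℚ * ι m)
          ≡⟨ Sum.⨁-congAll (All.map (λ mf → trans (ℚ.*-identityˡ (ι m)) (degree-sum J mf m≤J)) (monics-monic m)) ⟩
        ∑ (monics m) (λ f → ∑ (primesBetween 0 J) (λ P → ∑ (interval 0 J) (λ i → Sum.when (power∣? P i f) (ι (degree P)))))
          ≡⟨ Sum.⨁-swap (monics m) (primesBetween 0 J) _ ⟩
        ∑ (primesBetween 0 J) (λ P → ∑ (monics m) (λ f → ∑ (interval 0 J) (λ i → Sum.when (power∣? P i f) (ι (degree P)))))
          ≡⟨ Sum.⨁-cong (primesBetween 0 J) (λ P → Sum.⨁-swap (monics m) (interval 0 J) _) ⟩
        ∑ (primesBetween 0 J) (λ P → ∑ (interval 0 J) (λ i → ∑ (monics m) (λ f → Sum.when (power∣? P i f) (ι (degree P)))))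
          ≡⟨ Sum.⨁-cong (primesBetween 0 J) (λ P → Sum.⨁-cong (interval 0 J) (power-count m P)) ⟩
        ∑ (primesBetween 0 J) (λ P → ∑ (interval 0 J) (λ i → size m * frequency m P i))
          ≡⟨ trans (Sum.⨁-cong (primesBetween 0 J) (λ P → ∑-*ˡ (size m) (interval 0 J) (frequency m P)))
              (∑-*ˡ (size m) (primesBetween 0 J) _) ⟩
        size m * S ∎

    exact : ℕ → Prime → ℕ → ℚ
    exact n P i = Sum.when (i ℕ.* degree P ℕ.≟ n) (ι (degree P) * ρ ^ (i ℕ.* degree P))

    -- Raising the degree from n to n + 1 admits only the pairs with i deg P = n + 1; the difference
    -- of consecutive averages isolates these.
    frequency-suc : ∀ n P i → frequency (suc n) P i ≡ frequency n P i + exact (suc n) P i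
    frequency-suc n P i = go (i ℕ.* degree P ℕ.≤? suc n) (i ℕ.* degree P ℕ.≤? n) (i ℕ.* degree P ℕ.≟ suc n)
      where
      x = ι (degree P) * ρ ^ (i ℕ.* degree P)
      go : ∀ {s} (A? : Dec (s ℕ.≤ suc n)) (B? : Dec (s ℕ.≤ n)) (C? : Dec (s ≡ suc n)) →
           Sum.when A? x ≡ Sum.when B? x + Sum.when C? x
      go (yes a) (yes b) (yes refl) = contradiction b (ℕ.<⇒≱ ℕ.≤-refl)
      go (yes a) (yes b) (no ¬c)    = sym (ℚ.+-identityʳ x)
      go (yes a) (no ¬b) (yes c)    = sym (ℚ.+-identityˡ x)
      go (yes a) (no ¬b) (no ¬c)    = contradiction (ℕ.s≤s⁻¹ (ℕ.≤∧≢⇒< a ¬c)) ¬b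
      go (no ¬a) (yes b) C?         = contradiction (ℕ.m≤n⇒m≤1+n b) ¬a
      go (no ¬a) (no ¬b) (yes c)    = contradiction (ℕ.≤-reflexive c) ¬a
      go (no ¬a) (no ¬b) (no ¬c)    = sym (ℚ.+-identityʳ 0ℚ)

    -- The prime polynomial theorem: ∑_{i deg P = n} deg P = q^n.
    prime-polynomial-theorem : ∀ n → 1ℚ ≡ ∑ (primesBetween 0 (suc n)) (λ P → ∑ (interval 0 (suc n)) (exact (suc n) P))
    prime-polynomial-theorem n = begin
      1ℚ                      ≡⟨ cancel (ι n) 1ℚ ⟩
      (1ℚ + ι n) - ι n        ≡⟨ cong (_- ι n) (ι-suc n) ⟨
      ι (suc n) - ι n         ≡⟨ cong₂ _-_ increment (average-degree (suc n) n (ℕ.n≤1+n n)) ⟩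
      (A + E) - A             ≡⟨ cancel′ A E ⟩
      E                       ∎
      where
      open ≡-Reasoning
      A = ∑ (primesBetween 0 (suc n)) (λ P → ∑ (interval 0 (suc n)) (frequency n P))
      E = ∑ (primesBetween 0 (suc n)) (λ P → ∑ (interval 0 (suc n)) (exact (suc n) P))
      cancel : ∀ a b → b ≡ (b + a) - a
      cancel = solve-∀ ℚ-ring
      cancel′ : ∀ a b → (a + b) - a ≡ b
      cancel′ = solve-∀ ℚ-ring
      increment : ι (suc n) ≡ A + E
      increment = begin
        ι (suc n)
          ≡⟨ average-degree (suc n) (suc n) ℕ.≤-refl ⟩
        ∑ (primesBetween 0 (suc n)) (λ P → ∑ (interval 0 (suc n)) (frequency (suc n) P))
          ≡⟨ Sum.⨁-cong (primesBetween 0 (suc n)) (λ P → trans (Sum.⨁-cong (interval 0 (suc n)) (frequency-suc n P))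
              (Sum.⨁-distrib (interval 0 (suc n)) (frequency n P) (exact (suc n) P))) ⟩
        ∑ (primesBetween 0 (suc n)) (λ P → ∑ (interval 0 (suc n)) (frequency n P) + ∑ (interval 0 (suc n)) (exact (suc n) P))
          ≡⟨ Sum.⨁-distrib (primesBetween 0 (suc n)) _ _ ⟩
        A + E ∎

  reciprocals : ℕ → ℚ
  reciprocals d = ∑ (primesOfDegree d) (λ P → ρ ^ degree P)

  -- Bounds the primes of degree d by all q^d monic polynomials. The lost factor d is harmless
  -- wherever powers of Y are absorbed anyway.
  reciprocals-≤1 : ∀ d → reciprocals d ≤ 1ℚ
  reciprocals-≤1 d = begin
    ∑ (primesOfDegree d) (λ P → ρ ^ degree P)     ≡⟨ Sum.⨁-congAll (All.map (λ { refl → sym (ℚ.*-identityˡ _) }) (primesOfDegree-degree d)) ⟩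
    ∑ (primesOfDegree d) (λ P → 1ℚ * ρ ^ d)       ≡⟨ ∑-*ʳ (ρ ^ d) (primesOfDegree d) (λ _ → 1ℚ) ⟩
    ∑ (primesOfDegree d) (λ P → 1ℚ) * ρ ^ d       ≤⟨ *-monoʳ (^-nonneg d ρ≥0) (∑-primesOfDegree-1 d) ⟩
    size d * ρ ^ d                                ≡⟨ trans (ℚ.*-comm (size d) (ρ ^ d)) (ρ^*size d) ⟩
    1ℚ                                            ∎
    where open ℚ.≤-Reasoning

  ∑-reciprocals : ∀ lo k → ∑ (primesBetween lo k) (λ P → ρ ^ degree P) ≤ ι k
  ∑-reciprocals lo k = begin
    ∑ (primesBetween lo k) (λ P → ρ ^ degree P)   ≡⟨ Sum.⨁-concatMap primesOfDegree (interval lo k) _ ⟩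
    ∑ (interval lo k) reciprocals                 ≤⟨ ∑-≤-const (All.universal reciprocals-≤1 (interval lo k)) ⟩
    ι (length (interval lo k)) * 1ℚ               ≡⟨ trans (ℚ.*-identityʳ _) (cong ι (length-interval lo k)) ⟩
    ι k                                           ∎
    where open ℚ.≤-Reasoning

  private
    sqrt-mono : ∀ {x y} → 0ℚ < x → x * x ≤ y * y → 0ℚ ≤ y → x ≤ y
    sqrt-mono {x} {y} x>0 xx≤yy y≥0 with ℚ.≤-total x y
    ... | inj₁ x≤y = x≤y
    ... | inj₂ y≤x = *-cancelˡ x>0 (ℚ.≤-trans xx≤yy (*-monoʳ y≥0 y≤x))

  -- In the prime polynomial theorem for N = n + 1 the terms i = 1 form the main part. All others
  -- come from P of degree d with 2 d ≤ N, hence ρ^(N-d) ≤ β, where β is a rational upper bound for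
  -- the square root of ρ^N. The cube collects N values of i, deg P ≤ N, and a sum of reciprocals
  -- that is at most N.
  reciprocals-lower : ∀ n {β} → 0ℚ ≤ β → ρ ^ suc n ≤ β * β →
                      1ℚ ≤ ι (suc n) * reciprocals (suc n) + ι (suc n) ^ 3 * β
  reciprocals-lower n {β} β≥0 small = begin
    1ℚ
      ≡⟨ prime-polynomial-theorem n ⟩
    ∑ (primesOfDegree N ++ primesBetween 0 n) inner
      ≡⟨ Sum.⨁-++ (primesOfDegree N) (primesBetween 0 n) inner ⟩
    ∑ (primesOfDegree N) inner + ∑ (primesBetween 0 n) inner
      ≤⟨ ℚ.+-mono-≤ (ℚ.≤-reflexive main) rest ⟩
    ι N * reciprocals N + ι N ^ 3 * β ∎
    where
    open ℚ.≤-Reasoning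
    N = suc n
    inner : Prime → ℚ
    inner P = ∑ (interval 0 N) (exact N P)

    main : ∑ (primesOfDegree N) inner ≡ ι N * reciprocals N
    main = trans (Sum.⨁-congAll (All.map (λ {P} → single {P}) (primesOfDegree-degree N))) (∑-*ˡ (ι N) (primesOfDegree N) (λ P → ρ ^ degree P))
      where
      single : ∀ {P} → degree P ≡ N → inner P ≡ ι N * ρ ^ degree P
      single {P} refl = trans
        (Sum.⨁-congAll (All.map same (interval-bounds 0 N)))
        (trans (PS.interval-≤ N 1 (ι N * ρ ^ N) (s≤s z≤n)) (ℚ.+-identityʳ _))
        where
        same : ∀ {i} → 0 ℕ.< i × i ℕ.≤ N → exact N P i ≡ Sum.when (i ℕ.≤? 1) (ι N * ρ ^ N)
        same {i} (0<i , _) with ℕ.m≤n⇒m<n∨m≡n 0<i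
        ... | inj₂ refl = trans (Sum.when-yes (1 ℕ.* N ℕ.≟ N) (ℕ.*-identityˡ N)) (cong (λ j → ι N * ρ ^ j) (ℕ.*-identityˡ N))
        ... | inj₁ 1<i  = trans
                (Sum.when-no (i ℕ.* N ℕ.≟ N) (λ e → ℕ.<⇒≱ 1<i (ℕ.≤-reflexive (ℕ.*-cancelʳ-≡ i 1 N (trans e (sym (ℕ.*-identityˡ N)))))))
                (sym (Sum.when-no (i ℕ.≤? 1) (ℕ.<⇒≱ 1<i)))

    rest : ∑ (primesBetween 0 n) inner ≤ ι N ^ 3 * β
    rest = begin
      ∑ (primesBetween 0 n) inner
        ≤⟨ ∑-mono (All.map (λ {P} (_ , P≤n) → bound P P≤n) (primesBetween-bounds 0 n)) ⟩
      ∑ (primesBetween 0 n) (λ P → ι N * (ι N * β) * ρ ^ degree P)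
        ≡⟨ ∑-*ˡ (ι N * (ι N * β)) (primesBetween 0 n) (λ P → ρ ^ degree P) ⟩
      ι N * (ι N * β) * ∑ (primesBetween 0 n) (λ P → ρ ^ degree P)
        ≤⟨ *-monoˡ (*-nonneg (ι-nonneg N) (*-nonneg (ι-nonneg N) β≥0)) (ℚ.≤-trans (∑-reciprocals 0 n) (ι-mono (ℕ.n≤1+n n))) ⟩
      ι N * (ι N * β) * ι N
        ≡⟨ cube (ι N) β ⟩
      ι N ^ 3 * β ∎
      where
      cube : ∀ a b → a * (a * b) * a ≡ (a * (a * (a * 1ℚ))) * b
      cube = solve-∀ ℚ-ring
      bound : ∀ P → degree P ℕ.≤ n → inner P ≤ ι N * (ι N * β) * ρ ^ degree P
      bound P P≤n = ℚ.≤-trans (∑-≤-const (All.map (λ {i} _ → each i) (interval-bounds 0 N)))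
        (ℚ.≤-reflexive (trans (cong (λ l → ι l * (ι N * (β * ρ ^ d))) (length-interval 0 N)) (reorder (ι N) (ι N) β (ρ ^ d))))
        where
        d = degree P
        reorder : ∀ a a′ b r → a * (a′ * (b * r)) ≡ a * (a′ * b) * r
        reorder = solve-∀ ℚ-ring
        -- If i d = n with d < n, then 2 d ≤ n.
        each : ∀ i → exact N P i ≤ ι N * (β * ρ ^ d)
        each i with i ℕ.* d ℕ.≟ N
        ... | no ne = ℚ.≤-trans (ℚ.≤-reflexive (Sum.when-no (i ℕ.* d ℕ.≟ N) ne))
            (*-nonneg (ι-nonneg N) (*-nonneg β≥0 (^-nonneg d ρ≥0)))
        ... | yes e = begin
          exact N P i                       ≡⟨ Sum.when-yes (i ℕ.* d ℕ.≟ N) e ⟩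
          ι d * ρ ^ (i ℕ.* d)               ≤⟨ *-mono (ι-nonneg d) (ι-mono (ℕ.m≤n⇒m≤1+n P≤n)) (^-nonneg (i ℕ.* d) ρ≥0) power-bound ⟩
          ι N * (β * ρ ^ d)                 ∎
          where
          twice : ∀ i → i ℕ.* d ≡ N → d ℕ.+ d ℕ.≤ N
          twice zero          ()
          twice (suc zero)    e = contradiction (subst (ℕ._≤ n) (trans (sym (ℕ.+-identityʳ d)) e) P≤n) (ℕ.<⇒≱ ℕ.≤-refl)
          twice (suc (suc i)) e = ℕ.≤-trans (ℕ.+-monoʳ-≤ d (ℕ.m≤m+n d (i ℕ.* d))) (ℕ.≤-reflexive e)
          d≤N : d ℕ.≤ N
          d≤N = ℕ.m≤n⇒m≤1+n P≤n
          g = N ℕ.∸ d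
          N≤g+g : N ℕ.≤ g ℕ.+ g
          N≤g+g = ℕ.≤-trans (ℕ.≤-reflexive (sym (ℕ.m∸n+n≡m d≤N)))
            (ℕ.+-monoʳ-≤ g (ℕ.≤-trans (ℕ.≤-reflexive (sym (ℕ.m+n∸n≡m d d))) (ℕ.∸-monoˡ-≤ d (twice i e))))
          gap : ρ ^ g ≤ β
          gap = sqrt-mono (^-pos g ρ>0) (ℚ.≤-trans (ℚ.≤-reflexive (sym (^-homo ρ g g)))
              (ℚ.≤-trans (^-antimono ρ≥0 ρ≤1 N≤g+g) small)) β≥0
          power-bound : ρ ^ (i ℕ.* d) ≤ β * ρ ^ d
          power-bound = ℚ.≤-trans (ℚ.≤-reflexive (trans (cong (ρ ^_) (trans e (sym (ℕ.m∸n+n≡m d≤N)))) (^-homo ρ g d)))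
              (*-monoʳ (^-nonneg d ρ≥0) gap)

  ∏-≥1+∑ : ∀ {b} {B : Set b} (xs : List B) {f : B → ℚ} → (∀ x → 0ℚ ≤ f x) → 1ℚ + ∑ xs f ≤ ∏ xs (λ x → 1ℚ + f x)
  ∏-≥1+∑ []               f≥0 = ℚ.≤-reflexive (ℚ.+-identityʳ 1ℚ)
  ∏-≥1+∑ (x ∷ xs) {f = f} f≥0 = begin
    1ℚ + (f x + ∑ xs f)                     ≤⟨ +-nonneg-≤ (f x * ∑ xs f) (*-nonneg (f≥0 x) (∑-nonneg xs f≥0))
        (identity (f x) (∑ xs f)) ⟩
    (1ℚ + f x) * (1ℚ + ∑ xs f)              ≤⟨ *-monoˡ (+-nonneg 0≤1 (f≥0 x)) (∏-≥1+∑ xs f≥0) ⟩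
    (1ℚ + f x) * ∏ xs (λ y → 1ℚ + f y)      ∎
    where
    open ℚ.≤-Reasoning
    identity : ∀ a s → 1ℚ + (a + s) + a * s ≡ (1ℚ + a) * (1ℚ + s)
    identity = solve-∀ ℚ-ring

  eulerProduct : ℕ → ℕ → ℚ
  eulerProduct z k = ∏ (primesBetween z k) (λ P → 1ℚ + ρ ^ degree P)

  -- Degree d contributes at least 1 + (1 - ε)/d ≥ (1 - ε)(d + 1)/d, and the quotients (d + 1)/d
  -- telescope to (z + k + 1)/(z + 1). Thus Mertens' theorem needs no logarithm here.
  eulerProduct-lower : ∀ z k {β ε} → 0ℚ ≤ β → ρ ^ suc z ≤ β * β → 0ℚ ≤ ε → ε ≤ 1ℚ → ι (z ℕ.+ k) ^ 3 * β ≤ ε →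
                       ι (z ℕ.+ suc k) * (1ℚ - ε) ^ k ≤ ι (suc z) * eulerProduct z k
  eulerProduct-lower z zero    β≥0 small ε≥0 ε≤1 h =
    ℚ.≤-reflexive (cong (λ j → ι j * 1ℚ) (trans (ℕ.+-suc z 0) (cong suc (ℕ.+-identityʳ z))))
  eulerProduct-lower z (suc k) {β} {ε} β≥0 small ε≥0 ε≤1 h = begin
    ι (z ℕ.+ suc (suc k)) * ((1ℚ - ε) * (1ℚ - ε) ^ k)
      ≡⟨ trans (cong (λ j → ι j * ((1ℚ - ε) * (1ℚ - ε) ^ k)) (ℕ.+-suc z (suc k))) (cong (_* ((1ℚ - ε) * (1ℚ - ε) ^ k)) (ι-suc d)) ⟩
    (1ℚ + ι d) * ((1ℚ - ε) * E)
      ≤⟨ +-nonneg-≤ (ι d * ε * E) (*-nonneg (*-nonneg (ι-nonneg d) ε≥0) E≥0) (identity (ι d) ε E) ⟩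
    ((1ℚ - ε) + ι d) * E
      ≤⟨ *-monoʳ E≥0 (ℚ.+-monoˡ-≤ (ι d) local) ⟩
    (ι d * reciprocals d + ι d) * E
      ≡⟨ identity′ (ι d) (reciprocals d) E ⟩
    (1ℚ + reciprocals d) * (ι d * E)
      ≤⟨ *-mono (+-nonneg 0≤1 rec≥0) (∏-≥1+∑ (primesOfDegree d) (λ P → ^-nonneg (degree P) ρ≥0))
           (*-nonneg (ι-nonneg d) E≥0) (eulerProduct-lower z k β≥0 small ε≥0 ε≤1
               (ℚ.≤-trans (*-monoʳ β≥0 (^-mono 3 (ι-nonneg (z ℕ.+ k)) (ι-mono (ℕ.+-monoʳ-≤ z (ℕ.n≤1+n k))))) h)) ⟩
    ∏ (primesOfDegree d) (λ P → 1ℚ + ρ ^ degree P) * (ι (suc z) * eulerProduct z k)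
      ≡⟨ identity″ (∏ (primesOfDegree d) (λ P → 1ℚ + ρ ^ degree P)) (ι (suc z)) (eulerProduct z k) ⟩
    ι (suc z) * (∏ (primesOfDegree d) (λ P → 1ℚ + ρ ^ degree P) * eulerProduct z k)
      ≡⟨ cong (ι (suc z) *_) (Product.⨁-++ (primesOfDegree d) (primesBetween z k) _) ⟨
    ι (suc z) * eulerProduct z (suc k) ∎
    where
    open ℚ.≤-Reasoning
    d = z ℕ.+ suc k
    E = (1ℚ - ε) ^ k
    E≥0 : 0ℚ ≤ E
    E≥0 = ^-nonneg k (≤⇒0≤- ε≤1)
    rec≥0 : 0ℚ ≤ reciprocals d
    rec≥0 = ∑-nonneg (primesOfDegree d) (λ P → ^-nonneg (degree P) ρ≥0)
    identity : ∀ d e E → (1ℚ + d) * ((1ℚ - e) * E) + d * e * E ≡ ((1ℚ - e) + d) * E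
    identity = solve-∀ ℚ-ring
    identity′ : ∀ d r E → (d * r + d) * E ≡ (1ℚ + r) * (d * E)
    identity′ = solve-∀ ℚ-ring
    identity″ : ∀ a b c → a * (b * c) ≡ b * (a * c)
    identity″ = solve-∀ ℚ-ring
    cancel : ∀ a b → a + b - b ≡ a
    cancel = solve-∀ ℚ-ring
    local : 1ℚ - ε ≤ ι d * reciprocals d
    local = ℚ.≤-trans (ℚ.+-mono-≤ lower (ℚ.neg-antimono-≤ h)) (ℚ.≤-reflexive (cancel (ι d * reciprocals d) (ι d ^ 3 * β)))
      where
      lower : 1ℚ ≤ ι d * reciprocals d + ι d ^ 3 * β
      lower = subst (λ j → 1ℚ ≤ ι j * reciprocals j + ι j ^ 3 * β) (sym (ℕ.+-suc z k))
        (reciprocals-lower (z ℕ.+ k) β≥0 (ℚ.≤-trans (^-antimono ρ≥0 ρ≤1 (s≤s (ℕ.m≤m+n z k))) small))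

  -- Bernoulli gives 1 - 4 x ≤ (1 - x)^4, and (1 - x)(1 + x) ≤ 1. It converts the lower bound for
  -- the Euler product into an upper bound for the sieve product.
  1-4x-bound : ∀ x → 0ℚ ≤ x → x ≤ 1ℚ → (1ℚ - 2ℚ * (2ℚ * x)) * (1ℚ + x) ^ 4 ≤ 1ℚ
  1-4x-bound x x≥0 x≤1 = begin
    (1ℚ - 2ℚ * (2ℚ * x)) * (1ℚ + x) ^ 4   ≡⟨ cong (λ y → (1ℚ - y) * (1ℚ + x) ^ 4) four ⟩
    (1ℚ - ι 4 * x) * (1ℚ + x) ^ 4         ≤⟨ *-monoʳ (^-nonneg 4 (+-nonneg 0≤1 x≥0)) (bernoulli-neg 4 x≤1) ⟩
    (1ℚ - x) ^ 4 * (1ℚ + x) ^ 4           ≡⟨ ^-distrib (1ℚ - x) (1ℚ + x) 4 ⟨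
    ((1ℚ - x) * (1ℚ + x)) ^ 4             ≤⟨ ^-≤1 4 (*-nonneg (≤⇒0≤- x≤1) (+-nonneg 0≤1 x≥0))
        (+-nonneg-≤ (x * x) (*-nonneg x≥0 x≥0) (identity x)) ⟩
    1ℚ                                    ∎
    where
    open ℚ.≤-Reasoning
    identity : ∀ x → (1ℚ - x) * (1ℚ + x) + x * x ≡ 1ℚ
    identity = solve-∀ ℚ-ring
    four : 2ℚ * (2ℚ * x) ≡ ι 4 * x
    four = trans (sym (ℚ.*-assoc 2ℚ 2ℚ x)) (cong (_* x) (trans (cong₂ _*_ (sym ι-2) (sym ι-2)) (sym (ι-* 2 2))))

  sieveProduct-bound : ∀ {L : List Prime} → All (λ P → 0ℚ ≤ 1ℚ - 2ℚ * weight P) L →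
    ∏ L (λ P → 1ℚ - 2ℚ * weight P) * ∏ L (λ P → 1ℚ + ρ ^ degree P) ^ 4 ≤ 1ℚ
  sieveProduct-bound [] = ℚ.≤-reflexive (trans (ℚ.*-identityˡ (1ℚ ^ 4)) (1^ 4))
  sieveProduct-bound {P ∷ L} (h ∷ hs) = begin
    (a * A) * (b * B) ^ 4            ≡⟨ cong (a * A *_) (^-distrib b B 4) ⟩
    (a * A) * (b ^ 4 * B ^ 4)        ≡⟨ identity a A (b ^ 4) (B ^ 4) ⟩
    (a * b ^ 4) * (A * B ^ 4)        ≤⟨ *-≤1 (*-nonneg h (^-nonneg 4 (+-nonneg 0≤1 (^-nonneg (degree P) ρ≥0))))
                                          (1-4x-bound (ρ ^ degree P) (^-nonneg (degree P) ρ≥0)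
                                              (^-≤1 (degree P) ρ≥0 ρ≤1)) (sieveProduct-bound hs) ⟩
    1ℚ                               ∎
    where
    open ℚ.≤-Reasoning
    a = 1ℚ - 2ℚ * weight P
    b = 1ℚ + ρ ^ degree P
    A = ∏ L (λ P → 1ℚ - 2ℚ * weight P)
    B = ∏ L (λ P → 1ℚ + ρ ^ degree P)
    identity : ∀ a A b B → (a * A) * (b * B) ≡ (a * b) * (A * B)
    identity = solve-∀ ℚ-ring

  -- The assumption 2 (k + 1) ε ≤ 1 keeps (1 - ε)^k at least 1/2, which is the factor 2 beside z +
  -- 1.
  mertens : ∀ z k {β ε} → 0ℚ ≤ β → ρ ^ suc z ≤ β * β → 0ℚ ≤ ε → ι (z ℕ.+ k) ^ 3 * β ≤ ε → 2ℚ * (ι (suc k) * ε) ≤ 1ℚ →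
            All (λ P → 0ℚ ≤ 1ℚ - 2ℚ * weight P) (primesBetween z k) →
            ∏ (primesBetween z k) (λ P → 1ℚ - 2ℚ * weight P) * ι (z ℕ.+ suc k) ^ 4 ≤ (2ℚ * ι (suc z)) ^ 4
  mertens z k {β} {ε} β≥0 small ε≥0 h kε≤1 pos = begin
    W * ι (z ℕ.+ suc k) ^ 4                   ≤⟨ *-monoˡ (∏-nonneg pos) (^-mono 4 (ι-nonneg (z ℕ.+ suc k)) lower) ⟩
    W * ((2ℚ * ι (suc z)) * V) ^ 4            ≡⟨ cong (W *_) (^-distrib (2ℚ * ι (suc z)) V 4) ⟩
    W * ((2ℚ * ι (suc z)) ^ 4 * V ^ 4)        ≡⟨ swap W ((2ℚ * ι (suc z)) ^ 4) (V ^ 4) ⟩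
    (2ℚ * ι (suc z)) ^ 4 * (W * V ^ 4)        ≤⟨ *-≤ʳ (^-nonneg 4 (*-nonneg 0≤2 (ι-nonneg (suc z)))) (sieveProduct-bound pos) ⟩
    (2ℚ * ι (suc z)) ^ 4                      ∎
    where
    open ℚ.≤-Reasoning
    W = ∏ (primesBetween z k) (λ P → 1ℚ - 2ℚ * weight P)
    V = eulerProduct z k
    N = ι (z ℕ.+ suc k)
    swap : ∀ a b c → a * (b * c) ≡ b * (a * c)
    swap = solve-∀ ℚ-ring
    half : 1ℚ ≤ 2ℚ * (1ℚ - ι k * ε)
    half = begin
      1ℚ                                ≡⟨ identity 1ℚ ⟩
      2ℚ - 1ℚ                           ≤⟨ ℚ.+-monoʳ-≤ 2ℚ (ℚ.neg-antimono-≤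
          (ℚ.≤-trans (*-monoˡ 0≤2 (*-monoʳ ε≥0 (ι-mono (ℕ.n≤1+n k)))) kε≤1)) ⟩
      2ℚ - 2ℚ * (ι k * ε)               ≡⟨ identity′ (ι k * ε) ⟩
      2ℚ * (1ℚ - ι k * ε)               ∎
      where
      identity : ∀ (x : ℚ) → 1ℚ ≡ 2ℚ - 1ℚ
      identity = solve-∀ ℚ-ring
      identity′ : ∀ a → 2ℚ - 2ℚ * a ≡ 2ℚ * (1ℚ - a)
      identity′ = solve-∀ ℚ-ring
    ε≤1 : ε ≤ 1ℚ
    ε≤1 = begin
      ε                          ≡⟨ trans (sym (ℚ.*-identityˡ ε)) (cong (_* ε) (sym ι-1)) ⟩
      ι 1 * ε                    ≤⟨ *-monoʳ ε≥0 (ι-mono {1} {suc k} (s≤s z≤n)) ⟩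
      ι (suc k) * ε              ≤⟨ ≤-+ʳ (*-nonneg (ι-nonneg (suc k)) ε≥0) ⟩
      ι (suc k) * ε + ι (suc k) * ε ≡⟨ double (ι (suc k) * ε) ⟩
      2ℚ * (ι (suc k) * ε)       ≤⟨ kε≤1 ⟩
      1ℚ                         ∎
      where
      double : ∀ a → a + a ≡ 2ℚ * a
      double = solve-∀ ℚ-ring
    lower : N ≤ (2ℚ * ι (suc z)) * V
    lower = begin
      N                                ≡⟨ ℚ.*-identityʳ N ⟨
      N * 1ℚ                           ≤⟨ *-monoˡ (ι-nonneg (z ℕ.+ suc k)) (ℚ.≤-trans half (*-monoˡ 0≤2 (bernoulli-neg k ε≤1))) ⟩
      N * (2ℚ * (1ℚ - ε) ^ k)          ≡⟨ swap N 2ℚ ((1ℚ - ε) ^ k) ⟩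
      2ℚ * (N * (1ℚ - ε) ^ k)          ≤⟨ *-monoˡ 0≤2 (eulerProduct-lower z k β≥0 small ε≥0 ε≤1 h) ⟩
      2ℚ * (ι (suc z) * V)             ≡⟨ ℚ.*-assoc 2ℚ (ι (suc z)) V ⟨
      (2ℚ * ι (suc z)) * V             ∎

module Correlation {c ℓ : Level} (F : FiniteField c ℓ) where
  open PrimeDensity F public
  open import Data.Rational.Base using (_+_; _*_; _-_; -_; _≤_; _<_; ∣_∣)
  open RationalOrder
  open RationalSums
  open TruncatedProducts
  private
    module PP = PrimeSums ℚ._*_ 1ℚ ℚ.*-1-isCommutativeMonoid

  -- The local factor of λ_y at P, with the exponent of P in f cut off at k.
  χ : ℕ → Poly → Prime → ℚ
  χ k f P = ∏ (interval 0 k) (λ i → Product.when (power∣? P i f) (- 1ℚ))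

  private
    ∣sign∣ : ∀ {p} {A : Set p} (A? : Dec A) → ∣ Product.when A? (- 1ℚ) ∣ ≤ 1ℚ
    ∣sign∣ (yes _) = ℚ.≤-refl
    ∣sign∣ (no _)  = ℚ.≤-refl

  ∣χ∣≤1 : ∀ k f P → ∣ χ k f P ∣ ≤ 1ℚ
  ∣χ∣≤1 k f P = ∣∏∣-≤1 (interval 0 k) (λ i → ∣sign∣ (power∣? P i f))

  χ-stable : ∀ κ j f P → poly P ^ᵖ suc κ ∤ f → χ (κ ℕ.+ j) f P ≡ χ κ f P
  χ-stable κ zero    f P ∤f = cong (λ k → χ k f P) (ℕ.+-identityʳ κ)
  χ-stable κ (suc j) f P ∤f = begin
    χ (κ ℕ.+ suc j) f P                                                  ≡⟨ cong (λ k → χ k f P) (ℕ.+-suc κ j) ⟩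
    Product.when (power∣? P (suc (κ ℕ.+ j)) f) (- 1ℚ) * χ (κ ℕ.+ j) f P
        ≡⟨ cong₂ _*_ (Product.when-no (power∣? P (suc (κ ℕ.+ j)) f)
            (λ d → ∤f (∣-trans (^ᵖ-∣ (poly P) (s≤s (ℕ.m≤m+n κ j))) d))) (χ-stable κ j f P ∤f) ⟩
    1ℚ * χ κ f P                                                         ≡⟨ ℚ.*-identityˡ (χ κ f P) ⟩
    χ κ f P                                                              ∎
    where open ≡-Reasoning

  χ-error : ∀ {κ J} f P → κ ℕ.≤ J → ∣ χ J f P - χ κ f P ∣ ≤ 2ℚ * [ power∣? P (suc κ) f ]
  χ-error {κ} {J} f P κ≤J = go (power∣? P (suc κ) f)
    where
    go : (A? : Dec (poly P ^ᵖ suc κ ∣ f)) → ∣ χ J f P - χ κ f P ∣ ≤ 2ℚ * [ A? ]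
    go (yes _) = ℚ.≤-trans (ℚ.∣p-q∣≤∣p∣+∣q∣ (χ J f P) (χ κ f P)) (ℚ.+-mono-≤ (∣χ∣≤1 J f P) (∣χ∣≤1 κ f P))
    go (no ∤f) = ℚ.≤-reflexive (cong ∣_∣ (trans
      (cong (_- χ κ f P) (trans (cong (λ k → χ k f P) (sym (ℕ.m+[n∸m]≡n κ≤J))) (χ-stable κ (J ℕ.∸ κ) f P ∤f)))
      (ℚ.+-inverseʳ (χ κ f P))))

  χ-resp : ∀ k P {a x b} → poly P ^ᵖ k ∣ x → a ≃ x ⊕ b → χ k a P ≡ χ k b P
  χ-resp k P {a} {x} {b} d e = Product.⨁-congAll (All.map (λ {i} (_ , i≤k) → Product.when-⇔ (power∣? P i a) (power∣? P i b)
    (λ d′ → ∣-+-cancel (∣-respʳ e d′) (∣-trans (^ᵖ-∣ (poly P) i≤k) d))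
    (λ d′ → ∣-respʳ (R.sym e) (∣-+ (∣-trans (^ᵖ-∣ (poly P) i≤k) d) d′))) (interval-bounds 0 k))

  modulus : ℕ → List Prime → Poly
  modulus k []      = 1ₚ
  modulus k (P ∷ L) = poly P ^ᵖ k ⊗ modulus k L

  modulusDegree : ℕ → List Prime → ℕ
  modulusDegree k []      = 0
  modulusDegree k (P ∷ L) = k ℕ.* degree P ℕ.+ modulusDegree k L

  modulus-monic : ∀ k L → IsMonic (modulusDegree k L) (modulus k L)
  modulus-monic k []      = monic-1
  modulus-monic k (P ∷ L) = monic-* (monic-^ k (isMonic P)) (modulus-monic k L)

  modulus-∣ : ∀ k L → All (λ P → poly P ^ᵖ k ∣ modulus k L) L
  modulus-∣ k []      = []
  modulus-∣ k (P ∷ L) = ∣-*ʳ (modulus k L) ∣-refl ∷ All.map (∣-*ˡ (poly P ^ᵖ k)) (modulus-∣ k L)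

  modulus-comaximal : ∀ k {Q} {L : List Prime} → All (λ P → Comaximal Q (poly P)) L → Comaximal Q (modulus k L)
  modulus-comaximal k []       = comaximal-1
  modulus-comaximal k (h ∷ hs) = comaximal-* (comaximal-^ k h) (modulus-comaximal k hs)

  modulusDegree-bound : ∀ k {z} {L : List Prime} → All (λ P → degree P ℕ.≤ z) L → modulusDegree k L ℕ.≤ length L ℕ.* (k ℕ.* z)
  modulusDegree-bound k []       = z≤n
  modulusDegree-bound k (h ∷ hs) = ℕ.+-mono-≤ (ℕ.*-monoʳ-≤ k h) (modulusDegree-bound k hs)

  ^ₚ-≃ : ∀ f s → f ^ₚ s ≃ f ^ᵖ s
  ^ₚ-≃ f zero    = ≃-refl
  ^ₚ-≃ f (suc s) = R.trans (R.reflexive (sym (⊗-def f (f ^ₚ s)))) (R.*-congˡ (^ₚ-≃ f s))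

  -- A natural number Y stands for y here, so that the comparison of a degree with the threshold is
  -- decidable.
  module Truncated (Y : ℕ) (lam : Poly → ℤ)
    (lam-cong : ∀ {f g} → f ≋ g → lam f ≡ lam g)
    (lam-unit : lam 1ₚ ≡ 1ℤ)
    (lam-multiplicative : ∀ {f g} → Monic f → Monic g → Coprime f g → lam (f *ₚ g) ≡ lam f ℤ.* lam g)
    (lam-small : ∀ {P d} t → MonicOfDegree d P → Irreducible P → 1 ℕ.≤ t → d ℕ.≤ Y → lam (P ^ₚ t) ≡ -1ℤ ℤ.^ t)
    (lam-large : ∀ {P d} t → MonicOfDegree d P → Irreducible P → 1 ℕ.≤ t → Y ℕ.< d → lam (P ^ₚ t) ≡ 1ℤ)
    where

    μ : Poly → ℚ
    μ f = fromℤ (lam f)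

    private
      w : ℕ → ℚ
      w d = Product.when (d ℕ.≤? Y) (- 1ℚ)

      power-sign : ∀ s → fromℤ (-1ℤ ℤ.^ s) ≡ PP.power (- 1ℚ) s
      power-sign zero    = fromℤ-1
      power-sign (suc s) = trans (fromℤ-* -1ℤ (-1ℤ ℤ.^ s)) (cong₂ _*_ (trans (fromℤ-neg 1ℤ) (cong -_ fromℤ-1)) (power-sign s))

      power-1 : ∀ s → PP.power 1ℚ s ≡ 1ℚ
      power-1 zero    = refl
      power-1 (suc s) = trans (ℚ.*-identityˡ _) (power-1 s)

      μ-power : ∀ P t → μ (poly P ^ᵖ suc t) ≡ PP.power (w (degree P)) (suc t)
      μ-power P t = trans (cong fromℤ (lam-cong (at (R.sym (^ₚ-≃ (poly P) (suc t)))))) (go (degree P ℕ.≤? Y))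
        where
        go : Dec (degree P ℕ.≤ Y) → μ (poly P ^ₚ suc t) ≡ PP.power (w (degree P)) (suc t)
        go (yes le) = trans (cong fromℤ (lam-small (suc t) (fromMonic (isMonic P)) (isIrreducible P) (s≤s z≤n) le))
          (trans (power-sign (suc t)) (cong (λ x → PP.power x (suc t)) (sym (Product.when-yes (degree P ℕ.≤? Y) le))))
        go (no ¬le) = trans (cong fromℤ (lam-large (suc t) (fromMonic (isMonic P)) (isIrreducible P) (s≤s z≤n) (ℕ.≰⇒> ¬le)))
          (trans fromℤ-1 (trans (sym (power-1 (suc t))) (cong (λ x → PP.power x (suc t))
              (sym (Product.when-no (degree P ℕ.≤? Y) ¬le)))))

      μ-split : ∀ P t {n g} → IsMonic n g → poly P ∤ g → μ (poly P ^ᵖ suc t ⊗ g) ≡ PP.power (w (degree P)) (suc t) * μ g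
      μ-split P t {n} {g} mg P∤g = trans
        (cong fromℤ (trans (cong lam (⊗-def (poly P ^ᵖ suc t) g))
          (lam-multiplicative (_ , fromMonic (monic-^ (suc t) (isMonic P))) (_ , fromMonic mg)
            (comaximal⇒coprime (comaximal-sym (comaximal-^ (suc t)
                (comaximal-sym (irreducible-comaximal (isMonic P) (isIrreducible P) P∤g))))))))
        (trans (fromℤ-* (lam (poly P ^ᵖ suc t)) (lam g)) (cong (_* μ g) (μ-power P t)))

      module Factor = PP.Factorisation μ w (λ e → cong fromℤ (lam-cong (at e))) (trans (cong fromℤ lam-unit) fromℤ-1) μ-split

    -- The cut-off n loses nothing, as a power of P dividing f has exponent at most n; primes of
    -- degree above Y contribute the factor 1.
    μ-product : ∀ {n f} → IsMonic n f → Y ℕ.≤ n → μ f ≡ ∏ (primesBetween 0 Y) (χ n f)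
    μ-product {n} {f} mf Y≤n = begin
      μ f
        ≡⟨ Factor.factorisation n mf ℕ.≤-refl ⟩
      ∏ (primesBetween 0 n) (Factor.local n f)
        ≡⟨ cong (λ L → ∏ L (Factor.local n f)) (trans (cong (primesBetween 0) (sym (ℕ.m+[n∸m]≡n Y≤n))) (primesBetween-+ Y (n ℕ.∸ Y))) ⟩
      ∏ (primesBetween Y (n ℕ.∸ Y) ++ primesBetween 0 Y) (Factor.local n f)
        ≡⟨ Product.⨁-++ (primesBetween Y (n ℕ.∸ Y)) (primesBetween 0 Y) (Factor.local n f) ⟩
      ∏ (primesBetween Y (n ℕ.∸ Y)) (Factor.local n f) * ∏ (primesBetween 0 Y) (Factor.local n f)
        ≡⟨ cong₂ _*_ (trans (Product.⨁-congAll (All.map (λ {P} (l , _) → large P l) (primesBetween-bounds Y (n ℕ.∸ Y)))) (Product.⨁-ε (primesBetween Y (n ℕ.∸ Y))))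
             (Product.⨁-congAll (All.map (λ {P} (_ , u) → cong (λ x → ∏ (interval 0 n) (λ i → Product.when (power∣? P i f) x)) (Product.when-yes (degree P ℕ.≤? Y) u)) (primesBetween-bounds 0 Y))) ⟩
      1ℚ * ∏ (primesBetween 0 Y) (χ n f)
        ≡⟨ ℚ.*-identityˡ _ ⟩
      ∏ (primesBetween 0 Y) (χ n f) ∎
      where
      open ≡-Reasoning
      when-1 : ∀ {p} {A : Set p} (A? : Dec A) → Product.when A? 1ℚ ≡ 1ℚ
      when-1 (yes _) = refl
      when-1 (no _)  = refl
      large : ∀ P → Y ℕ.< degree P → Factor.local n f P ≡ 1ℚ
      large P Y<P = trans
        (Product.⨁-cong (interval 0 n) (λ i → trans (cong (Product.when (power∣? P i f))
            (Product.when-no (degree P ℕ.≤? Y) (ℕ.<⇒≱ Y<P))) (when-1 (power∣? P i f))))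
        (Product.⨁-ε (interval 0 n))

    ∣μ∣≤1 : ∀ {n f} → IsMonic n f → ∣ μ f ∣ ≤ 1ℚ
    ∣μ∣≤1 {n} {f} mf = subst (λ x → ∣ x ∣ ≤ 1ℚ) (sym (Factor.factorisation n mf ℕ.≤-refl))
      (∣∏∣-≤1 (primesBetween 0 n) (λ P → ∣∏∣-≤1 (interval 0 n) (λ i → go (power∣? P i f) (degree P ℕ.≤? Y))))
      where
      go : ∀ {p r} {A : Set p} {B : Set r} (A? : Dec A) (B? : Dec B) → ∣ Product.when A? (Product.when B? (- 1ℚ)) ∣ ≤ 1ℚ
      go (yes _) B? = ∣sign∣ B?
      go (no _)  _  = ℚ.≤-refl

  -- The primes of degree up to z, which carry no cancellation, are frozen modulo M; the primes of
  -- degree z + 1, …, z + k are sieved.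
  module Split (z k : ℕ) (h : Poly) (d : ℕ) (dh : IsDegree h d) (n : ℕ) where
    open Shifted h n

    divides-h? : ∀ P → Dec (poly P ∣ h)
    divides-h? P = divides? (isMonic P) h

    sieved : List Prime
    sieved = filter (λ P → ¬? (divides-h? P)) (primesBetween z k)

    M : Poly
    M = modulus (suc z) (primesBetween 0 z)

    degM : ℕ
    degM = modulusDegree (suc z) (primesBetween 0 z)

    private
      depthFor : ∀ {p r} {A : Set p} {B : Set r} → Dec A → Dec B → ℕ
      depthFor (yes _) _       = suc z
      depthFor (no _)  (yes _) = 0
      depthFor (no _)  (no _)  = 1

    -- The exponent beyond which powers of P are ignored. A small prime keeps z + 1, a large one
    -- keeps 1, and a large prime dividing h keeps 0, so that its factor becomes 1 and it drops out
    -- of the sieve.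
    depth : Prime → ℕ
    depth P = depthFor (degree P ℕ.≤? z) (divides-h? P)

    depth-low : ∀ P → degree P ℕ.≤ z → depth P ≡ suc z
    depth-low P le = go (degree P ℕ.≤? z)
      where
      go : (A? : Dec (degree P ℕ.≤ z)) → depthFor A? (divides-h? P) ≡ suc z
      go (yes _)  = refl
      go (no ¬le) = contradiction le ¬le

    depth-high : ∀ P → z ℕ.< degree P → depth P ≡ (if does (divides-h? P) then 0 else 1)
    depth-high P lt = go (degree P ℕ.≤? z) (divides-h? P)
      where
      go : (A? : Dec (degree P ℕ.≤ z)) (B? : Dec (poly P ∣ h)) → depthFor A? B? ≡ (if does B? then 0 else 1)
      go (yes le) _       = contradiction le (ℕ.<⇒≱ lt)
      go (no _)   (yes _) = refl
      go (no _)   (no _)  = refl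

    depth-≤ : ∀ P → depth P ℕ.≤ suc z
    depth-≤ P = go (degree P ℕ.≤? z) (divides-h? P)
      where
      go : (A? : Dec (degree P ℕ.≤ z)) (B? : Dec (poly P ∣ h)) → depthFor A? B? ℕ.≤ suc z
      go (yes _) _       = ℕ.≤-refl
      go (no _)  (yes _) = z≤n
      go (no _)  (no _)  = s≤s z≤n

    capped : Poly → Prime → ℚ
    capped f P = χ (depth P) f P * χ (depth P) (f ⊕ h) P

    full : Poly → Prime → ℚ
    full f P = χ n f P * χ n (f ⊕ h) P

    private
      ∣*∣≤1 : ∀ a b → ∣ a ∣ ≤ 1ℚ → ∣ b ∣ ≤ 1ℚ → ∣ a * b ∣ ≤ 1ℚ
      ∣*∣≤1 a b ha hb = subst (_≤ 1ℚ) (sym (ℚ.∣p*q∣≡∣p∣*∣q∣ a b)) (*-≤1 (ℚ.0≤∣p∣ a) ha hb)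

      excess : Poly → Prime → ℚ
      excess f P = [ power∣? P (suc (depth P)) f ]

    capped-error : suc z ℕ.≤ n → ∀ f P → ∣ full f P - capped f P ∣ ≤ 2ℚ * (excess f P + excess (f ⊕ h) P)
    capped-error sz≤n f P = ℚ.≤-trans
      (∣*-*∣-≤ (χ n f P) (χ (depth P) f P) (χ n (f ⊕ h) P) (χ (depth P) (f ⊕ h) P) (∣χ∣≤1 n f P) (∣χ∣≤1 (depth P) (f ⊕ h) P))
      (ℚ.≤-trans (ℚ.+-mono-≤ (χ-error f P le) (χ-error (f ⊕ h) P le))
          (ℚ.≤-reflexive (sym (ℚ.*-distribˡ-+ 2ℚ (excess f P) (excess (f ⊕ h) P)))))
      where
      le : depth P ℕ.≤ n
      le = ℕ.≤-trans (depth-≤ P) sz≤n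

    -- With g = deg P: for g ≤ z, (z + 2) g ≥ (z + 1) + g since g ≥ 1; for g > z and P not dividing
    -- h, 2 g ≥ (z + 1) + g; for g > z and P ∣ h only g ≥ z + 1 is left, which the indicator pays
    -- for.
    excess-bound : ∀ P → ρ ^ (suc (depth P) ℕ.* degree P) ≤ ρ ^ suc z * (ρ ^ degree P + [ divides-h? P ])
    excess-bound P = go (degree P ℕ.≤? z) (divides-h? P)
      where
      g = degree P
      go : (A? : Dec (g ℕ.≤ z)) (B? : Dec (poly P ∣ h)) → ρ ^ (suc (depthFor A? B?) ℕ.* g) ≤ ρ ^ suc z * (ρ ^ g + [ B? ])
      go (yes _) B? = ℚ.≤-trans
        (^-antimono ρ≥0 ρ≤1 (ℕ.≤-trans (ℕ.≤-reflexive (ℕ.+-comm (suc z) g))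
          (ℕ.+-monoʳ-≤ g (ℕ.≤-trans (ℕ.≤-reflexive (sym (ℕ.*-identityʳ (suc z)))) (ℕ.*-monoʳ-≤ (suc z) (degree-positive P))))))
        (ℚ.≤-trans (ℚ.≤-reflexive (^-homo ρ (suc z) g)) (*-monoˡ (^-nonneg (suc z) ρ≥0) (≤-+ʳ (indicator-nonneg B?))))
      go (no ¬le) (no _) = ℚ.≤-trans
        (^-antimono ρ≥0 ρ≤1 (ℕ.≤-trans (ℕ.+-monoˡ-≤ g (ℕ.≰⇒> ¬le)) (ℕ.≤-reflexive (cong (g ℕ.+_) (sym (ℕ.+-identityʳ g))))))
        (ℚ.≤-trans (ℚ.≤-reflexive (^-homo ρ (suc z) g)) (*-monoˡ (^-nonneg (suc z) ρ≥0) (≤-+ʳ ℚ.≤-refl)))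
      go (no ¬le) (yes _) = ℚ.≤-trans
        (^-antimono ρ≥0 ρ≤1 (ℕ.≤-trans (ℕ.≰⇒> ¬le) (ℕ.≤-reflexive (sym (ℕ.+-identityʳ g)))))
        (ℚ.≤-trans (ℚ.≤-reflexive (sym (ℚ.*-identityʳ (ρ ^ suc z))))
          (*-monoˡ (^-nonneg (suc z) ρ≥0) (ℚ.≤-trans (≤-+ʳ (^-nonneg g ρ≥0)) (ℚ.≤-reflexive (ℚ.+-comm 1ℚ (ρ ^ g))))))

    excess-sum : ∀ P b → (2 ℕ.+ z) ℕ.* degree P ℕ.≤ n →
      ∑ (monics n) (λ f → excess (f ⊕ b) P) ≡ size n * ρ ^ (suc (depth P) ℕ.* degree P)
    excess-sum P b le = divisible-monics (monic-^ (suc (depth P)) (isMonic P)) b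
      (ℕ.≤-trans (ℕ.*-monoˡ-≤ (degree P) (s≤s (depth-≤ P))) le)

    -- A union bound over primes in which the sum of ρ^(deg P) and the number of prime divisors of h
    -- are each at most Y. The 8 is 2 for the change of a sign, 2 for f and f ⊕ h, and 2 for these
    -- two sums.
    total-error : suc z ℕ.≤ n → (2 ℕ.+ z) ℕ.* (z ℕ.+ k) ℕ.≤ n → d ℕ.≤ z ℕ.+ k → 1 ℕ.≤ z ℕ.+ k →
      ∑ (monics n) (λ f → ∣ ∏ (primesBetween 0 (z ℕ.+ k)) (full f) - ∏ (primesBetween 0 (z ℕ.+ k)) (capped f) ∣) ≤
      size n * (ι 8 * (ρ ^ suc z * ι (z ℕ.+ k)))
    total-error sz≤n le d≤Y Y≥1 = begin
      ∑ (monics n) (λ f → ∣ ∏ L (full f) - ∏ L (capped f) ∣)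
        ≤⟨ ∑-mono (All.universal (λ f → ∣∏-∏∣-≤ L (λ P → ∣*∣≤1 (χ n f P) (χ n (f ⊕ h) P) (∣χ∣≤1 n f P) (∣χ∣≤1 n (f ⊕ h) P))
             (λ P → ∣*∣≤1 (χ (depth P) f P) (χ (depth P) (f ⊕ h) P) (∣χ∣≤1 (depth P) f P) (∣χ∣≤1 (depth P) (f ⊕ h) P))) (monics n)) ⟩
      ∑ (monics n) (λ f → ∑ L (λ P → ∣ full f P - capped f P ∣))
        ≤⟨ ∑-mono (All.universal (λ f → ∑-mono (All.universal (capped-error sz≤n f) L)) (monics n)) ⟩
      ∑ (monics n) (λ f → ∑ L (λ P → 2ℚ * (excess f P + excess (f ⊕ h) P)))
        ≡⟨ Sum.⨁-swap (monics n) L _ ⟩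
      ∑ L (λ P → ∑ (monics n) (λ f → 2ℚ * (excess f P + excess (f ⊕ h) P)))
        ≤⟨ ∑-mono (All.map (λ {P} (_ , P≤Y) → each P P≤Y) (primesBetween-bounds 0 Y)) ⟩
      ∑ L (λ P → (ι 4 * size n * ρ ^ suc z) * (ρ ^ degree P + [ divides-h? P ]))
        ≡⟨ trans (∑-*ˡ (ι 4 * size n * ρ ^ suc z) L _) (cong (ι 4 * size n * ρ ^ suc z *_) (Sum.⨁-distrib L _ _)) ⟩
      (ι 4 * size n * ρ ^ suc z) * (∑ L (λ P → ρ ^ degree P) + ∑ L (λ P → [ divides-h? P ]))
        ≤⟨ *-monoˡ (*-nonneg (*-nonneg (ι-nonneg 4) (size≥0 n)) (^-nonneg (suc z) ρ≥0))
             (ℚ.+-mono-≤ (∑-reciprocals 0 Y) (ℚ.≤-trans (divisors Y d≤Y Y≥1) (ι-mono d≤Y))) ⟩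
      (ι 4 * size n * ρ ^ suc z) * (ι Y + ι Y)
        ≡⟨ reorder (ι 4) (size n) (ρ ^ suc z) (ι Y) ⟩
      size n * ((ι 4 + ι 4) * (ρ ^ suc z * ι Y))
        ≡⟨ cong (λ c → size n * (c * (ρ ^ suc z * ι Y))) (ι-+ 4 4) ⟨
      size n * (ι 8 * (ρ ^ suc z * ι Y)) ∎
      where
      open ℚ.≤-Reasoning
      Y = z ℕ.+ k
      L = primesBetween 0 Y
      reorder : ∀ a s r y → (a * s * r) * (y + y) ≡ s * ((a + a) * (r * y))
      reorder = solve-∀ ℚ-ring
      divisors : ∀ Y → d ℕ.≤ Y → 1 ℕ.≤ Y → ∑ (primesBetween 0 Y) (λ P → [ divides-h? P ]) ≤ ι d
      divisors (suc J) d≤ _ = prime-divisors J dh d≤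
      four : 2ℚ * 2ℚ ≡ ι 4
      four = trans (cong₂ _*_ (sym ι-2) (sym ι-2)) (sym (ι-* 2 2))
      each : ∀ P → degree P ℕ.≤ Y → ∑ (monics n) (λ f → 2ℚ * (excess f P + excess (f ⊕ h) P)) ≤
          (ι 4 * size n * ρ ^ suc z) * (ρ ^ degree P + [ divides-h? P ])
      each P P≤Y = begin
        ∑ (monics n) (λ f → 2ℚ * (excess f P + excess (f ⊕ h) P))
          ≡⟨ trans (∑-*ˡ 2ℚ (monics n) _) (cong (2ℚ *_) (Sum.⨁-distrib (monics n) _ _)) ⟩
        2ℚ * (∑ (monics n) (λ f → excess f P) + ∑ (monics n) (λ f → excess (f ⊕ h) P))
          ≡⟨ cong (2ℚ *_) (cong₂ _+_ (trans (Sum.⨁-cong (monics n) unshift) (excess-sum P [] fits)) (excess-sum P h fits)) ⟩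
        2ℚ * (size n * E + size n * E)
          ≡⟨ reorder′ (size n) E ⟩
        2ℚ * 2ℚ * size n * E
          ≤⟨ *-monoˡ (*-nonneg (*-nonneg 0≤2 0≤2) (size≥0 n)) (excess-bound P) ⟩
        2ℚ * 2ℚ * size n * (ρ ^ suc z * (ρ ^ degree P + [ divides-h? P ]))
          ≡⟨ trans (sym (ℚ.*-assoc (2ℚ * 2ℚ * size n) (ρ ^ suc z) _))
              (cong (λ c → c * size n * ρ ^ suc z * (ρ ^ degree P + [ divides-h? P ])) four) ⟩
        (ι 4 * size n * ρ ^ suc z) * (ρ ^ degree P + [ divides-h? P ]) ∎
        where
        E = ρ ^ (suc (depth P) ℕ.* degree P)
        fits : (2 ℕ.+ z) ℕ.* degree P ℕ.≤ n
        fits = ℕ.≤-trans (ℕ.*-monoʳ-≤ (2 ℕ.+ z) P≤Y) le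
        unshift : ∀ f → excess f P ≡ excess (f ⊕ []) P
        unshift f = Sum.when-⇔ (power∣? P (suc (depth P)) f) (power∣? P (suc (depth P)) (f ⊕ []))
            (∣-respʳ (R.sym (R.+-identityʳ f))) (∣-respʳ (R.+-identityʳ f))
        reorder′ : ∀ s e → 2ℚ * (s * e + s * e) ≡ 2ℚ * 2ℚ * s * e
        reorder′ = solve-∀ ℚ-ring

    χ₁ : ∀ f P → χ 1 f P ≡ 1ℚ - 2ℚ * [ divides? (isMonic P) f ]
    χ₁ f P = trans (ℚ.*-identityʳ _) (go (power∣? P 1 f) (divides? (isMonic P) f)
      (∣-respˡ (R.*-identityʳ (poly P))) (∣-respˡ (R.sym (R.*-identityʳ (poly P)))))
      where
      go : ∀ {p r} {A : Set p} {B : Set r} (A? : Dec A) (B? : Dec B) → (A → B) → (B → A) →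
           Product.when A? (- 1ℚ) ≡ 1ℚ - 2ℚ * [ B? ]
      go (yes _) (yes _) f g = refl
      go (yes a) (no ¬b) f g = contradiction (f a) ¬b
      go (no ¬a) (yes b) f g = contradiction (g b) ¬a
      go (no _)  (no _)  f g = refl

    capped-high : ∀ f P → z ℕ.< degree P →
      capped f P ≡ (if does (¬? (divides-h? P)) then 1ℚ - 2ℚ * hits f P else 1ℚ)
    capped-high f P lt = trans (cong (λ κ → χ κ f P * χ κ (f ⊕ h) P) (depth-high P lt)) (go (divides-h? P))
      where
      go : (P? : Dec (poly P ∣ h)) →
        (λ κ → χ κ f P * χ κ (f ⊕ h) P) (if does P? then 0 else 1) ≡ (if does (¬? P?) then 1ℚ - 2ℚ * hits f P else 1ℚ)
      go (yes _)  = refl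
      go (no P∤h) = trans (cong₂ _*_ (χ₁ f P) (χ₁ (f ⊕ h) P)) (combine (divides? (isMonic P) f) (divides? (isMonic P) (f ⊕ h)))
        where
        -- The cross term of the two indicators vanishes, because P cannot divide both f and f ⊕ h.
        combine : (A? : Dec (poly P ∣ f)) (B? : Dec (poly P ∣ f ⊕ h)) →
          (1ℚ - 2ℚ * [ A? ]) * (1ℚ - 2ℚ * [ B? ]) ≡ 1ℚ - 2ℚ * ([ A? ] + [ B? ])
        combine (yes d) (yes d′) = contradiction (∣-+-cancel d′ d) P∤h
        combine (yes _) (no _)   = refl
        combine (no _)  (yes _)  = refl
        combine (no _)  (no _)   = refl

    lowPart : Poly → ℚ
    lowPart f = ∏ (primesBetween 0 z) (λ P → χ (suc z) f P * χ (suc z) (f ⊕ h) P)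

    capped-product : ∀ f → ∏ (primesBetween 0 (z ℕ.+ k)) (capped f) ≡ lowPart f * ∏ sieved (λ P → 1ℚ - 2ℚ * hits f P)
    capped-product f = begin
      ∏ (primesBetween 0 (z ℕ.+ k)) (capped f)
        ≡⟨ trans (cong (λ L → ∏ L (capped f)) (primesBetween-+ z k))
            (Product.⨁-++ (primesBetween z k) (primesBetween 0 z) (capped f)) ⟩
      ∏ (primesBetween z k) (capped f) * ∏ (primesBetween 0 z) (capped f)
        ≡⟨ cong₂ _*_ (trans (Product.⨁-congAll (All.map (λ {P} (l , _) → capped-high f P l) (primesBetween-bounds z k))) (sym (Product.⨁-filter (λ P → ¬? (divides-h? P)) (primesBetween z k) _)))
             (Product.⨁-congAll (All.map (λ {P} (_ , u) → cong (λ κ → χ κ f P * χ κ (f ⊕ h) P) (depth-low P u)) (primesBetween-bounds 0 z))) ⟩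
      ∏ sieved (λ P → 1ℚ - 2ℚ * hits f P) * lowPart f
        ≡⟨ ℚ.*-comm _ (lowPart f) ⟩
      lowPart f * ∏ sieved (λ P → 1ℚ - 2ℚ * hits f P) ∎
      where open ≡-Reasoning

    -- Exponents are cut off at z + 1 and P^(z+1) divides M, so only the residue of f matters; the
    -- class of f ⊕ w ≡ 0 is represented by -w.
    lowPart-residue : ∀ f w → M ∣ f ⊕ w → lowPart f ≡ lowPart (⊖ w)
    lowPart-residue f w M∣ = Product.⨁-congAll (All.map (λ {P} P∣M → cong₂ _*_
      (χ-resp (suc z) P (∣-trans P∣M M∣) shift) (χ-resp (suc z) P (∣-trans P∣M M∣)
          (R.trans (R.+-congʳ shift) (R.+-assoc (f ⊕ w) (⊖ w) h))))
      (modulus-∣ (suc z) (primesBetween 0 z)))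
      where
      shift : f ≃ (f ⊕ w) ⊕ ⊖ w
      shift = R.sym (R.trans (R.+-assoc f w (⊖ w)) (R.trans (R.+-congˡ (R.-‿inverseʳ w)) (R.+-identityʳ f)))

    ∣lowPart∣≤1 : ∀ f → ∣ lowPart f ∣ ≤ 1ℚ
    ∣lowPart∣≤1 f = ∣∏∣-≤1 (primesBetween 0 z) (λ P → ∣*∣≤1 (χ (suc z) f P) (χ (suc z) (f ⊕ h) P) (∣χ∣≤1 (suc z) f P)
        (∣χ∣≤1 (suc z) (f ⊕ h) P))

    main-term : ∀ r → degM ℕ.+ suc r ℕ.* (z ℕ.+ k) ℕ.≤ n →
      ∣ ∑ (monics n) (λ f → ∏ (primesBetween 0 (z ℕ.+ k)) (capped f)) ∣ ≤
      size n * (∣ ∏ sieved (λ P → 1ℚ - 2ℚ * weight P) ∣ + 2ℚ * (2ℚ ^ suc r * elementary (suc r) sieved weight))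
    main-term r le = ℚ.≤-trans
      (ℚ.≤-reflexive (cong ∣_∣ (Sum.⨁-cong (monics n) capped-product)))
      (sieve (modulus-monic (suc z) (primesBetween 0 z)) coprime
        (AllPairs.filter⁺ (λ P → ¬? (divides-h? P)) (primesBetween-comaximal z k))
        (All.all-filter (λ P → ¬? (divides-h? P)) (primesBetween z k)) r le
        lowPart (λ w → lowPart (⊖ w)) lowPart-residue (λ w → ∣lowPart∣≤1 (⊖ w)))
      where
      coprime : All (λ P → degree P ℕ.≤ z ℕ.+ k × Comaximal (poly P) M) sieved
      coprime = All.filter⁺ (λ P → ¬? (divides-h? P)) (All.map (λ {P} (l , u) → u ,
        modulus-comaximal (suc z) (All.map (λ {Q} (_ , v) → primes-comaximal P Q (λ e → ℕ.<⇒≱ l (subst (ℕ._≤ z) (sym (degree-cong P Q e)) v))) (primesBetween-bounds 0 z)))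
        (primesBetween-bounds z k))

-- Powers of 2 and numerical constants

module Dyadic where
  open import Data.Rational.Base using (_+_; _*_; _-_; -_; _≤_; _<_; ½)
  open RationalOrder

  ι-2^ : ∀ e → ι (2 ℕ.^ e) ≡ 2ℚ ^ e
  ι-2^ e = trans (ι-^ 2 e) (cong (_^ e) ι-2)

  0≤½ : 0ℚ ≤ ½
  0≤½ = ℚ.≤ᵇ⇒≤ _

  ½≤1 : ½ ≤ 1ℚ
  ½≤1 = ℚ.≤ᵇ⇒≤ _

  1≤2 : 1ℚ ≤ 2ℚ
  1≤2 = ℚ.≤ᵇ⇒≤ _

  ½^*2^ : ∀ e → ½ ^ e * 2ℚ ^ e ≡ 1ℚ
  ½^*2^ e = trans (sym (^-distrib ½ 2ℚ e)) (1^ e)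

  ½^*2^-≤1 : ∀ {a b} → a ℕ.≤ b → ½ ^ b * 2ℚ ^ a ≤ 1ℚ
  ½^*2^-≤1 {a} {b} a≤b = ℚ.≤-trans (*-monoˡ (^-nonneg b 0≤½) (^-mono-exp 1≤2 a≤b)) (ℚ.≤-reflexive (½^*2^ b))

  opaque
    -- It has to exceed 2 * 22^4 + 2 + 8, the sum of the constants for large l, and 2^(4 l) for l ≤
    -- 6, where the trivial bound is used.
    K : ℕ
    K = 2 ℕ.^ 24

    K-large : 2 ℕ.* 22 ℕ.^ 4 ℕ.+ 2 ℕ.+ 8 ℕ.≤ K
    K-large = ℕ.≤ᵇ⇒≤ (2 ℕ.* 22 ℕ.^ 4 ℕ.+ 2 ℕ.+ 8) (2 ℕ.^ 24) _

    2^24≤K : 2 ℕ.^ 24 ℕ.≤ K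
    2^24≤K = ℕ.≤-refl

  ιK-large : 2ℚ * ι 22 ^ 4 + 2ℚ + ι 8 ≤ ι K
  ιK-large = begin
    2ℚ * ι 22 ^ 4 + 2ℚ + ι 8                   ≡⟨ cong₂ (λ x y → x * y + x + ι 8) (sym ι-2) (sym (ι-^ 22 4)) ⟩
    ι 2 * ι (22 ℕ.^ 4) + ι 2 + ι 8             ≡⟨ cong (λ x → x + ι 2 + ι 8) (ι-* 2 (22 ℕ.^ 4)) ⟨
    ι (2 ℕ.* 22 ℕ.^ 4) + ι 2 + ι 8             ≡⟨ cong (_+ ι 8) (ι-+ (2 ℕ.* 22 ℕ.^ 4) 2) ⟨
    ι (2 ℕ.* 22 ℕ.^ 4 ℕ.+ 2) + ι 8             ≡⟨ ι-+ (2 ℕ.* 22 ℕ.^ 4 ℕ.+ 2) 8 ⟨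
    ι (2 ℕ.* 22 ℕ.^ 4 ℕ.+ 2 ℕ.+ 8)             ≤⟨ ι-mono K-large ⟩
    ι K                                        ∎
    where open ℚ.≤-Reasoning

  -- The least possible threshold: for l = 7 it reads 106 ≤ 128, and it fails for l = 6. This
  -- separates the sieve range from the trivial range.
  exponential-dominates : ∀ {l} → 7 ℕ.≤ l → 13 ℕ.* suc l ℕ.+ 2 ℕ.≤ 2 ℕ.^ l
  exponential-dominates {l} 7≤l = subst (λ l → 13 ℕ.* suc l ℕ.+ 2 ℕ.≤ 2 ℕ.^ l) (ℕ.m∸n+n≡m 7≤l) (go (l ℕ.∸ 7))
    where
    go : ∀ j → 13 ℕ.* suc (j ℕ.+ 7) ℕ.+ 2 ℕ.≤ 2 ℕ.^ (j ℕ.+ 7)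
    go zero    = ℕ.≤ᵇ⇒≤ 106 128 _
    go (suc j) = begin
      13 ℕ.* suc (suc (j ℕ.+ 7)) ℕ.+ 2          ≡⟨ identity (j ℕ.+ 7) ⟩
      13 ℕ.+ (13 ℕ.* suc (j ℕ.+ 7) ℕ.+ 2)       ≤⟨ ℕ.+-mono-≤
          (ℕ.≤-trans (ℕ.≤-trans (ℕ.m≤m*n 13 (suc (j ℕ.+ 7))) (ℕ.m≤m+n _ 2)) (go j)) (go j) ⟩
      2 ℕ.^ (j ℕ.+ 7) ℕ.+ 2 ℕ.^ (j ℕ.+ 7)       ≡⟨ cong (2 ℕ.^ (j ℕ.+ 7) ℕ.+_) (ℕ.+-identityʳ (2 ℕ.^ (j ℕ.+ 7))) ⟨
      2 ℕ.^ suc (j ℕ.+ 7)                       ∎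
      where
      open ℕ.≤-Reasoning
      identity : ∀ x → 13 ℕ.* suc (suc x) ℕ.+ 2 ≡ 13 ℕ.+ (13 ℕ.* suc x ℕ.+ 2)
      identity x = cong (ℕ._+ 2) (ℕ.*-suc 13 (suc x))

-- Choice of the sieve parameters for large l and the resulting bound

module LargeParameters {c ℓ : Level} (F : FiniteField c ℓ)
  (l t Y n : ℕ) (t≡1+l : t ≡ suc l) (7≤l : 7 ℕ.≤ l) (2^l≤Y+1 : 2 ℕ.^ l ℕ.≤ suc Y) (Y≤2^t : Y ℕ.≤ 2 ℕ.^ t)
      (large : 2 ℕ.^ (2 ℕ.^ l ℕ.∸ 1) ℕ.≤ n)
  where
  open Correlation F public
  open import Data.Rational.Base using (_+_; _*_; _-_; -_; _≤_; _<_; ∣_∣; ½)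
  open RationalOrder
  open RationalSums
  open TruncatedProducts
  open Dyadic

  l≤t : l ℕ.≤ t
  l≤t = ℕ.≤-trans (ℕ.n≤1+n l) (ℕ.≤-reflexive (sym t≡1+l))

  7≤t : 7 ℕ.≤ t
  7≤t = ℕ.≤-trans 7≤l l≤t

  1≤t : 1 ℕ.≤ t
  1≤t = ℕ.≤-trans (s≤s z≤n) 7≤t

  -- The parameter z below is the least integer with q^(z+1) ≥ β⁻² = 2^(10 t).  A prime of degree d > z then
  -- has ρ^d ≤ β², which makes all unions over such primes negligible, while the primes of degree at most z are
  -- few enough for M to have small degree.
  β : ℚ
  β = ½ ^ (5 ℕ.* t)

  β²-def : β * β ≡ ½ ^ (10 ℕ.* t)
  β²-def = trans (sym (^-homo ½ (5 ℕ.* t) (5 ℕ.* t))) (cong (½ ^_) (sym (ℕ.*-distribʳ-+ t 5 5)))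

  private
    -- Downward search from an exponent known to be large enough; the last component records
    -- minimality.
    least : ∀ b x → ρ ^ suc b ≤ x → ∃[ z ] z ℕ.≤ b × ρ ^ suc z ≤ x × (z ≡ 0 ⊎ x ≤ ρ ^ z)
    least zero    x h = 0 , z≤n , h , inj₁ refl
    least (suc b) x h with ℚ.≤-total (ρ ^ suc b) x
    ... | inj₂ x≤ = suc b , ℕ.≤-refl , h , inj₂ x≤
    ... | inj₁ h′ = let (z , z≤b , p , q) = least b x h′ in z , ℕ.m≤n⇒m≤1+n z≤b , p , q

    ρ≤½ : ρ ≤ ½
    ρ≤½ = *-cancelˡ {c = 2ℚ} (ℚ.positive⁻¹ 2ℚ) (ℚ.≤-trans (ℚ.≤-reflexive (cong (_* ρ) (sym ι-2))) 2ρ≤1)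

    threshold : ∃[ z ] z ℕ.≤ 10 ℕ.* t × ρ ^ suc z ≤ β * β × (z ≡ 0 ⊎ β * β ≤ ρ ^ z)
    threshold = least (10 ℕ.* t) (β * β) (ℚ.≤-trans (^-mono (suc (10 ℕ.* t)) ρ≥0 ρ≤½)
      (ℚ.≤-trans (^-antimono 0≤½ ½≤1 (ℕ.n≤1+n (10 ℕ.* t))) (ℚ.≤-reflexive (sym β²-def))))

  opaque
    z : ℕ
    z = proj₁ threshold

    z≤10t : z ℕ.≤ 10 ℕ.* t
    z≤10t = proj₁ (proj₂ threshold)

    ρ^z-small : ρ ^ suc z ≤ β * β
    ρ^z-small = proj₁ (proj₂ (proj₂ threshold))

    z-minimal : z ≡ 0 ⊎ β * β ≤ ρ ^ z
    z-minimal = proj₂ (proj₂ (proj₂ threshold))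

  private
    -- Minimality of z read backwards: β^2 ≤ ρ^z says q^z ≤ 2^(10 t). For z = 0 there are no low
    -- primes to bound.
    size-z : z ≡ 0 ⊎ size z ≤ 2ℚ ^ (10 ℕ.* t)
    size-z with z-minimal
    ... | inj₁ z≡0 = inj₁ z≡0
    ... | inj₂ h   = inj₂ (begin
      size z                                             ≡⟨ trans (sym (ℚ.*-identityʳ (size z)))
          (cong (size z *_) (sym (½^*2^ (10 ℕ.* t)))) ⟩
      size z * (½ ^ (10 ℕ.* t) * 2ℚ ^ (10 ℕ.* t))        ≡⟨ ℚ.*-assoc (size z) (½ ^ (10 ℕ.* t)) (2ℚ ^ (10 ℕ.* t)) ⟨
      size z * ½ ^ (10 ℕ.* t) * 2ℚ ^ (10 ℕ.* t)          ≤⟨ *-monoʳ (^-nonneg (10 ℕ.* t) 0≤2)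
          (*-monoˡ (size≥0 z) (ℚ.≤-trans (ℚ.≤-reflexive (sym β²-def)) h)) ⟩
      size z * ρ ^ z * 2ℚ ^ (10 ℕ.* t)                   ≡⟨ trans
          (cong (_* 2ℚ ^ (10 ℕ.* t)) (trans (ℚ.*-comm (size z) (ρ ^ z)) (ρ^*size z))) (ℚ.*-identityˡ (2ℚ ^ (10 ℕ.* t))) ⟩
      2ℚ ^ (10 ℕ.* t)                                    ∎)
      where open ℚ.≤-Reasoning

    t≤2^l : 13 ℕ.* t ℕ.+ 2 ℕ.≤ 2 ℕ.^ l
    t≤2^l = subst (λ t → 13 ℕ.* t ℕ.+ 2 ℕ.≤ 2 ℕ.^ l) (sym t≡1+l) (exponential-dominates 7≤l)

    2^l≤2^t : 2 ℕ.^ l ℕ.≤ 2 ℕ.^ t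
    2^l≤2^t = ℕ.^-monoʳ-≤ 2 l≤t

    z+2≤2^l : 2 ℕ.+ z ℕ.≤ 2 ℕ.^ l
    z+2≤2^l = ℕ.≤-trans (ℕ.≤-trans (ℕ.≤-reflexive (ℕ.+-comm 2 z))
        (ℕ.+-monoˡ-≤ 2 (ℕ.≤-trans z≤10t (ℕ.*-monoˡ-≤ t (ℕ.m≤m+n 10 3))))) t≤2^l

  z≤Y : z ℕ.≤ Y
  z≤Y = ℕ.s≤s⁻¹ (ℕ.≤-trans (ℕ.≤-trans (ℕ.n≤1+n (suc z)) z+2≤2^l) 2^l≤Y+1)

  k : ℕ
  k = Y ℕ.∸ z

  z+k≡Y : z ℕ.+ k ≡ Y
  z+k≡Y = ℕ.m+[n∸m]≡n z≤Y

  -- The sieve is truncated at level suc r = 2 a + m, where a bounds 2 ∑ weight.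
  a m r : ℕ
  a = 2 ℕ.^ (t ℕ.+ 2)
  m = (t ℕ.+ 2) ℕ.* (2 ℕ.* a) ℕ.+ 4 ℕ.* t
  r = ℕ.pred (2 ℕ.* a ℕ.+ m)

  private
    J : ℕ
    J = 2 ℕ.* a ℕ.+ m

    a>0 : 0 ℕ.< a
    a>0 = ℕ.m^n>0 2 (t ℕ.+ 2)

  suc-r : suc r ≡ 2 ℕ.* a ℕ.+ m
  suc-r = go (2 ℕ.* a ℕ.+ m) (ℕ.≤-trans a>0 (ℕ.≤-trans (ℕ.m≤m+n a (a ℕ.+ 0)) (ℕ.m≤m+n (2 ℕ.* a) m)))
    where
    go : ∀ j → 0 ℕ.< j → suc (ℕ.pred j) ≡ j
    go (suc j) _ = refl

  private
    low : List Prime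
    low = primesBetween 0 z

    ι-length : ∀ {b} {B : Set b} (xs : List B) → ∑ xs (λ _ → 1ℚ) ≡ ι (length xs)
    ι-length xs = trans (∑-const 1ℚ xs) (ℚ.*-identityʳ _)

    length-low : length low ℕ.≤ z ℕ.* q ℕ.^ z
    length-low = ι-cancel (begin
      ι (length low)                                                        ≡⟨ ι-length low ⟨
      ∑ low (λ _ → 1ℚ)                                                      ≡⟨ Sum.⨁-concatMap primesOfDegree (interval 0 z) _ ⟩
      ∑ (interval 0 z) (λ d → ∑ (primesOfDegree d) (λ _ → 1ℚ))              ≤⟨ ∑-≤-const (All.map (λ {d} (_ , d≤z) → ℚ.≤-trans (∑-primesOfDegree-1 d) (ι-mono (ℕ.^-monoʳ-≤ q {{ℕ.>-nonZero (ℕ.≤-trans (s≤s z≤n) q≥2)}} d≤z))) (interval-bounds 0 z)) ⟩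
      ι (length (interval 0 z)) * ι (q ℕ.^ z)                               ≡⟨ cong (λ j → ι j * ι (q ℕ.^ z)) (length-interval 0 z) ⟩
      ι z * ι (q ℕ.^ z)                                                     ≡⟨ ι-* z (q ℕ.^ z) ⟨
      ι (z ℕ.* q ℕ.^ z)                                                     ∎)
      where open ℚ.≤-Reasoning

    -- There are at most z q^z ≤ 2^(t + 10 t) low primes, and each adds at most (z + 1) z ≤ 2^(2 t)
    -- to the degree of M; hence the 13.
    modulus-small : modulusDegree (suc z) low ℕ.≤ 2 ℕ.^ (13 ℕ.* t)
    modulus-small = ℕ.≤-trans (modulusDegree-bound (suc z) (All.map proj₂ (primesBetween-bounds 0 z))) (go z refl size-z)
      where
      go : ∀ z′ → z ≡ z′ → z ≡ 0 ⊎ size z ≤ 2ℚ ^ (10 ℕ.* t) → length low ℕ.* (suc z ℕ.* z) ℕ.≤ 2 ℕ.^ (13 ℕ.* t)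
      go _ _ (inj₁ z≡0) = ℕ.≤-trans (ℕ.≤-reflexive (trans (cong (λ x → length low ℕ.* (suc z ℕ.* x)) z≡0)
          (trans (cong (length low ℕ.*_) (ℕ.*-zeroʳ (suc z))) (ℕ.*-zeroʳ (length low))))) z≤n
      go _ _ (inj₂ h) = begin
        length low ℕ.* (suc z ℕ.* z)                            ≤⟨ ℕ.*-monoˡ-≤ (suc z ℕ.* z) length-low ⟩
        z ℕ.* q ℕ.^ z ℕ.* (suc z ℕ.* z)                         ≤⟨ ℕ.*-mono-≤ (ℕ.*-mono-≤ z≤2^t q^z) (ℕ.*-mono-≤ sz≤2^t z≤2^t) ⟩
        2 ℕ.^ t ℕ.* 2 ℕ.^ (10 ℕ.* t) ℕ.* (2 ℕ.^ t ℕ.* 2 ℕ.^ t)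
            ≡⟨ cong₂ ℕ._*_ (sym (ℕ.^-distribˡ-+-* 2 t (10 ℕ.* t))) (sym (ℕ.^-distribˡ-+-* 2 t t)) ⟩
        2 ℕ.^ (t ℕ.+ 10 ℕ.* t) ℕ.* 2 ℕ.^ (t ℕ.+ t)              ≡⟨ ℕ.^-distribˡ-+-* 2 (t ℕ.+ 10 ℕ.* t) (t ℕ.+ t) ⟨
        2 ℕ.^ ((t ℕ.+ 10 ℕ.* t) ℕ.+ (t ℕ.+ t))                  ≡⟨ cong (2 ℕ.^_) (collect t) ⟩
        2 ℕ.^ (13 ℕ.* t)                                        ∎
        where
        open ℕ.≤-Reasoning
        collect : ∀ x → (x ℕ.+ 10 ℕ.* x) ℕ.+ (x ℕ.+ x) ≡ 13 ℕ.* x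
        collect = ℕ-solve-∀
        sz≤2^t : suc z ℕ.≤ 2 ℕ.^ t
        sz≤2^t = ℕ.≤-trans (ℕ.≤-trans (ℕ.n≤1+n (suc z)) z+2≤2^l) 2^l≤2^t
        z≤2^t : z ℕ.≤ 2 ℕ.^ t
        z≤2^t = ℕ.≤-trans (ℕ.n≤1+n z) sz≤2^t
        q^z : q ℕ.^ z ℕ.≤ 2 ℕ.^ (10 ℕ.* t)
        q^z = ι-cancel (ℚ.≤-trans h (ℚ.≤-reflexive (sym (ι-2^ (10 ℕ.* t)))))

    -- From n ≥ 2^(2^l - 1) and 13 t + 2 ≤ 2^l. The room needed is 2^(13 t) twice, for the modulus
    -- and for the sieve level, hence 13 t + 1.
    2^-large : ∀ {e} → e ℕ.≤ 13 ℕ.* t ℕ.+ 1 → 2 ℕ.^ e ℕ.≤ n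
    2^-large {e} h = ℕ.≤-trans (ℕ.^-monoʳ-≤ 2 (ℕ.≤-trans h (ℕ.∸-monoˡ-≤ 1
        (ℕ.≤-trans (ℕ.≤-reflexive (sym (ℕ.+-suc (13 ℕ.* t) 1))) t≤2^l)))) large

    -- The level is of order t 2^t, hence at most 2^(2 t + 3), and Y adds another factor 2^t.
    J≤ : J ℕ.* Y ℕ.≤ 2 ℕ.^ (13 ℕ.* t)
    J≤ = begin
      J ℕ.* Y                                            ≤⟨ ℕ.*-mono-≤ J-bound Y≤2^t ⟩
      2 ℕ.^ (t ℕ.+ (t ℕ.+ 3)) ℕ.* 2 ℕ.^ t                ≡⟨ ℕ.^-distribˡ-+-* 2 (t ℕ.+ (t ℕ.+ 3)) t ⟨
      2 ℕ.^ ((t ℕ.+ (t ℕ.+ 3)) ℕ.+ t)                    ≤⟨ ℕ.^-monoʳ-≤ 2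
          (ℕ.≤-trans (ℕ.≤-reflexive (collect t)) (ℕ.+-monoʳ-≤ (3 ℕ.* t)
              (ℕ.≤-trans (s≤s (s≤s (s≤s z≤n))) (ℕ.≤-trans 7≤t (ℕ.m≤n*m t 10))))) ⟩
      2 ℕ.^ (3 ℕ.* t ℕ.+ 10 ℕ.* t)                       ≡⟨ cong (2 ℕ.^_) (sym (ℕ.*-distribʳ-+ t 3 10)) ⟩
      2 ℕ.^ (13 ℕ.* t)                                   ∎
      where
      open ℕ.≤-Reasoning
      collect : ∀ x → (x ℕ.+ (x ℕ.+ 3)) ℕ.+ x ≡ 3 ℕ.* x ℕ.+ 3
      collect = ℕ-solve-∀
      J-bound : J ℕ.≤ 2 ℕ.^ (t ℕ.+ (t ℕ.+ 3))
      J-bound = begin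
        2 ℕ.* a ℕ.+ ((t ℕ.+ 2) ℕ.* (2 ℕ.* a) ℕ.+ 4 ℕ.* t)
            ≤⟨ ℕ.+-monoʳ-≤ (2 ℕ.* a) (ℕ.+-monoʳ-≤ ((t ℕ.+ 2) ℕ.* (2 ℕ.* a))
                (ℕ.m≤m*n (4 ℕ.* t) (2 ℕ.* a) {{ℕ.>-nonZero (ℕ.≤-trans a>0 (ℕ.m≤m+n a (a ℕ.+ 0)))}})) ⟩
        2 ℕ.* a ℕ.+ ((t ℕ.+ 2) ℕ.* (2 ℕ.* a) ℕ.+ 4 ℕ.* t ℕ.* (2 ℕ.* a)) ≡⟨ factor t (2 ℕ.* a) ⟩
        (5 ℕ.* t ℕ.+ 3) ℕ.* (2 ℕ.* a)                         ≤⟨ ℕ.*-monoˡ-≤ (2 ℕ.* a) 5t+3 ⟩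
        2 ℕ.^ t ℕ.* (2 ℕ.* a)                                 ≡⟨ cong (λ e → 2 ℕ.^ t ℕ.* 2 ℕ.^ e) (sym (ℕ.+-suc t 2)) ⟩
        2 ℕ.^ t ℕ.* 2 ℕ.^ (t ℕ.+ 3)                           ≡⟨ ℕ.^-distribˡ-+-* 2 t (t ℕ.+ 3) ⟨
        2 ℕ.^ (t ℕ.+ (t ℕ.+ 3))                               ∎
        where
        factor : ∀ t x → x ℕ.+ ((t ℕ.+ 2) ℕ.* x ℕ.+ 4 ℕ.* t ℕ.* x) ≡ (5 ℕ.* t ℕ.+ 3) ℕ.* x
        factor = ℕ-solve-∀
        5t+3 : 5 ℕ.* t ℕ.+ 3 ℕ.≤ 2 ℕ.^ t
        5t+3 = ℕ.≤-trans (ℕ.≤-trans (ℕ.+-monoʳ-≤ (5 ℕ.* t) (s≤s (s≤s (s≤s (z≤n {7 ℕ.* t})))))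
            (ℕ.≤-trans (ℕ.≤-reflexive (collect′ t)) (ℕ.+-monoˡ-≤ 2
                (ℕ.≤-trans (ℕ.+-monoʳ-≤ (12 ℕ.* t) 1≤t) (ℕ.≤-reflexive (ℕ.+-comm (12 ℕ.* t) t)))))) (ℕ.≤-trans t≤2^l 2^l≤2^t)
          where
          collect′ : ∀ x → 5 ℕ.* x ℕ.+ (3 ℕ.+ 7 ℕ.* x) ≡ 12 ℕ.* x ℕ.+ 1 ℕ.+ 2
          collect′ = ℕ-solve-∀

  enough-room : modulusDegree (suc z) (primesBetween 0 z) ℕ.+ suc r ℕ.* (z ℕ.+ k) ℕ.≤ n
  enough-room = begin
    modulusDegree (suc z) low ℕ.+ suc r ℕ.* (z ℕ.+ k)     ≤⟨ ℕ.+-mono-≤ modulus-small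
        (ℕ.≤-trans (ℕ.≤-reflexive (cong₂ ℕ._*_ suc-r z+k≡Y)) J≤) ⟩
    2 ℕ.^ (13 ℕ.* t) ℕ.+ 2 ℕ.^ (13 ℕ.* t)                 ≡⟨ cong (2 ℕ.^ (13 ℕ.* t) ℕ.+_) (ℕ.+-identityʳ (2 ℕ.^ (13 ℕ.* t))) ⟨
    2 ℕ.^ suc (13 ℕ.* t)                                  ≤⟨ 2^-large (ℕ.≤-reflexive (ℕ.+-comm 1 (13 ℕ.* t))) ⟩
    n                                                     ∎
    where open ℕ.≤-Reasoning

  depth-room : (2 ℕ.+ z) ℕ.* (z ℕ.+ k) ℕ.≤ n
  depth-room = begin
    (2 ℕ.+ z) ℕ.* (z ℕ.+ k)          ≤⟨ ℕ.*-mono-≤ (ℕ.≤-trans z+2≤2^l 2^l≤2^t) (ℕ.≤-trans (ℕ.≤-reflexive z+k≡Y) Y≤2^t) ⟩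
    2 ℕ.^ t ℕ.* 2 ℕ.^ t              ≡⟨ ℕ.^-distribˡ-+-* 2 t t ⟨
    2 ℕ.^ (t ℕ.+ t)                  ≤⟨ 2^-large (ℕ.≤-trans (ℕ.≤-trans (ℕ.+-monoʳ-≤ t (ℕ.m≤n*m t 12)) ℕ.≤-refl)
        (ℕ.m≤m+n (13 ℕ.* t) 1)) ⟩
    n                                ∎
    where open ℕ.≤-Reasoning

  Y≥1 : 1 ℕ.≤ Y
  Y≥1 = ℕ.s≤s⁻¹ (ℕ.≤-trans (ℕ.≤-trans (ℕ.m≤m+n 2 z) z+2≤2^l) 2^l≤Y+1)

  Y<n : Y ℕ.< n
  Y<n = begin-strict
    Y                        ≤⟨ Y≤2^t ⟩
    2 ℕ.^ t                  <⟨ ℕ.^-monoʳ-< 2 ℕ.≤-refl {t} {suc t} ℕ.≤-refl ⟩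
    2 ℕ.^ suc t              ≤⟨ 2^-large (ℕ.≤-trans (ℕ.≤-reflexive (ℕ.+-comm 1 t)) (ℕ.+-monoˡ-≤ 1 (ℕ.m≤n*m t 13))) ⟩
    n                        ∎
    where open ℕ.≤-Reasoning

  ιY≤ : ι (z ℕ.+ k) ≤ 2ℚ ^ t
  ιY≤ = ℚ.≤-trans (ℚ.≤-reflexive (cong ι z+k≡Y)) (ℚ.≤-trans (ι-mono Y≤2^t) (ℚ.≤-reflexive (ι-2^ t)))

  β≥0 : 0ℚ ≤ β
  β≥0 = ^-nonneg (5 ℕ.* t) 0≤½

  private
    t≥2 : 2 ℕ.≤ t
    t≥2 = ℕ.≤-trans (s≤s (s≤s z≤n)) 7≤t

    ε : ℚ
    ε = ι (z ℕ.+ k) ^ 3 * β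

    ε≥0 : 0ℚ ≤ ε
    ε≥0 = *-nonneg (^-nonneg 3 (ι-nonneg (z ℕ.+ k))) β≥0

    -- Y^3 and k + 1 together cost about 2^(4 t), and the exponent 5 t of β leaves 2^(-t) for the
    -- factors 2.
    kε≤1 : 2ℚ * (ι (suc k) * ε) ≤ 1ℚ
    kε≤1 = begin
      2ℚ * (ι (suc k) * (ι (z ℕ.+ k) ^ 3 * β))
        ≤⟨ *-monoˡ 0≤2 (*-mono (ι-nonneg (suc k)) ιk (*-nonneg (^-nonneg 3 (ι-nonneg (z ℕ.+ k))) β≥0)
            (*-monoʳ β≥0 (^-mono 3 (ι-nonneg (z ℕ.+ k)) ιY≤))) ⟩
      2ℚ * (2ℚ ^ suc t * ((2ℚ ^ t) ^ 3 * β))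
        ≡⟨ cong (λ x → 2ℚ * (2ℚ ^ suc t * (x * β))) (^-assoc 2ℚ t 3) ⟩
      2ℚ * (2ℚ ^ suc t * (2ℚ ^ (t ℕ.* 3) * β))
        ≡⟨ reorder 2ℚ (2ℚ ^ suc t) (2ℚ ^ (t ℕ.* 3)) β ⟩
      β * (2ℚ ^ suc (suc t) * 2ℚ ^ (t ℕ.* 3))
        ≡⟨ cong (β *_) (^-homo 2ℚ (suc (suc t)) (t ℕ.* 3)) ⟨
      β * 2ℚ ^ (suc (suc t) ℕ.+ t ℕ.* 3)
        ≤⟨ ½^*2^-≤1 (ℕ.≤-trans (ℕ.+-monoˡ-≤ (t ℕ.+ t ℕ.* 3) t≥2) (ℕ.≤-reflexive (collect t))) ⟩
      1ℚ ∎
      where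
      open ℚ.≤-Reasoning
      reorder : ∀ w x y b → w * (x * (y * b)) ≡ b * (w * x * y)
      reorder = solve-∀ ℚ-ring
      collect : ∀ x → x ℕ.+ (x ℕ.+ x ℕ.* 3) ≡ 5 ℕ.* x
      collect = ℕ-solve-∀
      ιk : ι (suc k) ≤ 2ℚ ^ suc t
      ιk = ℚ.≤-trans (ι-mono (ℕ.≤-trans (s≤s (ℕ.≤-trans (ℕ.m∸n≤m Y z) Y≤2^t))
          (ℕ.^-monoʳ-< 2 ℕ.≤-refl {t} {suc t} ℕ.≤-refl))) (ℚ.≤-reflexive (ι-2^ (suc t)))

    -- Prepares for up to Y primes dividing h: their factors 1 - 4 ρ^(deg P) can be restored at a
    -- total loss of at most 1/2, as 8 β^2 2^t ≤ 1.
    divisor-room : 2ℚ * (ι 4 * ρ ^ suc z * ι (z ℕ.+ k)) ≤ 1ℚ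
    divisor-room = begin
      2ℚ * (ι 4 * ρ ^ suc z * ι (z ℕ.+ k))       ≤⟨ *-monoˡ 0≤2
          (*-mono (*-nonneg (ι-nonneg 4) (^-nonneg (suc z) ρ≥0)) (*-monoˡ (ι-nonneg 4) ρ^z-small) (ι-nonneg (z ℕ.+ k)) ιY≤) ⟩
      2ℚ * (ι 4 * (β * β) * 2ℚ ^ t)              ≡⟨ cong₂ (λ x y → 2ℚ * (x * y * 2ℚ ^ t)) (ι-2^ 2) β²-def ⟩
      2ℚ * (2ℚ ^ 2 * ½ ^ (10 ℕ.* t) * 2ℚ ^ t)    ≡⟨ reorder (½ ^ (10 ℕ.* t)) (2ℚ ^ t) ⟩
      ½ ^ (10 ℕ.* t) * 2ℚ ^ (3 ℕ.+ t)            ≤⟨ ½^*2^-≤1 (ℕ.≤-trans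
          (ℕ.+-monoˡ-≤ t (ℕ.≤-trans (s≤s (s≤s (s≤s z≤n))) (ℕ.≤-trans 7≤t (ℕ.m≤n*m t 9)))) (ℕ.≤-reflexive (ℕ.+-comm (9 ℕ.* t) t))) ⟩
      1ℚ                                         ∎
      where
      open ℚ.≤-Reasoning
      reorder : ∀ b x → 2ℚ * (2ℚ * (2ℚ * 1ℚ) * b * x) ≡ b * (2ℚ * (2ℚ * (2ℚ * x)))
      reorder = solve-∀ ℚ-ring

    four-weight : ∀ P → 2ℚ * weight P ≡ ι 4 * ρ ^ degree P
    four-weight P = trans (sym (ℚ.*-assoc 2ℚ 2ℚ (ρ ^ degree P)))
        (cong (_* ρ ^ degree P) (trans (cong₂ _*_ (sym ι-2) (sym ι-2)) (sym (ι-* 2 2))))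

    2weight-bounds : All (λ P → 0ℚ ≤ 2ℚ * weight P × 2ℚ * weight P ≤ ι 4 * ρ ^ suc z) (primesBetween z k)
    2weight-bounds = All.map (λ {P} (lt , _) → *-nonneg 0≤2 (weight-nonneg P) ,
      ℚ.≤-trans (ℚ.≤-reflexive (four-weight P)) (*-monoˡ (ι-nonneg 4) (^-antimono ρ≥0 ρ≤1 lt))) (primesBetween-bounds z k)

    4ρ≤1 : ι 4 * ρ ^ suc z ≤ 1ℚ
    4ρ≤1 = begin
      x                          ≡⟨ trans (sym (ℚ.*-identityʳ x)) (cong (x *_) (sym ι-1)) ⟩
      x * ι 1                    ≤⟨ *-monoˡ x≥0 (ι-mono {1} (ℕ.≤-trans Y≥1 (ℕ.≤-reflexive (sym z+k≡Y)))) ⟩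
      x * ι (z ℕ.+ k)            ≤⟨ ≤-+ʳ (*-nonneg x≥0 (ι-nonneg (z ℕ.+ k))) ⟩
      x * ι (z ℕ.+ k) + x * ι (z ℕ.+ k) ≡⟨ double (x * ι (z ℕ.+ k)) ⟩
      2ℚ * (x * ι (z ℕ.+ k))     ≤⟨ divisor-room ⟩
      1ℚ                         ∎
      where
      open ℚ.≤-Reasoning
      x = ι 4 * ρ ^ suc z
      x≥0 : 0ℚ ≤ x
      x≥0 = *-nonneg (ι-nonneg 4) (^-nonneg (suc z) ρ≥0)
      double : ∀ a → a + a ≡ 2ℚ * a
      double = solve-∀ ℚ-ring

    factor-bounds : All (λ P → 0ℚ ≤ 1ℚ - 2ℚ * weight P) (primesBetween z k)
    factor-bounds = All.map (λ (_ , u) → ≤⇒0≤- (ℚ.≤-trans u 4ρ≤1)) 2weight-bounds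

  module _ (h : Poly) (d : ℕ) (dh : IsDegree h d) (d≤Y : d ℕ.≤ Y) where
    open Split z k h d dh n

    private
      X : Prime → ℚ
      X P = 1ℚ - 2ℚ * weight P

      W W′ : ℚ
      W = ∏ sieved X
      W′ = ∏ (primesBetween z k) X

      W≥0 : 0ℚ ≤ W
      W≥0 = ∏-nonneg (All.filter⁺ (λ P → ¬? (divides-h? P)) factor-bounds)

      removed : Prime → ℚ
      removed P = 2ℚ * weight P * [ divides-h? P ]

      W′-split : W′ ≡ W * ∏ (primesBetween z k) (λ P → 1ℚ - removed P)
      W′-split = trans (Product.⨁-cong (primesBetween z k) (λ P → go P (divides-h? P)))
        (trans (Product.⨁-distrib (primesBetween z k) _ _) (cong (_* ∏ (primesBetween z k) (λ P → 1ℚ - removed P))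
            (sym (Product.⨁-filter (λ P → ¬? (divides-h? P)) (primesBetween z k) X))))
        where
        go : ∀ P (A? : Dec (poly P ∣ h)) → X P ≡ (if does (¬? A?) then X P else 1ℚ) * (1ℚ - 2ℚ * weight P * [ A? ])
        go P (yes _) = identity (2ℚ * weight P)
          where
          identity : ∀ x → 1ℚ - x ≡ 1ℚ * (1ℚ - x * 1ℚ)
          identity = solve-∀ ℚ-ring
        go P (no _) = identity (2ℚ * weight P) (X P)
          where
          identity : ∀ x y → y ≡ y * (1ℚ - x * 0ℚ)
          identity = solve-∀ ℚ-ring

      removed-sum : ∑ (primesBetween z k) removed ≤ ι 4 * ρ ^ suc z * ι (z ℕ.+ k)
      removed-sum = begin
        ∑ (primesBetween z k) removed
          ≤⟨ ∑-mono (All.map (λ {P} (_ , u) → *-monoʳ (indicator-nonneg (divides-h? P)) u) 2weight-bounds) ⟩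
        ∑ (primesBetween z k) (λ P → ι 4 * ρ ^ suc z * [ divides-h? P ])
          ≡⟨ ∑-*ˡ (ι 4 * ρ ^ suc z) (primesBetween z k) _ ⟩
        ι 4 * ρ ^ suc z * D
          ≤⟨ *-monoˡ (*-nonneg (ι-nonneg 4) (^-nonneg (suc z) ρ≥0)) D≤ ⟩
        ι 4 * ρ ^ suc z * ι (z ℕ.+ k) ∎
        where
        open ℚ.≤-Reasoning
        D = ∑ (primesBetween z k) (λ P → [ divides-h? P ])
        all-divisors : ∀ Y′ → d ℕ.≤ Y′ → 1 ℕ.≤ Y′ → ∑ (primesBetween 0 Y′) (λ P → [ divides-h? P ]) ≤ ι d
        all-divisors (suc J) d≤ _ = prime-divisors J dh d≤
        d≤ : d ℕ.≤ z ℕ.+ k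
        d≤ = ℕ.≤-trans d≤Y (ℕ.≤-reflexive (sym z+k≡Y))
        D≤ : D ≤ ι (z ℕ.+ k)
        D≤ = begin
          D
            ≤⟨ ≤-+ʳ (∑-nonneg (primesBetween 0 z) (λ P → indicator-nonneg (divides-h? P))) ⟩
          D + ∑ (primesBetween 0 z) (λ P → [ divides-h? P ])
            ≡⟨ trans (sym (Sum.⨁-++ (primesBetween z k) (primesBetween 0 z) _))
                (cong (λ L → ∑ L (λ P → [ divides-h? P ])) (sym (primesBetween-+ z k))) ⟩
          ∑ (primesBetween 0 (z ℕ.+ k)) (λ P → [ divides-h? P ])
            ≤⟨ all-divisors (z ℕ.+ k) d≤ (ℕ.≤-trans Y≥1 (ℕ.≤-reflexive (sym z+k≡Y))) ⟩
          ι d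
            ≤⟨ ι-mono d≤ ⟩
          ι (z ℕ.+ k) ∎

      -- The sieve omits the primes dividing h while the Mertens bound is for all primes of the
      -- range. The missing factors have product at least 1/2 by Weierstrass' inequality.
      W≤2W′ : W ≤ 2ℚ * W′
      W≤2W′ = begin
        W                                                        ≡⟨ ℚ.*-identityʳ W ⟨
        W * 1ℚ                                                   ≤⟨ *-monoˡ W≥0 half ⟩
        W * (2ℚ * ∏ (primesBetween z k) (λ P → 1ℚ - removed P))  ≡⟨ swap W (∏ (primesBetween z k) (λ P → 1ℚ - removed P)) ⟩
        2ℚ * (W * ∏ (primesBetween z k) (λ P → 1ℚ - removed P))  ≡⟨ cong (2ℚ *_) W′-split ⟨
        2ℚ * W′                                                  ∎
        where
        open ℚ.≤-Reasoning
        swap : ∀ a b → a * (2ℚ * b) ≡ 2ℚ * (a * b)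
        swap = solve-∀ ℚ-ring
        removed-bounds : All (λ P → 0ℚ ≤ removed P × removed P ≤ 1ℚ) (primesBetween z k)
        removed-bounds = All.map (λ {P} (p , u) → *-nonneg p (indicator-nonneg (divides-h? P)) ,
          ℚ.≤-trans (*-≤ʳ p (indicator-≤1 (divides-h? P))) (ℚ.≤-trans u 4ρ≤1)) 2weight-bounds
        S = ∑ (primesBetween z k) removed
        half : 1ℚ ≤ 2ℚ * ∏ (primesBetween z k) (λ P → 1ℚ - removed P)
        half = begin
          1ℚ
              ≤⟨ +-nonneg-≤ (1ℚ - 2ℚ * S) (≤⇒0≤- (ℚ.≤-trans (*-monoˡ 0≤2 removed-sum) divisor-room)) (identity S) ⟩
          2ℚ * (1ℚ - S)                                           ≤⟨ *-monoˡ 0≤2 (∏-≥1-∑ removed-bounds) ⟩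
          2ℚ * ∏ (primesBetween z k) (λ P → 1ℚ - removed P)       ∎
          where
          identity : ∀ s → 1ℚ + (1ℚ - 2ℚ * s) ≡ 2ℚ * (1ℚ - s)
          identity = solve-∀ ℚ-ring

      T4 : ℚ
      T4 = ι t ^ 4

      -- The telescoped Euler product ends at z + k + 1 = Y + 1, the very number known to be at
      -- least 2^l. The 22 comes from 2 (z + 1) ≤ 2 (t + 10 t).
      main-bound : ∣ W ∣ * 2ℚ ^ (4 ℕ.* l) ≤ 2ℚ * ι 22 ^ 4 * T4
      main-bound = begin
        ∣ W ∣ * 2ℚ ^ (4 ℕ.* l)
          ≡⟨ cong₂ _*_ (ℚ.0≤p⇒∣p∣≡p W≥0) (trans (cong (2ℚ ^_) (ℕ.*-comm 4 l)) (sym (^-assoc 2ℚ l 4))) ⟩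
        W * (2ℚ ^ l) ^ 4
          ≤⟨ *-mono W≥0 W≤2W′ (^-nonneg 4 (^-nonneg l 0≤2)) (^-mono 4 (^-nonneg l 0≤2) 2^l≤) ⟩
        2ℚ * W′ * ι (z ℕ.+ suc k) ^ 4
          ≡⟨ ℚ.*-assoc 2ℚ W′ _ ⟩
        2ℚ * (W′ * ι (z ℕ.+ suc k) ^ 4)
          ≤⟨ *-monoˡ 0≤2 (mertens z k β≥0 ρ^z-small ε≥0 ℚ.≤-refl kε≤1 factor-bounds) ⟩
        2ℚ * (2ℚ * ι (suc z)) ^ 4
          ≤⟨ *-monoˡ 0≤2 (^-mono 4 (*-nonneg 0≤2 (ι-nonneg (suc z))) 2z≤22t) ⟩
        2ℚ * (ι 22 * ι t) ^ 4
          ≡⟨ cong (2ℚ *_) (^-distrib (ι 22) (ι t) 4) ⟩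
        2ℚ * (ι 22 ^ 4 * T4)
          ≡⟨ ℚ.*-assoc 2ℚ (ι 22 ^ 4) T4 ⟨
        2ℚ * ι 22 ^ 4 * T4 ∎
        where
        open ℚ.≤-Reasoning
        2^l≤ : 2ℚ ^ l ≤ ι (z ℕ.+ suc k)
        2^l≤ = ℚ.≤-trans (ℚ.≤-reflexive (sym (ι-2^ l))) (ι-mono
            (ℕ.≤-trans 2^l≤Y+1 (ℕ.≤-reflexive (trans (cong suc (sym z+k≡Y)) (sym (ℕ.+-suc z k))))))
        2z≤22t : 2ℚ * ι (suc z) ≤ ι 22 * ι t
        2z≤22t = ℚ.≤-trans (ℚ.≤-reflexive (trans (cong (_* ι (suc z)) (sym ι-2)) (sym (ι-* 2 (suc z)))))
          (ℚ.≤-trans (ι-mono (ℕ.≤-trans (ℕ.*-monoʳ-≤ 2 (ℕ.+-mono-≤ 1≤t z≤10t)) (ℕ.≤-reflexive (double t)))) (ℚ.≤-reflexive (ι-* 22 t)))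
          where
          double : ∀ x → 2 ℕ.* (x ℕ.+ 10 ℕ.* x) ≡ 22 ℕ.* x
          double = ℕ-solve-∀

      -- Explains the two parts of m in the decay estimate 2^m E ≤ a^(2 a): the part (t + 2)(2 a)
      -- cancels a^(2 a) exactly, since a = 2^(t+2), and the part 4 t gains the fourth power of 2^t.
      tail-bound : 2ℚ ^ suc r * elementary (suc r) sieved weight * 2ℚ ^ (4 ℕ.* l) ≤ 1ℚ
      tail-bound = begin
        2ℚ ^ suc r * elementary (suc r) sieved weight * 2ℚ ^ (4 ℕ.* l)
          ≡⟨ cong (λ j → 2ℚ ^ j * elementary j sieved weight * 2ℚ ^ (4 ℕ.* l)) suc-r ⟩
        E * 2ℚ ^ (4 ℕ.* l)
          ≤⟨ *-monoˡ E≥0 (^-mono-exp 1≤2 (ℕ.*-monoʳ-≤ 4 l≤t)) ⟩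
        E * 2ℚ ^ (4 ℕ.* t)
          ≤⟨ *-cancelˡ {c = 2ℚ ^ e} (^-pos e (ℚ.positive⁻¹ 2ℚ)) scaled ⟩
        1ℚ ∎
        where
        open ℚ.≤-Reasoning
        e = (t ℕ.+ 2) ℕ.* (2 ℕ.* a)
        E = 2ℚ ^ J * elementary J sieved weight
        weights≥0 : All (λ P → 0ℚ ≤ weight P) sieved
        weights≥0 = All.universal weight-nonneg sieved
        E≥0 : 0ℚ ≤ E
        E≥0 = *-nonneg (^-nonneg J 0≤2) (elementary-nonneg J weights≥0)
        weight-sum : 2ℚ * ∑ sieved weight ≤ ι a
        weight-sum = begin
          2ℚ * ∑ sieved weight                                     ≤⟨ *-monoˡ 0≤2 filtered ⟩
          2ℚ * ∑ (primesBetween z k) weight                        ≡⟨ cong (2ℚ *_) (∑-*ˡ 2ℚ (primesBetween z k) (λ P → ρ ^ degree P)) ⟩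
          2ℚ * (2ℚ * ∑ (primesBetween z k) (λ P → ρ ^ degree P))
              ≤⟨ *-monoˡ 0≤2 (*-monoˡ 0≤2 (ℚ.≤-trans (∑-reciprocals z k) (ℚ.≤-trans (ι-mono (ℕ.m≤n+m k z)) ιY≤))) ⟩
          2ℚ * (2ℚ * 2ℚ ^ t)                                       ≡⟨ trans (cong (2ℚ ^_) (ℕ.+-comm 2 t)) (sym (ι-2^ (t ℕ.+ 2))) ⟩
          ι a                                                      ∎
          where
          filtered : ∑ sieved weight ≤ ∑ (primesBetween z k) weight
          filtered = ℚ.≤-trans (ℚ.≤-reflexive (Sum.⨁-filter (λ P → ¬? (divides-h? P)) (primesBetween z k) weight))
            (∑-mono (All.universal (λ P → go P (¬? (divides-h? P))) (primesBetween z k)))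
            where
            go : ∀ {p} {A : Set p} P (A? : Dec A) → (if does A? then weight P else 0ℚ) ≤ weight P
            go P (yes _) = ℚ.≤-refl
            go P (no _)  = weight-nonneg P
        scaled : 2ℚ ^ e * (E * 2ℚ ^ (4 ℕ.* t)) ≤ 2ℚ ^ e * 1ℚ
        scaled = begin
          2ℚ ^ e * (E * 2ℚ ^ (4 ℕ.* t))          ≡⟨ reorder (2ℚ ^ e) E (2ℚ ^ (4 ℕ.* t)) ⟩
          (2ℚ ^ e * 2ℚ ^ (4 ℕ.* t)) * E          ≡⟨ cong (_* E) (^-homo 2ℚ e (4 ℕ.* t)) ⟨
          2ℚ ^ m * E                             ≤⟨ elementary-decay weights≥0 a weight-sum a>0 m ⟩
          ι a ^ (2 ℕ.* a)                        ≡⟨ trans (cong (_^ (2 ℕ.* a)) (ι-2^ (t ℕ.+ 2))) (^-assoc 2ℚ (t ℕ.+ 2) (2 ℕ.* a)) ⟩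
          2ℚ ^ e                                 ≡⟨ ℚ.*-identityʳ (2ℚ ^ e) ⟨
          2ℚ ^ e * 1ℚ                            ∎
          where
          reorder : ∀ x y w → x * (y * w) ≡ (x * w) * y
          reorder = solve-∀ ℚ-ring

      -- Here β^2 = 2^(-10 t) faces only 2^(5 t): one factor 2^t from Y and four from the target.
      error-bound : ρ ^ suc z * ι (z ℕ.+ k) * 2ℚ ^ (4 ℕ.* l) ≤ 1ℚ
      error-bound = begin
        ρ ^ suc z * ι (z ℕ.+ k) * 2ℚ ^ (4 ℕ.* l)
          ≤⟨ *-mono (*-nonneg (^-nonneg (suc z) ρ≥0) (ι-nonneg (z ℕ.+ k)))
               (*-mono (^-nonneg (suc z) ρ≥0) (ℚ.≤-trans ρ^z-small (ℚ.≤-reflexive β²-def)) (ι-nonneg (z ℕ.+ k)) ιY≤)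
               (^-nonneg (4 ℕ.* l) 0≤2) (^-mono-exp 1≤2 (ℕ.*-monoʳ-≤ 4 l≤t)) ⟩
        ½ ^ (10 ℕ.* t) * 2ℚ ^ t * 2ℚ ^ (4 ℕ.* t)
          ≡⟨ trans (ℚ.*-assoc (½ ^ (10 ℕ.* t)) (2ℚ ^ t) _) (cong (½ ^ (10 ℕ.* t) *_) (sym (^-homo 2ℚ t (4 ℕ.* t)))) ⟩
        ½ ^ (10 ℕ.* t) * 2ℚ ^ (5 ℕ.* t)
          ≤⟨ ½^*2^-≤1 (ℕ.*-monoˡ-≤ t (ℕ.m≤m+n 5 5)) ⟩
        1ℚ ∎
        where open ℚ.≤-Reasoning

    product-correlation : ∣ ∑ (monics n) (λ f → ∏ (primesBetween 0 (z ℕ.+ k)) (full f)) ∣ * 2ℚ ^ (4 ℕ.* l) ≤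
                          ι K * ι t ^ 4 * size n
    product-correlation = begin
      ∣ A ∣ * D
        ≤⟨ *-monoʳ D≥0 (ℚ.≤-trans (∣∣-triangle A B) (ℚ.+-mono-≤ (main-term r enough-room) difference)) ⟩
      (size n * (∣ W ∣ + 2ℚ * E) + size n * (ι 8 * (ρ ^ suc z * ι (z ℕ.+ k)))) * D
        ≡⟨ distribute (size n) ∣ W ∣ E (ι 8) (ρ ^ suc z * ι (z ℕ.+ k)) D ⟩
      size n * (∣ W ∣ * D + 2ℚ * (E * D) + ι 8 * (ρ ^ suc z * ι (z ℕ.+ k) * D))
        ≤⟨ *-monoˡ (size≥0 n) (ℚ.+-mono-≤ (ℚ.+-mono-≤ main-bound (*-monoˡ 0≤2 tail-bound)) (*-monoˡ (ι-nonneg 8) error-bound)) ⟩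
      size n * ((2ℚ * ι 22 ^ 4) * T4 + 2ℚ * 1ℚ + ι 8 * 1ℚ)
        ≤⟨ *-monoˡ (size≥0 n) (ℚ.+-mono-≤ (ℚ.+-monoʳ-≤ ((2ℚ * ι 22 ^ 4) * T4) (*-monoˡ 0≤2 T4≥1)) (*-monoˡ (ι-nonneg 8) T4≥1)) ⟩
      size n * ((2ℚ * ι 22 ^ 4) * T4 + 2ℚ * T4 + ι 8 * T4)
        ≡⟨ collect (size n) ((2ℚ * ι 22 ^ 4)) (ι 8) T4 ⟩
      ((2ℚ * ι 22 ^ 4) + 2ℚ + ι 8) * T4 * size n
        ≤⟨ *-monoʳ (size≥0 n) (*-monoʳ (^-nonneg 4 (ι-nonneg t)) ιK-large) ⟩
      ι K * T4 * size n ∎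
      where
      open ℚ.≤-Reasoning
      L = primesBetween 0 (z ℕ.+ k)
      A = ∑ (monics n) (λ f → ∏ L (full f))
      B = ∑ (monics n) (λ f → ∏ L (capped f))
      D = 2ℚ ^ (4 ℕ.* l)
      E = 2ℚ ^ suc r * elementary (suc r) sieved weight
      D≥0 : 0ℚ ≤ D
      D≥0 = ^-nonneg (4 ℕ.* l) 0≤2
      T4≥1 : 1ℚ ≤ T4
      T4≥1 = ^-≥1 4 (ℚ.≤-trans (ℚ.≤-reflexive (sym ι-1)) (ι-mono {1} {t} 1≤t))
      difference : ∣ A - B ∣ ≤ size n * (ι 8 * (ρ ^ suc z * ι (z ℕ.+ k)))
      difference = ℚ.≤-trans (ℚ.≤-reflexive (cong ∣_∣ (sym (∑-minus (monics n) _ _)))) (ℚ.≤-trans (∣∑∣-≤ (monics n) _)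
        (total-error (ℕ.≤-trans (s≤s z≤Y) Y<n) depth-room (ℕ.≤-trans d≤Y (ℕ.≤-reflexive (sym z+k≡Y)))
            (ℕ.≤-trans Y≥1 (ℕ.≤-reflexive (sym z+k≡Y)))))
      distribute : ∀ s w e c x D → (s * (w + 2ℚ * e) + s * (c * x)) * D ≡ s * (w * D + 2ℚ * (e * D) + c * (x * D))
      distribute = solve-∀ ℚ-ring
      collect : ∀ s a c T → s * (a * T + 2ℚ * T + c * T) ≡ (a + 2ℚ + c) * T * s
      collect = solve-∀ ℚ-ring

-- The correlation bound in natural numbers

module CorrelationBound {c ℓ : Level} (F : FiniteField c ℓ) where
  open Correlation F
  open import Data.Rational.Base using (_+_; _*_; _-_; -_; _≤_; _<_; ∣_∣)
  open RationalOrder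
  open RationalSums
  open Dyadic using (K; 2^24≤K; ι-2^)

  module _ (Y : ℕ) (lam : Poly → ℤ)
    (lam-cong : ∀ {f g} → f ≋ g → lam f ≡ lam g)
    (lam-unit : lam 1ₚ ≡ 1ℤ)
    (lam-multiplicative : ∀ {f g} → Monic f → Monic g → Coprime f g → lam (f *ₚ g) ≡ lam f ℤ.* lam g)
    (lam-small : ∀ {P d} t → MonicOfDegree d P → Irreducible P → 1 ℕ.≤ t → d ℕ.≤ Y → lam (P ^ₚ t) ≡ -1ℤ ℤ.^ t)
    (lam-large : ∀ {P d} t → MonicOfDegree d P → Irreducible P → 1 ℕ.≤ t → Y ℕ.< d → lam (P ^ₚ t) ≡ 1ℤ)
    (h : Poly) (d : ℕ) (dh : HasDegree h d) (d≤Y : d ℕ.≤ Y) (n : ℕ) (d<n : d ℕ.< n)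
    (l : ℕ) (2^l≤Y+1 : 2 ℕ.^ l ℕ.≤ suc Y) (Y≤2^l+1 : Y ℕ.≤ 2 ℕ.^ suc l) (large : 2 ℕ.^ (2 ℕ.^ l ℕ.∸ 1) ℕ.≤ n)
    where

    open Truncated Y lam lam-cong lam-unit lam-multiplicative lam-small lam-large

    private
      h-degree : IsDegree h d
      h-degree = mkDegree (proj₁ dh) (mkBelow (proj₂ dh))

      shifted-monic : ∀ {f} → IsMonic n f → IsMonic n (f ⊕ h)
      shifted-monic mf = monic-+-below mf (below-weaken d<n (IsDegree.bounded h-degree))

      total : ℤ
      total = sumOverMonics n (λ f → lam f ℤ.* lam (f +ₚ h))

      total-sum : fromℤ total ≡ ∑ (monics n) (λ f → μ f * μ (f ⊕ h))
      total-sum = trans (fromℤ-∑ (λ f → lam f ℤ.* lam (f +ₚ h)) (monics n))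
        (Sum.⨁-cong (monics n) (λ f → trans (fromℤ-* (lam f) (lam (f +ₚ h))) (cong (λ g → μ f * fromℤ (lam g)) (sym (⊕-def f h)))))

      trivial : ∣ fromℤ total ∣ ≤ size n
      trivial = begin
        ∣ fromℤ total ∣                                   ≡⟨ cong ∣_∣ total-sum ⟩
        ∣ ∑ (monics n) (λ f → μ f * μ (f ⊕ h)) ∣          ≤⟨ ∣∑∣-≤ (monics n) _ ⟩
        ∑ (monics n) (λ f → ∣ μ f * μ (f ⊕ h) ∣)          ≤⟨ ∑-mono (All.map (λ {f} mf → termwise f mf) (monics-monic n)) ⟩
        ∑ (monics n) (λ f → 1ℚ)                           ≡⟨ ∑-monics-1 n ⟩
        size n                                            ∎
        where
        open ℚ.≤-Reasoning
        termwise : ∀ f → IsMonic n f → ∣ μ f * μ (f ⊕ h) ∣ ≤ 1ℚ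
        termwise f mf = subst (_≤ 1ℚ) (sym (ℚ.∣p*q∣≡∣p∣*∣q∣ (μ f) (μ (f ⊕ h))))
            (*-≤1 (ℚ.0≤∣p∣ (μ f)) (∣μ∣≤1 mf) (∣μ∣≤1 (shifted-monic mf)))

      -- For l ≤ 6 the trivial bound q^n is enough, as 2^(4 l) ≤ 2^24 ≤ `K`; otherwise the sieve
      -- applies to the product form of λ.
      rational-bound : Dec (7 ℕ.≤ l) → ∣ fromℤ total ∣ * 2ℚ ^ (4 ℕ.* l) ≤ ι K * ι (suc l) ^ 4 * size n
      rational-bound (no l<7) = begin
        ∣ fromℤ total ∣ * 2ℚ ^ (4 ℕ.* l)         ≤⟨ *-mono (ℚ.0≤∣p∣ (fromℤ total)) trivial (^-nonneg (4 ℕ.* l) 0≤2) power-bound ⟩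
        size n * ι K                             ≡⟨ trans (ℚ.*-comm (size n) (ι K)) (cong (_* size n) (sym (ℚ.*-identityʳ (ι K)))) ⟩
        ι K * 1ℚ * size n                        ≤⟨ *-monoʳ (size≥0 n)
            (*-monoˡ (ι-nonneg K) (^-≥1 4 (ℚ.≤-trans (ℚ.≤-reflexive (sym ι-1)) (ι-mono {1} {suc l} (s≤s z≤n))))) ⟩
        ι K * ι (suc l) ^ 4 * size n             ∎
        where
        open ℚ.≤-Reasoning
        power-bound : 2ℚ ^ (4 ℕ.* l) ≤ ι K
        power-bound = ℚ.≤-trans (ℚ.≤-reflexive (sym (ι-2^ (4 ℕ.* l))))
          (ι-mono (ℕ.≤-trans (ℕ.^-monoʳ-≤ 2 (ℕ.*-monoʳ-≤ 4 (ℕ.s≤s⁻¹ (ℕ.≰⇒> l<7)))) 2^24≤K))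
      rational-bound (yes 7≤l) = subst (λ x → ∣ x ∣ * 2ℚ ^ (4 ℕ.* l) ≤ ι K * ι (suc l) ^ 4 * size n) (sym total-products)
        (product-correlation h d h-degree d≤Y)
        where
        open LargeParameters F l (suc l) Y n refl 7≤l 2^l≤Y+1 Y≤2^l+1 large using (z; k; z+k≡Y; Y<n; product-correlation)
        product-form : ∀ {f} → IsMonic n f → μ f ≡ ∏ (primesBetween 0 (z ℕ.+ k)) (χ n f)
        product-form {f} mf = trans (μ-product mf (ℕ.<⇒≤ Y<n)) (cong (λ y → ∏ (primesBetween 0 y) (χ n f)) (sym z+k≡Y))
        total-products : fromℤ total ≡ ∑ (monics n) (λ f → ∏ (primesBetween 0 (z ℕ.+ k)) (λ P → χ n f P * χ n (f ⊕ h) P))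
        total-products = trans total-sum (Sum.⨁-congAll (All.map (λ {f} mf →
          trans (cong₂ _*_ (product-form mf) (product-form (shifted-monic mf)))
            (sym (Product.⨁-distrib (primesBetween 0 (z ℕ.+ k)) (χ n f) (χ n (f ⊕ h))))) (monics-monic n)))

    -- Stated between natural numbers to be decidable, and with l as the only trace of y, so that
    -- the integer part Y does not appear in it.
    correlation-bound : ℤ.∣ sumOverMonics n (λ f → lam f ℤ.* lam (f +ₚ h)) ∣ ℕ.* 2 ℕ.^ (4 ℕ.* l) ℕ.≤ K ℕ.* suc l ℕ.^ 4 ℕ.* q ℕ.^ n
    correlation-bound = ι-cancel (begin
      ι (ℤ.∣ total ∣ ℕ.* 2 ℕ.^ (4 ℕ.* l))         ≡⟨ ι-* ℤ.∣ total ∣ (2 ℕ.^ (4 ℕ.* l)) ⟩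
      ι ℤ.∣ total ∣ * ι (2 ℕ.^ (4 ℕ.* l))         ≡⟨ cong₂ _*_ (sym (∣fromℤ∣ total)) (ι-2^ (4 ℕ.* l)) ⟩
      ∣ fromℤ total ∣ * 2ℚ ^ (4 ℕ.* l)            ≤⟨ rational-bound (7 ℕ.≤? l) ⟩
      ι K * ι (suc l) ^ 4 * size n                ≡⟨ cong (λ x → ι K * x * size n) (ι-^ (suc l) 4) ⟨
      ι K * ι (suc l ℕ.^ 4) * size n              ≡⟨ cong (_* size n) (ι-* K (suc l ℕ.^ 4)) ⟨
      ι (K ℕ.* suc l ℕ.^ 4) * size n              ≡⟨ ι-* (K ℕ.* suc l ℕ.^ 4) (q ℕ.^ n) ⟨
      ι (K ℕ.* suc l ℕ.^ 4 ℕ.* q ℕ.^ n)           ∎)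
      where open ℚ.≤-Reasoning

-- Rational bounds for the Riemann sums of the logarithm

module Logarithm where
  open import Data.Rational.Base using (_+_; _*_; _-_; -_; _≤_; _<_; ∣_∣)
  open RationalOrder
  open RationalSums

  ÷₀-* : ∀ p r → 0ℚ < r → (p ÷₀ r) * r ≡ p
  ÷₀-* p r r>0 with r ℚ.≟ 0ℚ
  ... | yes r≡0 = contradiction (sym r≡0) (ℚ.<⇒≢ r>0)
  ... | no  r≢0 = trans (ℚ.*-assoc p (ℚ.1/ r) r) (trans (cong (p *_) (ℚ.*-inverseˡ r)) (ℚ.*-identityʳ p))
    where instance _ = ℚ.≢-nonZero r≢0

  -- With D j = k + j (x - 1), the j-th summand is τ j = 1 - D j / D (j + 1), so that the products
  -- of the quotients D (j + 1) / D j telescope to D k / D 0 = x.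
  module RiemannSum (k : ℕ) (k>0 : 0 ℕ.< k) (x : ℚ) (x≥1 : 1ℚ ≤ x) where

    step : ℚ
    step = x - 1ℚ

    step≥0 : 0ℚ ≤ step
    step≥0 = ≤⇒0≤- x≥1

    D : ℕ → ℚ
    D j = ι k + ι j * step

    τ : ℕ → ℚ
    τ j = step ÷₀ D (suc j)

    partial : ℕ → ℚ
    partial j = ∑ (upTo j) τ

    D≥k : ∀ j → ι k ≤ D j
    D≥k j = ≤-+ʳ (*-nonneg (ι-nonneg j) step≥0)

    D>0 : ∀ j → 0ℚ < D j
    D>0 j = ℚ.<-≤-trans (ℚ.<-≤-trans (ι-pos 0) (ι-mono k>0)) (D≥k j)

    D-suc : ∀ j → D (suc j) ≡ D j + step
    D-suc j = trans (cong (λ y → ι k + y * step) (ι-suc j)) (identity (ι k) (ι j) step)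
      where
      identity : ∀ a j s → a + (1ℚ + j) * s ≡ a + j * s + s
      identity = solve-∀ ℚ-ring

    D-0 : D 0 ≡ ι k
    D-0 = trans (cong (λ y → ι k + y * step) ι-0) (trans (cong (λ y → ι k + y) (ℚ.*-zeroˡ step)) (ℚ.+-identityʳ (ι k)))

    D-k : D k ≡ ι k * x
    D-k = identity (ι k) x
      where
      identity : ∀ a x → a + a * (x - 1ℚ) ≡ a * x
      identity = solve-∀ ℚ-ring

    τ-D : ∀ j → τ j * D (suc j) ≡ step
    τ-D j = ÷₀-* step (D (suc j)) (D>0 (suc j))

    τ-gap : ∀ j → (1ℚ - τ j) * D (suc j) ≡ D j
    τ-gap j = trans (identity (τ j) (D (suc j))) (trans (cong (λ y → D (suc j) - y) (τ-D j))
        (trans (cong (_- step) (D-suc j)) (identity′ (D j) step)))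
      where
      identity : ∀ t d → (1ℚ - t) * d ≡ d - t * d
      identity = solve-∀ ℚ-ring
      identity′ : ∀ d s → d + s - s ≡ d
      identity′ = solve-∀ ℚ-ring

    τ≥0 : ∀ j → 0ℚ ≤ τ j
    τ≥0 j = *-cancelˡ (D>0 (suc j)) (ℚ.≤-trans (ℚ.≤-reflexive (ℚ.*-zeroʳ (D (suc j))))
      (ℚ.≤-trans step≥0 (ℚ.≤-reflexive (trans (sym (τ-D j)) (ℚ.*-comm (τ j) (D (suc j)))))))

    τ≤1 : ∀ j → τ j ≤ 1ℚ
    τ≤1 j = *-cancelˡ (D>0 (suc j)) (begin
      D (suc j) * τ j        ≡⟨ trans (ℚ.*-comm (D (suc j)) (τ j)) (τ-D j) ⟩
      step                   ≤⟨ ≤-+ʳ (ℚ.<⇒≤ (D>0 j)) ⟩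
      step + D j             ≡⟨ trans (ℚ.+-comm step (D j)) (sym (D-suc j)) ⟩
      D (suc j)              ≡⟨ ℚ.*-identityʳ (D (suc j)) ⟨
      D (suc j) * 1ℚ         ∎)
      where open ℚ.≤-Reasoning

    partial-suc : ∀ j → partial (suc j) ≡ partial j + τ j
    partial-suc j = trans (cong (λ xs → ∑ xs τ) (sym (upTo-∷ʳ j)))
      (trans (Sum.⨁-++ (upTo j) (j ∷ []) τ) (cong (λ y → partial j + y) (ℚ.+-identityʳ (τ j))))

    partial≥0 : ∀ j → 0ℚ ≤ partial j
    partial≥0 j = ∑-nonneg (upTo j) τ≥0

    module Upper (m : ℕ) (σ : ℚ) (σ≥0 : 0ℚ ≤ σ) (σ≤1 : σ ≤ 1ℚ) (σm : ι m * σ ≡ 1ℚ) where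

      private
        -- As m σ = 1, Bernoulli gives 1 - τ ≤ (1 - σ τ)^m, and (1 + σ (p + τ))(1 - σ τ) ≤ 1 + σ p.
        one-step : ∀ j → (1ℚ + σ * partial (suc j)) ^ m * (1ℚ - τ j) ≤ (1ℚ + σ * partial j) ^ m
        one-step j = begin
          (1ℚ + σ * partial (suc j)) ^ m * (1ℚ - τ j)
              ≡⟨ cong (λ y → (1ℚ + σ * partial (suc j)) ^ m * (1ℚ - y))
                  (trans (sym (ℚ.*-identityˡ (τ j))) (trans (cong (_* τ j) (sym σm)) (ℚ.*-assoc (ι m) σ (τ j)))) ⟩
          (1ℚ + σ * partial (suc j)) ^ m * (1ℚ - ι m * (σ * τ j))
              ≤⟨ *-monoˡ (^-nonneg m u≥0) (bernoulli-neg m (*-≤1 σ≥0 σ≤1 (τ≤1 j))) ⟩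
          (1ℚ + σ * partial (suc j)) ^ m * (1ℚ - σ * τ j) ^ m      ≡⟨ ^-distrib (1ℚ + σ * partial (suc j)) (1ℚ - σ * τ j) m ⟨
          ((1ℚ + σ * partial (suc j)) * (1ℚ - σ * τ j)) ^ m        ≤⟨ ^-mono m (*-nonneg u≥0 (≤⇒0≤- (*-≤1 σ≥0 σ≤1 (τ≤1 j)))) inner ⟩
          (1ℚ + σ * partial j) ^ m                                 ∎
          where
          open ℚ.≤-Reasoning
          u≥0 : 0ℚ ≤ 1ℚ + σ * partial (suc j)
          u≥0 = +-nonneg 0≤1 (*-nonneg σ≥0 (partial≥0 (suc j)))
          στ≥0 : 0ℚ ≤ σ * τ j
          στ≥0 = *-nonneg σ≥0 (τ≥0 j)
          inner : (1ℚ + σ * partial (suc j)) * (1ℚ - σ * τ j) ≤ 1ℚ + σ * partial j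
          inner = +-nonneg-≤ (σ * τ j * (σ * partial j) + σ * τ j * (σ * τ j))
            (+-nonneg (*-nonneg στ≥0 (*-nonneg σ≥0 (partial≥0 j))) (*-nonneg στ≥0 στ≥0))
            (trans (cong (λ p → (1ℚ + σ * p) * (1ℚ - σ * τ j) + (σ * τ j * (σ * partial j) + σ * τ j * (σ * τ j)))
                (partial-suc j)) (identity σ (partial j) (τ j)))
            where
            identity : ∀ s p t → (1ℚ + s * (p + t)) * (1ℚ - s * t) + (s * t * (s * p) + s * t * (s * t)) ≡ 1ℚ + s * p
            identity = solve-∀ ℚ-ring

        invariant : ∀ j → (1ℚ + σ * partial j) ^ m * ι k ≤ D j
        invariant zero = ℚ.≤-reflexive (trans (cong (_* ι k) (trans
            (cong (_^ m) (trans (cong (λ y → 1ℚ + y) (ℚ.*-zeroʳ σ)) (ℚ.+-identityʳ 1ℚ))) (1^ m)))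
                (trans (ℚ.*-identityˡ (ι k)) (sym D-0)))
        invariant (suc j) = *-cancelˡ (D>0 j) (begin
          D j * (u′ * ι k)                              ≡⟨ cong (_* (u′ * ι k)) (τ-gap j) ⟨
          (1ℚ - τ j) * D (suc j) * (u′ * ι k)           ≡⟨ reorder (1ℚ - τ j) (D (suc j)) u′ (ι k) ⟩
          u′ * (1ℚ - τ j) * (ι k * D (suc j))           ≤⟨ *-monoʳ (*-nonneg (ι-nonneg k) (ℚ.<⇒≤ (D>0 (suc j)))) (one-step j) ⟩
          u * (ι k * D (suc j))                         ≡⟨ ℚ.*-assoc u (ι k) (D (suc j)) ⟨
          u * ι k * D (suc j)                           ≤⟨ *-monoʳ (ℚ.<⇒≤ (D>0 (suc j))) (invariant j) ⟩
          D j * D (suc j)                               ∎)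
          where
          open ℚ.≤-Reasoning
          u = (1ℚ + σ * partial j) ^ m
          u′ = (1ℚ + σ * partial (suc j)) ^ m
          reorder : ∀ a b c d → a * b * (c * d) ≡ c * a * (d * b)
          reorder = solve-∀ ℚ-ring

      -- A rational form of s ≤ log x for the Riemann sum s, since (1 + s/m)^m approximates e^s from
      -- below.
      upper : (1ℚ + σ * partial k) ^ m ≤ x
      upper = *-cancelˡ (ℚ.<-≤-trans (ι-pos 0) (ι-mono k>0)) (ℚ.≤-trans (ℚ.≤-reflexive (ℚ.*-comm (ι k) _))
          (ℚ.≤-trans (invariant k) (ℚ.≤-reflexive D-k)))

    module Lower (m : ℕ) (σ : ℚ) (σ≥0 : 0ℚ ≤ σ) (σm : ι m * σ ≡ 1ℚ) (step≤k : step ≤ ι k) where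

      private
        u : ℕ → ℚ
        u j = 1ℚ - 2ℚ * (σ * partial j)

        invariant : ∀ j → 0ℚ ≤ u j → u j ^ m * D j ≤ ι k
        invariant zero _ = ℚ.≤-reflexive (trans (cong (_* D 0)
            (trans (cong (_^ m) (trans (cong (λ y → 1ℚ - 2ℚ * y) (ℚ.*-zeroʳ σ)) refl)) (1^ m))) (trans (ℚ.*-identityˡ (D 0)) D-0))
        invariant (suc j) u′≥0 = begin
          u (suc j) ^ m * D (suc j)                        ≤⟨ *-monoˡ (^-nonneg m u′≥0) D-growth ⟩
          u (suc j) ^ m * ((1ℚ + 2ℚ * τ j) * D j)          ≡⟨ ℚ.*-assoc (u (suc j) ^ m) (1ℚ + 2ℚ * τ j) (D j) ⟨
          u (suc j) ^ m * (1ℚ + 2ℚ * τ j) * D j            ≤⟨ *-monoʳ (ℚ.<⇒≤ (D>0 j)) power-step ⟩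
          u j ^ m * D j                                    ≤⟨ invariant j u≥0 ⟩
          ι k                                              ∎
          where
          open ℚ.≤-Reasoning
          η = 2ℚ * (σ * τ j)
          η≥0 : 0ℚ ≤ η
          η≥0 = *-nonneg 0≤2 (*-nonneg σ≥0 (τ≥0 j))
          u-suc : u (suc j) ≡ u j - η
          u-suc = trans (cong (λ p → 1ℚ - 2ℚ * (σ * p)) (partial-suc j)) (identity σ (partial j) (τ j))
            where
            identity : ∀ s p t → 1ℚ - 2ℚ * (s * (p + t)) ≡ 1ℚ - 2ℚ * (s * p) - 2ℚ * (s * t)
            identity = solve-∀ ℚ-ring
          u≥0 : 0ℚ ≤ u j
          u≥0 = ℚ.≤-trans u′≥0 (ℚ.≤-trans (ℚ.≤-reflexive u-suc) (+-nonneg-≤ η η≥0 (identity (u j) η)))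
            where
            identity : ∀ a e → a - e + e ≡ a
            identity = solve-∀ ℚ-ring
          u≤1 : u j ≤ 1ℚ
          u≤1 = +-nonneg-≤ (2ℚ * (σ * partial j)) (*-nonneg 0≤2 (*-nonneg σ≥0 (partial≥0 j))) (identity (2ℚ * (σ * partial j)))
            where
            identity : ∀ a → 1ℚ - a + a ≡ 1ℚ
            identity = solve-∀ ℚ-ring
          inner : u (suc j) * (1ℚ + η) ≤ u j
          inner = begin
            u (suc j) * (1ℚ + η)     ≡⟨ cong (_* (1ℚ + η)) u-suc ⟩
            (u j - η) * (1ℚ + η)     ≤⟨ +-nonneg-≤ ((1ℚ - u j) * η + η * η)
                (+-nonneg (*-nonneg (≤⇒0≤- u≤1) η≥0) (*-nonneg η≥0 η≥0)) (identity (u j) η) ⟩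
            u j                      ∎
            where
            identity : ∀ a e → (a - e) * (1ℚ + e) + ((1ℚ - a) * e + e * e) ≡ a
            identity = solve-∀ ℚ-ring
          power-step : u (suc j) ^ m * (1ℚ + 2ℚ * τ j) ≤ u j ^ m
          power-step = begin
            u (suc j) ^ m * (1ℚ + 2ℚ * τ j)          ≡⟨ cong (λ y → u (suc j) ^ m * (1ℚ + 2ℚ * y))
                (trans (sym (ℚ.*-identityˡ (τ j))) (cong (_* τ j) (sym σm))) ⟩
            u (suc j) ^ m * (1ℚ + 2ℚ * (ι m * σ * τ j)) ≡⟨ cong (λ y → u (suc j) ^ m * (1ℚ + y)) (identity (ι m) σ (τ j)) ⟩
            u (suc j) ^ m * (1ℚ + ι m * η)           ≤⟨ *-monoˡ (^-nonneg m u′≥0) (bernoulli m (+-nonneg 0≤1 η≥0)) ⟩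
            u (suc j) ^ m * (1ℚ + η) ^ m             ≡⟨ ^-distrib (u (suc j)) (1ℚ + η) m ⟨
            (u (suc j) * (1ℚ + η)) ^ m               ≤⟨ ^-mono m (*-nonneg u′≥0 (+-nonneg 0≤1 η≥0)) inner ⟩
            u j ^ m                                  ∎
            where
            identity : ∀ a s t → 2ℚ * (a * s * t) ≡ a * (2ℚ * (s * t))
            identity = solve-∀ ℚ-ring
          -- Since `step` ≤ k ≤ D j, the quotient D (j + 1) / D j is at most 2; this is the only
          -- loss in the lower bound.
          D-growth : D (suc j) ≤ (1ℚ + 2ℚ * τ j) * D j
          D-growth = begin
            D (suc j)                                  ≡⟨ D-suc j ⟩
            D j + step                                 ≡⟨ cong (λ y → D j + y) (τ-D j) ⟨
            D j + τ j * D (suc j)                      ≡⟨ cong (λ y → D j + τ j * y) (D-suc j) ⟩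
            D j + τ j * (D j + step)                   ≤⟨ ℚ.+-monoʳ-≤ (D j)
                (*-monoˡ (τ≥0 j) (ℚ.+-monoʳ-≤ (D j) (ℚ.≤-trans step≤k (D≥k j)))) ⟩
            D j + τ j * (D j + D j)                    ≡⟨ identity (D j) (τ j) ⟩
            (1ℚ + 2ℚ * τ j) * D j                      ∎
            where
            identity : ∀ d t → d + t * (d + d) ≡ (1ℚ + 2ℚ * t) * d
            identity = solve-∀ ℚ-ring

      -- A rational form of log x ≤ 2 s. Right endpoints underestimate the integral, but by at most
      -- a factor 2 once `step` ≤ k.
      lower : 0ℚ ≤ u k → u k ^ m * x ≤ 1ℚ
      lower h = *-cancelˡ (ℚ.<-≤-trans (ι-pos 0) (ι-mono k>0)) (begin
        ι k * (u k ^ m * x)     ≡⟨ reorder (ι k) (u k ^ m) x ⟩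
        u k ^ m * (ι k * x)     ≡⟨ cong (u k ^ m *_) D-k ⟨
        u k ^ m * D k           ≤⟨ invariant k h ⟩
        ι k                     ≡⟨ ℚ.*-identityʳ (ι k) ⟨
        ι k * 1ℚ                ∎)
        where
        open ℚ.≤-Reasoning
        reorder : ∀ a b c → a * (b * c) ≡ b * (a * c)
        reorder = solve-∀ ℚ-ring

    logSum-partial : logSum k x ≡ partial k
    logSum-partial = trans (unfold (upTo k)) (Sum.⨁-cong (upTo k)
        (λ i → cong (step ÷₀_) (sym (cong₂ (λ a b → a + b * step) (ι-def k) (ι-def (suc i))))))
      where
      unfold : ∀ xs → foldr _+_ 0ℚ (map (λ i → step ÷₀ ((+ k ℚ./ 1) + (+ suc i ℚ./ 1) * step)) xs) ≡ ∑ xs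
          (λ i → step ÷₀ ((+ k ℚ./ 1) + (+ suc i ℚ./ 1) * step))
      unfold []       = refl
      unfold (i ∷ xs) = cong (λ y → step ÷₀ ((+ k ℚ./ 1) + (+ suc i ℚ./ 1) * step) + y) (unfold xs)

  inverse-of : ∀ m → 0 ℕ.< m → ∃[ σ ] 0ℚ ≤ σ × σ ≤ 1ℚ × ι m * σ ≡ 1ℚ
  inverse-of m m>0 = σ , σ≥0 , σ≤1 , ℚ.*-inverseʳ (ι m) {{nz}}
    where
    ιm>0 : 0ℚ < ι m
    ιm>0 = ℚ.<-≤-trans (ι-pos 0) (ι-mono m>0)
    nz = ℚ.pos⇒nonZero (ι m) {{ℚ.positive ιm>0}}
    σ = ℚ.1/_ (ι m) {{nz}}
    σ≥0 : 0ℚ ≤ σ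
    σ≥0 = ℚ.<⇒≤ (ℚ.positive⁻¹ σ {{ℚ.1/pos⇒pos (ι m) {{ℚ.positive ιm>0}}}})
    σ≤1 : σ ≤ 1ℚ
    σ≤1 = ℚ.≤-trans (ℚ.≤-reflexive (trans (sym (ℚ.*-identityˡ σ)) (cong (_* σ) (sym ι-1))))
      (ℚ.≤-trans (*-monoʳ σ≥0 (ι-mono m>0)) (ℚ.≤-reflexive (ℚ.*-inverseʳ (ι m) {{nz}})))

  -- Were the sum at least m, the base 1 + s/m would be at least 2, and `upper` would give 2^m ≤ x.
  logSum-upper : ∀ {k x m} → 0 ℕ.< k → 0 ℕ.< m → 1ℚ ≤ x → x < 2ℚ ^ m → logSum k x ≤ ι m
  logSum-upper {k} {x} {m} k>0 m>0 x≥1 x<2^m with inverse-of m m>0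
  ... | σ , σ≥0 , σ≤1 , σm with ℚ.≤-total (partial k) (ι m)
    where open RiemannSum k k>0 x x≥1
  ...   | inj₁ h = ℚ.≤-trans (ℚ.≤-reflexive (RiemannSum.logSum-partial k k>0 x x≥1)) h
  ...   | inj₂ h = contradiction (ℚ.<-≤-trans x<2^m (ℚ.≤-trans (^-mono m 0≤2 base) upper)) (ℚ.<-irrefl refl)
    where
    open RiemannSum k k>0 x x≥1
    open Upper m σ σ≥0 σ≤1 σm
    base : 2ℚ ≤ 1ℚ + σ * partial k
    base = ℚ.+-monoʳ-≤ 1ℚ (ℚ.≤-trans (ℚ.≤-reflexive (trans (sym σm) (ℚ.*-comm (ι m) σ))) (*-monoˡ σ≥0 h))

  -- The case m = 1 of `upper`.
  logSum-≤ : ∀ {k x} → 0 ℕ.< k → 1ℚ ≤ x → 1ℚ + logSum k x ≤ x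
  logSum-≤ {k} {x} k>0 x≥1 = ℚ.≤-trans
    (ℚ.≤-reflexive (trans (cong (λ y → 1ℚ + y) logSum-partial) (identity (partial k))))
    (Upper.upper 1 1ℚ 0≤1 ℚ.≤-refl (trans (ℚ.*-identityʳ (ι 1)) ι-1))
    where
    open RiemannSum k k>0 x x≥1
    identity : ∀ p → 1ℚ + p ≡ (1ℚ + 1ℚ * p) * 1ℚ
    identity = solve-∀ ℚ-ring

  3/2 : ℚ
  3/2 = + 3 ℚ./ 2

  2/3 : ℚ
  2/3 = + 2 ℚ./ 3

  1/3 : ℚ
  1/3 = + 1 ℚ./ 3

  -- If 6 s ≤ m, then 1 - 2 s/m ≥ 2/3, and `lower` gives x ≤ (3/2)^m. The choice of 6 makes this
  -- base rational.
  logSum-lower : ∀ {k x m} → 0 ℕ.< k → 0 ℕ.< m → 1ℚ ≤ x → x ≤ ι k → 3/2 ^ m < x → ι m ≤ ι 6 * logSum k x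
  logSum-lower {k} {x} {m} k>0 m>0 x≥1 x≤k big with inverse-of m m>0
  ... | σ , σ≥0 , _ , σm with ℚ.≤-total (ι m) (ι 6 * logSum k x)
  ...   | inj₁ h = h
  ...   | inj₂ h = contradiction (ℚ.<-≤-trans big small) (ℚ.<-irrefl refl)
    where
    open RiemannSum k k>0 x x≥1
    open ℚ.≤-Reasoning
    step≤k : step ≤ ι k
    step≤k = ℚ.≤-trans (+-nonneg-≤ 1ℚ 0≤1 (identity x)) x≤k
      where
      identity : ∀ x → x - 1ℚ + 1ℚ ≡ x
      identity = solve-∀ ℚ-ring
    open Lower m σ σ≥0 σm step≤k
    3σp≤ : ι 6 * (σ * partial k) ≤ 1ℚ
    3σp≤ = begin
      ι 6 * (σ * partial k)       ≡⟨ reorder (ι 6) σ (partial k) ⟩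
      ι 6 * partial k * σ         ≡⟨ cong (λ y → ι 6 * y * σ) logSum-partial ⟨
      ι 6 * logSum k x * σ        ≤⟨ *-monoʳ σ≥0 h ⟩
      ι m * σ                     ≡⟨ σm ⟩
      1ℚ                          ∎
      where
      reorder : ∀ a b c → a * (b * c) ≡ a * c * b
      reorder = solve-∀ ℚ-ring
    2/3≤ : 2/3 ≤ 1ℚ - 2ℚ * (σ * partial k)
    2/3≤ = 0≤-⇒≤ (ℚ.≤-trans (*-nonneg {1/3} (ℚ.≤ᵇ⇒≤ _) (≤⇒0≤- 3σp≤))
      (ℚ.≤-reflexive (trans (cong (λ y → 1/3 * (1ℚ - y * (σ * partial k))) (ι-def 6)) (identity (σ * partial k)))))
      where
      identity : ∀ a → 1/3 * (1ℚ - (+ 6 ℚ./ 1) * a) ≡ 1ℚ - 2ℚ * a - 2/3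
      identity = solve-∀ ℚ-ring
    small : x ≤ 3/2 ^ m
    small = *-cancelˡ {c = 2/3 ^ m} (^-pos m (ℚ.positive⁻¹ 2/3)) (begin
      2/3 ^ m * x                                 ≤⟨ *-monoʳ (ℚ.≤-trans 0≤1 x≥1) (^-mono m (ℚ.≤ᵇ⇒≤ _) 2/3≤) ⟩
      (1ℚ - 2ℚ * (σ * partial k)) ^ m * x         ≤⟨ lower (ℚ.≤-trans (ℚ.≤ᵇ⇒≤ _) 2/3≤) ⟩
      1ℚ                                          ≡⟨ 1^ m ⟨
      (2/3 * 3/2) ^ m                             ≡⟨ ^-distrib 2/3 3/2 m ⟩
      2/3 ^ m * 3/2 ^ m                           ∎)

-- Comparing a Cauchy sequence with integers and powers of 2

module RealComparison where
  open import Data.Rational.Base using (_+_; _*_; _-_; -_; _≤_; _<_; ∣_∣; ½)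
  open RationalOrder
  open Logarithm using (3/2)
  open Dyadic using (K; 2^24≤K)

  ⅛ ¼ ¾ : ℚ
  ⅛ = + 1 ℚ./ 8
  ¼ = + 1 ℚ./ 4
  ¾ = + 3 ℚ./ 4

  0<⅛ : 0ℚ < ⅛
  0<⅛ = ℚ.positive⁻¹ ⅛

  halve-pos : ∀ {ε} → 0ℚ < ε → 0ℚ < ε * ½
  halve-pos {ε} ε>0 = ℚ.≤-<-trans (ℚ.≤-reflexive (sym (ℚ.*-zeroʳ ε))) (ℚ.*-monoʳ-<-pos ε {{ℚ.positive ε>0}} (ℚ.positive⁻¹ ½))

  fromℕ-ι : ∀ n k → fromℕ n k ≡ ι n
  fromℕ-ι n k = sym (ι-def n)

  -≤⇒≤+ : ∀ {a b e} → a - b ≤ e → a ≤ b + e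
  -≤⇒≤+ {a} {b} {e} h = ℚ.≤-trans (ℚ.≤-reflexive (identity a b)) (ℚ.+-monoʳ-≤ b h)
    where
    identity : ∀ a b → a ≡ b + (a - b)
    identity = solve-∀ ℚ-ring

  -- At precision e = ε/4, comparing d with y N + 3 e is a decision between rationals: one outcome
  -- gives d ≤ y k + ε, the other leaves the gap e that makes y < d.
  ≮ʳ⇒≥ʳ : ∀ y → IsCauchy y → ∀ d → ¬ (y <ʳ fromℕ d) → fromℕ d ≤ʳ y
  ≮ʳ⇒≥ʳ y cauchy d ¬lt ε ε>0 = decide (ℚ.≤-total (ι d) (y N + (e + e + e)))
    where
    e = ε * ½ * ½
    e>0 : 0ℚ < e
    e>0 = halve-pos (halve-pos ε>0)
    N = proj₁ (cauchy e e>0)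
    close : ∀ i j → N ℕ.≤ i → N ℕ.≤ j → y i ≤ y j + e
    close i j hi hj = -≤⇒≤+ (ℚ.≤-trans (≤-∣∣ (y i - y j)) (proj₂ (cauchy e e>0) i j hi hj))
    decide : ι d ≤ y N + (e + e + e) ⊎ y N + (e + e + e) ≤ ι d → ∃[ M ] (∀ k → M ℕ.≤ k → fromℕ d k ≤ y k + ε)
    decide (inj₁ h) = N , λ k N≤k → ℚ.≤-trans (ℚ.≤-reflexive (fromℕ-ι d k)) (ℚ.≤-trans h
      (ℚ.≤-trans (ℚ.+-monoˡ-≤ (e + e + e) (close N k ℕ.≤-refl N≤k)) (ℚ.≤-reflexive (identity (y k) ε))))
      where
      identity : ∀ a x → a + x * ½ * ½ + (x * ½ * ½ + x * ½ * ½ + x * ½ * ½) ≡ a + x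
      identity = solve-∀ ℚ-ring
    decide (inj₂ h) = contradiction (e , e>0 , N , λ k N≤k → ℚ.≤-trans (ℚ.+-monoˡ-≤ e (close k N N≤k ℕ.≤-refl))
      (ℚ.≤-trans (+-nonneg-≤ e (ℚ.<⇒≤ e>0) (identity (y N) e)) (ℚ.≤-trans h (ℚ.≤-reflexive (sym (fromℕ-ι d k)))))) ¬lt
      where
      identity : ∀ a e → a + e + e + e ≡ a + (e + e + e)
      identity = solve-∀ ℚ-ring

  ≤ʳ-trans-ℕ : ∀ d m y → d ℕ.≤ m → fromℕ m ≤ʳ y → fromℕ d ≤ʳ y
  ≤ʳ-trans-ℕ d m y d≤m h ε ε>0 = let (N , hN) = h ε ε>0 in N , λ k N≤k →
    ℚ.≤-trans (subst₂ _≤_ (sym (fromℕ-ι d k)) (sym (fromℕ-ι m k)) (ι-mono d≤m)) (hN k N≤k)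

  <ʳ-trans-ℕ : ∀ d m y → m ℕ.≤ d → y <ʳ fromℕ m → y <ʳ fromℕ d
  <ʳ-trans-ℕ d m y m≤d (ε , ε>0 , N , hN) = ε , ε>0 , N , λ k N≤k →
    ℚ.≤-trans (hN k N≤k) (subst₂ _≤_ (sym (fromℕ-ι m k)) (sym (fromℕ-ι d k)) (ι-mono m≤d))

  ≤ʳ-<ʳ-ℕ : ∀ d m y → fromℕ d ≤ʳ y → y <ʳ fromℕ m → d ℕ.< m
  ≤ʳ-<ʳ-ℕ d m y h (ε , ε>0 , N′ , hN′) with suc d ℕ.≤? m
  ... | yes lt = lt
  ... | no ¬lt = contradiction d<d (ℚ.<-irrefl refl)
    where
    e = ε * ½
    e>0 : 0ℚ < e
    e>0 = halve-pos ε>0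
    N = proj₁ (h e e>0)
    k = N ℕ.⊔ N′
    open ℚ.≤-Reasoning
    d<d : ι d < ι d
    d<d = begin-strict
      ι d                ≡⟨ fromℕ-ι d k ⟨
      fromℕ d k          ≤⟨ proj₂ (h e e>0) k (ℕ.m≤m⊔n N N′) ⟩
      y k + e            <⟨ ℚ.+-monoʳ-< (y k) (ℚ.≤-<-trans (ℚ.≤-reflexive (sym (ℚ.+-identityʳ e)))
          (ℚ.<-≤-trans (ℚ.+-monoʳ-< e e>0) (ℚ.≤-reflexive (identity ε)))) ⟩
      y k + ε            ≤⟨ hN′ k (ℕ.m≤n⊔m N N′) ⟩
      fromℕ m k          ≡⟨ fromℕ-ι m k ⟩
      ι m                ≤⟨ ι-mono (ℕ.s≤s⁻¹ (ℕ.≰⇒> ¬lt)) ⟩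
      ι d                ∎
      where
      identity : ∀ x → x * ½ + x * ½ ≡ x
      identity = solve-∀ ℚ-ring

  -- Constructively the integer part of a real number exists only up to double negation.
  integer-part : ∀ y → IsCauchy y → fromℕ 2 ≤ʳ y → ∀ B → y <ʳ fromℕ B →
                 ¬ ¬ (∃[ Y ] (∀ d → d ℕ.≤ Y → fromℕ d ≤ʳ y) × (∀ d → Y ℕ.< d → y <ʳ fromℕ d))
  integer-part y cauchy y≥2 zero    y<0 = contradiction (≤ʳ-<ʳ-ℕ 2 0 y y≥2 y<0) λ ()
  integer-part y cauchy y≥2 (suc B) y<B none = ¬¬y<B λ y<B′ → integer-part y cauchy y≥2 B y<B′ none
    where
    -- If y < B is refuted, B itself is the integer part, so the upper bound can be lowered under
    -- the double negation.
    ¬¬y<B : ¬ ¬ (y <ʳ fromℕ B)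
    ¬¬y<B ¬y<B = none (B , (λ d d≤B → ≤ʳ-trans-ℕ d B y d≤B (≮ʳ⇒≥ʳ y cauchy B ¬y<B)) , λ d B<d → <ʳ-trans-ℕ d (suc B) y B<d y<B)

  -- Between integers an error below 1 disappears. All approximations of y in one estimate are kept
  -- within 3/4 in total.
  ι-cancel-¾ : ∀ {a b} → ι a ≤ ι b + ¾ → a ℕ.≤ b
  ι-cancel-¾ {a} {b} h with a ℕ.≤? b
  ... | yes le = le
  ... | no ¬le = contradiction (ℚ.<-≤-trans (ℚ.+-monoʳ-< (ι b) ¾<1) (ℚ.≤-trans
      (ℚ.≤-reflexive (trans (ℚ.+-comm (ι b) 1ℚ) (sym (ι-suc b)))) (ℚ.≤-trans (ι-mono (ℕ.≰⇒> ¬le)) h))) (ℚ.<-irrefl refl)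
    where
    ¾<1 : ¾ < 1ℚ
    ¾<1 = ℚ.+-monoʳ-< ¾ (ℚ.positive⁻¹ ¼)

  -- The search compares rationals only. It starts from 2, so the exponent of the lower end is at
  -- least 1.
  dyadic-bracket : ∀ b {x} → ι 2 ≤ x → x ≤ ι (2 ℕ.^ suc b) →
                   ∃[ l ] ι (2 ℕ.^ suc l) ≤ x × x ≤ ι (2 ℕ.^ suc (suc l))
  dyadic-bracket zero    x≥2 x≤ = 0 , x≥2 , ℚ.≤-trans x≤ (ι-mono (ℕ.≤ᵇ⇒≤ 2 4 _))
  dyadic-bracket (suc b) {x} x≥2 x≤ with ℚ.≤-total x (ι (2 ℕ.^ suc b))
  ... | inj₁ x≤′ = dyadic-bracket b x≥2 x≤′
  ... | inj₂ x≥  = b , x≥ , x≤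

  archimedean : ∀ x → ∃[ b ] x ≤ ι (2 ℕ.^ suc b)
  archimedean x = ℤ.∣ ℚ.↥ x ∣ , ℚ.≤-trans (≤-ι-numerator x) (ι-mono
      (ℕ.≤-trans (n≤2^n ℤ.∣ ℚ.↥ x ∣) (ℕ.^-monoʳ-≤ 2 (ℕ.n≤1+n ℤ.∣ ℚ.↥ x ∣))))
    where
    n≤2^n : ∀ n → n ℕ.≤ 2 ℕ.^ n
    n≤2^n zero    = z≤n
    n≤2^n (suc n) = ℕ.≤-trans (ℕ.+-mono-≤ (ℕ.m^n>0 2 n) (n≤2^n n))
        (ℕ.≤-reflexive (cong (2 ℕ.^ n ℕ.+_) (sym (ℕ.+-identityʳ (2 ℕ.^ n)))))

  -- The slack 1/4 absorbs the error with which 2^l is known to be below y, so that y > (3/2)^l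
  -- holds strictly.
  3/2-power : ∀ l → 3/2 ^ suc l + ¼ < 2ℚ ^ suc l
  3/2-power zero    = ℚ.+-monoʳ-< (+ 7 ℚ./ 4) (ℚ.positive⁻¹ ¼)
  3/2-power (suc l) = begin-strict
    3/2 * 3/2 ^ suc l + ¼                   ≤⟨ +-nonneg-≤ ⅛ (ℚ.<⇒≤ 0<⅛) (identity (3/2 ^ suc l)) ⟩
    3/2 * (3/2 ^ suc l + ¼)                 <⟨ ℚ.*-monoʳ-<-pos 3/2 (3/2-power l) ⟩
    3/2 * 2ℚ ^ suc l                        ≤⟨ *-monoʳ {3/2} {2ℚ} (^-nonneg (suc l) 0≤2) (ℚ.≤ᵇ⇒≤ _) ⟩
    2ℚ * 2ℚ ^ suc l                         ∎
    where
    open ℚ.≤-Reasoning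
    identity : ∀ p → 3/2 * p + ¼ + ⅛ ≡ 3/2 * (p + ¼)
    identity = solve-∀ ℚ-ring

  -- The first 2 pays for strictness, `K` comes from the bound in natural numbers, 12 from l + 1 ≤ 2
  -- l ≤ 12 log y, and 2^4 from y ≤ 2^(l+1).
  constant : ℚ
  constant = 2ℚ * ι K * ι 12 ^ 4 * 2ℚ ^ 4

  constant>0 : 0ℚ < constant
  constant>0 = *-pos (*-pos (*-pos (ℚ.positive⁻¹ 2ℚ) (ℚ.<-≤-trans (ι-pos 0) (ι-mono (ℕ.≤-trans (ℕ.m^n>0 2 24) 2^24≤K))))
    (^-pos 4 (ι-pos 11))) (^-pos 4 (ℚ.positive⁻¹ 2ℚ))
    where
    *-pos : ∀ {a b} → 0ℚ < a → 0ℚ < b → 0ℚ < a * b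
    *-pos {a} a>0 b>0 = ℚ.≤-<-trans (ℚ.≤-reflexive (sym (ℚ.*-zeroʳ a))) (ℚ.*-monoʳ-<-pos a {{ℚ.positive a>0}} b>0)

-- From the bound in natural numbers to the real inequality

module Comparison {c ℓ : Level} (F : FiniteField c ℓ) (n : ℕ) (n≥2 : 2 ℕ.≤ n)
  (y : Seq) (cauchy : IsCauchy y) (y≥2 : fromℕ 2 ≤ʳ y) (y≤log : y ≤ʳ log (fromℕ n))
  (lam : Polynomials.Poly F → ℤ) (isLam : Polynomials.IsTruncatedLiouville F y lam)
  (h : Polynomials.Poly F) (d : ℕ) (dh : Polynomials.HasDegree F h d) (d≤y : fromℕ d ≤ʳ y)
  where
  open Polynomials F
  open import Data.Rational.Base using (_+_; _*_; _-_; -_; _≤_; _<_; ∣_∣; ½)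
  open RationalOrder
  open Dyadic using (K; 2^24≤K; ι-2^; ½^*2^)
  open Logarithm
  open RealComparison

  private
    opaque
      A B C : ℕ
      A = proj₁ (cauchy ⅛ 0<⅛) ℕ.⊔ proj₁ (y≥2 ⅛ 0<⅛)
      B = proj₁ (y≤log ⅛ 0<⅛)
      C = proj₁ (d≤y ⅛ 0<⅛)

      close : ∀ i j → A ℕ.≤ i → A ℕ.≤ j → y i ≤ y j + ⅛
      close i j hi hj = -≤⇒≤+ (ℚ.≤-trans (≤-∣∣ (y i - y j))
        (proj₂ (cauchy ⅛ 0<⅛) i j (ℕ.m⊔n≤o⇒m≤o _ _ hi) (ℕ.m⊔n≤o⇒m≤o _ _ hj)))

      -- A rational stand-in for y: it is at least 2, and for every k from A on it is an upper bound
      -- of y k that is off by at most 1/4.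
      a : ℚ
      a = y A + ⅛

      a≥2 : ι 2 ≤ a
      a≥2 = ℚ.≤-trans (ℚ.≤-reflexive (ι-def 2)) (proj₂ (y≥2 ⅛ 0<⅛) A (ℕ.m≤n⊔m (proj₁ (cauchy ⅛ 0<⅛)) (proj₁ (y≥2 ⅛ 0<⅛))))

      a≤y : ∀ k → A ℕ.≤ k → a ≤ y k + ¼
      a≤y k A≤k = ℚ.≤-trans (ℚ.+-monoˡ-≤ ⅛ (close A k ℕ.≤-refl A≤k)) (ℚ.≤-reflexive (ℚ.+-assoc (y k) ⅛ ⅛))

      y≤a : ∀ k → A ℕ.≤ k → y k ≤ a
      y≤a k A≤k = close k A A≤k ℕ.≤-refl

      y≤logSum : ∀ k → B ℕ.≤ k → y k ≤ logSum k (ι n) + ⅛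
      y≤logSum k B≤k = subst (λ x → y k ≤ logSum k x + ⅛) (sym (ι-def n)) (proj₂ (y≤log ⅛ 0<⅛) k B≤k)

      d≤y+⅛ : ∀ k → C ℕ.≤ k → ι d ≤ y k + ⅛
      d≤y+⅛ k C≤k = ℚ.≤-trans (ℚ.≤-reflexive (ι-def d)) (proj₂ (d≤y ⅛ 0<⅛) k C≤k)

    bracket : ∃[ l ] ι (2 ℕ.^ suc l) ≤ a × a ≤ ι (2 ℕ.^ suc (suc l))
    bracket = dyadic-bracket (proj₁ (archimedean a)) a≥2 (proj₂ (archimedean a))

    opaque
      l₀ : ℕ
      l₀ = proj₁ bracket

      2^l≤a : ι (2 ℕ.^ suc l₀) ≤ a
      2^l≤a = proj₁ (proj₂ bracket)

      a≤2^l+1 : a ≤ ι (2 ℕ.^ suc (suc l₀))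
      a≤2^l+1 = proj₂ (proj₂ bracket)

    l : ℕ
    l = suc l₀

    y≤ : ∀ k → A ℕ.≤ k → y k ≤ ι (2 ℕ.^ suc l)
    y≤ k A≤k = ℚ.≤-trans (y≤a k A≤k) a≤2^l+1

    2^l≤y : ∀ k → A ℕ.≤ k → ι (2 ℕ.^ l) ≤ y k + ¼
    2^l≤y k A≤k = ℚ.≤-trans 2^l≤a (a≤y k A≤k)

    ιn≥1 : 1ℚ ≤ ι n
    ιn≥1 = ℚ.≤-trans (ℚ.≤-reflexive (sym ι-1)) (ι-mono (ℕ.≤-trans (s≤s z≤n) n≥2))

    -- With m = 2^l - 1, n < 2^m would give log n ≤ m, hence 2^l ≤ y + 1/4 ≤ m + 3/4 < m + 1. The 1
    -- lost in the exponent pays for the approximations.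
    n-large : 2 ℕ.^ (2 ℕ.^ l ℕ.∸ 1) ℕ.≤ n
    n-large = ℕ.≮⇒≥ λ n<2^m → small (2 ℕ.^ l ℕ.∸ 1) (ℕ.m+[n∸m]≡n (ℕ.m^n>0 2 l)) n<2^m
      where
      small : ∀ m → suc m ≡ 2 ℕ.^ l → ¬ n ℕ.< 2 ℕ.^ m
      small m m≡ n<2^m = ℕ.<⇒≱ (ℕ.≤-reflexive m≡) (ι-cancel-¾ upper)
        where
        k = A ℕ.⊔ B ℕ.⊔ 1
        open ℚ.≤-Reasoning
        m>0 : 0 ℕ.< m
        m>0 = ℕ.s≤s⁻¹ (ℕ.≤-trans (ℕ.^-monoʳ-≤ 2 {1} {l} (s≤s z≤n)) (ℕ.≤-reflexive (sym m≡)))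
        n< : ι n < 2ℚ ^ m
        n< = ℚ.<-≤-trans (ℚ.<-≤-trans (ℚ.≤-<-trans (ℚ.≤-reflexive (sym (ℚ.+-identityʳ (ι n)))) (ℚ.+-monoʳ-< (ι n) (ℚ.positive⁻¹ 1ℚ)))
          (ℚ.≤-trans (ℚ.≤-reflexive (trans (ℚ.+-comm (ι n) 1ℚ) (sym (ι-suc n)))) (ι-mono n<2^m))) (ℚ.≤-reflexive (ι-2^ m))
        upper : ι (2 ℕ.^ l) ≤ ι m + ¾
        upper = begin
          ι (2 ℕ.^ l)                   ≤⟨ 2^l≤y k (ℕ.≤-trans (ℕ.m≤m⊔n A B) (ℕ.m≤m⊔n (A ℕ.⊔ B) 1)) ⟩
          y k + ¼                       ≤⟨ ℚ.+-monoˡ-≤ ¼ (y≤logSum k (ℕ.≤-trans (ℕ.m≤n⊔m A B) (ℕ.m≤m⊔n (A ℕ.⊔ B) 1))) ⟩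
          logSum k (ι n) + ⅛ + ¼        ≤⟨ ℚ.+-monoˡ-≤ ¼ (ℚ.+-monoˡ-≤ ⅛ (logSum-upper (ℕ.m≤n⊔m (A ℕ.⊔ B) 1) m>0 ιn≥1 n<)) ⟩
          ι m + ⅛ + ¼                   ≤⟨ +-nonneg-≤ (⅛ + ¼) (ℚ.≤ᵇ⇒≤ _) (identity (ι m)) ⟩
          ι m + ¾                       ∎
          where
          identity : ∀ x → x + ⅛ + ¼ + (⅛ + ¼) ≡ x + ¾
          identity = solve-∀ ℚ-ring

    -- From d ≤ y ≤ log n ≤ n - 1. It keeps f + h monic of degree n.
    d<n : d ℕ.< n
    d<n = ι-cancel-¾ (begin
      ι (suc d)                         ≡⟨ ι-suc d ⟩
      1ℚ + ι d                          ≤⟨ ℚ.+-monoʳ-≤ 1ℚ (d≤y+⅛ k (ℕ.≤-trans (ℕ.m≤n⊔m B C) (ℕ.m≤m⊔n (B ℕ.⊔ C) 1))) ⟩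
      1ℚ + (y k + ⅛)                    ≤⟨ ℚ.+-monoʳ-≤ 1ℚ (ℚ.+-monoˡ-≤ ⅛
          (y≤logSum k (ℕ.≤-trans (ℕ.m≤m⊔n B C) (ℕ.m≤m⊔n (B ℕ.⊔ C) 1)))) ⟩
      1ℚ + (logSum k (ι n) + ⅛ + ⅛)     ≡⟨ identity (logSum k (ι n)) ⟩
      1ℚ + logSum k (ι n) + (⅛ + ⅛)     ≤⟨ ℚ.+-mono-≤ (logSum-≤ (ℕ.m≤n⊔m (B ℕ.⊔ C) 1) ιn≥1) (ℚ.≤ᵇ⇒≤ _) ⟩
      ι n + ¾                           ∎)
      where
      open ℚ.≤-Reasoning
      k = B ℕ.⊔ C ℕ.⊔ 1
      identity : ∀ s → 1ℚ + (s + ⅛ + ⅛) ≡ 1ℚ + s + (⅛ + ⅛)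
      identity = solve-∀ ℚ-ring

    y<bound : y <ʳ fromℕ (suc (2 ℕ.^ suc l))
    y<bound = 1ℚ , ℚ.positive⁻¹ 1ℚ , A , λ k A≤k → ℚ.≤-trans (ℚ.+-monoˡ-≤ 1ℚ (y≤ k A≤k))
      (ℚ.≤-reflexive (trans (ℚ.+-comm (ι (2 ℕ.^ suc l)) 1ℚ) (trans (sym (ι-suc (2 ℕ.^ suc l))) (ι-def (suc (2 ℕ.^ suc l))))))

    S : ℤ
    S = sumOverMonics n (λ f → lam f ℤ.* lam (f +ₚ h))

    -- The integer part is available only under a double negation, which can be removed because an
    -- inequality between natural numbers is decidable.
    integer-bound : ℤ.∣ S ∣ ℕ.* 2 ℕ.^ (4 ℕ.* l) ℕ.≤ K ℕ.* suc l ℕ.^ 4 ℕ.* q ℕ.^ n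
    integer-bound = decidable-stable (_ ℕ.≤? _) λ ¬bound →
      integer-part y cauchy y≥2 (suc (2 ℕ.^ suc l)) y<bound λ (Y , small , large) → ¬bound
        (CorrelationBound.correlation-bound F Y lam Lam.cong Lam.unit Lam.multiplicative
          (λ t mP iP 1≤t le → Lam.small t mP iP 1≤t (small _ le))
          (λ t mP iP 1≤t lt → Lam.large t mP iP 1≤t (large _ lt))
          h d dh (d≤Y Y large) n d<n l (2^l≤Y+1 Y large) (ℕ.s≤s⁻¹
              (≤ʳ-<ʳ-ℕ Y (suc (2 ℕ.^ suc l)) y (small Y ℕ.≤-refl) y<bound)) n-large)
      where
      module Lam = IsTruncatedLiouville isLam
      d≤Y : ∀ Y → (∀ d → Y ℕ.< d → y <ʳ fromℕ d) → d ℕ.≤ Y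
      d≤Y Y large = ℕ.≮⇒≥ λ Y<d → ℕ.<-irrefl refl (≤ʳ-<ʳ-ℕ d d y d≤y (large d Y<d))
      2^l≤Y+1 : ∀ Y → (∀ d → Y ℕ.< d → y <ʳ fromℕ d) → 2 ℕ.^ l ℕ.≤ suc Y
      2^l≤Y+1 Y large = go (large (suc Y) ℕ.≤-refl)
        where
        go : y <ʳ fromℕ (suc Y) → 2 ℕ.^ l ℕ.≤ suc Y
        go (ε , ε>0 , N , hN) = ι-cancel-¾ (ℚ.≤-trans (2^l≤y k (ℕ.m≤m⊔n A N)) (ℚ.+-mono-≤ below ¼≤¾))
          where
          k = A ℕ.⊔ N
          below : y k ≤ ι (suc Y)
          below = ℚ.≤-trans (≤-+ʳ (ℚ.<⇒≤ ε>0)) (ℚ.≤-trans (hN k (ℕ.m≤n⊔m A N)) (ℚ.≤-reflexive (fromℕ-ι (suc Y) k)))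
          ¼≤¾ : ¼ ≤ ¾
          ¼≤¾ = ℚ.≤ᵇ⇒≤ _

  private
    E N : ℚ
    E = 2ℚ ^ (4 ℕ.* l)
    N = ι (q ℕ.^ n)

    N≥0 : 0ℚ ≤ N
    N≥0 = ι-nonneg (q ℕ.^ n)

    -- The strict order asks for a fixed gap, and 2^(-4 l) is put on the left for it. Multiplied by
    -- E it becomes 1, which is at most the right side of the integer bound; hence the factor 2.
    rational-bound : (ι ℤ.∣ S ∣ + ½ ^ (4 ℕ.* l)) * E ≤ 2ℚ * (ι K * ι (suc l) ^ 4 * N)
    rational-bound = begin
      (ι ℤ.∣ S ∣ + ½ ^ (4 ℕ.* l)) * E            ≡⟨ ℚ.*-distribʳ-+ E (ι ℤ.∣ S ∣) (½ ^ (4 ℕ.* l)) ⟩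
      ι ℤ.∣ S ∣ * E + ½ ^ (4 ℕ.* l) * E          ≡⟨ cong₂ _+_
          (trans (cong (ι ℤ.∣ S ∣ *_) (sym (ι-2^ (4 ℕ.* l)))) (sym (ι-* ℤ.∣ S ∣ (2 ℕ.^ (4 ℕ.* l)))))
              (trans (½^*2^ (4 ℕ.* l)) (sym ι-1)) ⟩
      ι (ℤ.∣ S ∣ ℕ.* 2 ℕ.^ (4 ℕ.* l)) + ι 1      ≤⟨ ℚ.+-mono-≤ (ι-mono integer-bound) (ι-mono X≥1) ⟩
      ι X + ι X                                  ≡⟨ double (ι X) ⟩
      2ℚ * ι X                                   ≡⟨ cong (2ℚ *_)
          (trans (ι-* (K ℕ.* suc l ℕ.^ 4) (q ℕ.^ n)) (cong (_* N) (trans (ι-* K (suc l ℕ.^ 4)) (cong (ι K *_) (ι-^ (suc l) 4))))) ⟩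
      2ℚ * (ι K * ι (suc l) ^ 4 * N)             ∎
      where
      open ℚ.≤-Reasoning
      X = K ℕ.* suc l ℕ.^ 4 ℕ.* q ℕ.^ n
      double : ∀ x → x + x ≡ 2ℚ * x
      double = solve-∀ ℚ-ring
      K≥1 : 1 ℕ.≤ K
      K≥1 = ℕ.≤-trans (ℕ.m^n>0 2 24) 2^24≤K
      q≥1 : 1 ℕ.≤ q
      q≥1 = ℕ.≤-trans (s≤s z≤n) (Enumeration.q≥2 F)
      X≥1 : 1 ℕ.≤ X
      X≥1 = ℕ.*-mono-≤ (ℕ.*-mono-≤ K≥1 (ℕ.m^n>0 (suc l) 4)) (ℕ.m^n>0 q {{ℕ.>-nonZero q≥1}} n)

  comparison : fromℕ ℤ.∣ S ∣ <ʳ (λ _ → constant) *ʳ ((log y ^ʳ 4) ÷ʳ (y ^ʳ 4)) *ʳ fromℕ (q ℕ.^ n)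
  -- Indices start at 2^(l+1) because `logSum-lower` needs y k ≤ k; this also excludes k = 0.
  comparison = ½ ^ (4 ℕ.* l) , ^-pos (4 ℕ.* l) (ℚ.positive⁻¹ ½) , A ℕ.⊔ 2 ℕ.^ suc l , λ k le →
    subst₂ (λ x z → x + ½ ^ (4 ℕ.* l) ≤ constant * ((logSum k (y k)) ^ 4 ÷₀ y k ^ 4) * z) (sym (fromℕ-ι ℤ.∣ S ∣ k))
        (sym (fromℕ-ι (q ℕ.^ n) k))
      (termwise k (ℕ.≤-trans (ℕ.m≤m⊔n A (2 ℕ.^ suc l)) le) (ℕ.≤-trans (ℕ.m≤n⊔m A (2 ℕ.^ suc l)) le))
    where
    termwise : ∀ k → A ℕ.≤ k → 2 ℕ.^ suc l ℕ.≤ k → ι ℤ.∣ S ∣ + ½ ^ (4 ℕ.* l) ≤ constant * ((logSum k (y k)) ^ 4 ÷₀ y k ^ 4) * N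
    termwise k A≤k k-large = *-cancelˡ {c = E} (^-pos (4 ℕ.* l) (ℚ.positive⁻¹ 2ℚ)) (begin
      E * (ι ℤ.∣ S ∣ + ½ ^ (4 ℕ.* l))                      ≡⟨ ℚ.*-comm E _ ⟩
      (ι ℤ.∣ S ∣ + ½ ^ (4 ℕ.* l)) * E                      ≤⟨ rational-bound ⟩
      2ℚ * (ι K * ι (suc l) ^ 4 * N)                       ≤⟨ *-monoˡ 0≤2
          (*-monoʳ N≥0 (*-monoˡ (ι-nonneg K) (^-mono 4 (ι-nonneg (suc l)) l≤12s))) ⟩
      2ℚ * (ι K * (ι 12 * s) ^ 4 * N)                      ≡⟨ cong (λ x → 2ℚ * (ι K * x * N))
          (trans (^-distrib (ι 12) s 4) (cong (ι 12 ^ 4 *_) (sym v-def))) ⟩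
      2ℚ * (ι K * (ι 12 ^ 4 * (v * u ^ 4)) * N)            ≤⟨ *-monoˡ 0≤2
          (*-monoʳ N≥0 (*-monoˡ (ι-nonneg K) (*-monoˡ (^-nonneg 4 (ι-nonneg 12)) (*-monoˡ v≥0 u^4≤)))) ⟩
      2ℚ * (ι K * (ι 12 ^ 4 * (v * (2ℚ ^ 4 * E))) * N)     ≡⟨ reorder 2ℚ (ι K) (ι 12 ^ 4) v (2ℚ ^ 4) E N ⟩
      E * (constant * v * N)                               ∎)
      where
      open ℚ.≤-Reasoning
      u = y k
      s = logSum k u
      v = s ^ 4 ÷₀ u ^ 4
      reorder : ∀ a b c v w E N → a * (b * (c * (v * (w * E))) * N) ≡ E * (a * b * c * w * v * N)
      reorder = solve-∀ ℚ-ring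
      k>0 : 0 ℕ.< k
      k>0 = ℕ.≤-trans (ℕ.m^n>0 2 (suc l)) k-large
      u≥1 : 1ℚ ≤ u
      u≥1 = ℚ.≤-trans (+-nonneg-≤ ¾ (ℚ.≤ᵇ⇒≤ _) refl) (ℚ.≤-trans
          (ℚ.+-monoˡ-≤ (- ¼) (ℚ.≤-trans (ℚ.≤-reflexive (sym ι-2)) (ℚ.≤-trans a≥2 (a≤y k A≤k)))) (ℚ.≤-reflexive (identity u)))
        where
        identity : ∀ x → x + ¼ - ¼ ≡ x
        identity = solve-∀ ℚ-ring
      u≤k : u ≤ ι k
      u≤k = ℚ.≤-trans (y≤ k A≤k) (ι-mono k-large)
      big : 3/2 ^ l < u
      big = ℚ.≤-<-trans (ℚ.≤-reflexive (sym (identity (3/2 ^ l)))) (ℚ.<-≤-trans (ℚ.+-monoˡ-< (- ¼) (3/2-power l₀))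
        (ℚ.≤-trans (ℚ.+-monoˡ-≤ (- ¼) (ℚ.≤-trans (ℚ.≤-reflexive (sym (ι-2^ l))) (2^l≤y k A≤k))) (ℚ.≤-reflexive (identity u))))
        where
        identity : ∀ x → x + ¼ - ¼ ≡ x
        identity = solve-∀ ℚ-ring
      u^4>0 : 0ℚ < u ^ 4
      u^4>0 = ^-pos 4 (ℚ.<-≤-trans (ℚ.positive⁻¹ 1ℚ) u≥1)
      v-def : v * u ^ 4 ≡ s ^ 4
      v-def = ÷₀-* (s ^ 4) (u ^ 4) u^4>0
      6s≥l : ι l ≤ ι 6 * s
      6s≥l = logSum-lower k>0 (s≤s z≤n) u≥1 u≤k big
      s≥0 : 0ℚ ≤ s
      s≥0 = *-cancelˡ {c = ι 6} (ι-pos 5) (ℚ.≤-trans (ℚ.≤-reflexive (ℚ.*-zeroʳ (ι 6))) (ℚ.≤-trans (ι-nonneg l) 6s≥l))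
      v≥0 : 0ℚ ≤ v
      v≥0 = *-cancelˡ u^4>0 (ℚ.≤-trans (ℚ.≤-reflexive (ℚ.*-zeroʳ (u ^ 4)))
          (ℚ.≤-trans (^-nonneg 4 s≥0) (ℚ.≤-reflexive (trans (sym v-def) (ℚ.*-comm v (u ^ 4))))))
      l≤12s : ι (suc l) ≤ ι 12 * s
      l≤12s = begin
        ι (suc l)             ≤⟨ ι-mono (ℕ.+-mono-≤ (s≤s (z≤n {l₀})) (ℕ.≤-reflexive (sym (ℕ.+-identityʳ l)))) ⟩
        ι (2 ℕ.* l)           ≡⟨ ι-* 2 l ⟩
        ι 2 * ι l             ≤⟨ *-monoˡ (ι-nonneg 2) 6s≥l ⟩
        ι 2 * (ι 6 * s)       ≡⟨ trans (sym (ℚ.*-assoc (ι 2) (ι 6) s)) (cong (_* s) (sym (ι-* 2 6))) ⟩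
        ι 12 * s              ∎
      u^4≤ : u ^ 4 ≤ 2ℚ ^ 4 * E
      u^4≤ = begin
        u ^ 4                      ≤⟨ ^-mono 4 (ℚ.≤-trans 0≤1 u≥1) (ℚ.≤-trans (y≤ k A≤k) (ℚ.≤-reflexive (ι-2^ (suc l)))) ⟩
        (2ℚ * 2ℚ ^ l) ^ 4          ≡⟨ ^-distrib 2ℚ (2ℚ ^ l) 4 ⟩
        2ℚ ^ 4 * (2ℚ ^ l) ^ 4      ≡⟨ cong (2ℚ ^ 4 *_) (trans (^-assoc 2ℚ l 4) (cong (2ℚ ^_) (ℕ.*-comm l 4))) ⟩
        2ℚ ^ 4 * E                 ∎

open import Data.Integer.Base using (ℤ; ∣_∣) renaming (_*_ to _*ᶻ_)
open import Data.Nat.Base using (ℕ; _≤_; _^_)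
open import Data.Nat.Divisibility using (_∤_)
open import Data.Product.Base using (∃-syntax; _×_)
open import Level using (Level)
open import Relation.Nullary using (¬_)

corollary1p3 : (c ℓ : Level) →
    ∃[ C ] (IsCauchy C × fromℕ 0 <ʳ C ×
    ((F : FiniteField c ℓ) → let open Polynomials F in
    2 ∤ q →
    (n : ℕ) → 2 ≤ n →
    (y : Seq) → IsCauchy y → fromℕ 2 ≤ʳ y → y ≤ʳ log (fromℕ n) →
    (lam : Poly → ℤ) → IsTruncatedLiouville y lam →
    (h : Poly) → ¬ (h ≋ 0ₚ) → (d : ℕ) → HasDegree h d → fromℕ d ≤ʳ y →
    fromℕ ∣ sumOverMonics n (λ f → lam f *ᶻ lam (f +ₚ h)) ∣
    <ʳ C *ʳ ((log y ^ʳ 4) ÷ʳ (y ^ʳ 4)) *ʳ fromℕ (q ^ n)))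
corollary1p3 c ℓ =
  (λ _ → RealComparison.constant) ,
  (λ ε ε>0 → 0 , λ _ _ _ _ → ℚ.≤-trans (ℚ.≤-reflexive (cong ℚ.∣_∣ (ℚ.+-inverseʳ RealComparison.constant))) (ℚ.<⇒≤ ε>0)) ,
  (RealComparison.constant , RealComparison.constant>0 , 0 , λ _ _ → ℚ.≤-reflexive (ℚ.+-identityˡ RealComparison.constant)) ,
  λ F _ n n≥2 y cauchy y≥2 y≤log lam isLam h _ d dh d≤y → Comparison.comparison F n n≥2 y cauchy y≥2 y≤log lam isLam h d dh d≤y
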